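{- Let $R(q)=\dfrac{(q;q^5)_\infty(q^4;q^5)_\infty}{(q^2;q^5)_\infty(q^3;q^5)_\infty}$. Define power series \[ \sum\lambda_1(n)q^n=\frac{1}{R^5(q)},\ \sum\lambda_2(n)q^n=\frac{R^5(q)}{R(q^5)},\ \sum\lambda_3(n)q^n=\frac{R(q^2)}{R^2(q)},\ \sum\lambda_4(n)q^n=\frac{1}{R(q)R^2(q^2)}, \] \[ \sum\lambda_5(n)q^n=\frac{1}{R(q)R(q^4)},\ \sum\lambda_6(n)q^n=\frac{1}{R(-q)R(-q^4)},\ \sum\lambda_7(n)q^n=\frac{R(q^4)}{R^4(q)},\ \sum\lambda_8(n)q^n=\frac{R^2(q)}{R^3(q^4)}, \] \[ \sum\lambda_9(n)q^n=\frac{R(q)}{R(q^{16})},\ \sum\lambda_{10}(n)q^n=\frac{R(q^4)}{R^2(q)R(q^2)}, \] (sums over $n\ge0$), and let $\lambda'_j(n)$ denote the coefficient of $q^n$ in the reciprocal of $\sum_n\lambda_j(n)q^n$. Then for all $n\ge0$: (i) $\lambda_1(5n+r)=-\lambda_1'(5n+r-2)$ for $r\in\{3,4\}$; (ii) $\lambda_2(5n)=\lambda_2'(5n)$; (iii) $\lambda_3(5n+r)=-\lambda_3'(5n+r)$ for $r\in\{1,4\}$; (iv) $\lambda_4(5n+r)=-\lambda_4'(5n+r-2)$ for $r\in\{3,4\}$; (v) $\lambda_5(5n+r)=\lambda_5'(5n+r-2)$ for $r\in\{3,4\}$; (vi) $\lambda_6(10n+r)=\lambda_6'(10n+r-2)$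 for $r\in\{5,7\}$; (vii) $\lambda_7(10n+r)=-\lambda_7'(10n+r)$ for $r\in\{1,9\}$; (viii) $\lambda_8(10n+r)=-\lambda_8'(10n+r-4)$ for $r\in\{5,9\}$; (ix) $\lambda_9(10n+r)=\lambda_9'(10n+r-6)$ for $r\in\{7,9\}$; (x) $\lambda_{10}(2n+r)=(-1)^r\lambda_{10}'(2n+r)$ for $r\in\{0,1\}$; (xi) $\lambda_{10}(5n+r)=\lambda_{10}'(5n+r)$ for $r\in\{2,3\}$.
   Context: $(a;q)_\infty=\prod_{j\ge0}(1-aq^j)$, $q$ a formal variable (or complex with $|q|<1$). $R(q)$ is the product form of the Rogers–Ramanujan continued fraction $\frac{1}{1+}\frac{q}{1+}\frac{q^2}{1+}\cdots$; it has constant term $1$, so all the series above and their reciprocals are power series in $q$. -}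

module Defs where

open import Data.Nat as ℕ using (ℕ; zero; suc; NonZero; _≡ᵇ_)
open import Data.Nat.DivMod using (_/_; _%_)
open import Data.Integer using (ℤ; +_; -_; _+_; _-_; _*_; _^_)
open import Data.Bool using (if_then_else_)

-- Formal power series with integer coefficients: n ↦ coefficient of q^n.
PS : Set
PS = ℕ → ℤ

sumTo : ℕ → (ℕ → ℤ) → ℤ
sumTo zero    f = f 0
sumTo (suc n) f = sumTo n f + f (suc n)

infixl 7 _⊛_
_⊛_ : PS → PS → PS
(f ⊛ g) n = sumTo n (λ k → f k * g (n ℕ.∸ k))

oneS : PS
oneS n = if n ≡ᵇ 0 then + 1 else + 0

powS : PS → ℕ → PS
powS f zero    = oneS
powS f (suc k) = f ⊛ powS f k

oneMinusQ : ℕ → PS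
oneMinusQ m n = oneS n - (if n ≡ᵇ m then + 1 else + 0)

prodTo : ℕ → (ℕ → PS) → PS
prodTo zero    F = F 0
prodTo (suc n) F = prodTo n F ⊛ F (suc n)

-- (q^a ; q^d)_∞ = ∏_{j≥0} (1 - q^{a+dj}), for a ≥ 1, d ≥ 1.
-- Its q^n coefficient equals that of the finite product over 0 ≤ j ≤ n,
-- since the remaining factors are ≡ 1 modulo q^{n+1}.
poch : ℕ → ℕ → PS
poch a d n = prodTo n (λ j → oneMinusQ (a ℕ.+ d ℕ.* j)) n

-- Reciprocal of a power series with constant term 1:
-- c 0 = 1,  c n = - Σ_{k=0}^{n-1} f (n-k) c k.
-- invUpTo f n agrees with the reciprocal on coefficients 0..n.
invUpTo : PS → ℕ → PS
invUpTo f zero    m = oneS m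
invUpTo f (suc n) m =
  if m ≡ᵇ suc n
  then - sumTo n (λ k → f (suc n ℕ.∸ k) * invUpTo f n k)
  else invUpTo f n m

inv : PS → PS
inv f n = invUpTo f n n

dil : (k : ℕ) → .{{NonZero k}} → PS → PS
dil k f n = if (n % k) ≡ᵇ 0 then f (n / k) else + 0

negq : PS → PS
negq f n = (- + 1) ^ n * f n

R : PS
R = poch 1 5 ⊛ poch 4 5 ⊛ inv (poch 2 5 ⊛ poch 3 5)

λ₁ λ₂ λ₃ λ₄ λ₅ λ₆ λ₇ λ₈ λ₉ λ₁₀ : PS
λ₁  = inv (powS R 5)
λ₂  = powS R 5 ⊛ inv (dil 5 R)
λ₃  = dil 2 R ⊛ inv (powS R 2)
λ₄  = inv (R ⊛ powS (dil 2 R) 2)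
λ₅  = inv (R ⊛ dil 4 R)
λ₆  = inv (negq R ⊛ dil 4 (negq R))
λ₇  = dil 4 R ⊛ inv (powS R 4)
λ₈  = powS R 2 ⊛ inv (powS (dil 4 R) 3)
λ₉  = R ⊛ inv (dil 16 R)
λ₁₀ = dil 4 R ⊛ inv (powS R 2 ⊛ dil 2 R)

λ′ : PS → PS
λ′ = inv

{-# OPTIONS --safe #-}
-- With λ′ = 1/λ, the claims say that a combination λ ± q^c λ′, or its odd part, has no exponents in certain
-- residue classes modulo 5 (for λ₁₀ modulo 2 the reason is λ′(q) = λ(-q)).  All the series are quotients of theta
-- functions of level 10 and of their images under q ↦ -q and q ↦ q².  Weierstrass' three-term relation turns each
-- combination into a sum of theta quotients which, up to factors that are series in q⁵ and up to q ↦ -q and q ↦ q²,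
-- are (q; q)_∞, φ(-q) = Σ (-1)^n q^(n²) or ψ(-q).  Their exponents, the pentagonal, square and triangular numbers,
-- miss two classes modulo 5.  For λ₁ and λ₂ the combination is a polynomial in v = q R(q⁵) divided by a series
-- in q⁵, by Ramanujan's relation R(q)⁵ Q(v) = R(q⁵) P(v), which follows from the 5-dissection of (q; q)_∞.
module Submission where

-- Weierstrass' relation makes both 1 + k and 1 - k products, where k = q R(q) R(q²)²; hence R(q²) /
-- R(q)² = (1 + k) / (1 - k), and what follows is algebra in k and its analogues at -q and q².
-- Identities between products alone are settled by comparing exponents of independent generators.
-- Identities involving sums are settled by ideal membership with explicit cofactors. In the absence
-- of division, a factor is cancelled because its constant term is not zero; the same device
-- extracts square roots, since f² = g² gives f = g as soon as f + g has a nonzero constant term.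
-- The classes modulo 10 in the theorem are all odd, so only L(q) - L(-q) matters there. This
-- difference factors for λ₆ to λ₉, mostly because R(-q) - R(q) is 2q times a product in q². The
-- hard cases are λ₆ and λ₉: the remaining factor is a product only by virtue of relations linking
-- R(q) with R(q⁴) and R(q⁸), whose certificates are the two large blocks of cofactors.

open import Defs
open import Algebra.Bundles using (CommutativeRing)
open import Algebra.Structures using (IsCommutativeRing)
open import Data.Bool using (Bool; true; false; _∧_; T; if_then_else_; not; _∨_)
open import Data.Empty using (⊥-elim; ⊥)
open import Data.Fin as Fin using (Fin; #_)
open import Data.Integer as ℤ using (ℤ; +_; -[1+_]; _⊖_; ∣_∣)
import Data.Integer.Properties as ℤ
open import Data.Integer.DivMod using (_/ℕ_; _%ℕ_; a≡a%ℕn+[a/ℕn]*n; n%ℕd<d)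
open import Data.Integer.Tactic.RingSolver using (solve-∀)
open import Data.List using (List; []; _∷_)
import Data.List as List
open import Data.Nat as ℕ using (ℕ; zero; suc; _≡ᵇ_; _<_; _≤_; z≤n; s≤s; z<s; NonZero; _≤ᵇ_)
import Data.Nat.Properties as ℕ
import Data.Nat.Tactic.RingSolver as ℕ-Solver
open import Data.Nat.DivMod using (_/_; _%_; [m+n]%n≡m%n; m<n⇒m%n≡m; m/n≡1+[m∸n]/n; m≡m%n+[m/n]*n; m%n<n; [m+kn]%n≡m%n; %-distribˡ-+; %-distribˡ-*; m%n%n≡m%n)
open import Data.Nat.Divisibility using (_∣_; divides; _∣?_)
open import Data.Product using (_×_; _,_; proj₁; proj₂; Σ-syntax)
open import Data.Sum using (inj₁; inj₂; _⊎_)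
open import Data.Unit using (tt)
open import Data.Vec using (Vec; []; _∷_; lookup; map; replicate; tabulate)
open import Data.Vec.Properties using (lookup-map)
open import Level using (0ℓ)
open import Relation.Nullary using (yes; no; ¬_)
open import Relation.Nullary.Decidable using (False; toWitnessFalse)
open import Relation.Binary.PropositionalEquality as ≡ using (_≡_)

-- Ideal membership in commutative rings

infixl 6 _:+_ _:-_
infixl 7 _:*_
infixr 8 _:^_

data Expr (n : ℕ) : Set where
  con : ℤ → Expr n
  var : Fin n → Expr n
  _:+_ _:-_ _:*_ : Expr n → Expr n → Expr n
  _:^_ : Expr n → ℕ → Expr n

-- Recursive dense representation: a polynomial in 1+n variables is the list of its coefficients,
-- which are polynomials in the last n variables.
Poly : ℕ → Set
Poly zero    = ℤ
Poly (suc n) = List (Poly n)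

0P : ∀ n → Poly n
0P zero    = + 0
0P (suc n) = []

constP : ∀ n → ℤ → Poly n
constP zero    c = c
constP (suc n) c = constP n c ∷ []

varP : ∀ {n} → Fin n → Poly n
varP {suc n} Fin.zero    = 0P n ∷ constP n (+ 1) ∷ []
varP {suc n} (Fin.suc i) = varP i ∷ []

addP : ∀ n → Poly n → Poly n → Poly n
addP zero    a       b       = a ℤ.+ b
addP (suc n) []      q       = q
addP (suc n) (a ∷ p) []      = a ∷ p
addP (suc n) (a ∷ p) (b ∷ q) = addP n a b ∷ addP (suc n) p q

negP : ∀ n → Poly n → Poly n
negP zero    a = ℤ.- a
negP (suc n) p = List.map (negP n) p

mulP : ∀ n → Poly n → Poly n → Poly n
mulP zero    a       b = a ℤ.* b
mulP (suc n) []      q = []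
mulP (suc n) (a ∷ p) q = addP (suc n) (List.map (mulP n a) q) (0P n ∷ mulP (suc n) p q)

powP : ∀ n → Poly n → ℕ → Poly n
powP n p zero    = constP n (+ 1)
powP n p (suc k) = mulP n p (powP n p k)

isZero : ∀ n → Poly n → Bool
isZero zero    (+ 0)      = true
isZero zero    _          = false
isZero (suc n) []         = true
isZero (suc n) (a ∷ p)    = isZero n a ∧ isZero (suc n) p

norm : ∀ {n} → Expr n → Poly n
norm {n} (con c)  = constP n c
norm     (var i)  = varP i
norm {n} (a :+ b) = addP n (norm a) (norm b)
norm {n} (a :- b) = addP n (norm a) (negP n (norm b))
norm {n} (a :* b) = mulP n (norm a) (norm b)
norm {n} (a :^ k) = powP n (norm a) k

-- A triple (cofactor , left side , right side).
Rule : ℕ → Set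
Rule n = Expr n × Expr n × Expr n

combination : ∀ {n} → List (Rule n) → Expr n
combination []                = con (+ 0)
combination ((f , a , b) ∷ h) = f :* (a :- b) :+ combination h

module RingSolver {c ℓ} (𝓡 : CommutativeRing c ℓ) where
  open CommutativeRing 𝓡
  open import Algebra.Properties.Ring ring
  open import Algebra.Properties.Semiring.Mult semiring using (×-homo-+; ×1-homo-*) renaming (_×_ to _⊗_)
  open import Algebra.Properties.CommutativeSemigroup +-commutativeSemigroup using () renaming (interchange to +-interchange)
  open import Algebra.Properties.CommutativeSemigroup *-commutativeSemigroup using (x∙yz≈y∙xz)
  open import Relation.Binary.Reasoning.Setoid setoid

  infixr 8 _^_
  _^_ : Carrier → ℕ → Carrier
  x ^ zero  = 1#
  x ^ suc k = x * x ^ k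

  ⌜_⌝ : ℤ → Carrier
  ⌜ + n ⌝      = n ⊗ 1#
  ⌜ -[1+ n ] ⌝ = - (suc n ⊗ 1#)

  -- Zero and one have clauses of their own because `⌜ + 1 ⌝` unfolds to `1# + 0#`, while the
  -- interpreted equations should read as the plain `0#` and `1#`.
  ⟦_⟧ : ∀ {n} → Expr n → Vec Carrier n → Carrier
  ⟦ con (+ 0) ⟧    ρ = 0#
  ⟦ con (+ 1) ⟧    ρ = 1#
  ⟦ con c ⟧    ρ = ⌜ c ⌝
  ⟦ var i ⟧    ρ = lookup ρ i
  ⟦ a :+ b ⟧   ρ = ⟦ a ⟧ ρ + ⟦ b ⟧ ρ
  ⟦ a :- b ⟧   ρ = ⟦ a ⟧ ρ - ⟦ b ⟧ ρ
  ⟦ a :* b ⟧   ρ = ⟦ a ⟧ ρ * ⟦ b ⟧ ρ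
  ⟦ a :^ k ⟧   ρ = ⟦ a ⟧ ρ ^ k

  ⌜⌝-⊖ : ∀ m n → ⌜ m ⊖ n ⌝ ≈ m ⊗ 1# - n ⊗ 1#
  ⌜⌝-⊖ m zero = sym (trans (+-congˡ -0#≈0#) (+-identityʳ _))
  ⌜⌝-⊖ zero (suc n) = sym (+-identityˡ _)
  ⌜⌝-⊖ (suc m) (suc n) = begin
    ⌜ suc m ⊖ suc n ⌝                   ≡⟨ ≡.cong ⌜_⌝ (ℤ.[1+m]⊖[1+n]≡m⊖n m n) ⟩
    ⌜ m ⊖ n ⌝                           ≈⟨ ⌜⌝-⊖ m n ⟩
    m ⊗ 1# - n ⊗ 1#                     ≈⟨ +-identityˡ _ ⟨
    0# + (m ⊗ 1# - n ⊗ 1#)              ≈⟨ +-congʳ (-‿inverseʳ 1#) ⟨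
    (1# - 1#) + (m ⊗ 1# - n ⊗ 1#)       ≈⟨ +-interchange _ _ _ _ ⟩
    (1# + m ⊗ 1#) + (- 1# - n ⊗ 1#)     ≈⟨ +-congˡ (-‿+-comm _ _) ⟩
    (1# + m ⊗ 1#) - (1# + n ⊗ 1#)       ∎

  ⌜⌝-+ : ∀ a b → ⌜ a ℤ.+ b ⌝ ≈ ⌜ a ⌝ + ⌜ b ⌝
  ⌜⌝-+ (+ m)      (+ n)      = ×-homo-+ 1# m n
  ⌜⌝-+ (+ m)      (-[1+ n ]) = ⌜⌝-⊖ m (suc n)
  ⌜⌝-+ (-[1+ m ]) (+ n)      = trans (⌜⌝-⊖ n (suc m)) (+-comm _ _)
  ⌜⌝-+ (-[1+ m ]) (-[1+ n ]) = begin
    - (suc (suc (m ℕ.+ n)) ⊗ 1#)          ≡⟨ ≡.cong (λ k → - (k ⊗ 1#)) (≡.cong suc (ℕ.+-suc m n)) ⟨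
    - ((suc m ℕ.+ suc n) ⊗ 1#)            ≈⟨ -‿cong (×-homo-+ 1# (suc m) (suc n)) ⟩
    - (suc m ⊗ 1# + suc n ⊗ 1#)           ≈⟨ -‿+-comm _ _ ⟨
    - (suc m ⊗ 1#) - (suc n ⊗ 1#)         ∎

  ⌜⌝-neg : ∀ a → ⌜ ℤ.- a ⌝ ≈ - ⌜ a ⌝
  ⌜⌝-neg (+ zero)   = sym -0#≈0#
  ⌜⌝-neg (+ suc n)  = refl
  ⌜⌝-neg (-[1+ n ]) = sym (-‿involutive _)

  ⌜⌝-*-pos : ∀ m b → ⌜ + m ℤ.* b ⌝ ≈ m ⊗ 1# * ⌜ b ⌝
  ⌜⌝-*-pos m (+ n) = begin
    ⌜ + m ℤ.* + n ⌝       ≡⟨ ≡.cong ⌜_⌝ (ℤ.pos-* m n) ⟨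
    (m ℕ.* n) ⊗ 1#        ≈⟨ ×1-homo-* m n ⟩
    m ⊗ 1# * n ⊗ 1#       ∎
  ⌜⌝-*-pos m (-[1+ n ]) = begin
    ⌜ + m ℤ.* -[1+ n ] ⌝            ≡⟨ ≡.cong ⌜_⌝ (ℤ.neg-distribʳ-* (+ m) (+ suc n)) ⟨
    ⌜ ℤ.- (+ m ℤ.* + suc n) ⌝       ≈⟨ ⌜⌝-neg (+ m ℤ.* + suc n) ⟩
    - ⌜ + m ℤ.* + suc n ⌝           ≈⟨ -‿cong (⌜⌝-*-pos m (+ suc n)) ⟩
    - (m ⊗ 1# * suc n ⊗ 1#)         ≈⟨ -‿distribʳ-* _ _ ⟩
    m ⊗ 1# * - (suc n ⊗ 1#)         ∎

  ⌜⌝-* : ∀ a b → ⌜ a ℤ.* b ⌝ ≈ ⌜ a ⌝ * ⌜ b ⌝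
  ⌜⌝-* (+ m) b = ⌜⌝-*-pos m b
  ⌜⌝-* (-[1+ m ]) b = begin
    ⌜ -[1+ m ] ℤ.* b ⌝         ≡⟨ ≡.cong ⌜_⌝ (ℤ.neg-distribˡ-* (+ suc m) b) ⟨
    ⌜ ℤ.- (+ suc m ℤ.* b) ⌝    ≈⟨ ⌜⌝-neg (+ suc m ℤ.* b) ⟩
    - ⌜ + suc m ℤ.* b ⌝        ≈⟨ -‿cong (⌜⌝-*-pos (suc m) b) ⟩
    - (suc m ⊗ 1# * ⌜ b ⌝)     ≈⟨ -‿distribˡ-* _ _ ⟩
    - (suc m ⊗ 1#) * ⌜ b ⌝     ∎

  eval : ∀ n → Poly n → Vec Carrier n → Carrier
  eval zero    a       []      = ⌜ a ⌝
  eval (suc n) []      (x ∷ ρ) = 0#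
  eval (suc n) (a ∷ p) (x ∷ ρ) = eval n a ρ + x * eval (suc n) p (x ∷ ρ)

  eval-0 : ∀ n ρ → eval n (0P n) ρ ≈ 0#
  eval-0 zero    []      = refl
  eval-0 (suc n) (x ∷ ρ) = refl

  eval-const : ∀ n a ρ → eval n (constP n a) ρ ≈ ⌜ a ⌝
  eval-const zero    a []      = refl
  eval-const (suc n) a (x ∷ ρ) = trans (+-congˡ (zeroʳ x)) (trans (+-identityʳ _) (eval-const n a ρ))

  1⊗ : 1 ⊗ 1# ≈ 1#
  1⊗ = +-identityʳ 1#

  eval-var : ∀ {n} (i : Fin n) ρ → eval n (varP i) ρ ≈ lookup ρ i
  eval-var {suc n} Fin.zero (x ∷ ρ) = begin
    eval n (0P n) ρ + x * (eval n (constP n (+ 1)) ρ + x * 0#)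
      ≈⟨ +-cong (eval-0 n ρ) (*-congˡ (trans (+-congˡ (zeroʳ x)) (+-identityʳ _))) ⟩
    0# + x * eval n (constP n (+ 1)) ρ  ≈⟨ +-identityˡ _ ⟩
    x * eval n (constP n (+ 1)) ρ       ≈⟨ *-congˡ (trans (eval-const n (+ 1) ρ) 1⊗) ⟩
    x * 1#                              ≈⟨ *-identityʳ x ⟩
    x                                   ∎
  eval-var {suc n} (Fin.suc i) (x ∷ ρ) = trans (+-congˡ (zeroʳ x)) (trans (+-identityʳ _) (eval-var i ρ))

  eval-+ : ∀ n p r ρ → eval n (addP n p r) ρ ≈ eval n p ρ + eval n r ρ
  eval-+ zero    a       b       []      = ⌜⌝-+ a b
  eval-+ (suc n) []      r       (x ∷ ρ) = sym (+-identityˡ _)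
  eval-+ (suc n) (a ∷ p) []      (x ∷ ρ) = sym (+-identityʳ _)
  eval-+ (suc n) (a ∷ p) (b ∷ r) (x ∷ ρ) = begin
    eval n (addP n a b) ρ + x * eval (suc n) (addP (suc n) p r) (x ∷ ρ)
      ≈⟨ +-cong (eval-+ n a b ρ) (trans (*-congˡ (eval-+ (suc n) p r (x ∷ ρ))) (distribˡ _ _ _)) ⟩
    (eval n a ρ + eval n b ρ) + (x * eval (suc n) p (x ∷ ρ) + x * eval (suc n) r (x ∷ ρ))
      ≈⟨ +-interchange _ _ _ _ ⟩
    eval (suc n) (a ∷ p) (x ∷ ρ) + eval (suc n) (b ∷ r) (x ∷ ρ) ∎

  eval-neg : ∀ n p ρ → eval n (negP n p) ρ ≈ - eval n p ρ
  eval-neg zero    a       []      = ⌜⌝-neg a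
  eval-neg (suc n) []      (x ∷ ρ) = sym -0#≈0#
  eval-neg (suc n) (a ∷ p) (x ∷ ρ) = begin
    eval n (negP n a) ρ + x * eval (suc n) (negP (suc n) p) (x ∷ ρ)
      ≈⟨ +-cong (eval-neg n a ρ) (trans (*-congˡ (eval-neg (suc n) p (x ∷ ρ))) (sym (-‿distribʳ-* _ _))) ⟩
    - eval n a ρ - x * eval (suc n) p (x ∷ ρ)  ≈⟨ -‿+-comm _ _ ⟩
    - eval (suc n) (a ∷ p) (x ∷ ρ)             ∎

  eval-* : ∀ n p r ρ → eval n (mulP n p r) ρ ≈ eval n p ρ * eval n r ρ
  eval-scale : ∀ n a r x ρ → eval (suc n) (List.map (mulP n a) r) (x ∷ ρ) ≈ eval n a ρ * eval (suc n) r (x ∷ ρ)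
  eval-* zero    a       b []      = ⌜⌝-* a b
  eval-* (suc n) []      r (x ∷ ρ) = sym (zeroˡ _)
  eval-* (suc n) (a ∷ p) r (x ∷ ρ) = begin
    eval (suc n) (addP (suc n) (List.map (mulP n a) r) (0P n ∷ mulP (suc n) p r)) (x ∷ ρ)
      ≈⟨ eval-+ (suc n) (List.map (mulP n a) r) (0P n ∷ mulP (suc n) p r) (x ∷ ρ) ⟩
    eval (suc n) (List.map (mulP n a) r) (x ∷ ρ) + (eval n (0P n) ρ + x * eval (suc n) (mulP (suc n) p r) (x ∷ ρ))
      ≈⟨ +-cong (eval-scale n a r x ρ) (trans (+-congʳ (eval-0 n ρ)) (trans (+-identityˡ _) (*-congˡ (eval-* (suc n) p r (x ∷ ρ))))) ⟩
    eval n a ρ * eval (suc n) r (x ∷ ρ) + x * (eval (suc n) p (x ∷ ρ) * eval (suc n) r (x ∷ ρ))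
      ≈⟨ trans (+-congˡ (sym (*-assoc _ _ _))) (sym (distribʳ _ _ _)) ⟩
    eval (suc n) (a ∷ p) (x ∷ ρ) * eval (suc n) r (x ∷ ρ) ∎
  eval-scale n a []      x ρ = sym (zeroʳ _)
  eval-scale n a (b ∷ r) x ρ = begin
    eval n (mulP n a b) ρ + x * eval (suc n) (List.map (mulP n a) r) (x ∷ ρ)
      ≈⟨ +-cong (eval-* n a b ρ) (trans (*-congˡ (eval-scale n a r x ρ)) (x∙yz≈y∙xz _ _ _)) ⟩
    eval n a ρ * eval n b ρ + eval n a ρ * (x * eval (suc n) r (x ∷ ρ))
      ≈⟨ distribˡ _ _ _ ⟨
    eval n a ρ * eval (suc n) (b ∷ r) (x ∷ ρ) ∎

  eval-pow : ∀ n p k ρ → eval n (powP n p k) ρ ≈ eval n p ρ ^ k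
  eval-pow n p zero    ρ = trans (eval-const n (+ 1) ρ) 1⊗
  eval-pow n p (suc k) ρ = trans (eval-* n p (powP n p k) ρ) (*-congˡ (eval-pow n p k ρ))

  ^-cong : ∀ {x y} k → x ≈ y → x ^ k ≈ y ^ k
  ^-cong zero    e = refl
  ^-cong (suc k) e = *-cong e (^-cong k e)

  con-correct : ∀ {n} c (ρ : Vec Carrier n) → ⟦ con c ⟧ ρ ≈ ⌜ c ⌝
  con-correct (+ 0)         ρ = refl
  con-correct (+ 1)         ρ = sym 1⊗
  con-correct (+ suc (suc n)) ρ = refl
  con-correct (-[1+ n ])    ρ = refl

  norm-correct : ∀ {n} (e : Expr n) ρ → eval n (norm e) ρ ≈ ⟦ e ⟧ ρ
  norm-correct {n} (con c)  ρ = trans (eval-const n c ρ) (sym (con-correct c ρ))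
  norm-correct     (var i)  ρ = eval-var i ρ
  norm-correct {n} (a :+ b) ρ = trans (eval-+ n (norm a) (norm b) ρ) (+-cong (norm-correct a ρ) (norm-correct b ρ))
  norm-correct {n} (a :- b) ρ = trans (eval-+ n (norm a) _ ρ)
    (+-cong (norm-correct a ρ) (trans (eval-neg n (norm b) ρ) (-‿cong (norm-correct b ρ))))
  norm-correct {n} (a :* b) ρ = trans (eval-* n (norm a) (norm b) ρ) (*-cong (norm-correct a ρ) (norm-correct b ρ))
  norm-correct {n} (a :^ k) ρ = trans (eval-pow n (norm a) k ρ) (^-cong k (norm-correct a ρ))

  T-∧ : ∀ {a b} → T (a ∧ b) → T a × T b
  T-∧ {true} {true} _ = tt , tt

  isZero-correct : ∀ n p ρ → T (isZero n p) → eval n p ρ ≈ 0#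
  isZero-correct zero    (+ 0)   []      _ = refl
  isZero-correct (suc n) []      (x ∷ ρ) _ = refl
  isZero-correct (suc n) (a ∷ p) (x ∷ ρ) t = begin
    eval n a ρ + x * eval (suc n) p (x ∷ ρ)
      ≈⟨ +-cong (isZero-correct n a ρ (proj₁ (T-∧ t))) (*-congˡ (isZero-correct (suc n) p (x ∷ ρ) (proj₂ (T-∧ {isZero n a} t)))) ⟩
    0# + x * 0#  ≈⟨ +-identityˡ _ ⟩
    x * 0#       ≈⟨ zeroʳ x ⟩
    0#           ∎

  -- A last rule is not paired with a unit, so that the hypotheses can be supplied as a plain tuple;
  -- the empty list gets the provable `1# ≈ 1#`.
  Holds : ∀ {n} → Vec Carrier n → List (Rule n) → Set ℓ
  Holds ρ []                      = 1# ≈ 1#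
  Holds ρ ((_ , a , b) ∷ [])      = ⟦ a ⟧ ρ ≈ ⟦ b ⟧ ρ
  Holds ρ ((_ , a , b) ∷ r@(_ ∷ _)) = ⟦ a ⟧ ρ ≈ ⟦ b ⟧ ρ × Holds ρ r

  -- Replaces division: an identity divided by a factor on paper is here multiplied by it and then
  -- cancelled.
  Regular : Carrier → Set _
  Regular x = ∀ y → x * y ≈ 0# → y ≈ 0#

  x≈y⇒x-y≈0 : ∀ {x y} → x ≈ y → x - y ≈ 0#
  x≈y⇒x-y≈0 {x} {y} e = trans (+-congʳ e) (-‿inverseʳ y)

  x-y≈0⇒x≈y : ∀ {x y} → x - y ≈ 0# → x ≈ y
  x-y≈0⇒x≈y = x∙y⁻¹≈ε⇒x≈y _ _

  combination-0 : ∀ {n} (ρ : Vec Carrier n) h → Holds ρ h → ⟦ combination h ⟧ ρ ≈ 0#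
  combination-0 ρ [] _ = refl
  combination-0 ρ ((f , a , b) ∷ []) e =
    trans (+-identityʳ _) (trans (*-congˡ (x≈y⇒x-y≈0 e)) (zeroʳ _))
  combination-0 ρ ((f , a , b) ∷ r@(_ ∷ _)) (e , es) =
    trans (+-congˡ (combination-0 ρ r es)) (trans (+-identityʳ _) (trans (*-congˡ (x≈y⇒x-y≈0 e)) (zeroʳ _)))

  solve : ∀ {n} (l r : Expr n) ρ → {T (isZero n (norm (l :- r)))} → ⟦ l ⟧ ρ ≈ ⟦ r ⟧ ρ
  solve {n} l r ρ {t} = x-y≈0⇒x≈y (trans (sym (norm-correct (l :- r) ρ)) (isZero-correct n (norm (l :- r)) ρ t))

  -- c (l - r) lies in the ideal generated by the rules, with the given cofactors.
  cancel-by : ∀ {n} (c l r : Expr n) (h : List (Rule n)) ρ → {T (isZero n (norm (c :* (l :- r) :- combination h)))} →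
              Regular (⟦ c ⟧ ρ) → Holds ρ h → ⟦ l ⟧ ρ ≈ ⟦ r ⟧ ρ
  cancel-by c l r h ρ {t} reg hs = x-y≈0⇒x≈y (reg _ (trans (solve (c :* (l :- r)) (combination h) ρ {t}) (combination-0 ρ h hs)))

  follow : ∀ {n} (l r : Expr n) (h : List (Rule n)) ρ → {T (isZero n (norm ((l :- r) :- combination h)))} →
           Holds ρ h → ⟦ l ⟧ ρ ≈ ⟦ r ⟧ ρ
  follow l r h ρ {t} hs = x-y≈0⇒x≈y (trans (solve (l :- r) (combination h) ρ {t}) (combination-0 ρ h hs))

open import Relation.Binary.PropositionalEquality using (_≢_; refl; cong; cong₂)

-- The ring of power series

infix 4 _≋_
-- A record and not the bare family of equations, so that unification can recover `f` and `g` from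
-- the type of a proof.
record _≋_ (f g : PS) : Set where
  constructor pointwise
  field at : ∀ n → f n ≡ g n
open _≋_ public

infixl 6 _+ᵖ_
_+ᵖ_ : PS → PS → PS
(f +ᵖ g) n = f n ℤ.+ g n

tail : PS → PS
tail f n = f (suc n)

sumTo-cong : ∀ n {f g : PS} → (∀ k → k ≤ n → f k ≡ g k) → sumTo n f ≡ sumTo n g
sumTo-cong zero    e = e 0 z≤n
sumTo-cong (suc n) e = cong₂ ℤ._+_ (sumTo-cong n (λ k k≤n → e k (ℕ.m≤n⇒m≤1+n k≤n))) (e (suc n) ℕ.≤-refl)

sumTo-suc : ∀ n (f : PS) → sumTo (suc n) f ≡ f 0 ℤ.+ sumTo n (tail f)
sumTo-suc zero    f = refl
sumTo-suc (suc n) f = ≡.trans (cong (ℤ._+ f (2 ℕ.+ n)) (sumTo-suc n f)) (ℤ.+-assoc (f 0) _ _)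

sumTo-⊕ : ∀ n (f g : PS) → sumTo n (f +ᵖ g) ≡ sumTo n f ℤ.+ sumTo n g
sumTo-⊕ zero    f g = refl
sumTo-⊕ (suc n) f g = ≡.trans (cong (ℤ._+ (f (suc n) ℤ.+ g (suc n))) (sumTo-⊕ n f g)) (lemma (sumTo n f) _ _ _)
  where
  lemma : ∀ a b c d → (a ℤ.+ b) ℤ.+ (c ℤ.+ d) ≡ (a ℤ.+ c) ℤ.+ (b ℤ.+ d)
  lemma = solve-∀

sumTo-* : ∀ n c (f : PS) → sumTo n (λ k → c ℤ.* f k) ≡ c ℤ.* sumTo n f
sumTo-* zero    c f = refl
sumTo-* (suc n) c f = ≡.trans (cong (ℤ._+ c ℤ.* f (suc n)) (sumTo-* n c f)) (≡.sym (ℤ.*-distribˡ-+ c _ _))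

sumTo-0 : ∀ n → sumTo n (λ _ → + 0) ≡ + 0
sumTo-0 zero    = refl
sumTo-0 (suc n) = cong (ℤ._+ + 0) (sumTo-0 n)

⊛-suc : ∀ f g n → (f ⊛ g) (suc n) ≡ f 0 ℤ.* g (suc n) ℤ.+ (tail f ⊛ g) n
⊛-suc f g n = sumTo-suc n (λ k → f k ℤ.* g (suc n ℕ.∸ k))

⊛-congᵖ : ∀ {f f′ g g′} n → (∀ k → k ≤ n → f k ≡ f′ k) → (∀ k → k ≤ n → g k ≡ g′ k) → (f ⊛ g) n ≡ (f′ ⊛ g′) n
⊛-congᵖ n p q = sumTo-cong n (λ k k≤n → cong₂ ℤ._*_ (p k k≤n) (q _ (ℕ.m∸n≤m n k)))

⊛-distribʳ : ∀ h f g n → ((f +ᵖ g) ⊛ h) n ≡ (f ⊛ h) n ℤ.+ (g ⊛ h) n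
⊛-distribʳ h f g n = ≡.trans (sumTo-cong n (λ k _ → ℤ.*-distribʳ-+ (h (n ℕ.∸ k)) (f k) (g k))) (sumTo-⊕ n _ _)

⊛-scaleˡ : ∀ c f g n → ((λ k → c ℤ.* f k) ⊛ g) n ≡ c ℤ.* (f ⊛ g) n
⊛-scaleˡ c f g n = ≡.trans (sumTo-cong n (λ k _ → ℤ.*-assoc c (f k) _)) (sumTo-* n c _)

⊛-tailʳ : ∀ f g n {t} → (tail f ⊛ g) n ≡ t → (f ⊛ g) (suc n) ≡ f 0 ℤ.* g (suc n) ℤ.+ t
⊛-tailʳ f g n e = ≡.trans (⊛-suc f g n) (cong (λ t → f 0 ℤ.* g (suc n) ℤ.+ t) e)

-- Taking the constant term off both factors leaves `tail f ⊛ tail g` two degrees lower, surrounded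
-- by terms symmetric in `f` and `g`; hence the recursion by two.
⊛-comm : ∀ f g n → (f ⊛ g) n ≡ (g ⊛ f) n
⊛-comm f g zero = ℤ.*-comm (f 0) (g 0)
⊛-comm f g (suc zero) = lemma (f 0) (f 1) (g 0) (g 1)
  where
  lemma : ∀ a b c d → a ℤ.* d ℤ.+ b ℤ.* c ≡ c ℤ.* b ℤ.+ d ℤ.* a
  lemma = solve-∀
⊛-comm f g (suc (suc n)) = begin
  (f ⊛ g) (2 ℕ.+ n)
    ≡⟨ ⊛-tailʳ f g (suc n) (≡.trans (⊛-comm (tail f) g (suc n)) (⊛-tailʳ g (tail f) n (⊛-comm (tail g) (tail f) n))) ⟩
  f 0 ℤ.* g (2 ℕ.+ n) ℤ.+ (g 0 ℤ.* f (2 ℕ.+ n) ℤ.+ (tail f ⊛ tail g) n)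
    ≡⟨ lemma (f 0) (g (2 ℕ.+ n)) (g 0) (f (2 ℕ.+ n)) _ ⟩
  g 0 ℤ.* f (2 ℕ.+ n) ℤ.+ (f 0 ℤ.* g (2 ℕ.+ n) ℤ.+ (tail f ⊛ tail g) n)
    ≡⟨ ⊛-tailʳ g f (suc n) (≡.trans (⊛-comm (tail g) f (suc n)) (⊛-suc f (tail g) n)) ⟨
  (g ⊛ f) (2 ℕ.+ n) ∎
  where
  open ≡.≡-Reasoning
  lemma : ∀ a b c d t → a ℤ.* b ℤ.+ (c ℤ.* d ℤ.+ t) ≡ c ℤ.* d ℤ.+ (a ℤ.* b ℤ.+ t)
  lemma = solve-∀

⊛-assoc : ∀ f g h n → ((f ⊛ g) ⊛ h) n ≡ (f ⊛ (g ⊛ h)) n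
⊛-assoc f g h zero = ℤ.*-assoc (f 0) (g 0) (h 0)
⊛-assoc f g h (suc n) = begin
  ((f ⊛ g) ⊛ h) (suc n)
    ≡⟨ ⊛-tailʳ (f ⊛ g) h n tail-part ⟩
  f 0 ℤ.* g 0 ℤ.* h (suc n) ℤ.+ (f 0 ℤ.* (tail g ⊛ h) n ℤ.+ (tail f ⊛ (g ⊛ h)) n)
    ≡⟨ lemma (f 0) (g 0) (h (suc n)) _ _ ⟩
  f 0 ℤ.* (g 0 ℤ.* h (suc n) ℤ.+ (tail g ⊛ h) n) ℤ.+ (tail f ⊛ (g ⊛ h)) n
    ≡⟨ cong (λ t → f 0 ℤ.* t ℤ.+ (tail f ⊛ (g ⊛ h)) n) (⊛-suc g h n) ⟨
  f 0 ℤ.* (g ⊛ h) (suc n) ℤ.+ (tail f ⊛ (g ⊛ h)) n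
    ≡⟨ ⊛-suc f (g ⊛ h) n ⟨
  (f ⊛ (g ⊛ h)) (suc n) ∎
  where
  open ≡.≡-Reasoning
  f₀g : PS
  f₀g k = f 0 ℤ.* tail g k
  tail-part : (tail (f ⊛ g) ⊛ h) n ≡ f 0 ℤ.* (tail g ⊛ h) n ℤ.+ (tail f ⊛ (g ⊛ h)) n
  tail-part = begin
    (tail (f ⊛ g) ⊛ h) n                                   ≡⟨ ⊛-congᵖ {tail (f ⊛ g)} {f₀g +ᵖ (tail f ⊛ g)} {h} {h} n (λ k _ → ⊛-suc f g k) (λ _ _ → refl) ⟩
    ((f₀g +ᵖ (tail f ⊛ g)) ⊛ h) n                          ≡⟨ ⊛-distribʳ h f₀g (tail f ⊛ g) n ⟩
    (f₀g ⊛ h) n ℤ.+ ((tail f ⊛ g) ⊛ h) n                   ≡⟨ cong₂ ℤ._+_ (⊛-scaleˡ (f 0) (tail g) h n) (⊛-assoc (tail f) g h n) ⟩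
    f 0 ℤ.* (tail g ⊛ h) n ℤ.+ (tail f ⊛ (g ⊛ h)) n        ∎
  lemma : ∀ a b c s t → a ℤ.* b ℤ.* c ℤ.+ (a ℤ.* s ℤ.+ t) ≡ a ℤ.* (b ℤ.* c ℤ.+ s) ℤ.+ t
  lemma = solve-∀

⊛-zeroˡ : ∀ f n → ((λ _ → + 0) ⊛ f) n ≡ + 0
⊛-zeroˡ f n = ≡.trans (sumTo-cong n (λ k _ → ℤ.*-zeroˡ (f (n ℕ.∸ k)))) (sumTo-0 n)

⊛-identityˡ : ∀ f n → (oneS ⊛ f) n ≡ f n
⊛-identityˡ f zero    = ℤ.*-identityˡ (f 0)
⊛-identityˡ f (suc n) = ≡.trans (⊛-tailʳ oneS f n (⊛-zeroˡ f n)) (≡.trans (ℤ.+-identityʳ _) (ℤ.*-identityˡ (f (suc n))))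

-- The ring operations are opaque: otherwise unification would unfold them to sums of integers.
opaque
  infixl 6 _⊕_
  infixl 7 _·_
  _⊕_ _·_ : PS → PS → PS
  _⊕_ = _+ᵖ_
  _·_ = _⊛_

  ⊝_ : PS → PS
  (⊝ f) n = ℤ.- f n

  zeroS : PS
  zeroS n = + 0

  at-⊕ : ∀ f g n → (f ⊕ g) n ≡ f n ℤ.+ g n
  at-⊕ f g n = refl

  at-· : ∀ f g n → (f · g) n ≡ (f ⊛ g) n
  at-· f g n = refl

  at-⊝ : ∀ f n → (⊝ f) n ≡ ℤ.- f n
  at-⊝ f n = refl

  at-0 : ∀ n → zeroS n ≡ + 0
  at-0 n = refl

  ps-isCommutativeRing : IsCommutativeRing _≋_ _⊕_ _·_ ⊝_ zeroS oneS
  ps-isCommutativeRing = record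
      { isRing = record
        { +-isAbelianGroup = record
          { isGroup = record
            { isMonoid = record
              { isSemigroup = record
                { isMagma = record
                  { isEquivalence = record
                    { refl = pointwise λ _ → refl
                    ; sym = λ p → pointwise λ n → ≡.sym (at p n)
                    ; trans = λ p q → pointwise λ n → ≡.trans (at p n) (at q n) }
                  ; ∙-cong = λ p q → pointwise λ n → cong₂ ℤ._+_ (at p n) (at q n) }
                ; assoc = λ f g h → pointwise λ n → ℤ.+-assoc (f n) (g n) (h n) }
              ; identity = (λ f → pointwise λ n → ℤ.+-identityˡ (f n)) , (λ f → pointwise λ n → ℤ.+-identityʳ (f n)) }
            ; inverse = (λ f → pointwise λ n → ℤ.+-inverseˡ (f n)) , (λ f → pointwise λ n → ℤ.+-inverseʳ (f n))
            ; ⁻¹-cong = λ p → pointwise λ n → cong ℤ.-_ (at p n) }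
          ; comm = λ f g → pointwise λ n → ℤ.+-comm (f n) (g n) }
        ; *-cong = λ p q → pointwise λ n → ⊛-congᵖ n (λ k _ → at p k) (λ k _ → at q k)
        ; *-assoc = λ f g h → pointwise (⊛-assoc f g h)
        ; *-identity = (λ f → pointwise (⊛-identityˡ f)) , (λ f → pointwise λ n → ≡.trans (⊛-comm f oneS n) (⊛-identityˡ f n))
        ; distrib = (λ h f g → pointwise λ n → ≡.trans (⊛-comm h (f ⊕ g) n)
                      (≡.trans (⊛-distribʳ h f g n) (cong₂ ℤ._+_ (⊛-comm f h n) (⊛-comm g h n))))
                  , (λ h f g → pointwise (⊛-distribʳ h f g)) }
      ; *-comm = λ f g → pointwise (⊛-comm f g) }

psRing : CommutativeRing 0ℓ 0ℓ
psRing = record { isCommutativeRing = ps-isCommutativeRing }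

module ℛ where
  open CommutativeRing psRing public hiding (_+_; _*_)
  open RingSolver psRing public

open ℛ using (Regular) public

opaque
  mono : ℕ → PS
  mono e n = if n ≡ᵇ e then + 1 else + 0

  const : ℤ → PS
  const c n = if n ≡ᵇ 0 then c else + 0

  mono-suc : ∀ e f n → (mono (suc e) · f) (suc n) ≡ (mono e · f) n
  mono-suc e f n = ≡.trans (at-· (mono (suc e)) f (suc n)) (≡.trans (⊛-suc (mono (suc e)) f n)
    (≡.trans (cong (λ t → t ℤ.+ (mono e ⊛ f) n) (ℤ.*-zeroˡ (f (suc n)))) (≡.trans (ℤ.+-identityˡ _) (≡.sym (at-· (mono e) f n)))))

  mono-0 : mono 0 ≋ oneS
  mono-0 = pointwise λ _ → refl

  mono-below : ∀ e f {n} → n < e → (mono e · f) n ≡ + 0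
  mono-below (suc e) f {zero}  _         = ≡.trans (at-· (mono (suc e)) f 0) (ℤ.*-zeroˡ (f 0))
  mono-below (suc e) f {suc n} (s≤s n<e) = ≡.trans (mono-suc e f n) (mono-below e f n<e)

  const-· : ∀ c f n → (const c · f) n ≡ c ℤ.* f n
  const-· c f n = ≡.trans (at-· (const c) f n) (raw n)
    where
    raw : ∀ n → (const c ⊛ f) n ≡ c ℤ.* f n
    raw zero    = refl
    raw (suc n) = ≡.trans (⊛-tailʳ (const c) f n (⊛-zeroˡ f n)) (ℤ.+-identityʳ _)

  at-mono : ∀ e n → mono e n ≡ (if n ≡ᵇ e then + 1 else + 0)
  at-mono e n = refl

  const-0 : const (+ 0) ≋ zeroS
  const-0 = pointwise λ { zero → ≡.sym (at-0 0) ; (suc n) → ≡.sym (at-0 (suc n)) }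

mono-shift : ∀ e f n → (mono e · f) (e ℕ.+ n) ≡ f n
mono-shift zero    f n = at (ℛ.trans (ℛ.*-congʳ mono-0) (ℛ.*-identityˡ f)) n
mono-shift (suc e) f n = ≡.trans (mono-suc e f (e ℕ.+ n)) (mono-shift e f n)

mono-+ : ∀ a b → mono a · mono b ≋ mono (a ℕ.+ b)
mono-+ zero    b = ℛ.trans (ℛ.*-congʳ mono-0) (ℛ.*-identityˡ (mono b))
mono-+ (suc a) b = pointwise λ
  { zero    → ≡.trans (mono-below (suc a) (mono b) z<s) (≡.sym (at-mono (suc a ℕ.+ b) 0))
  ; (suc n) → ≡.trans (mono-suc a (mono b) n) (≡.trans (at (mono-+ a b) n)
      (≡.trans (at-mono (a ℕ.+ b) n) (≡.sym (at-mono (suc a ℕ.+ b) (suc n))))) }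

opaque
  unfolding const
  -- This recursion takes the place of infinite summation: facts about substitutions are proved
  -- along it, and each step gains one order in q.
  head-tail : ∀ f → f ≋ const (f 0) ⊕ mono 1 · tail f
  head-tail f = pointwise λ
    { zero    → ≡.sym (≡.trans (at-⊕ (const (f 0)) (mono 1 · tail f) 0)
                  (≡.trans (cong (λ t → f 0 ℤ.+ t) (mono-below 1 (tail f) z<s)) (ℤ.+-identityʳ (f 0))))
    ; (suc n) → ≡.sym (≡.trans (at-⊕ (const (f 0)) (mono 1 · tail f) (suc n)) (≡.trans (ℤ.+-identityˡ _) (mono-shift 1 (tail f) n))) }

-- Congruence modulo q^K

infix 4 _≈[_]_
_≈[_]_ : PS → ℕ → PS → Set
f ≈[ K ] g = ∀ n → n < K → f n ≡ g n

≋⇒≈[] : ∀ {f g} K → f ≋ g → f ≈[ K ] g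
≋⇒≈[] K e n _ = at e n

≈[]⇒≋ : ∀ {f g} → (∀ K → f ≈[ K ] g) → f ≋ g
≈[]⇒≋ e = pointwise λ n → e (suc n) n ℕ.≤-refl

opaque
  unfolding _⊕_
  ≈[]-⊕ : ∀ K {f f′ g g′} → f ≈[ K ] f′ → g ≈[ K ] g′ → f ⊕ g ≈[ K ] f′ ⊕ g′
  ≈[]-⊕ K p q n n<K = cong₂ ℤ._+_ (p n n<K) (q n n<K)

  ≈[]-· : ∀ K {f f′ g g′} → f ≈[ K ] f′ → g ≈[ K ] g′ → f · g ≈[ K ] f′ · g′
  ≈[]-· K {f} {f′} {g} {g′} p q n n<K =
    ⊛-congᵖ {f} {f′} {g} {g′} n (λ k k≤n → p k (ℕ.≤-<-trans k≤n n<K)) (λ k k≤n → q k (ℕ.≤-<-trans k≤n n<K))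

≈[]-trans : ∀ {K f g h} → f ≈[ K ] g → g ≈[ K ] h → f ≈[ K ] h
≈[]-trans p q n n<K = ≡.trans (p n n<K) (q n n<K)

≈[]-sym : ∀ {K f g} → f ≈[ K ] g → g ≈[ K ] f
≈[]-sym p n n<K = ≡.sym (p n n<K)

≈[]-mono : ∀ e K {f g} → f ≈[ K ] g → mono e · f ≈[ e ℕ.+ K ] mono e · g
≈[]-mono zero    K p n n<K = ≡.trans (mono-shift 0 _ n) (≡.trans (p n n<K) (≡.sym (mono-shift 0 _ n)))
≈[]-mono (suc e) K p zero  n<K = ≡.trans (mono-below (suc e) _ z<s) (≡.sym (mono-below (suc e) _ z<s))
≈[]-mono (suc e) K {f} {g} p (suc n) (s≤s n<K) =
  ≡.trans (mono-suc e f n) (≡.trans (≈[]-mono e K p n n<K) (≡.sym (mono-suc e g n)))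

mono-≈[]0 : ∀ {e K} → K ≤ e → ∀ f → mono e · f ≈[ K ] zeroS
mono-≈[]0 {e} K≤e f n n<K = ≡.trans (mono-below e f (ℕ.<-≤-trans n<K K≤e)) (≡.sym (at-0 n))

opaque
  unfolding _⊕_
  -- By strong induction on n: once the coefficients of `g` below n vanish, the n-th coefficient of
  -- the product is f(0) g(n), and ℤ has no zero divisors.
  regular-≢0 : ∀ {f} → f 0 ≢ + 0 → Regular f
  regular-≢0 {f} f0≢0 g e = pointwise λ n → below (suc n) n ℕ.≤-refl
    where
    below : ∀ K n → n < K → g n ≡ + 0
    below (suc K) n (s≤s n≤K) with ℕ.m≤n⇒m<n∨m≡n n≤K
    ... | inj₁ n<K  = below K n n<K
    ... | inj₂ refl with ℤ.i*j≡0⇒i≡0∨j≡0 (f 0) {g n} (≡.trans (≡.sym (leading n (below n))) (at e n))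
      where
      leading : ∀ m → (∀ k → k < m → g k ≡ + 0) → (f ⊛ g) m ≡ f 0 ℤ.* g m
      leading zero    _  = refl
      leading (suc m) g0 = ≡.trans (⊛-tailʳ f g m (≡.trans (⊛-comm (tail f) g m)
        (≡.trans (⊛-congᵖ {g} {λ _ → + 0} {tail f} {tail f} m (λ k k≤m → g0 k (s≤s k≤m)) (λ _ _ → refl)) (⊛-zeroˡ (tail f) m))))
        (ℤ.+-identityʳ _)
    ... | inj₁ f0≡0 = ⊥-elim (f0≢0 f0≡0)
    ... | inj₂ gn≡0 = gn≡0

-- Reciprocals

invUpTo-stable : ∀ f n d → invUpTo f (d ℕ.+ n) n ≡ inv f n
invUpTo-stable f n zero    = refl
invUpTo-stable f n (suc d) with n ≡ᵇ suc (d ℕ.+ n) | ℕ.≡ᵇ⇒≡ n (suc (d ℕ.+ n))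
... | true  | p = ⊥-elim (ℕ.m≢1+n+m n (p _))
... | false | _ = invUpTo-stable f n d

≡ᵇ-refl : ∀ n → (n ≡ᵇ n) ≡ true
≡ᵇ-refl zero    = refl
≡ᵇ-refl (suc n) = ≡ᵇ-refl n

inv-suc : ∀ f n → inv f (suc n) ≡ ℤ.- sumTo n (λ k → f (suc n ℕ.∸ k) ℤ.* inv f k)
inv-suc f n rewrite ≡ᵇ-refl n = cong ℤ.-_ (sumTo-cong n (λ k k≤n →
  cong (λ t → f (suc n ℕ.∸ k) ℤ.* t) (≡.trans (cong (λ m → invUpTo f m k) (≡.sym (ℕ.m∸n+n≡m k≤n))) (invUpTo-stable f k (n ℕ.∸ k)))))

opaque
  unfolding _⊕_
  inv-left : ∀ f → f 0 ≡ + 1 → inv f · f ≋ oneS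
  inv-left f f0 = pointwise λ
    { zero    → ≡.trans (ℤ.*-identityˡ _) f0
    ; (suc n) → begin
        (inv f ⊛ f) (suc n)
          ≡⟨ cong₂ ℤ._+_ (sumTo-cong n (λ k _ → ℤ.*-comm (inv f k) (f (suc n ℕ.∸ k))))
                         (cong₂ ℤ._*_ (inv-suc f n) (≡.trans (cong f (ℕ.n∸n≡0 n)) f0)) ⟩
        S n ℤ.+ ℤ.- S n ℤ.* + 1  ≡⟨ cong (λ t → S n ℤ.+ t) (ℤ.*-identityʳ (ℤ.- S n)) ⟩
        S n ℤ.+ ℤ.- S n          ≡⟨ ℤ.+-inverseʳ (S n) ⟩
        + 0                      ∎ }
    where
    open ≡.≡-Reasoning
    S : ℕ → ℤ
    S n = sumTo n (λ k → f (suc n ℕ.∸ k) ℤ.* inv f k)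

inv-right : ∀ f → f 0 ≡ + 1 → f · inv f ≋ oneS
inv-right f f0 = ℛ.trans (ℛ.*-comm f (inv f)) (inv-left f f0)

inv-unique : ∀ {f g} → f 0 ≡ + 1 → f · g ≋ oneS → g ≋ inv f
inv-unique {f} {g} f0 e = ℛ.trans (ℛ.sym (ℛ.*-identityˡ g)) (ℛ.trans (ℛ.*-congʳ (ℛ.sym (inv-left f f0)))
  (ℛ.trans (ℛ.*-assoc (inv f) f g) (ℛ.trans (ℛ.*-congˡ e) (ℛ.*-identityʳ (inv f)))))

inv-cong : ∀ {f g} → f 0 ≡ + 1 → f ≋ g → inv f ≋ inv g
inv-cong {f} {g} f0 e = inv-unique (≡.trans (≡.sym (at e 0)) f0) (ℛ.trans (ℛ.*-congʳ (ℛ.sym e)) (inv-right f f0))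

opaque
  unfolding _⊕_
  ·-0 : ∀ f g → (f · g) 0 ≡ f 0 ℤ.* g 0
  ·-0 f g = refl

  ⊛≡· : _⊛_ ≡ _·_
  ⊛≡· = refl

open ℛ using (⟦_⟧; ⌜_⌝; Holds) renaming (_^_ to _^ˢ_)
open import Algebra.Properties.CommutativeSemigroup ℛ.*-commutativeSemigroup using (interchange)
open import Algebra.Properties.Ring ℛ.ring using (-1*x≈-x; -‿involutive; -‿distribʳ-*; -‿distribˡ-*; -‿+-comm; +-inverseʳ-unique)
open import Relation.Binary.Reasoning.Setoid ℛ.setoid

-- Substitutions

-- Φ is the substitution q ↦ U q.
record IsSubst (Φ : PS → PS) (U : PS) : Set where
  field
    subst-cong  : ∀ {f g} → f ≋ g → Φ f ≋ Φ g
    subst-⊕     : ∀ f g → Φ (f ⊕ g) ≋ Φ f ⊕ Φ g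
    subst-const : ∀ c f → Φ (const c · f) ≋ const c · Φ f
    subst-q     : ∀ f → Φ (mono 1 · f) ≋ U · mono 1 · Φ f
    subst-1     : Φ oneS ≋ oneS

const-alone : ∀ c → const c ≋ const c · oneS
const-alone c = ℛ.sym (ℛ.*-identityʳ (const c))

module Subst {Φ U} (s : IsSubst Φ U) where
  open IsSubst s public

  subst-head-tail : ∀ f → Φ f ≋ const (f 0) ⊕ U · mono 1 · Φ (tail f)
  subst-head-tail f = begin
    Φ f                                                      ≈⟨ subst-cong (head-tail f) ⟩
    Φ (const (f 0) ⊕ mono 1 · tail f)                        ≈⟨ subst-⊕ _ _ ⟩
    Φ (const (f 0)) ⊕ Φ (mono 1 · tail f)
      ≈⟨ ℛ.+-cong (ℛ.trans (subst-cong (const-alone (f 0))) (ℛ.trans (subst-const (f 0) oneS) (ℛ.*-congˡ subst-1))) (subst-q (tail f)) ⟩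
    const (f 0) · oneS ⊕ U · mono 1 · Φ (tail f)             ≈⟨ ℛ.+-congʳ (const-alone (f 0)) ⟨
    const (f 0) ⊕ U · mono 1 · Φ (tail f)                    ∎

  raise : ∀ K {f g} → f ≈[ K ] g → U · mono 1 · f ≈[ suc K ] U · mono 1 · g
  raise K {f} {g} e = ≈[]-trans (≋⇒≈[] (suc K) (ℛ.*-assoc U (mono 1) f))
    (≈[]-trans (≈[]-· (suc K) (λ _ _ → refl) (≈[]-mono 1 K e)) (≋⇒≈[] (suc K) (ℛ.sym (ℛ.*-assoc U (mono 1) g))))

  -- Multiplicativity need not be an axiom of `IsSubst`: splitting `f` into constant term and tail
  -- leaves the claim for `tail f` multiplied by `U · mono 1`, which raises the precision from K to
  -- K + 1.
  subst-·-mod : ∀ K f g → Φ (f · g) ≈[ K ] Φ f · Φ g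
  subst-·-mod (suc K) f g = ≈[]-trans (≋⇒≈[] (suc K) left)
    (≈[]-trans (≈[]-⊕ (suc K) (λ _ _ → refl) (raise K (subst-·-mod K (tail f) g))) (≋⇒≈[] (suc K) right))
    where
    left : Φ (f · g) ≋ const (f 0) · Φ g ⊕ U · mono 1 · Φ (tail f · g)
    left = begin
      Φ (f · g)                                                ≈⟨ subst-cong (ℛ.trans (ℛ.*-congʳ (head-tail f)) (ℛ.distribʳ g _ _)) ⟩
      Φ (const (f 0) · g ⊕ mono 1 · tail f · g)                ≈⟨ subst-⊕ _ _ ⟩
      Φ (const (f 0) · g) ⊕ Φ (mono 1 · tail f · g)
        ≈⟨ ℛ.+-cong (subst-const (f 0) g) (ℛ.trans (subst-cong (ℛ.*-assoc (mono 1) (tail f) g)) (subst-q (tail f · g))) ⟩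
      const (f 0) · Φ g ⊕ U · mono 1 · Φ (tail f · g)          ∎
    right : const (f 0) · Φ g ⊕ U · mono 1 · (Φ (tail f) · Φ g) ≋ Φ f · Φ g
    right = begin
      const (f 0) · Φ g ⊕ U · mono 1 · (Φ (tail f) · Φ g)      ≈⟨ ℛ.+-congˡ (ℛ.*-assoc _ _ _) ⟨
      const (f 0) · Φ g ⊕ U · mono 1 · Φ (tail f) · Φ g        ≈⟨ ℛ.distribʳ (Φ g) _ _ ⟨
      (const (f 0) ⊕ U · mono 1 · Φ (tail f)) · Φ g            ≈⟨ ℛ.*-congʳ (subst-head-tail f) ⟨
      Φ f · Φ g                                                ∎

  subst-· : ∀ f g → Φ (f · g) ≋ Φ f · Φ g
  subst-· f g = ≈[]⇒≋ λ K → subst-·-mod K f g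

  subst-mono1 : Φ (mono 1) ≋ U · mono 1
  subst-mono1 = begin
    Φ (mono 1)              ≈⟨ subst-cong (ℛ.*-identityʳ (mono 1)) ⟨
    Φ (mono 1 · oneS)       ≈⟨ subst-q oneS ⟩
    U · mono 1 · Φ oneS     ≈⟨ ℛ.*-congˡ subst-1 ⟩
    U · mono 1 · oneS       ≈⟨ ℛ.*-identityʳ _ ⟩
    U · mono 1              ∎

  subst-0 : Φ zeroS ≋ zeroS
  subst-0 = begin
    Φ zeroS                 ≈⟨ subst-cong (ℛ.trans (ℛ.sym (ℛ.zeroˡ oneS)) (ℛ.*-congʳ (ℛ.sym const-0))) ⟩
    Φ (const (+ 0) · oneS)  ≈⟨ subst-const (+ 0) oneS ⟩
    const (+ 0) · Φ oneS    ≈⟨ ℛ.*-congʳ const-0 ⟩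
    zeroS · Φ oneS          ≈⟨ ℛ.zeroˡ _ ⟩
    zeroS                   ∎

  subst-⊝ : ∀ f → Φ (⊝ f) ≋ ⊝ Φ f
  subst-⊝ f = +-inverseʳ-unique (Φ f) (Φ (⊝ f)) (ℛ.trans (ℛ.sym (subst-⊕ f (⊝ f))) (ℛ.trans (subst-cong (ℛ.-‿inverseʳ f)) subst-0))

  subst-^ : ∀ f k → Φ (f ^ˢ k) ≋ Φ f ^ˢ k
  subst-^ f zero    = subst-1
  subst-^ f (suc k) = ℛ.trans (subst-· f (f ^ˢ k)) (ℛ.*-congˡ (subst-^ f k))

  subst-ℕ : ∀ n → Φ ⌜ + n ⌝ ≋ ⌜ + n ⌝
  subst-ℕ zero    = subst-0
  subst-ℕ (suc n) = ℛ.trans (subst-⊕ _ _) (ℛ.+-cong subst-1 (subst-ℕ n))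

  subst-⌜⌝ : ∀ c → Φ ⌜ c ⌝ ≋ ⌜ c ⌝
  subst-⌜⌝ (+ n)      = subst-ℕ n
  subst-⌜⌝ (-[1+ n ]) = ℛ.trans (subst-⊝ _) (ℛ.-‿cong (subst-ℕ (suc n)))

  subst-⟦⟧ : ∀ {n} (e : Expr n) ρ → Φ (⟦ e ⟧ ρ) ≋ ⟦ e ⟧ (map Φ ρ)
  subst-⟦⟧ (con (+ 0))           ρ = subst-0
  subst-⟦⟧ (con (+ 1))           ρ = subst-1
  subst-⟦⟧ (con (+ suc (suc n))) ρ = subst-⌜⌝ (+ suc (suc n))
  subst-⟦⟧ (con (-[1+ n ]))      ρ = subst-⌜⌝ (-[1+ n ])
  subst-⟦⟧ (var i)  ρ = ℛ.reflexive (≡.sym (lookup-map i Φ ρ))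
  subst-⟦⟧ (a :+ b) ρ = ℛ.trans (subst-⊕ _ _) (ℛ.+-cong (subst-⟦⟧ a ρ) (subst-⟦⟧ b ρ))
  subst-⟦⟧ (a :- b) ρ = ℛ.trans (subst-⊕ _ _) (ℛ.+-cong (subst-⟦⟧ a ρ) (ℛ.trans (subst-⊝ _) (ℛ.-‿cong (subst-⟦⟧ b ρ))))
  subst-⟦⟧ (a :* b) ρ = ℛ.trans (subst-· _ _) (ℛ.*-cong (subst-⟦⟧ a ρ) (subst-⟦⟧ b ρ))
  subst-⟦⟧ (a :^ k) ρ = ℛ.trans (subst-^ _ k) (^-cong k (subst-⟦⟧ a ρ))
    where open ℛ using (^-cong)

  subst-at0 : ∀ f → Φ f 0 ≡ f 0
  subst-at0 f = ≡.trans (at (subst-head-tail f) 0) (≡.trans (at-⊕ (const (f 0)) (U · mono 1 · Φ (tail f)) 0)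
    (≡.trans (cong₂ ℤ._+_ (const-at0 (f 0))
      (≡.trans (at (ℛ.trans (ℛ.*-congʳ (ℛ.*-comm U (mono 1))) (ℛ.*-assoc (mono 1) U _)) 0) (mono-below 1 _ z<s))) (ℤ.+-identityʳ _)))
    where
    opaque
      unfolding const
      const-at0 : ∀ c → const c 0 ≡ c
      const-at0 c = refl

  subst-inv : ∀ {f} → f 0 ≡ + 1 → Φ (inv f) ≋ inv (Φ f)
  subst-inv {f} f0 = inv-unique (≡.trans (subst-at0 f) f0)
    (ℛ.trans (ℛ.sym (subst-· f (inv f))) (ℛ.trans (subst-cong (inv-right f f0)) subst-1))

-- A substitution is determined by the image of q. Composition laws such as `dil-∘` and `negq-dil2`
-- thereby reduce to comparing two monomials.
subst-unique : ∀ {Φ Ψ U V} → IsSubst Φ U → IsSubst Ψ V → U ≋ V → ∀ f → Φ f ≋ Ψ f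
subst-unique {Φ} {Ψ} {U} {V} s t U≋V f = ≈[]⇒≋ λ K → go K f
  where
  module S = Subst s
  module T = Subst t
  go : ∀ K f → Φ f ≈[ K ] Ψ f
  go (suc K) f = ≈[]-trans (≋⇒≈[] (suc K) (S.subst-head-tail f))
    (≈[]-trans (≈[]-⊕ (suc K) (λ _ _ → refl) (S.raise K (go K (tail f))))
      (≋⇒≈[] (suc K) (ℛ.trans (ℛ.+-congˡ (ℛ.*-congʳ (ℛ.*-congʳ U≋V))) (ℛ.sym (T.subst-head-tail f)))))

subst-∘ : ∀ {Φ Ψ U V} → IsSubst Φ U → IsSubst Ψ V → IsSubst (λ f → Φ (Ψ f)) (Φ V · U)
subst-∘ {Φ} {Ψ} {U} {V} s t = record
  { subst-cong = λ e → S.subst-cong (T.subst-cong e)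
  ; subst-⊕ = λ f g → ℛ.trans (S.subst-cong (T.subst-⊕ f g)) (S.subst-⊕ _ _)
  ; subst-const = λ c f → ℛ.trans (S.subst-cong (T.subst-const c f)) (S.subst-const c _)
  ; subst-q = λ f → begin
      Φ (Ψ (mono 1 · f))            ≈⟨ S.subst-cong (T.subst-q f) ⟩
      Φ (V · mono 1 · Ψ f)          ≈⟨ ℛ.trans (S.subst-· _ _) (ℛ.*-congʳ (ℛ.trans (S.subst-· _ _) (ℛ.*-congˡ S.subst-mono1))) ⟩
      Φ V · (U · mono 1) · Φ (Ψ f)  ≈⟨ ℛ.*-congʳ (ℛ.*-assoc _ _ _) ⟨
      Φ V · U · mono 1 · Φ (Ψ f)    ∎
  ; subst-1 = ℛ.trans (S.subst-cong T.subst-1) S.subst-1 }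
  where
  module S = Subst s
  module T = Subst t

-- The substitutions q ↦ q^k and q ↦ -q

dil-below : ∀ k .{{_ : NonZero k}} f {n} → suc n < k → dil k f (suc n) ≡ + 0
dil-below k f {n} n<k rewrite m<n⇒m%n≡m n<k = refl

dil-at0 : ∀ k .{{_ : NonZero k}} f → dil k f 0 ≡ f 0
dil-at0 (suc k) f = refl

dil-shift : ∀ k .{{_ : NonZero k}} f n → dil k f (k ℕ.+ n) ≡ dil k (tail f) n
dil-shift k f n = cong₂ (λ r v → if r ≡ᵇ 0 then f v else + 0) mod div
  where
  mod : (k ℕ.+ n) % k ≡ n % k
  mod = ≡.trans (cong (_% k) (ℕ.+-comm k n)) ([m+n]%n≡m%n n k)
  div : (k ℕ.+ n) / k ≡ suc (n / k)
  div = ≡.trans (m/n≡1+[m∸n]/n (ℕ.m≤m+n k n)) (cong (λ t → suc (t / k)) (ℕ.m+n∸m≡n k n))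

dil-cong : ∀ k .{{_ : NonZero k}} {f g} → f ≋ g → dil k f ≋ dil k g
dil-cong k {f} {g} e = pointwise λ n → cong (λ t → if n % k ≡ᵇ 0 then t else + 0) (at e (n / k))

dil-q : ∀ k .{{_ : NonZero k}} f → dil k (mono 1 · f) ≋ mono k · dil k f
dil-q k f = pointwise λ n → go n
  where
  go : ∀ n → dil k (mono 1 · f) n ≡ (mono k · dil k f) n
  go n with n ℕ.<? k
  go zero    | yes 0<k = ≡.trans (dil-at0 k (mono 1 · f)) (≡.trans (mono-below 1 f z<s) (≡.sym (mono-below k _ 0<k)))
  go (suc n) | yes n<k = ≡.trans (dil-below k (mono 1 · f) n<k) (≡.sym (mono-below k _ n<k))
  go n | no n≮k with ℕ.m≤n⇒∃[o]m+o≡n (ℕ.≮⇒≥ n≮k)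
  ... | o , refl = ≡.trans (dil-shift k (mono 1 · f) o)
    (≡.trans (at (dil-cong k {tail (mono 1 · f)} {f} (pointwise λ m → mono-shift 1 f m)) o) (≡.sym (mono-shift k _ o)))

opaque
  unfolding _⊕_ const
  dil-⊕ : ∀ k .{{_ : NonZero k}} f g → dil k (f ⊕ g) ≋ dil k f ⊕ dil k g
  dil-⊕ k f g = pointwise λ n → go n
    where
    go : ∀ n → dil k (f ⊕ g) n ≡ dil k f n ℤ.+ dil k g n
    go n with n % k ≡ᵇ 0
    ... | true  = refl
    ... | false = refl

  dil-const : ∀ k .{{_ : NonZero k}} c f → dil k (const c · f) ≋ const c · dil k f
  dil-const k c f = pointwise λ n → ≡.trans (go n) (≡.sym (const-· c (dil k f) n))
    where
    go : ∀ n → dil k (const c · f) n ≡ c ℤ.* dil k f n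
    go n with n % k ≡ᵇ 0
    ... | true  = const-· c f (n / k)
    ... | false = ≡.sym (ℤ.*-zeroʳ c)

  negq-⊕ : ∀ f g → negq (f ⊕ g) ≋ negq f ⊕ negq g
  negq-⊕ f g = pointwise λ n → ℤ.*-distribˡ-+ ((ℤ.- (+ 1)) ℤ.^ n) (f n) (g n)

negq-const : ∀ c f → negq (const c · f) ≋ const c · negq f
negq-const c f = pointwise λ n → ≡.trans (cong (λ t → (ℤ.- (+ 1)) ℤ.^ n ℤ.* t) (const-· c f n))
  (≡.trans (lemma ((ℤ.- (+ 1)) ℤ.^ n) c (f n)) (≡.sym (const-· c (negq f) n)))
  where
  lemma : ∀ a b c → a ℤ.* (b ℤ.* c) ≡ b ℤ.* (a ℤ.* c)
  lemma = solve-∀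

⊝mono1 : ∀ f n → (⊝ oneS · mono 1 · f) n ≡ ℤ.- (mono 1 · f) n
⊝mono1 f n = ≡.trans (at (ℛ.trans (ℛ.*-congʳ (ℛ.trans (ℛ.sym (-‿distribˡ-* oneS (mono 1))) (ℛ.-‿cong (ℛ.*-identityˡ (mono 1)))))
    (ℛ.sym (-‿distribˡ-* (mono 1) f))) n) (at-⊝ (mono 1 · f) n)

negq-q : ∀ f → negq (mono 1 · f) ≋ ⊝ oneS · mono 1 · negq f
negq-q f = pointwise λ
  { zero    → ≡.trans (cong (λ t → + 1 ℤ.* t) (mono-below 1 f z<s)) (≡.sym (≡.trans (⊝mono1 (negq f) 0) (cong ℤ.-_ (mono-below 1 (negq f) z<s))))
  ; (suc n) → ≡.trans (cong (λ t → (ℤ.- (+ 1)) ℤ.^ suc n ℤ.* t) (mono-shift 1 f n))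
      (≡.trans (lemma ((ℤ.- (+ 1)) ℤ.^ n) (f n))
        (≡.sym (≡.trans (⊝mono1 (negq f) (suc n)) (cong ℤ.-_ (mono-shift 1 (negq f) n))))) }
  where
  lemma : ∀ a b → (ℤ.- (+ 1)) ℤ.* a ℤ.* b ≡ ℤ.- (a ℤ.* b)
  lemma = solve-∀

dil-isSubst : ∀ k → IsSubst (dil (suc k)) (mono k)
dil-isSubst k = record
  { subst-cong = dil-cong (suc k) ; subst-⊕ = dil-⊕ (suc k) ; subst-const = dil-const (suc k)
  ; subst-q = λ f → ℛ.trans (dil-q (suc k) f) (ℛ.*-congʳ (ℛ.sym (ℛ.trans (mono-+ k 1) (ℛ.reflexive (cong mono (ℕ.+-comm k 1))))))
  ; subst-1 = pointwise λ n → go n }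
  where
  go : ∀ n → dil (suc k) oneS n ≡ oneS n
  go n with n ℕ.<? suc k
  go zero    | yes _   = refl
  go (suc n) | yes n<k = dil-below (suc k) oneS n<k
  go n | no n≮k with ℕ.m≤n⇒∃[o]m+o≡n (ℕ.≮⇒≥ n≮k)
  ... | o , refl = ≡.trans (dil-shift (suc k) oneS o) (zero-dil o)
    where
    zero-dil : ∀ o → dil (suc k) (tail oneS) o ≡ + 0
    zero-dil o with o % suc k ≡ᵇ 0
    ... | true  = refl
    ... | false = refl

negq-isSubst : IsSubst negq (⊝ oneS)
negq-isSubst = record
  { subst-cong = λ e → pointwise λ n → cong (λ t → (ℤ.- (+ 1)) ℤ.^ n ℤ.* t) (at e n)
  ; subst-⊕ = negq-⊕ ; subst-const = negq-const ; subst-q = negq-q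
  ; subst-1 = pointwise λ { zero → refl ; (suc n) → ℤ.*-zeroʳ ((ℤ.- (+ 1)) ℤ.^ suc n) } }

-- Infinite products

-- The image of q is divisible by q, so K correct coefficients of the argument determine K
-- coefficients of the image.
subst-mod : ∀ {Φ U} → IsSubst Φ U → ∀ K {f g} → f ≈[ K ] g → Φ f ≈[ K ] Φ g
subst-mod {Φ} {U} s zero    e _ ()
subst-mod {Φ} {U} s (suc K) {f} {g} e = ≈[]-trans (≋⇒≈[] (suc K) (subst-head-tail f))
  (≈[]-trans (≈[]-⊕ (suc K) (λ n _ → cong (λ c → const c n) (e 0 z<s)) (raise K (subst-mod s K (λ n n<K → e (suc n) (s≤s n<K)))))
    (≋⇒≈[] (suc K) (ℛ.sym (subst-head-tail g))))
  where open Subst s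

∏ : ℕ → (ℕ → PS) → PS
∏ zero    F = oneS
∏ (suc n) F = ∏ n F · F n

1-q^ 1+q^ : ℕ → PS
1-q^ e = oneS ⊕ ⊝ mono e
1+q^ e = oneS ⊕ mono e

∏-cong : ∀ n {F G} → (∀ j → F j ≋ G j) → ∏ n F ≋ ∏ n G
∏-cong zero    e = ℛ.refl
∏-cong (suc n) e = ℛ.*-cong (∏-cong n e) (e n)

∏-mod : ∀ K n {F G} → (∀ j → F j ≈[ K ] G j) → ∏ n F ≈[ K ] ∏ n G
∏-mod K zero    e = λ _ _ → refl
∏-mod K (suc n) e = ≈[]-· K (∏-mod K n e) (e n)

∏-· : ∀ n F G → ∏ n (λ j → F j · G j) ≋ ∏ n F · ∏ n G
∏-· zero    F G = ℛ.sym (ℛ.*-identityˡ oneS)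
∏-· (suc n) F G = ℛ.trans (ℛ.*-congʳ (∏-· n F G)) (interchange _ _ _ _)

∏-+ : ∀ m n F → ∏ (n ℕ.+ m) F ≋ ∏ m F · ∏ n (λ j → F (j ℕ.+ m))
∏-+ m zero    F = ℛ.sym (ℛ.*-identityʳ _)
∏-+ m (suc n) F = ℛ.trans (ℛ.*-congʳ (∏-+ m n F)) (ℛ.*-assoc _ _ _)

∏-dissect : ∀ c n F → ∏ (n ℕ.* c) F ≋ ∏ c (λ r → ∏ n (λ j → F (r ℕ.+ j ℕ.* c)))
∏-dissect c zero    F = ones c
  where
  ones : ∀ c → oneS ≋ ∏ c (λ _ → oneS)
  ones zero    = ℛ.refl
  ones (suc c) = ℛ.trans (ones c) (ℛ.sym (ℛ.*-identityʳ _))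
∏-dissect c (suc n) F = begin
  ∏ (c ℕ.+ n ℕ.* c) F                                                         ≈⟨ ∏-+ (n ℕ.* c) c F ⟩
  ∏ (n ℕ.* c) F · ∏ c (λ r → F (r ℕ.+ n ℕ.* c))                               ≈⟨ ℛ.*-congʳ (∏-dissect c n F) ⟩
  ∏ c (λ r → ∏ n (λ j → F (r ℕ.+ j ℕ.* c))) · ∏ c (λ r → F (r ℕ.+ n ℕ.* c))   ≈⟨ ∏-· c _ _ ⟨
  ∏ c (λ r → ∏ n (λ j → F (r ℕ.+ j ℕ.* c)) · F (r ℕ.+ n ℕ.* c))               ∎

∏-subst : ∀ {Φ U} → IsSubst Φ U → ∀ n F → Φ (∏ n F) ≋ ∏ n (λ j → Φ (F j))
∏-subst s zero    F = IsSubst.subst-1 s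
∏-subst s (suc n) F = ℛ.trans (Subst.subst-· s _ _) (ℛ.*-congʳ (∏-subst s n F))

opaque
  unfolding _⊕_ mono
  oneMinusQ≋ : ∀ e → oneMinusQ e ≋ 1-q^ e
  oneMinusQ≋ e = pointwise λ _ → refl

1-q^≈1 : ∀ {K e} → K ≤ e → 1-q^ e ≈[ K ] oneS
1-q^≈1 {K} {e} K≤e = ≈[]-trans (≈[]-⊕ K (λ _ _ → refl) vanish) (≋⇒≈[] K (ℛ.+-identityʳ oneS))
  where
  vanish : ⊝ mono e ≈[ K ] zeroS
  vanish n n<K = ≡.trans (at-⊝ (mono e) n) (≡.trans (cong ℤ.-_ (≡.trans (at (ℛ.sym (ℛ.*-identityʳ (mono e))) n)
    (mono-below e oneS (ℕ.<-≤-trans n<K K≤e)))) (≡.sym (at-0 n)))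

∏-stable : ∀ K n F → (∀ j → K ≤ j → F j ≈[ K ] oneS) → ∏ (n ℕ.+ K) F ≈[ K ] ∏ K F
∏-stable K zero    F e = λ _ _ → refl
∏-stable K (suc n) F e = ≈[]-trans (≈[]-· K (∏-stable K n F e) (e (n ℕ.+ K) (ℕ.m≤n+m K n))) (≋⇒≈[] K (ℛ.*-identityʳ _))

prodTo≋∏ : ∀ n F → prodTo n F ≋ ∏ (suc n) F
prodTo≋∏ zero    F = ℛ.sym (ℛ.*-identityˡ (F 0))
prodTo≋∏ (suc n) F = ℛ.trans (pointwise λ m → ≡.sym (at-· (prodTo n F) (F (suc n)) m)) (ℛ.*-congʳ (prodTo≋∏ n F))

exponent-≥ : ∀ a d K j → K ≤ j → suc K ≤ suc a ℕ.+ suc d ℕ.* j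
exponent-≥ a d K j K≤j = s≤s (ℕ.≤-trans K≤j (ℕ.≤-trans (ℕ.m≤n*m j (suc d)) (ℕ.m≤n+m _ a)))

-- The n-th coefficient of `poch` is defined by a product whose length depends on n. Modulo q^K one
-- finite product serves for all coefficients at once, and then finite products can be regrouped and
-- substituted factor by factor.
poch-∏ : ∀ a d K n → K ≤ n → poch (suc a) (suc d) ≈[ K ] ∏ n (λ j → 1-q^ (suc a ℕ.+ suc d ℕ.* j))
poch-∏ a d K n K≤n m m<K = ≡.trans (at (prodTo≋∏ m _) m) (≡.trans (at (∏-cong (suc m) {G = F} (λ j → oneMinusQ≋ _)) m) stable)
  where
  F : ℕ → PS
  F j = 1-q^ (suc a ℕ.+ suc d ℕ.* j)
  stable : ∏ (suc m) F m ≡ ∏ n F m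
  stable = ≡.trans (≡.sym (∏-stable (suc m) (n ℕ.∸ suc m) F (λ j le → 1-q^≈1 (ℕ.≤-trans (ℕ.n≤1+n _) (exponent-≥ a d (suc m) j le))) m ℕ.≤-refl))
    (cong (λ t → ∏ t F m) (ℕ.m∸n+n≡m (ℕ.≤-trans m<K K≤n)))

poch-at0 : ∀ a d → poch (suc a) (suc d) 0 ≡ + 1
poch-at0 a d = refl

poch-dissect : ∀ a d c → poch (suc a) (suc d) ≋ ∏ (suc c) (λ r → poch (suc a ℕ.+ suc d ℕ.* r) (suc c ℕ.* suc d))
poch-dissect a d c = ≈[]⇒≋ λ K → ≈[]-trans (poch-∏ a d K (K ℕ.* suc c) (ℕ.m≤m*n K (suc c)))
  (≈[]-trans (≋⇒≈[] K (∏-dissect (suc c) K _)) (∏-mod K (suc c) (λ r →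
    ≈[]-trans (≋⇒≈[] K (∏-cong K (λ j → ℛ.reflexive (cong 1-q^ (exponents a d c r j)))))
      (≈[]-sym (poch-∏ (a ℕ.+ suc d ℕ.* r) (d ℕ.+ c ℕ.* suc d) K K ℕ.≤-refl)))))
  where
  exponents : ∀ a d c r j → suc a ℕ.+ suc d ℕ.* (r ℕ.+ j ℕ.* suc c) ≡ suc (a ℕ.+ suc d ℕ.* r) ℕ.+ suc (d ℕ.+ c ℕ.* suc d) ℕ.* j
  exponents = ℕ-Solver.solve-∀

dil-mono : ∀ k e → dil (suc k) (mono e) ≋ mono (suc k ℕ.* e)
dil-mono k zero    = ℛ.trans (subst-cong mono-0) (ℛ.trans subst-1 (ℛ.trans (ℛ.sym mono-0) (ℛ.reflexive (cong mono (≡.sym (ℕ.*-zeroʳ (suc k)))))))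
  where open Subst (dil-isSubst k)
dil-mono k (suc e) = begin
  dil (suc k) (mono (suc e))           ≈⟨ subst-cong (mono-+ 1 e) ⟨
  dil (suc k) (mono 1 · mono e)        ≈⟨ dil-q (suc k) (mono e) ⟩
  mono (suc k) · dil (suc k) (mono e)  ≈⟨ ℛ.*-congˡ (dil-mono k e) ⟩
  mono (suc k) · mono (suc k ℕ.* e)    ≈⟨ mono-+ (suc k) (suc k ℕ.* e) ⟩
  mono (suc k ℕ.+ suc k ℕ.* e)         ≡⟨ cong mono (ℕ.*-suc (suc k) e) ⟨
  mono (suc k ℕ.* suc e)               ∎
  where open Subst (dil-isSubst k)

negq-mono-suc : ∀ e → negq (mono (suc e)) ≋ ⊝ (mono 1 · negq (mono e))
negq-mono-suc e = begin
  negq (mono (suc e))             ≈⟨ IsSubst.subst-cong negq-isSubst (mono-+ 1 e) ⟨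
  negq (mono 1 · mono e)          ≈⟨ negq-q (mono e) ⟩
  ⊝ oneS · mono 1 · negq (mono e) ≈⟨ ℛ.*-assoc _ _ _ ⟩
  ⊝ oneS · (mono 1 · negq (mono e)) ≈⟨ -1*x≈-x _ ⟩
  ⊝ (mono 1 · negq (mono e))      ∎

negq-mono-even : ∀ e → negq (mono (2 ℕ.* e)) ≋ mono (2 ℕ.* e)
negq-mono-odd : ∀ e → negq (mono (suc (2 ℕ.* e))) ≋ ⊝ mono (suc (2 ℕ.* e))
negq-mono-even zero = ℛ.trans (subst-cong mono-0) (ℛ.trans subst-1 (ℛ.sym mono-0))
  where open Subst negq-isSubst
negq-mono-even (suc e) = begin
  negq (mono (2 ℕ.* suc e))                ≡⟨ cong (λ t → negq (mono t)) (ℕ.*-suc 2 e) ⟩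
  negq (mono (2 ℕ.+ 2 ℕ.* e))              ≈⟨ negq-mono-suc _ ⟩
  ⊝ (mono 1 · negq (mono (suc (2 ℕ.* e)))) ≈⟨ ℛ.-‿cong (ℛ.*-congˡ (negq-mono-odd e)) ⟩
  ⊝ (mono 1 · ⊝ mono (suc (2 ℕ.* e)))      ≈⟨ ℛ.-‿cong (-‿distribʳ-* _ _) ⟨
  ⊝ (⊝ (mono 1 · mono (suc (2 ℕ.* e))))    ≈⟨ -‿involutive _ ⟩
  mono 1 · mono (suc (2 ℕ.* e))            ≈⟨ mono-+ 1 _ ⟩
  mono (2 ℕ.+ 2 ℕ.* e)                     ≡⟨ cong mono (ℕ.*-suc 2 e) ⟨
  mono (2 ℕ.* suc e)                       ∎
negq-mono-odd e = ℛ.trans (negq-mono-suc (2 ℕ.* e)) (ℛ.-‿cong (ℛ.trans (ℛ.*-congˡ (negq-mono-even e)) (mono-+ 1 _)))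

poch-dil : ∀ k a d → dil (suc k) (poch (suc a) (suc d)) ≋ poch (suc k ℕ.* suc a) (suc k ℕ.* suc d)
poch-dil k a d = ≈[]⇒≋ λ K → ≈[]-trans (subst-mod (dil-isSubst k) K (poch-∏ a d K K ℕ.≤-refl))
  (≈[]-trans (≋⇒≈[] K (ℛ.trans (∏-subst (dil-isSubst k) K _) (∏-cong K factor)))
    (≈[]-sym (poch-∏ (a ℕ.+ k ℕ.* suc a) (d ℕ.+ k ℕ.* suc d) K K ℕ.≤-refl)))
  where
  open Subst (dil-isSubst k)
  exponents : ∀ k a d j → suc k ℕ.* (suc a ℕ.+ suc d ℕ.* j) ≡ suc (a ℕ.+ k ℕ.* suc a) ℕ.+ suc (d ℕ.+ k ℕ.* suc d) ℕ.* j
  exponents = ℕ-Solver.solve-∀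
  factor : ∀ j → dil (suc k) (1-q^ (suc a ℕ.+ suc d ℕ.* j)) ≋ 1-q^ (suc (a ℕ.+ k ℕ.* suc a) ℕ.+ suc (d ℕ.+ k ℕ.* suc d) ℕ.* j)
  factor j = ℛ.trans (subst-⊕ _ _) (ℛ.+-cong subst-1 (ℛ.trans (subst-⊝ _)
    (ℛ.-‿cong (ℛ.trans (dil-mono k _) (ℛ.reflexive (cong mono (exponents k a d j)))))))

difference-of-squares : ∀ e → 1-q^ e · 1+q^ e ≋ 1-q^ (2 ℕ.* e)
difference-of-squares e = ℛ.trans
  (ℛ.solve ((con (+ 1) :- var (# 0)) :* (con (+ 1) :+ var (# 0))) (con (+ 1) :- var (# 0) :* var (# 0)) (mono e ∷ []))
  (ℛ.+-congˡ (ℛ.-‿cong (ℛ.trans (mono-+ e e) (ℛ.reflexive (cong mono (cong (λ t → e ℕ.+ t) (≡.sym (ℕ.+-identityʳ e))))))))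

-- By 1 - x² = (1 - x)(1 + x), a product of factors 1 + q^e is a quotient of two `poch`; this is
-- what justifies `poch⁺`.
poch-square : ∀ a d K n → K ≤ n →
  poch (suc a) (suc d) · ∏ n (λ j → 1+q^ (suc a ℕ.+ suc d ℕ.* j)) ≈[ K ] poch (2 ℕ.* suc a) (2 ℕ.* suc d)
poch-square a d K n K≤n = ≈[]-trans (≈[]-· K (poch-∏ a d K n K≤n) (λ _ _ → refl))
  (≈[]-trans (≋⇒≈[] K (ℛ.trans (ℛ.sym (∏-· n _ _)) (∏-cong n (λ j → ℛ.trans (difference-of-squares _) (ℛ.reflexive (cong 1-q^ (exponents a d j)))))))
    (≈[]-sym (poch-∏ (a ℕ.+ (suc a ℕ.+ 0)) (d ℕ.+ (suc d ℕ.+ 0)) K n K≤n)))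
  where
  exponents : ∀ a d j → 2 ℕ.* (suc a ℕ.+ suc d ℕ.* j) ≡ suc (a ℕ.+ (suc a ℕ.+ 0)) ℕ.+ suc (d ℕ.+ (suc d ℕ.+ 0)) ℕ.* j
  exponents = ℕ-Solver.solve-∀

-- The exponents are all odd, so q ↦ -q turns every 1 - q^e into 1 + q^e.
poch-negq : ∀ a d → poch (suc (2 ℕ.* a)) (2 ℕ.* suc d) · negq (poch (suc (2 ℕ.* a)) (2 ℕ.* suc d))
              ≋ poch (2 ℕ.* suc (2 ℕ.* a)) (2 ℕ.* (2 ℕ.* suc d))
poch-negq a d = ≈[]⇒≋ λ K → ≈[]-trans (≈[]-· K (λ _ _ → refl)
    (≈[]-trans (subst-mod negq-isSubst K (poch-∏ (2 ℕ.* a) (d ℕ.+ (suc d ℕ.+ 0)) K K ℕ.≤-refl))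
      (≋⇒≈[] K (ℛ.trans (∏-subst negq-isSubst K _) (∏-cong K factor)))))
  (poch-square (2 ℕ.* a) (d ℕ.+ (suc d ℕ.+ 0)) K K ℕ.≤-refl)
  where
  open Subst negq-isSubst
  exponents : ∀ a d j → suc (2 ℕ.* a) ℕ.+ suc (d ℕ.+ (suc d ℕ.+ 0)) ℕ.* j ≡ suc (2 ℕ.* (a ℕ.+ suc d ℕ.* j))
  exponents = ℕ-Solver.solve-∀
  factor : ∀ j → negq (1-q^ (suc (2 ℕ.* a) ℕ.+ suc (d ℕ.+ (suc d ℕ.+ 0)) ℕ.* j)) ≋ 1+q^ (suc (2 ℕ.* a) ℕ.+ suc (d ℕ.+ (suc d ℕ.+ 0)) ℕ.* j)
  factor j rewrite exponents a d j = ℛ.trans (subst-⊕ _ _) (ℛ.+-cong subst-1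
    (ℛ.trans (subst-⊝ _) (ℛ.trans (ℛ.-‿cong (negq-mono-odd (a ℕ.+ suc d ℕ.* j))) (-‿involutive _))))

negq-dil2 : ∀ f → negq (dil 2 f) ≋ dil 2 f
negq-dil2 = subst-unique (subst-∘ negq-isSubst (dil-isSubst 1)) (dil-isSubst 1) (begin
  negq (mono 1) · ⊝ oneS          ≈⟨ ℛ.*-congʳ (Subst.subst-mono1 negq-isSubst) ⟩
  ⊝ oneS · mono 1 · ⊝ oneS        ≈⟨ ℛ.*-congʳ (-1*x≈-x (mono 1)) ⟩
  ⊝ mono 1 · ⊝ oneS               ≈⟨ x*-1≈-x (⊝ mono 1) ⟩
  ⊝ (⊝ mono 1)                    ≈⟨ -‿involutive (mono 1) ⟩
  mono 1                          ∎)
  where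
  x*-1≈-x : ∀ x → x · ⊝ oneS ≋ ⊝ x
  x*-1≈-x x = ℛ.trans (ℛ.sym (-‿distribʳ-* x oneS)) (ℛ.-‿cong (ℛ.*-identityʳ x))

dil-∘ : ∀ j k f → dil (suc j) (dil (suc k) f) ≋ dil (suc j ℕ.* suc k) f
dil-∘ j k = subst-unique (subst-∘ (dil-isSubst j) (dil-isSubst k)) (dil-isSubst (k ℕ.+ j ℕ.* suc k))
  (ℛ.trans (ℛ.*-congʳ (dil-mono j k)) (ℛ.trans (mono-+ _ _) (ℛ.reflexive (cong mono (exponents j k)))))
  where
  exponents : ∀ j k → suc j ℕ.* k ℕ.+ j ≡ k ℕ.+ j ℕ.* suc k
  exponents = ℕ-Solver.solve-∀

-- Sums over ℤ

∑ : ℕ → (ℕ → PS) → PS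
∑ zero    g = zeroS
∑ (suc n) g = ∑ n g ⊕ g n

∑-cong : ∀ n {g h} → (∀ j → g j ≋ h j) → ∑ n g ≋ ∑ n h
∑-cong zero    e = ℛ.refl
∑-cong (suc n) e = ℛ.+-cong (∑-cong n e) (e n)

∑-mod : ∀ K n {g h} → (∀ j → j < n → g j ≈[ K ] h j) → ∑ n g ≈[ K ] ∑ n h
∑-mod K zero    e = λ _ _ → refl
∑-mod K (suc n) e = ≈[]-⊕ K (∑-mod K n (λ j j<n → e j (ℕ.m≤n⇒m≤1+n j<n))) (e n ℕ.≤-refl)

∑-zero : ∀ n → ∑ n (λ _ → zeroS) ≋ zeroS
∑-zero zero    = ℛ.refl
∑-zero (suc n) = ℛ.trans (ℛ.+-identityʳ _) (∑-zero n)

∑-⊕ : ∀ n g h → ∑ n (λ j → g j ⊕ h j) ≋ ∑ n g ⊕ ∑ n h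
∑-⊕ zero    g h = ℛ.sym (ℛ.+-identityˡ _)
∑-⊕ (suc n) g h = ℛ.trans (ℛ.+-congʳ (∑-⊕ n g h)) (+-interchange _ _ _ _)
  where open import Algebra.Properties.CommutativeSemigroup ℛ.+-commutativeSemigroup using () renaming (interchange to +-interchange)

∑-·ˡ : ∀ n f g → ∑ n (λ j → f · g j) ≋ f · ∑ n g
∑-·ˡ zero    f g = ℛ.sym (ℛ.zeroʳ f)
∑-·ˡ (suc n) f g = ℛ.trans (ℛ.+-congʳ (∑-·ˡ n f g)) (ℛ.sym (ℛ.distribˡ f _ _))

∑-+ : ∀ m n g → ∑ (n ℕ.+ m) g ≋ ∑ m g ⊕ ∑ n (λ j → g (m ℕ.+ j))
∑-+ m zero    g = ℛ.sym (ℛ.+-identityʳ _)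
∑-+ m (suc n) g = begin
  ∑ (n ℕ.+ m) g ⊕ g (n ℕ.+ m)                           ≈⟨ ℛ.+-cong (∑-+ m n g) (ℛ.reflexive (cong g (ℕ.+-comm n m))) ⟩
  ∑ m g ⊕ ∑ n (λ j → g (m ℕ.+ j)) ⊕ g (m ℕ.+ n)         ≈⟨ ℛ.+-assoc _ _ _ ⟩
  ∑ m g ⊕ ∑ (suc n) (λ j → g (m ℕ.+ j))                 ∎

∑-swap : ∀ m n (f : ℕ → ℕ → PS) → ∑ m (λ i → ∑ n (λ j → f i j)) ≋ ∑ n (λ j → ∑ m (λ i → f i j))
∑-swap zero    n f = ℛ.sym (∑-zero n)
∑-swap (suc m) n f = ℛ.trans (ℛ.+-congʳ (∑-swap m n f)) (ℛ.sym (∑-⊕ n _ _))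

-- The sum of f over the interval {a, …, a + l − 1} of ℤ.
S : ℤ → ℕ → (ℤ → PS) → PS
S a l f = ∑ l (λ j → f (a ℤ.+ + j))

S-cong : ∀ a l {f g} → (∀ k → f k ≋ g k) → S a l f ≋ S a l g
S-cong a l e = ∑-cong l (λ j → e (a ℤ.+ + j))

S-mod : ∀ K a l {f g} → (∀ k → f k ≈[ K ] g k) → S a l f ≈[ K ] S a l g
S-mod K a l e = ∑-mod K l (λ j _ → e (a ℤ.+ + j))

S-shift : ∀ a l c f → S a l (λ k → f (k ℤ.+ c)) ≋ S (a ℤ.+ c) l f
S-shift a l c f = ∑-cong l (λ j → ℛ.reflexive (cong f (lemma a (+ j) c)))
  where
  lemma : ∀ a j c → (a ℤ.+ j) ℤ.+ c ≡ (a ℤ.+ c) ℤ.+ j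
  lemma = solve-∀

S-+ : ∀ a m n f → S a (n ℕ.+ m) f ≋ S a m f ⊕ S (a ℤ.+ + m) n f
S-+ a m n f = ℛ.trans (∑-+ m n _) (ℛ.+-congˡ (∑-cong n (λ j → ℛ.reflexive (cong f (≡.sym (ℤ.+-assoc a (+ m) (+ j)))))))

S-dissect : ∀ d a l f → S (+ d ℤ.* a) (l ℕ.* d) f ≋ S a l (λ t → ∑ d (λ r → f (+ d ℤ.* t ℤ.+ + r)))
S-dissect d a zero    f = ℛ.refl
S-dissect d a (suc l) f = begin
  S (+ d ℤ.* a) (d ℕ.+ l ℕ.* d) f                                       ≈⟨ S-+ (+ d ℤ.* a) (l ℕ.* d) d f ⟩
  S (+ d ℤ.* a) (l ℕ.* d) f ⊕ S (+ d ℤ.* a ℤ.+ + (l ℕ.* d)) d f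
    ≈⟨ ℛ.+-cong (S-dissect d a l f) (∑-cong d (λ r → ℛ.reflexive (cong (λ t → f (t ℤ.+ + r)) origin))) ⟩
  S a (suc l) (λ t → ∑ d (λ r → f (+ d ℤ.* t ℤ.+ + r)))                 ∎
  where
  origin : + d ℤ.* a ℤ.+ + (l ℕ.* d) ≡ + d ℤ.* (a ℤ.+ + l)
  origin = ≡.trans (cong (λ t → + d ℤ.* a ℤ.+ t) (≡.trans (ℤ.pos-* l d) (ℤ.*-comm (+ l) (+ d)))) (≡.sym (ℤ.*-distribˡ-+ (+ d) a (+ l)))

abs≤⇒bounds : ∀ {i B} → ∣ i ∣ ≤ B → (ℤ.- + B ℤ.≤ i) × (i ℤ.≤ + B)
abs≤⇒bounds {+ n}      n≤B = ℤ.≤-trans (ℤ.neg-mono-≤ (ℤ.+≤+ (z≤n {_}))) (ℤ.+≤+ z≤n) , ℤ.+≤+ n≤B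
abs≤⇒bounds { -[1+ n ]} n≤B = ℤ.neg-mono-≤ (ℤ.+≤+ n≤B) , ℤ.-≤+

beyond-left : ∀ {i B} → i ℤ.< ℤ.- + B → B < ∣ i ∣
beyond-left i<-B = ℕ.≰⇒> (λ le → ℤ.<⇒≱ i<-B (proj₁ (abs≤⇒bounds le)))

beyond-right : ∀ {i B} → + B ℤ.< i → B < ∣ i ∣
beyond-right B<i = ℕ.≰⇒> (λ le → ℤ.<⇒≱ B<i (proj₂ (abs≤⇒bounds le)))

gap : ∀ {i j} → i ℤ.≤ j → Σ[ n ∈ ℕ ] j ≡ i ℤ.+ + n
gap {i} {j} i≤j = ∣ j ℤ.- i ∣ , ≡.trans (lemma i j) (cong (λ t → i ℤ.+ t) (≡.sym (ℤ.0≤i⇒+∣i∣≡i (ℤ.i≤j⇒0≤j-i i≤j))))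
  where
  lemma : ∀ i j → j ≡ i ℤ.+ (j ℤ.- i)
  lemma = solve-∀

-- T sums to f modulo q^K, and its terms outside [−L, L] vanish modulo q^K.
record SumsMod (T : ℤ → PS) (f : PS) (K L : ℕ) : Set where
  field
    small : ∀ k → L < ∣ k ∣ → T k ≈[ K ] zeroS
    cover : ∀ a l → a ℤ.≤ ℤ.- + L → + L ℤ.< a ℤ.+ + l → S a l T ≈[ K ] f

-- Convergence of the bilateral sum of `T` to `f`. One symmetric interval per precision is enough as
-- data; `sums-mod` extends this to every interval that contains it.
record Sums (T : ℤ → PS) (f : PS) : Set where
  field
    bound : ℕ → ℕ
    small : ∀ K k → bound K < ∣ k ∣ → T k ≈[ K ] zeroS
    total : ∀ K → S (ℤ.- + bound K) (suc (2 ℕ.* bound K)) T ≈[ K ] f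

S-small : ∀ K a l {T} → (∀ j → j < l → T (a ℤ.+ + j) ≈[ K ] zeroS) → S a l T ≈[ K ] zeroS
S-small K a l e = ≈[]-trans (∑-mod K l e) (≋⇒≈[] K (∑-zero l))

sums-mod : ∀ {T f} (s : Sums T f) K → SumsMod T f K (Sums.bound s K)
sums-mod {T} {f} s K = record { small = Sums.small s K ; cover = cover }
  where
  B = Sums.bound s K
  cover : ∀ a l → a ℤ.≤ ℤ.- + B → + B ℤ.< a ℤ.+ + l → S a l T ≈[ K ] f
  cover a l a≤-B B<a+l with gap a≤-B | gap (ℤ.i<j⇒suc[i]≤j B<a+l)
  ... | x , -B≡a+x | y , a+l≡1+B+y with ℤ.+-injective (length-of a (+ l) (+ x) (+ y) (+ B) -B≡a+x a+l≡1+B+y)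
    where
    length-of : ∀ a l x y b → ℤ.- b ≡ a ℤ.+ x → a ℤ.+ l ≡ ℤ.suc b ℤ.+ y → l ≡ y ℤ.+ (ℤ.suc (b ℤ.+ (b ℤ.+ + 0)) ℤ.+ x)
    length-of a l x y b p r = ≡.trans (e₁ a l) (≡.trans (cong (λ t → t ℤ.- a) r) (≡.trans (cong (λ t → ℤ.suc b ℤ.+ y ℤ.- t) e₃) (e₂ b x y)))
      where
      e₁ : ∀ a l → l ≡ a ℤ.+ l ℤ.- a
      e₁ = solve-∀
      e₃ : a ≡ ℤ.- b ℤ.- x
      e₃ = ≡.trans (e₄ a x) (cong (λ t → t ℤ.- x) (≡.sym p))
        where
        e₄ : ∀ a x → a ≡ a ℤ.+ x ℤ.- x
        e₄ = solve-∀
      e₂ : ∀ b x y → ℤ.suc b ℤ.+ y ℤ.- (ℤ.- b ℤ.- x) ≡ y ℤ.+ (ℤ.suc (b ℤ.+ (b ℤ.+ + 0)) ℤ.+ x)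
      e₂ b x y = e₅ (+ 1) b x y
        where
        e₅ : ∀ o b x y → (o ℤ.+ b) ℤ.+ y ℤ.- (ℤ.- b ℤ.- x) ≡ y ℤ.+ ((o ℤ.+ (b ℤ.+ (b ℤ.+ + 0))) ℤ.+ x)
        e₅ = solve-∀
  -- The interval is cut into x terms on the left, the symmetric core of 2B + 1 terms, and y terms
  -- on the right; the outer terms vanish modulo q^K.
  ... | refl = ≈[]-trans (≋⇒≈[] K (ℛ.trans (S-+ a (suc (2 ℕ.* B) ℕ.+ x) y T) (ℛ.+-congʳ (S-+ a x (suc (2 ℕ.* B)) T))))
      (≈[]-trans (≈[]-⊕ K (≈[]-⊕ K left middle) right) (≋⇒≈[] K (ℛ.trans (ℛ.+-identityʳ _) (ℛ.+-identityˡ _))))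
    where
    left : S a x T ≈[ K ] zeroS
    left = S-small K a x {T} (λ j j<x → Sums.small s K (a ℤ.+ + j) (beyond-left
      (≡.subst (λ t → a ℤ.+ + j ℤ.< t) (≡.sym -B≡a+x) (ℤ.+-monoʳ-< a (ℤ.+<+ j<x)))))
    middle : S (a ℤ.+ + x) (suc (2 ℕ.* B)) T ≈[ K ] f
    middle = ≡.subst (λ t → S t (suc (2 ℕ.* B)) T ≈[ K ] f) -B≡a+x (Sums.total s K)
    end : a ℤ.+ + (suc (2 ℕ.* B) ℕ.+ x) ≡ ℤ.suc (+ B)
    end = ≡.trans (e₁ a (+ x) (+ B) (+ 1)) (≡.trans (cong (λ t → t ℤ.+ (+ 1 ℤ.+ (+ B ℤ.+ (+ B ℤ.+ + 0)))) (≡.sym -B≡a+x)) (e₂ (+ B) (+ 1)))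
      where
      e₁ : ∀ a x b o → a ℤ.+ (o ℤ.+ (b ℤ.+ (b ℤ.+ + 0)) ℤ.+ x) ≡ (a ℤ.+ x) ℤ.+ (o ℤ.+ (b ℤ.+ (b ℤ.+ + 0)))
      e₁ = solve-∀
      e₂ : ∀ b o → ℤ.- b ℤ.+ (o ℤ.+ (b ℤ.+ (b ℤ.+ + 0))) ≡ o ℤ.+ b
      e₂ = solve-∀
    right : S (a ℤ.+ + (suc (2 ℕ.* B) ℕ.+ x)) y T ≈[ K ] zeroS
    right = S-small K (a ℤ.+ + (suc (2 ℕ.* B) ℕ.+ x)) y {T} (λ j _ → Sums.small s K (a ℤ.+ + (suc (2 ℕ.* B) ℕ.+ x) ℤ.+ + j) (beyond-right (≡.subst (λ t → + B ℤ.< t ℤ.+ + j) (≡.sym end) (ℤ.+<+ (s≤s (ℕ.m≤m+n B j))))))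

sumsMod-weaken : ∀ {T f K L M} → L ≤ M → SumsMod T f K L → SumsMod T f K M
sumsMod-weaken L≤M s = record
  { small = λ k M<k → small k (ℕ.≤-<-trans L≤M M<k)
  ; cover = λ a l p q → cover a l (ℤ.≤-trans p (ℤ.neg-mono-≤ (ℤ.+≤+ L≤M))) (ℤ.≤-<-trans (ℤ.+≤+ L≤M) q) }
  where open SumsMod s

sums-cong : ∀ {T U f g} → (∀ k → T k ≋ U k) → f ≋ g → Sums T f → Sums U g
sums-cong e fg s = record
  { bound = bound
  ; small = λ K k p → ≈[]-trans (≋⇒≈[] K (ℛ.sym (e k))) (small K k p)
  ; total = λ K → ≈[]-trans (≋⇒≈[] K (S-cong (ℤ.- + bound K) (suc (2 ℕ.* bound K)) (λ k → ℛ.sym (e k)))) (≈[]-trans (total K) (≋⇒≈[] K fg)) }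
  where open Sums s

sums-scale : ∀ {T f} g → Sums T f → Sums (λ k → g · T k) (g · f)
sums-scale g s = record
  { bound = bound
  ; small = λ K k p → ≈[]-trans (≈[]-· K (λ _ _ → refl) (small K k p)) (≋⇒≈[] K (ℛ.zeroʳ g))
  ; total = λ K → ≈[]-trans (≋⇒≈[] K (∑-·ˡ (suc (2 ℕ.* bound K)) g _)) (≈[]-· K (λ _ _ → refl) (total K)) }
  where open Sums s

sums-shift : ∀ {T f} c → Sums T f → Sums (λ k → T (k ℤ.+ c)) f
sums-shift {T} {f} c s = record
  { bound = λ K → bound K ℕ.+ ∣ c ∣
  ; small = λ K k p → small K (k ℤ.+ c) (ℕ.+-cancelʳ-< ∣ c ∣ _ _ (ℕ.<-≤-trans p (far k)))
  ; total = λ K → ≈[]-trans (≋⇒≈[] K (S-shift (ℤ.- + (bound K ℕ.+ ∣ c ∣)) (suc (2 ℕ.* (bound K ℕ.+ ∣ c ∣))) c T)) (SumsMod.cover (sums-mod s K) _ _ (left (bound K)) (right (bound K))) }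
  where
  open Sums s
  far : ∀ k → ∣ k ∣ ≤ ∣ k ℤ.+ c ∣ ℕ.+ ∣ c ∣
  far k = ≡.subst (λ t → ∣ t ∣ ≤ ∣ k ℤ.+ c ∣ ℕ.+ ∣ c ∣) (lemma k c) (ℤ.∣i-j∣≤∣i∣+∣j∣ (k ℤ.+ c) c)
    where
    lemma : ∀ k c → (k ℤ.+ c) ℤ.- c ≡ k
    lemma = solve-∀
  left : ∀ B → ℤ.- + (B ℕ.+ ∣ c ∣) ℤ.+ c ℤ.≤ ℤ.- + B
  left B = ≡.subst (λ t → ℤ.- + (B ℕ.+ ∣ c ∣) ℤ.+ c ℤ.≤ t) (lemma (+ B) (+ ∣ c ∣)) (ℤ.+-monoʳ-≤ (ℤ.- + (B ℕ.+ ∣ c ∣)) (proj₂ (abs≤⇒bounds ℕ.≤-refl)))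
    where
    lemma : ∀ b x → ℤ.- (b ℤ.+ x) ℤ.+ x ≡ ℤ.- b
    lemma = solve-∀
  right : ∀ B → + B ℤ.< ℤ.- + (B ℕ.+ ∣ c ∣) ℤ.+ c ℤ.+ + suc (2 ℕ.* (B ℕ.+ ∣ c ∣))
  right B = ℤ.suc[i]≤j⇒i<j (≡.subst (λ t → t ℤ.≤ ℤ.- + (B ℕ.+ ∣ c ∣) ℤ.+ c ℤ.+ + suc (2 ℕ.* (B ℕ.+ ∣ c ∣))) (lemma (+ B) (+ ∣ c ∣) (+ 1))
    (ℤ.+-monoˡ-≤ (+ suc (2 ℕ.* (B ℕ.+ ∣ c ∣))) (ℤ.+-monoʳ-≤ (ℤ.- + (B ℕ.+ ∣ c ∣)) (proj₁ (abs≤⇒bounds {c} ℕ.≤-refl)))))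
    where
    lemma : ∀ b x o → ℤ.- (b ℤ.+ x) ℤ.+ (ℤ.- x) ℤ.+ (o ℤ.+ ((b ℤ.+ x) ℤ.+ ((b ℤ.+ x) ℤ.+ + 0))) ≡ o ℤ.+ b
    lemma = solve-∀

common-bound : ∀ K n {T : ℕ → ℤ → PS} {f_ : ℕ → PS} → (∀ r → r < n → Sums (T r) (f_ r)) → Σ[ M ∈ ℕ ] (∀ r → r < n → SumsMod (T r) (f_ r) K M)
common-bound K zero    h = 0 , λ _ ()
common-bound K (suc n) {T} {f_} h with common-bound K n {T} {f_} (λ r p → h r (ℕ.m≤n⇒m≤1+n p))
... | M , near = M ℕ.+ Sums.bound (h n ℕ.≤-refl) K , λ r p → pick r (ℕ.m≤n⇒m<n∨m≡n (ℕ.≤-pred p))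
  where
  pick : ∀ r → r < n ⊎ r ≡ n → SumsMod (T r) (f_ r) K (M ℕ.+ Sums.bound (h n ℕ.≤-refl) K)
  pick r (inj₁ r<n)  = sumsMod-weaken (ℕ.m≤m+n M _) (near r r<n)
  pick r (inj₂ refl) = sumsMod-weaken (ℕ.m≤n+m _ M) (sums-mod (h n ℕ.≤-refl) K)

sums-dissect : ∀ d .{{_ : ℕ.NonZero d}} {T f} (f_ : ℕ → PS) → Sums T f → (∀ r → r < d → Sums (λ t → T (+ d ℤ.* t ℤ.+ + r)) (f_ r)) → f ≋ ∑ d f_
sums-dissect d {T} {f} f_ s parts = ≈[]⇒≋ step
  where
  step : ∀ K → f ≈[ K ] ∑ d f_
  step K = ≈[]-trans (≈[]-sym (SumsMod.cover near (+ d ℤ.* ℤ.- + L) (suc (2 ℕ.* L) ℕ.* d) left right))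
    (≈[]-trans (≋⇒≈[] K (ℛ.trans (S-dissect d (ℤ.- + L) (suc (2 ℕ.* L)) T) (∑-swap (suc (2 ℕ.* L)) d (λ i r → T (+ d ℤ.* (ℤ.- + L ℤ.+ + i) ℤ.+ + r)))))
      (∑-mod K d (λ r r<d → SumsMod.cover (nearᵣ r r<d) (ℤ.- + L) (suc (2 ℕ.* L)) ℤ.≤-refl
        (≡.subst (λ i → + L ℤ.< i) (≡.sym (lemma (+ L) (+ 1))) (ℤ.+<+ ℕ.≤-refl)))))
    where
    lemma : ∀ l o → ℤ.- l ℤ.+ (o ℤ.+ (l ℤ.+ (l ℤ.+ + 0))) ≡ o ℤ.+ l
    lemma = solve-∀
    common = common-bound K d {λ r t → T (+ d ℤ.* t ℤ.+ + r)} {f_} parts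
    M = proj₁ common
    L = Sums.bound s K ℕ.+ M
    near : SumsMod T f K L
    near = sumsMod-weaken (ℕ.m≤m+n _ M) (sums-mod s K)
    nearᵣ : ∀ r → r < d → SumsMod (λ t → T (+ d ℤ.* t ℤ.+ + r)) (f_ r) K L
    nearᵣ r r<d = sumsMod-weaken (ℕ.m≤n+m M _) (proj₂ common r r<d)
    left : + d ℤ.* ℤ.- + L ℤ.≤ ℤ.- + L
    left = ≡.subst (λ t → t ℤ.≤ ℤ.- + L) (≡.trans (cong ℤ.-_ (ℤ.pos-* d L)) (ℤ.neg-distribʳ-* (+ d) (+ L)))
      (ℤ.neg-mono-≤ (ℤ.+≤+ (ℕ.m≤n*m L d)))
    right : + L ℤ.< + d ℤ.* ℤ.- + L ℤ.+ + (suc (2 ℕ.* L) ℕ.* d)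
    right = ≡.subst (λ t → + L ℤ.< t) (≡.sym end) (ℤ.+<+ (ℕ.<-≤-trans (ℕ.n<1+n L) (ℕ.m≤n*m (suc L) d)))
      where
      end : + d ℤ.* ℤ.- + L ℤ.+ + (suc (2 ℕ.* L) ℕ.* d) ≡ + (d ℕ.* suc L)
      end = ≡.trans (cong (λ t → + d ℤ.* ℤ.- + L ℤ.+ t) (ℤ.pos-* (suc (2 ℕ.* L)) d))
        (≡.trans (e (+ d) (+ L) (+ 1)) (≡.sym (ℤ.pos-* d (suc L))))
        where
        e : ∀ d l o → d ℤ.* ℤ.- l ℤ.+ (o ℤ.+ (l ℤ.+ (l ℤ.+ + 0))) ℤ.* d ≡ d ℤ.* (o ℤ.+ l)
        e = solve-∀

-- The row of the double sum belonging to m may start at a place `b m` that moves with m. It has to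
-- cover the essential terms of `U` only when ∣ m ∣ ≤ L, because otherwise `T m` vanishes modulo
-- q^K. This permits slanted rows.
product-mod : ∀ {T U f g K L} → SumsMod T f K L → SumsMod U g K L → ∀ a l (b : ℤ → ℤ) l′ →
  a ℤ.≤ ℤ.- + L → + L ℤ.< a ℤ.+ + l →
  (∀ m → ∣ m ∣ ≤ L → (b m ℤ.≤ ℤ.- + L) × (+ L ℤ.< b m ℤ.+ + l′)) →
  S a l (λ m → T m · S (b m) l′ U) ≈[ K ] f · g
product-mod {T} {U} {f} {g} {K} {L} s t a l b l′ p r inner =
  ≈[]-trans (S-mod K a l {λ m → T m · S (b m) l′ U} {λ m → T m · g} row)
    (≈[]-trans (≋⇒≈[] K (ℛ.trans (S-cong a l {λ m → T m · g} (λ m → ℛ.*-comm (T m) g)) (ℛ.trans (∑-·ˡ l g _) (ℛ.*-comm g _))))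
      (≈[]-· K (SumsMod.cover s a l p r) (λ _ _ → refl)))
  where
  row : ∀ m → T m · S (b m) l′ U ≈[ K ] T m · g
  row m with ∣ m ∣ ℕ.≤? L
  ... | yes m≤L = ≈[]-· K {T m} {T m} {S (b m) l′ U} {g} (λ _ _ → refl) (SumsMod.cover t (b m) l′ (proj₁ (inner m m≤L)) (proj₂ (inner m m≤L)))
  ... | no m≰L  = ≈[]-trans (vanish (S (b m) l′ U)) (≈[]-sym (vanish g))
    where
    vanish : ∀ h → T m · h ≈[ K ] zeroS
    vanish h = ≈[]-trans (≈[]-· K (SumsMod.small s m (ℕ.≰⇒> m≰L)) (λ _ _ → refl)) (≋⇒≈[] K (ℛ.zeroˡ h))

window : ∀ L X P len w → ∣ w ∣ ≤ X → L ℕ.+ X ≤ P → suc (P ℕ.+ (L ℕ.+ X)) ≤ len →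
         (ℤ.- + P ℤ.+ w ℤ.≤ ℤ.- + L) × (+ L ℤ.< ℤ.- + P ℤ.+ w ℤ.+ + len)
window L X P len w w≤X L+X≤P len≥ =
  ℤ.≤-trans (ℤ.+-mono-≤ (ℤ.neg-mono-≤ (ℤ.+≤+ L+X≤P)) (proj₂ (abs≤⇒bounds w≤X))) (ℤ.≤-reflexive (e₁ (+ L) (+ X))) ,
  ℤ.suc[i]≤j⇒i<j (ℤ.≤-trans (ℤ.≤-reflexive (e₂ (+ L) (+ X) (+ P) (+ 1)))
    (ℤ.+-mono-≤ (ℤ.+-monoʳ-≤ (ℤ.- + P) (proj₁ (abs≤⇒bounds w≤X))) (ℤ.+≤+ len≥)))
  where
  e₁ : ∀ l x → ℤ.- (l ℤ.+ x) ℤ.+ x ≡ ℤ.- l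
  e₁ = solve-∀
  e₂ : ∀ l x p o → o ℤ.+ l ≡ ℤ.- p ℤ.+ ℤ.- x ℤ.+ (o ℤ.+ (p ℤ.+ (l ℤ.+ x)))
  e₂ = solve-∀

abs-*-≤ : ∀ c {m L} → ∣ m ∣ ≤ L → ∣ c ℤ.* m ∣ ≤ ∣ c ∣ ℕ.* L
abs-*-≤ c {m} m≤L = ℕ.≤-trans (ℕ.≤-reflexive (ℤ.abs-* c m)) (ℕ.*-monoʳ-≤ ∣ c ∣ m≤L)

-- Change of variables (m , n) = (l + e t , d t + ρ + c m) in a double sum over ℤ².
change-of-variables : ∀ {A B f g} → Sums A f → Sums B g → ∀ d .{{_ : ℕ.NonZero d}} c e
  (u v : ℕ → PS) (U V : ℕ → ℤ → PS) → (∀ ρ → ρ < d → Sums (U ρ) (u ρ)) → (∀ ρ → ρ < d → Sums (V ρ) (v ρ)) →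
  (∀ ρ → ρ < d → ∀ t l → A (l ℤ.+ e ℤ.* t) · B (+ d ℤ.* t ℤ.+ + ρ ℤ.+ c ℤ.* (l ℤ.+ e ℤ.* t)) ≋ U ρ t · V ρ l) →
  f · g ≋ ∑ d (λ ρ → u ρ · v ρ)
change-of-variables {A} {B} {f} {g} sA sB d c e u v U V sU sV factor = ≈[]⇒≋ step
  where
  step : ∀ K → f · g ≈[ K ] ∑ d (λ ρ → u ρ · v ρ)
  step K = ≈[]-trans (≈[]-sym (product-mod nA nB (ℤ.- + N₂) l₂ (λ m → + d ℤ.* a₁ ℤ.+ c ℤ.* m) (l₁ ℕ.* d) left₂ right₂ inner₁))
    (≈[]-trans (≋⇒≈[] K rearrange) (∑-mod K d (λ ρ ρ<d → ≈[]-trans (≋⇒≈[] K (separate ρ ρ<d))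
      (product-mod (nU ρ ρ<d) (nV ρ ρ<d) a₁ l₁ (λ t → ℤ.- + N₂ ℤ.+ ℤ.- (e ℤ.* t)) l₂ left₁ right₁ inner₂))))
    where
    commonU = common-bound K d {U} {u} sU
    commonV = common-bound K d {V} {v} sV
    L = Sums.bound sA K ℕ.+ Sums.bound sB K ℕ.+ (proj₁ commonU ℕ.+ proj₁ commonV)
    nA : SumsMod A f K L
    nA = sumsMod-weaken (ℕ.≤-trans (ℕ.m≤m+n _ _) (ℕ.m≤m+n _ _)) (sums-mod sA K)
    nB : SumsMod B g K L
    nB = sumsMod-weaken (ℕ.≤-trans (ℕ.m≤n+m _ (Sums.bound sA K)) (ℕ.m≤m+n _ _)) (sums-mod sB K)
    nU : ∀ ρ → ρ < d → SumsMod (U ρ) (u ρ) K L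
    nU ρ ρ<d = sumsMod-weaken (ℕ.≤-trans (ℕ.m≤m+n _ _) (ℕ.m≤n+m _ (Sums.bound sA K ℕ.+ Sums.bound sB K))) (proj₂ commonU ρ ρ<d)
    nV : ∀ ρ → ρ < d → SumsMod (V ρ) (v ρ) K L
    nV ρ ρ<d = sumsMod-weaken (ℕ.≤-trans (ℕ.m≤n+m _ (proj₁ commonU)) (ℕ.m≤n+m _ (Sums.bound sA K ℕ.+ Sums.bound sB K))) (proj₂ commonV ρ ρ<d)
    -- Both orders of summation use the same box, m between -N₂ and N₂ and t between -N₁ and N₁. The
    -- margins ∣ c ∣ L and ∣ e ∣ L compensate the slant of the rows, which move by c m and by -e t.
    N₁ = L ℕ.+ ∣ c ∣ ℕ.* L
    N₂ = L ℕ.+ ∣ e ∣ ℕ.* L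
    a₁ = ℤ.- + N₁
    l₁ = suc (2 ℕ.* N₁)
    l₂ = suc (2 ℕ.* N₂)
    a₂ = ℤ.- + N₂
    double : ∀ N → suc (N ℕ.+ N) ≤ suc (2 ℕ.* N)
    double N = ℕ.≤-reflexive (lemma N)
      where
      lemma : ∀ N → suc (N ℕ.+ N) ≡ suc (2 ℕ.* N)
      lemma = ℕ-Solver.solve-∀
    wide : ∀ N M → L ℕ.+ M ≡ N → (ℤ.- + N ℤ.≤ ℤ.- + L) × (+ L ℤ.< ℤ.- + N ℤ.+ + suc (2 ℕ.* N))
    wide N M refl = ≡.subst (λ t → (t ℤ.≤ ℤ.- + L) × (+ L ℤ.< t ℤ.+ + suc (2 ℕ.* N))) (ℤ.+-identityʳ _)
      (window L 0 N (suc (2 ℕ.* N)) (+ 0) z≤n (≡.subst (λ t → t ≤ N) (≡.sym (ℕ.+-identityʳ L)) (ℕ.m≤m+n L M))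
        (ℕ.≤-trans (s≤s (ℕ.+-monoʳ-≤ N (≡.subst (λ t → t ≤ N) (≡.sym (ℕ.+-identityʳ L)) (ℕ.m≤m+n L M)))) (double N)))
    left₁  = proj₁ (wide N₁ (∣ c ∣ ℕ.* L) refl)
    right₁ = proj₂ (wide N₁ (∣ c ∣ ℕ.* L) refl)
    left₂  = proj₁ (wide N₂ (∣ e ∣ ℕ.* L) refl)
    right₂ = proj₂ (wide N₂ (∣ e ∣ ℕ.* L) refl)
    inner₁ : ∀ m → ∣ m ∣ ≤ L → (+ d ℤ.* a₁ ℤ.+ c ℤ.* m ℤ.≤ ℤ.- + L) × (+ L ℤ.< + d ℤ.* a₁ ℤ.+ c ℤ.* m ℤ.+ + (l₁ ℕ.* d))
    inner₁ m m≤L = ≡.subst (λ t → (t ℤ.+ c ℤ.* m ℤ.≤ ℤ.- + L) × (+ L ℤ.< t ℤ.+ c ℤ.* m ℤ.+ + (l₁ ℕ.* d)))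
      (≡.trans (cong ℤ.-_ (ℤ.pos-* d N₁)) (ℤ.neg-distribʳ-* (+ d) (+ N₁)))
      (window L (∣ c ∣ ℕ.* L) (d ℕ.* N₁) (l₁ ℕ.* d) (c ℤ.* m) (abs-*-≤ c m≤L) (ℕ.m≤n*m N₁ d)
        (ℕ.≤-trans (ℕ.+-mono-≤ (ℕ.>-nonZero⁻¹ d) (ℕ.+-monoʳ-≤ (d ℕ.* N₁) (ℕ.m≤n*m N₁ d))) (ℕ.≤-reflexive (lemma d N₁))))
      where
      lemma : ∀ d N → d ℕ.+ (d ℕ.* N ℕ.+ d ℕ.* N) ≡ suc (2 ℕ.* N) ℕ.* d
      lemma = ℕ-Solver.solve-∀
    inner₂ : ∀ t → ∣ t ∣ ≤ L → (a₂ ℤ.+ ℤ.- (e ℤ.* t) ℤ.≤ ℤ.- + L) × (+ L ℤ.< a₂ ℤ.+ ℤ.- (e ℤ.* t) ℤ.+ + l₂)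
    inner₂ t t≤L = window L (∣ e ∣ ℕ.* L) N₂ l₂ (ℤ.- (e ℤ.* t))
      (≡.subst (λ z → z ≤ ∣ e ∣ ℕ.* L) (≡.sym (ℤ.∣-i∣≡∣i∣ (e ℤ.* t))) (abs-*-≤ e t≤L)) ℕ.≤-refl (double N₂)
    X : ℕ → ℤ → ℤ → PS
    X ρ t m = A m · B (+ d ℤ.* t ℤ.+ + ρ ℤ.+ c ℤ.* m)
    rearrange : S a₂ l₂ (λ m → A m · S (+ d ℤ.* a₁ ℤ.+ c ℤ.* m) (l₁ ℕ.* d) B) ≋ ∑ d (λ ρ → S a₁ l₁ (λ t → S a₂ l₂ (X ρ t)))
    rearrange = begin
      S a₂ l₂ (λ m → A m · S (+ d ℤ.* a₁ ℤ.+ c ℤ.* m) (l₁ ℕ.* d) B)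
        ≈⟨ S-cong a₂ l₂ (λ m → ℛ.trans (ℛ.*-congˡ (ℛ.sym (S-shift (+ d ℤ.* a₁) (l₁ ℕ.* d) (c ℤ.* m) B))) (ℛ.sym (∑-·ˡ (l₁ ℕ.* d) (A m) _))) ⟩
      S a₂ l₂ (λ m → S (+ d ℤ.* a₁) (l₁ ℕ.* d) (λ s → A m · B (s ℤ.+ c ℤ.* m)))
        ≈⟨ ∑-swap l₂ (l₁ ℕ.* d) (λ i j → A (a₂ ℤ.+ + i) · B (+ d ℤ.* a₁ ℤ.+ + j ℤ.+ c ℤ.* (a₂ ℤ.+ + i))) ⟩
      S (+ d ℤ.* a₁) (l₁ ℕ.* d) (λ s → S a₂ l₂ (λ m → A m · B (s ℤ.+ c ℤ.* m)))
        ≈⟨ S-dissect d a₁ l₁ (λ s → S a₂ l₂ (λ m → A m · B (s ℤ.+ c ℤ.* m))) ⟩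
      S a₁ l₁ (λ t → ∑ d (λ ρ → S a₂ l₂ (X ρ t)))
        ≈⟨ ∑-swap l₁ d (λ i ρ → S a₂ l₂ (X ρ (a₁ ℤ.+ + i))) ⟩
      ∑ d (λ ρ → S a₁ l₁ (λ t → S a₂ l₂ (X ρ t))) ∎
    separate : ∀ ρ → ρ < d → S a₁ l₁ (λ t → S a₂ l₂ (X ρ t)) ≋ S a₁ l₁ (λ t → U ρ t · S (a₂ ℤ.+ ℤ.- (e ℤ.* t)) l₂ (V ρ))
    separate ρ ρ<d = S-cong a₁ l₁ (λ t → begin
      S a₂ l₂ (X ρ t)                                                       ≡⟨ cong (λ a → S a l₂ (X ρ t)) (lemma a₂ (e ℤ.* t)) ⟨
      S (a₂ ℤ.+ ℤ.- (e ℤ.* t) ℤ.+ e ℤ.* t) l₂ (X ρ t)                       ≈⟨ S-shift (a₂ ℤ.+ ℤ.- (e ℤ.* t)) l₂ (e ℤ.* t) (X ρ t) ⟨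
      S (a₂ ℤ.+ ℤ.- (e ℤ.* t)) l₂ (λ l → X ρ t (l ℤ.+ e ℤ.* t))             ≈⟨ S-cong (a₂ ℤ.+ ℤ.- (e ℤ.* t)) l₂ (λ l → factor ρ ρ<d t l) ⟩
      S (a₂ ℤ.+ ℤ.- (e ℤ.* t)) l₂ (λ l → U ρ t · V ρ l)                     ≈⟨ ∑-·ˡ l₂ (U ρ t) _ ⟩
      U ρ t · S (a₂ ℤ.+ ℤ.- (e ℤ.* t)) l₂ (V ρ)                             ∎)
      where
      lemma : ∀ a x → a ℤ.+ ℤ.- x ℤ.+ x ≡ a
      lemma = solve-∀

-- Jacobi's triple product

-- Exponents of theta series are integers by form and naturals by fact. At a negative exponent the
-- value is meaningless, and `monoℤ-+` therefore asks for nonnegativity.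
monoℤ : ℤ → PS
monoℤ x = mono ∣ x ∣

monoℤ-+ : ∀ {x y} → + 0 ℤ.≤ x → + 0 ℤ.≤ y → monoℤ x · monoℤ y ≋ monoℤ (x ℤ.+ y)
monoℤ-+ {+ m} {+ n} _ _ = mono-+ m n

quad : ℤ → ℤ → ℤ → ℤ
quad α β k = α ℤ.* (k ℤ.* k) ℤ.+ β ℤ.* k

quad-factor : ∀ α β k → α ℤ.* (k ℤ.* k) ℤ.+ β ℤ.* k ≡ k ℤ.* (α ℤ.* k ℤ.+ β)
quad-factor = solve-∀

-- For k ≥ 1 both factors of k (α k + β) are nonnegative; negative k are reflected to positive ones
-- by changing the sign of β.
quad-≥0 : ∀ α β → ∣ β ∣ ≤ α → ∀ k → + 0 ℤ.≤ quad (+ α) β k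
quad-≥0 α β β≤α (+ zero) = ℤ.≤-reflexive (zero-case (+ α) β)
  where
  zero-case : ∀ α β → + 0 ≡ quad α β (+ 0)
  zero-case α β = ≡.sym (≡.trans (quad-factor α β (+ 0)) refl)
quad-≥0 α β β≤α (+ suc n) = ℤ.≤-trans (ℤ.≤-reflexive (≡.sym (ℤ.*-zeroʳ (+ suc n))))
  (ℤ.≤-trans (ℤ.*-monoˡ-≤-nonNeg (+ suc n) nonneg) (ℤ.≤-reflexive (≡.sym (quad-factor (+ α) β (+ suc n)))))
  where
  nonneg : + 0 ℤ.≤ + α ℤ.* + suc n ℤ.+ β
  nonneg = ℤ.≤-trans (ℤ.≤-reflexive (≡.sym (ℤ.+-inverseʳ (+ α))))
    (ℤ.+-mono-≤ (ℤ.≤-trans (ℤ.+≤+ (ℕ.m≤m*n α (suc n))) (ℤ.≤-reflexive (ℤ.pos-* α (suc n)))) (proj₁ (abs≤⇒bounds β≤α)))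
quad-≥0 α β β≤α (-[1+ n ]) = ≡.subst (λ t → + 0 ℤ.≤ t) (flip (+ α) β (+ suc n))
  (quad-≥0 α (ℤ.- β) (≡.subst (λ t → t ≤ α) (≡.sym (ℤ.∣-i∣≡∣i∣ β)) β≤α) (+ suc n))
  where
  flip : ∀ α β k → α ℤ.* (k ℤ.* k) ℤ.+ ℤ.- β ℤ.* k ≡ α ℤ.* (ℤ.- k ℤ.* ℤ.- k) ℤ.+ β ℤ.* ℤ.- k
  flip = solve-∀

-- The strict bound on β makes α k + β nonzero for k ≠ 0, hence of absolute value at least 1. The
-- resulting growth gives convergence of the theta series.
quad-abs : ∀ α β → ∣ β ∣ < α → ∀ k → ∣ k ∣ ≤ ∣ quad (+ α) β k ∣
quad-abs α β β<α k = ℕ.≤-trans (bound k) (ℕ.≤-reflexive (≡.sym (≡.trans (cong ∣_∣ (quad-factor (+ α) β k)) (ℤ.abs-* k _))))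
  where
  nonzero : ∀ n k → ∣ k ∣ ≡ suc n → + α ℤ.* k ℤ.+ β ≢ + 0
  nonzero n k k≡ e = ℕ.<-irrefl refl (ℕ.≤-trans (s≤s (ℕ.m≤m*n α (suc n)))
    (≡.subst (λ t → suc t ≤ α) (≡.trans (≡.sym (ℤ.∣-i∣≡∣i∣ β)) (≡.trans (cong ∣_∣ (≡.sym eq)) (≡.trans (ℤ.abs-* (+ α) k) (cong (α ℕ.*_) k≡)))) β<α))
    where
    eq : + α ℤ.* k ≡ ℤ.- β
    eq = ≡.trans (lemma (+ α ℤ.* k) β) (≡.trans (cong (λ t → t ℤ.- β) e) (ℤ.+-identityˡ _))
      where
      lemma : ∀ x b → x ≡ x ℤ.+ b ℤ.- b
      lemma = solve-∀
  positive : ∀ x → x ≢ + 0 → 1 ≤ ∣ x ∣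
  positive (+ zero)   x≢0 = ⊥-elim (x≢0 refl)
  positive (+ suc n)  _   = s≤s z≤n
  positive (-[1+ n ]) _   = s≤s z≤n
  bound : ∀ k → ∣ k ∣ ≤ ∣ k ∣ ℕ.* ∣ + α ℤ.* k ℤ.+ β ∣
  bound k = go ∣ k ∣ refl
    where
    go : ∀ n → ∣ k ∣ ≡ n → n ≤ n ℕ.* ∣ + α ℤ.* k ℤ.+ β ∣
    go zero    _ = z≤n
    go (suc n) e = ≡.subst (λ t → t ≤ suc n ℕ.* ∣ + α ℤ.* k ℤ.+ β ∣) (ℕ.*-identityʳ (suc n)) (ℕ.*-monoʳ-≤ (suc n) (positive _ (nonzero n k e)))

mono-small : ∀ {K e} → K ≤ e → mono e ≈[ K ] zeroS
mono-small {K} {e} K≤e = ≈[]-trans (≋⇒≈[] K (ℛ.sym (ℛ.*-identityʳ (mono e)))) (mono-≈[]0 K≤e oneS)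

antidiagonal : ℕ → (ℕ → ℕ → PS) → PS
antidiagonal n g = ∑ (suc n) (λ i → g i (n ℕ.∸ i))

∑-cong-< : ∀ n {g h} → (∀ j → j < n → g j ≋ h j) → ∑ n g ≋ ∑ n h
∑-cong-< zero    e = ℛ.refl
∑-cong-< (suc n) e = ℛ.+-cong (∑-cong-< n (λ j j<n → e j (ℕ.m≤n⇒m≤1+n j<n))) (e n ℕ.≤-refl)

antidiagonal-cong : ∀ n {g h} → (∀ i j → i ℕ.+ j ≡ n → g i j ≋ h i j) → antidiagonal n g ≋ antidiagonal n h
antidiagonal-cong n e = ∑-cong-< (suc n) (λ i i≤n → e i (n ℕ.∸ i) (ℕ.m+[n∸m]≡n (ℕ.≤-pred i≤n)))

antidiagonal-sucˡ : ∀ n g → g 0 (suc n) ≋ zeroS → antidiagonal (suc n) g ≋ antidiagonal n (λ i j → g (suc i) j)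
antidiagonal-sucˡ n g e = begin
  ∑ (suc (suc n)) F                                ≡⟨ cong (λ t → ∑ t F) (ℕ.+-comm 1 (suc n)) ⟩
  ∑ (suc n ℕ.+ 1) F                                ≈⟨ ∑-+ 1 (suc n) F ⟩
  ∑ 1 F ⊕ ∑ (suc n) (λ j → F (suc j))              ≈⟨ ℛ.+-congʳ (ℛ.trans (ℛ.+-identityˡ _) e) ⟩
  zeroS ⊕ antidiagonal n (λ i j → g (suc i) j)     ≈⟨ ℛ.+-identityˡ _ ⟩
  antidiagonal n (λ i j → g (suc i) j)             ∎
  where
  F : ℕ → PS
  F i = g i (suc n ℕ.∸ i)

antidiagonal-sucʳ : ∀ n g → g (suc n) 0 ≋ zeroS → antidiagonal (suc n) g ≋ antidiagonal n (λ i j → g i (suc j))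
antidiagonal-sucʳ n g e = begin
  ∑ (suc n) F ⊕ g (suc n) (n ℕ.∸ n)
    ≈⟨ ℛ.+-cong (∑-cong-< (suc n) (λ i i≤n → ℛ.reflexive (cong (g i) (ℕ.+-∸-assoc 1 (ℕ.≤-pred i≤n)))))
         (ℛ.trans (ℛ.reflexive (cong (g (suc n)) (ℕ.n∸n≡0 n))) e) ⟩
  antidiagonal n (λ i j → g i (suc j)) ⊕ zeroS     ≈⟨ ℛ.+-identityʳ _ ⟩
  antidiagonal n (λ i j → g i (suc j))             ∎
  where
  F : ℕ → PS
  F i = g i (suc n ℕ.∸ i)

-- σ = 1 or σ = −1; the product is ∏ (1 + σ q^{a + 2μ j}) (1 + σ q^{b + 2μ j}) (1 − q^{2μ (j + 1)}).
module JacobiTriple (μ′ a′ b′ : ℕ) (a+b≡2μ : suc a′ ℕ.+ suc b′ ≡ 2 ℕ.* suc μ′) (σ : PS) (σσ≋1 : σ · σ ≋ oneS) where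
  private
    μ a b D : ℕ
    μ = suc μ′
    a = suc a′
    b = suc b′
    D = 2 ℕ.* μ

  β : ℤ
  β = + a ℤ.- + μ

  term : ℤ → PS
  term k = (σ ^ˢ ∣ k ∣) · monoℤ (quad (+ μ) β k)

  2μ≡a+b : + μ ℤ.+ + μ ≡ + a ℤ.+ + b
  2μ≡a+b = cong +_ (≡.trans (cong (μ ℕ.+_) (≡.sym (ℕ.+-identityʳ μ))) (≡.sym a+b≡2μ))

  private
    β<μ : ∣ β ∣ < μ
    β<μ = ℕ.≰⇒> λ μ≤β → case μ≤β
      where
      -μ<β : ℤ.- + μ ℤ.< β
      -μ<β = ≡.subst (λ t → t ℤ.< β) (ℤ.+-identityˡ _) (ℤ.+-monoˡ-< (ℤ.- + μ) (ℤ.+<+ (s≤s (z≤n {a′}))))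
      β<+μ : β ℤ.< + μ
      β<+μ = ≡.subst (λ t → β ℤ.< t) (lemma (+ μ)) (ℤ.+-monoˡ-< (ℤ.- + μ)
        (≡.subst (λ t → + a ℤ.< t) (≡.sym 2μ≡a+b) (ℤ.+<+ (ℕ.m<m+n a (s≤s (z≤n {b′}))))))
        where
        lemma : ∀ m → m ℤ.+ m ℤ.- m ≡ m
        lemma = solve-∀
      split : ∀ x m → m ≤ ∣ x ∣ → (+ m ℤ.≤ x) ⊎ (x ℤ.≤ ℤ.- + m)
      split (+ n)      m p = inj₁ (ℤ.+≤+ p)
      split (-[1+ n ]) m p = inj₂ (ℤ.neg-mono-≤ (ℤ.+≤+ p))
      case : μ ≤ ∣ β ∣ → Data.Empty.⊥
      case p with split β μ p
      ... | inj₁ q = ℤ.<⇒≱ β<+μ q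
      ... | inj₂ q = ℤ.<⇒≱ -μ<β q

    e≥0 : ∀ k → + 0 ℤ.≤ quad (+ μ) β k
    e≥0 = quad-≥0 μ β (ℕ.<⇒≤ β<μ)

    FX FY FQ : ℕ → PS
    FX j = oneS ⊕ σ · mono (a ℕ.+ D ℕ.* j)
    FY j = oneS ⊕ σ · mono (b ℕ.+ D ℕ.* j)
    FQ j = 1-q^ (D ℕ.+ D ℕ.* j)

    -- `fac (i + j) · r i · r j` is the Gaussian binomial coefficient in q^D. With the reciprocals
    -- as power series nothing has to be shown to be a polynomial.
    fac r : ℕ → PS
    fac n = ∏ n FQ
    r n = inv (fac n)

    w : ℕ → PS
    w i = 1-q^ (D ℕ.* i)

    factor-at0 : ∀ e → 1-q^ (suc e) 0 ≡ + 1
    factor-at0 e = 1-q^≈1 {1} (s≤s z≤n) 0 (s≤s z≤n)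

    fac-at0 : ∀ n → fac n 0 ≡ + 1
    fac-at0 zero    = refl
    fac-at0 (suc n) = ≡.trans (·-0 (fac n) (FQ n)) (cong₂ ℤ._*_ (fac-at0 n) (factor-at0 _))

    r-suc : ∀ n → w (suc n) · r (suc n) ≋ r n
    r-suc n = inv-unique (fac-at0 n) (begin
      fac n · (w (suc n) · r (suc n))   ≈⟨ ℛ.*-assoc _ _ _ ⟨
      fac n · w (suc n) · r (suc n)     ≈⟨ ℛ.*-congʳ (ℛ.*-congˡ (ℛ.reflexive (cong 1-q^ (ℕ.*-suc D n)))) ⟩
      fac (suc n) · r (suc n)           ≈⟨ inv-right (fac (suc n)) (fac-at0 (suc n)) ⟩
      oneS                              ∎)

    w-0 : w 0 ≋ zeroS
    w-0 = ℛ.trans (ℛ.+-congˡ (ℛ.-‿cong (ℛ.trans (ℛ.reflexive (cong mono (ℕ.*-zeroʳ D))) mono-0))) (ℛ.-‿inverseʳ oneS)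

    -- The q-Pascal rule in both of its forms: `stepX` reads it with i and j exchanged, `stepY` as
    -- it stands.
    w-+ : ∀ i j → 1-q^ (D ℕ.* (i ℕ.+ j)) ≋ w i ⊕ mono (D ℕ.* i) · w j
    w-+ i j = ℛ.trans (ℛ.+-congˡ (ℛ.-‿cong (ℛ.trans (ℛ.reflexive (cong mono (ℕ.*-distribˡ-+ D i j))) (ℛ.sym (mono-+ _ _)))))
      (ℛ.solve (con (+ 1) :- var (# 0) :* var (# 1)) ((con (+ 1) :- var (# 0)) :+ var (# 0) :* (con (+ 1) :- var (# 1))) (mono (D ℕ.* i) ∷ mono (D ℕ.* j) ∷ []))

    sgn-suc : ∀ k → σ ^ˢ ∣ ℤ.suc k ∣ ≋ σ · σ ^ˢ ∣ k ∣
    sgn-suc (+ n)          = ℛ.refl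
    sgn-suc (-[1+ zero ])  = ℛ.sym (ℛ.trans (ℛ.*-congˡ (ℛ.*-identityʳ σ)) σσ≋1)
    sgn-suc (-[1+ suc n ]) = ℛ.sym (ℛ.trans (ℛ.sym (ℛ.*-assoc σ σ _)) (ℛ.trans (ℛ.*-congʳ σσ≋1) (ℛ.*-identityˡ _)))

    exponents-agree : ∀ m m′ k k′ → + m ℤ.+ quad (+ μ) β k ≡ + m′ ℤ.+ quad (+ μ) β k′ →
      mono m · monoℤ (quad (+ μ) β k) ≋ mono m′ · monoℤ (quad (+ μ) β k′)
    exponents-agree m m′ k k′ e = ℛ.trans (monoℤ-+ (ℤ.+≤+ z≤n) (e≥0 k)) (ℛ.trans (ℛ.reflexive (cong monoℤ e)) (ℛ.sym (monoℤ-+ (ℤ.+≤+ z≤n) (e≥0 k′))))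

    D* : ∀ i → + (D ℕ.* i) ≡ (+ μ ℤ.+ + μ) ℤ.* + i
    D* i = ≡.trans (ℤ.pos-* D i) (cong (λ t → + t ℤ.* + i) (cong (μ ℕ.+_) (ℕ.+-identityʳ μ)))

    shuffle : ∀ {s x x′} m m′ → mono m · x′ ≋ mono m′ · x → mono m · (σ · s · x′) ≋ σ · mono m′ · (s · x)
    shuffle {s} {x} {x′} m m′ e = begin
      mono m · (σ · s · x′)     ≈⟨ ℛ.solve (y :* (v :* z :* t)) (v :* z :* (y :* t)) (mono m ∷ σ ∷ s ∷ x′ ∷ []) ⟩
      σ · s · (mono m · x′)     ≈⟨ ℛ.*-congˡ e ⟩
      σ · s · (mono m′ · x)     ≈⟨ ℛ.solve (v :* z :* (y :* t)) (v :* y :* (z :* t)) (mono m′ ∷ σ ∷ s ∷ x ∷ []) ⟩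
      σ · mono m′ · (s · x)     ∎
      where
      y v z t : Expr 4
      y = var (# 0)
      v = var (# 1)
      z = var (# 2)
      t = var (# 3)

    term-suc : ∀ i j M → i ℕ.+ j ≡ M → mono (D ℕ.* j) · term (+ suc i) ≋ σ · mono (a ℕ.+ D ℕ.* M) · term (+ i)
    term-suc i j M refl = shuffle (D ℕ.* j) (a ℕ.+ D ℕ.* (i ℕ.+ j))
      (exponents-agree (D ℕ.* j) (a ℕ.+ D ℕ.* (i ℕ.+ j)) (+ suc i) (+ i)
        (≡.trans (cong (λ t → t ℤ.+ quad (+ μ) β (+ suc i)) (D* j)) (≡.trans (lemma (+ μ) (+ a) (+ i) (+ j))
          (cong (λ t → + a ℤ.+ t ℤ.+ quad (+ μ) β (+ i)) (≡.sym (D* (i ℕ.+ j)))))))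
      where
      lemma : ∀ m a i j → (m ℤ.+ m) ℤ.* j ℤ.+ (m ℤ.* ((+ 1 ℤ.+ i) ℤ.* (+ 1 ℤ.+ i)) ℤ.+ (a ℤ.- m) ℤ.* (+ 1 ℤ.+ i))
        ≡ a ℤ.+ (m ℤ.+ m) ℤ.* (i ℤ.+ j) ℤ.+ (m ℤ.* (i ℤ.* i) ℤ.+ (a ℤ.- m) ℤ.* i)
      lemma = solve-∀

    term-pred : ∀ i N → mono (D ℕ.* i) · term (+ i ℤ.- + suc N) ≋ σ · mono (b ℕ.+ D ℕ.* N) · term (+ i ℤ.- + N)
    term-pred i N = ℛ.trans (ℛ.*-congˡ (ℛ.*-congʳ sign)) (shuffle (D ℕ.* i) (b ℕ.+ D ℕ.* N)
      (exponents-agree (D ℕ.* i) (b ℕ.+ D ℕ.* N) (+ i ℤ.- + suc N) (+ i ℤ.- + N)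
        (≡.trans (cong (λ t → t ℤ.+ quad (+ μ) β (+ i ℤ.- + suc N)) (D* i)) (≡.trans (lemma (+ μ) (+ a) (+ b) (+ i) (+ N) 2μ≡a+b)
          (cong (λ t → + b ℤ.+ t ℤ.+ quad (+ μ) β (+ i ℤ.- + N)) (≡.sym (D* N)))))))
      where
      sign : σ ^ˢ ∣ + i ℤ.- + suc N ∣ ≋ σ · σ ^ˢ ∣ + i ℤ.- + N ∣
      sign = ℛ.sym (ℛ.trans (ℛ.*-congˡ (ℛ.trans (ℛ.reflexive (cong (λ t → σ ^ˢ ∣ t ∣) (next (+ i) (+ N)))) (sgn-suc (+ i ℤ.- + suc N))))
        (ℛ.trans (ℛ.sym (ℛ.*-assoc _ _ _)) (ℛ.trans (ℛ.*-congʳ σσ≋1) (ℛ.*-identityˡ _))))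
        where
        next : ∀ i N → i ℤ.- N ≡ + 1 ℤ.+ (i ℤ.- (+ 1 ℤ.+ N))
        next = solve-∀
      lemma : ∀ m a b i N → m ℤ.+ m ≡ a ℤ.+ b →
        (m ℤ.+ m) ℤ.* i ℤ.+ (m ℤ.* ((i ℤ.- (+ 1 ℤ.+ N)) ℤ.* (i ℤ.- (+ 1 ℤ.+ N))) ℤ.+ (a ℤ.- m) ℤ.* (i ℤ.- (+ 1 ℤ.+ N)))
        ≡ b ℤ.+ (m ℤ.+ m) ℤ.* N ℤ.+ (m ℤ.* ((i ℤ.- N) ℤ.* (i ℤ.- N)) ℤ.+ (a ℤ.- m) ℤ.* (i ℤ.- N))
      lemma m a b i N e = ≡.trans (reduce m a i N) (cong (λ t → t ℤ.+ (m ℤ.+ m) ℤ.* N ℤ.+ (m ℤ.* ((i ℤ.- N) ℤ.* (i ℤ.- N)) ℤ.+ (a ℤ.- m) ℤ.* (i ℤ.- N)))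
        (≡.trans (cong (λ t → t ℤ.- a) e) (cancel a b)))
        where
        reduce : ∀ m a i N →
          (m ℤ.+ m) ℤ.* i ℤ.+ (m ℤ.* ((i ℤ.- (+ 1 ℤ.+ N)) ℤ.* (i ℤ.- (+ 1 ℤ.+ N))) ℤ.+ (a ℤ.- m) ℤ.* (i ℤ.- (+ 1 ℤ.+ N)))
          ≡ (m ℤ.+ m ℤ.- a) ℤ.+ (m ℤ.+ m) ℤ.* N ℤ.+ (m ℤ.* ((i ℤ.- N) ℤ.* (i ℤ.- N)) ℤ.+ (a ℤ.- m) ℤ.* (i ℤ.- N))
        reduce = solve-∀
        cancel : ∀ a b → a ℤ.+ b ℤ.- a ≡ b
        cancel = solve-∀

    rr : (ℕ → ℤ) → ℕ → ℕ → PS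
    rr s i j = r i · r j · term (s i)

    antidiagonal-⊕ : ∀ n g h → antidiagonal n (λ i j → g i j ⊕ h i j) ≋ antidiagonal n g ⊕ antidiagonal n h
    antidiagonal-⊕ n g h = ∑-⊕ (suc n) _ _

    -- The factor 1 - q^(D (M + 1)) is split by the q-Pascal rule. One part lowers j, the other
    -- lowers i; the boundary terms disappear by `w 0` = 0. The two sums are the contributions of 1
    -- and of σ q^(a + D M) in `FX M`.
    stepX : ∀ M → antidiagonal M (rr (λ i → + i)) · FX M ≋ FQ M · antidiagonal (suc M) (rr (λ i → + i))
    stepX M = ℛ.sym (begin
      FQ M · antidiagonal (suc M) (rr +_)                               ≈⟨ ∑-·ˡ (suc (suc M)) (FQ M) _ ⟨
      antidiagonal (suc M) (λ i j → FQ M · rr +_ i j)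
        ≈⟨ antidiagonal-cong (suc M) (λ i j e → ℛ.trans (ℛ.*-congʳ (ℛ.trans (ℛ.reflexive (cong 1-q^ (power i j e))) (w-+ j i))) (ℛ.distribʳ (rr +_ i j) _ _)) ⟩
      antidiagonal (suc M) (λ i j → G₁ i j ⊕ G₂ i j)                    ≈⟨ antidiagonal-⊕ (suc M) G₁ G₂ ⟩
      antidiagonal (suc M) G₁ ⊕ antidiagonal (suc M) G₂
        ≈⟨ ℛ.+-cong (antidiagonal-sucʳ M G₁ (ℛ.trans (ℛ.*-congʳ w-0) (ℛ.zeroˡ _)))
             (antidiagonal-sucˡ M G₂ (ℛ.trans (ℛ.*-congʳ (ℛ.trans (ℛ.*-congˡ w-0) (ℛ.zeroʳ _))) (ℛ.zeroˡ _))) ⟩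
      antidiagonal M (λ i j → G₁ i (suc j)) ⊕ antidiagonal M (λ i j → G₂ (suc i) j)
        ≈⟨ ℛ.+-cong (antidiagonal-cong M (λ i j _ → part₁ i j)) (antidiagonal-cong M part₂) ⟩
      antidiagonal M (rr +_) ⊕ antidiagonal M (λ i j → σ · mono (a ℕ.+ D ℕ.* M) · rr +_ i j)
        ≈⟨ ℛ.+-congˡ (∑-·ˡ (suc M) _ _) ⟩
      antidiagonal M (rr +_) ⊕ σ · mono (a ℕ.+ D ℕ.* M) · antidiagonal M (rr +_)
        ≈⟨ ℛ.solve (var (# 0) :+ var (# 1) :* var (# 0)) (var (# 0) :* (con (+ 1) :+ var (# 1))) (antidiagonal M (rr +_) ∷ σ · mono (a ℕ.+ D ℕ.* M) ∷ []) ⟩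
      antidiagonal M (rr +_) · FX M ∎)
      where
      G₁ G₂ : ℕ → ℕ → PS
      G₁ i j = w j · rr +_ i j
      G₂ i j = mono (D ℕ.* j) · w i · rr +_ i j
      power : ∀ i j → i ℕ.+ j ≡ suc M → D ℕ.+ D ℕ.* M ≡ D ℕ.* (j ℕ.+ i)
      power i j e = ≡.trans (≡.sym (ℕ.*-suc D M)) (cong (D ℕ.*_) (≡.trans (≡.sym e) (ℕ.+-comm i j)))
      part₁ : ∀ i j → G₁ i (suc j) ≋ rr +_ i j
      part₁ i j = ℛ.trans (ℛ.solve (var (# 0) :* (var (# 1) :* var (# 2) :* var (# 3))) (var (# 1) :* (var (# 0) :* var (# 2)) :* var (# 3))
        (w (suc j) ∷ r i ∷ r (suc j) ∷ term (+ i) ∷ [])) (ℛ.*-congʳ (ℛ.*-congˡ (r-suc j)))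
      part₂ : ∀ i j → i ℕ.+ j ≡ M → G₂ (suc i) j ≋ σ · mono (a ℕ.+ D ℕ.* M) · rr +_ i j
      part₂ i j e = ℛ.trans (ℛ.solve (var (# 0) :* var (# 1) :* (var (# 2) :* var (# 3) :* var (# 4))) (var (# 1) :* var (# 2) :* var (# 3) :* (var (# 0) :* var (# 4)))
        (mono (D ℕ.* j) ∷ w (suc i) ∷ r (suc i) ∷ r j ∷ term (+ suc i) ∷ []))
        (ℛ.trans (ℛ.*-cong (ℛ.*-congʳ (r-suc i)) (term-suc i j M e))
          (ℛ.solve (var (# 0) :* (var (# 1) :* var (# 2))) (var (# 1) :* (var (# 0) :* var (# 2))) (r i · r j ∷ σ · mono (a ℕ.+ D ℕ.* M) ∷ term (+ i) ∷ [])))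

    stepY : ∀ n N → antidiagonal n (rr (λ i → + i ℤ.- + N)) · FY N ≋ FQ n · antidiagonal (suc n) (rr (λ i → + i ℤ.- + suc N))
    stepY n N = ℛ.sym (begin
      FQ n · antidiagonal (suc n) (rr s′)                               ≈⟨ ∑-·ˡ (suc (suc n)) (FQ n) _ ⟨
      antidiagonal (suc n) (λ i j → FQ n · rr s′ i j)
        ≈⟨ antidiagonal-cong (suc n) (λ i j e → ℛ.trans (ℛ.*-congʳ (ℛ.trans (ℛ.reflexive (cong 1-q^ (power i j e))) (w-+ i j))) (ℛ.distribʳ (rr s′ i j) _ _)) ⟩
      antidiagonal (suc n) (λ i j → G₁ i j ⊕ G₂ i j)                    ≈⟨ antidiagonal-⊕ (suc n) G₁ G₂ ⟩
      antidiagonal (suc n) G₁ ⊕ antidiagonal (suc n) G₂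
        ≈⟨ ℛ.+-cong (antidiagonal-sucˡ n G₁ (ℛ.trans (ℛ.*-congʳ w-0) (ℛ.zeroˡ _)))
             (antidiagonal-sucʳ n G₂ (ℛ.trans (ℛ.*-congʳ (ℛ.trans (ℛ.*-congˡ w-0) (ℛ.zeroʳ _))) (ℛ.zeroˡ _))) ⟩
      antidiagonal n (λ i j → G₁ (suc i) j) ⊕ antidiagonal n (λ i j → G₂ i (suc j))
        ≈⟨ ℛ.+-cong (antidiagonal-cong n (λ i j _ → part₁ i j)) (antidiagonal-cong n (λ i j _ → part₂ i j)) ⟩
      antidiagonal n (rr s) ⊕ antidiagonal n (λ i j → σ · mono (b ℕ.+ D ℕ.* N) · rr s i j)
        ≈⟨ ℛ.+-congˡ (∑-·ˡ (suc n) _ _) ⟩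
      antidiagonal n (rr s) ⊕ σ · mono (b ℕ.+ D ℕ.* N) · antidiagonal n (rr s)
        ≈⟨ ℛ.solve (var (# 0) :+ var (# 1) :* var (# 0)) (var (# 0) :* (con (+ 1) :+ var (# 1))) (antidiagonal n (rr s) ∷ σ · mono (b ℕ.+ D ℕ.* N) ∷ []) ⟩
      antidiagonal n (rr s) · FY N ∎)
      where
      s s′ : ℕ → ℤ
      s i = + i ℤ.- + N
      s′ i = + i ℤ.- + suc N
      G₁ G₂ : ℕ → ℕ → PS
      G₁ i j = w i · rr s′ i j
      G₂ i j = mono (D ℕ.* i) · w j · rr s′ i j
      power : ∀ i j → i ℕ.+ j ≡ suc n → D ℕ.+ D ℕ.* n ≡ D ℕ.* (i ℕ.+ j)
      power i j e = ≡.trans (≡.sym (ℕ.*-suc D n)) (cong (D ℕ.*_) (≡.sym e))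
      same : ∀ i N → (+ 1 ℤ.+ i) ℤ.- (+ 1 ℤ.+ N) ≡ i ℤ.- N
      same = solve-∀
      part₁ : ∀ i j → G₁ (suc i) j ≋ rr s i j
      part₁ i j = ℛ.trans (ℛ.solve (var (# 0) :* (var (# 1) :* var (# 2) :* var (# 3))) (var (# 0) :* var (# 1) :* var (# 2) :* var (# 3))
        (w (suc i) ∷ r (suc i) ∷ r j ∷ term (s′ (suc i)) ∷ [])) (ℛ.*-cong (ℛ.*-congʳ (r-suc i)) (ℛ.reflexive (cong term (same (+ i) (+ N)))))
      part₂ : ∀ i j → G₂ i (suc j) ≋ σ · mono (b ℕ.+ D ℕ.* N) · rr s i j
      part₂ i j = ℛ.trans (ℛ.solve (var (# 0) :* var (# 1) :* (var (# 2) :* var (# 3) :* var (# 4))) (var (# 2) :* (var (# 1) :* var (# 3)) :* (var (# 0) :* var (# 4)))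
        (mono (D ℕ.* i) ∷ w (suc j) ∷ r i ∷ r (suc j) ∷ term (s′ i) ∷ []))
        (ℛ.trans (ℛ.*-cong (ℛ.*-congˡ (r-suc j)) (term-pred i N))
          (ℛ.solve (var (# 0) :* (var (# 1) :* var (# 2))) (var (# 1) :* (var (# 0) :* var (# 2))) (r i · r j ∷ σ · mono (b ℕ.+ D ℕ.* N) ∷ term (s i) ∷ [])))

    finiteX : ∀ M → ∏ M FX ≋ fac M · antidiagonal M (rr +_)
    finiteX zero = ℛ.sym (begin
      oneS · (zeroS ⊕ inv oneS · inv oneS · (oneS · monoℤ (quad (+ μ) β (+ 0))))
        ≈⟨ ℛ.*-congˡ (ℛ.+-congˡ (ℛ.*-cong (ℛ.*-cong one one) (ℛ.*-congˡ (ℛ.trans (ℛ.reflexive (cong monoℤ (at-zero (+ μ) β))) mono-0)))) ⟩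
      oneS · (zeroS ⊕ oneS · oneS · (oneS · oneS))
        ≈⟨ ℛ.solve (con (+ 1) :* (con (+ 0) :+ con (+ 1) :* con (+ 1) :* (con (+ 1) :* con (+ 1)))) (con (+ 1)) [] ⟩
      oneS ∎)
      where
      one : inv oneS ≋ oneS
      one = ℛ.sym (inv-unique refl (ℛ.*-identityˡ oneS))
      at-zero : ∀ m b → m ℤ.* (+ 0 ℤ.* + 0) ℤ.+ b ℤ.* + 0 ≡ + 0
      at-zero = solve-∀
    finiteX (suc M) = begin
      ∏ M FX · FX M                                        ≈⟨ ℛ.*-congʳ (finiteX M) ⟩
      fac M · antidiagonal M (rr +_) · FX M                ≈⟨ ℛ.*-assoc _ _ _ ⟩
      fac M · (antidiagonal M (rr +_) · FX M)              ≈⟨ ℛ.*-congˡ (stepX M) ⟩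
      fac M · (FQ M · antidiagonal (suc M) (rr +_))        ≈⟨ ℛ.*-assoc _ _ _ ⟨
      fac (suc M) · antidiagonal (suc M) (rr +_)           ∎

    -- Cauchy's finite form of the triple product. The case N = 0 is the q-binomial theorem; each
    -- further factor `FY N` shifts the index of the terms by one.
    finite : ∀ M N → ∏ M FX · ∏ N FY ≋ fac (N ℕ.+ M) · antidiagonal (N ℕ.+ M) (rr (λ i → + i ℤ.- + N))
    finite M zero = ℛ.trans (ℛ.*-identityʳ _) (ℛ.trans (finiteX M) (ℛ.*-congˡ (antidiagonal-cong M (λ i j _ →
      ℛ.*-congˡ {r i · r j} (ℛ.reflexive (cong term (≡.sym (ℤ.+-identityʳ (+ i)))))))))
    finite M (suc N) = begin
      ∏ M FX · (∏ N FY · FY N)                             ≈⟨ ℛ.*-assoc _ _ _ ⟨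
      ∏ M FX · ∏ N FY · FY N                               ≈⟨ ℛ.*-congʳ (finite M N) ⟩
      fac n · antidiagonal n (rr (λ i → + i ℤ.- + N)) · FY N             ≈⟨ ℛ.*-assoc _ _ _ ⟩
      fac n · (antidiagonal n (rr (λ i → + i ℤ.- + N)) · FY N)           ≈⟨ ℛ.*-congˡ (stepY n N) ⟩
      fac n · (FQ n · antidiagonal (suc n) (rr (λ i → + i ℤ.- + suc N))) ≈⟨ ℛ.*-assoc _ _ _ ⟨
      fac (suc n) · antidiagonal (suc n) (rr (λ i → + i ℤ.- + suc N))    ∎
      where n = N ℕ.+ M

    term-small : ∀ K k → K ≤ ∣ k ∣ → term k ≈[ K ] zeroS
    term-small K k K≤k = ≈[]-trans (≈[]-· K (λ _ _ → refl) (mono-small (ℕ.≤-trans K≤k (quad-abs μ β β<μ k)))) (≋⇒≈[] K (ℛ.zeroʳ _))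

  Qinf : PS
  Qinf = poch (2 ℕ.* suc μ′) (2 ℕ.* suc μ′)

  sums : ∀ {PX PY} → (∀ K n → K ≤ n → PX ≈[ K ] ∏ n FX) → (∀ K n → K ≤ n → PY ≈[ K ] ∏ n FY) → Sums term (PX · PY · Qinf)
  sums {PX} {PY} hX hY = record
    { bound = λ K → K ℕ.+ K
    ; small = λ K k p → term-small K k (ℕ.≤-trans (ℕ.m≤m+n K K) (ℕ.<⇒≤ p))
    ; total = λ K → ≈[]-sym (total K) }
    where
    fac≈Qinf : ∀ K n → K ≤ n → fac n ≈[ K ] Qinf
    fac≈Qinf K n K≤n = ≈[]-sym (poch-∏ (μ′ ℕ.+ (suc μ′ ℕ.+ 0)) (μ′ ℕ.+ (suc μ′ ℕ.+ 0)) K n K≤n)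
    iQ : PS
    iQ = inv Qinf
    r≈iQ : ∀ K n → K ≤ n → r n ≈[ K ] iQ
    r≈iQ K n K≤n = ≈[]-trans (≋⇒≈[] K (ℛ.sym (ℛ.trans (ℛ.*-congˡ (inv-right Qinf refl)) (ℛ.*-identityʳ (r n)))))
      (≈[]-trans (≈[]-· K {r n} {r n} (λ _ _ → refl) (≈[]-· K (≈[]-sym (fac≈Qinf K n K≤n)) (λ _ _ → refl)))
        (≋⇒≈[] K (ℛ.trans (ℛ.sym (ℛ.*-assoc _ _ _)) (ℛ.trans (ℛ.*-congʳ (inv-left (fac n) (fac-at0 n))) (ℛ.*-identityˡ iQ)))))
    total : ∀ K → PX · PY · Qinf ≈[ K ] S (ℤ.- + (K ℕ.+ K)) (suc (2 ℕ.* (K ℕ.+ K))) term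
    total K = ≈[]-trans (≈[]-· K (≈[]-· K (hX K N K≤N) (hY K N K≤N)) (λ _ _ → refl))
      (≈[]-trans (≋⇒≈[] K expand) (≈[]-trans (∑-mod K (suc (N ℕ.+ N)) limit)
        (≋⇒≈[] K (ℛ.trans (ℛ.reflexive (cong (λ t → ∑ t (λ i → term (+ i ℤ.- + N))) (length N)))
          (∑-cong (suc (2 ℕ.* N)) (λ j → ℛ.reflexive (cong term (ℤ.+-comm (+ j) (ℤ.- + N)))))))))
      where
      N : ℕ
      N = K ℕ.+ K
      K≤N : K ≤ N
      K≤N = ℕ.m≤m+n K K
      length : ∀ N → suc (N ℕ.+ N) ≡ suc (2 ℕ.* N)
      length = ℕ-Solver.solve-∀
      c : PS
      c = Qinf · fac (N ℕ.+ N)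
      g : ℕ → PS
      g i = c · rr (λ i → + i ℤ.- + N) i (N ℕ.+ N ℕ.∸ i)
      expand : ∏ N FX · ∏ N FY · Qinf ≋ ∑ (suc (N ℕ.+ N)) g
      expand = begin
        ∏ N FX · ∏ N FY · Qinf                                                       ≈⟨ ℛ.*-congʳ (finite N N) ⟩
        fac (N ℕ.+ N) · antidiagonal (N ℕ.+ N) (rr (λ i → + i ℤ.- + N)) · Qinf       ≈⟨ ℛ.trans (ℛ.*-comm _ _) (ℛ.sym (ℛ.*-assoc _ _ _)) ⟩
        c · antidiagonal (N ℕ.+ N) (rr (λ i → + i ℤ.- + N))                          ≈⟨ ∑-·ˡ (suc (N ℕ.+ N)) c _ ⟨
        ∑ (suc (N ℕ.+ N)) g                                                          ∎
      -- Terms with ∣ i - N ∣ ≥ K vanish modulo q^K. For the others N = 2K forces both i and 2N - i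
      -- to be at least K, where `r` agrees with the reciprocal of `Qinf` modulo q^K, and all
      -- products cancel.
      limit : ∀ i → i < suc (N ℕ.+ N) → g i ≈[ K ] term (+ i ℤ.- + N)
      limit i i≤ with K ℕ.≤? ∣ + i ℤ.- + N ∣
      ... | yes far = ≈[]-trans (≈[]-· K {c} {c} (λ _ _ → refl) (≈[]-· K {r i · r (N ℕ.+ N ℕ.∸ i)} (λ _ _ → refl) (term-small K (+ i ℤ.- + N) far)))
                        (≈[]-trans (≋⇒≈[] K (ℛ.trans (ℛ.*-congˡ (ℛ.zeroʳ _)) (ℛ.zeroʳ c))) (≈[]-sym (term-small K (+ i ℤ.- + N) far)))
      ... | no near = ≈[]-trans (≈[]-· K (≈[]-· K {Qinf} {Qinf} (λ _ _ → refl) (fac≈Qinf K (N ℕ.+ N) (ℕ.≤-trans K≤N (ℕ.m≤m+n N N))))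
                          (≈[]-· K {r i · r j} {iQ · iQ} {term (+ i ℤ.- + N)} (≈[]-· K (r≈iQ K i K≤i) (r≈iQ K j K≤j)) (λ _ _ → refl)))
                        (≋⇒≈[] K (ℛ.trans (ℛ.solve (var (# 0) :* var (# 0) :* (var (# 1) :* var (# 1) :* var (# 2))) ((var (# 0) :* var (# 1)) :* (var (# 0) :* var (# 1)) :* var (# 2))
                            (Qinf ∷ iQ ∷ term (+ i ℤ.- + N) ∷ []))
                          (ℛ.trans (ℛ.*-congʳ (ℛ.trans (ℛ.*-cong (inv-right Qinf refl) (inv-right Qinf refl)) (ℛ.*-identityˡ oneS))) (ℛ.*-identityˡ _))))
        where
        j : ℕ
        j = N ℕ.+ N ℕ.∸ i
        bounds : (ℤ.- + K ℤ.≤ + i ℤ.- + N) × (+ i ℤ.- + N ℤ.≤ + K)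
        bounds = abs≤⇒bounds (ℕ.<⇒≤ (ℕ.≰⇒> near))
        K≤i : K ≤ i
        K≤i = ℤ.drop‿+≤+ (≡.subst₂ ℤ._≤_ (e₁ (+ K)) (e₂ (+ i) (+ N)) (ℤ.+-monoˡ-≤ (+ N) (proj₁ bounds)))
          where
          e₁ : ∀ k → ℤ.- k ℤ.+ (k ℤ.+ k) ≡ k
          e₁ = solve-∀
          e₂ : ∀ i n → i ℤ.- n ℤ.+ n ≡ i
          e₂ = solve-∀
        i≤N+K : i ≤ N ℕ.+ K
        i≤N+K = ℤ.drop‿+≤+ (≡.subst₂ ℤ._≤_ (e₂ (+ i) (+ N)) (ℤ.+-comm (+ K) (+ N)) (ℤ.+-monoˡ-≤ (+ N) (proj₂ bounds)))
          where
          e₂ : ∀ i n → i ℤ.- n ℤ.+ n ≡ i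
          e₂ = solve-∀
        K≤j : K ≤ j
        K≤j = ℕ.m+n≤o⇒m≤o∸n K (ℕ.≤-trans (ℕ.≤-reflexive (ℕ.+-comm K i)) (ℕ.≤-trans (ℕ.+-monoˡ-≤ K i≤N+K) (ℕ.≤-reflexive (ℕ.+-assoc N K K))))

-- Products of two theta series

sgn : ℤ → PS
sgn k = (⊝ oneS) ^ˢ ∣ k ∣

-1·-1≋1 : ⊝ oneS · ⊝ oneS ≋ oneS
-1·-1≋1 = ℛ.trans (-1*x≈-x (⊝ oneS)) (-‿involutive oneS)

θ⁺ θ⁻ : ℕ → ℤ → ℤ → PS
θ⁺ α β k = monoℤ (quad (+ α) β k)
θ⁻ α β k = sgn k · monoℤ (quad (+ α) β k)

-- (−q^a ; q^d)_∞
poch⁺ : ℕ → ℕ → PS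
poch⁺ a d = poch (2 ℕ.* a) (2 ℕ.* d) · inv (poch a d)

-- The numbers supplied are predecessors: `jacobi⁻ 4 6 2` has μ = 5, a = 7, b = 3. The linear
-- coefficient a - μ is taken from the first of the two factors.
jacobi⁻ : ∀ μ a b → suc a ℕ.+ suc b ≡ 2 ℕ.* suc μ →
  Sums (θ⁻ (suc μ) (+ suc a ℤ.- + suc μ)) (poch (suc a) (2 ℕ.* suc μ) · poch (suc b) (2 ℕ.* suc μ) · poch (2 ℕ.* suc μ) (2 ℕ.* suc μ))
jacobi⁻ μ a b e = sums (factors a) (factors b)
  where
  open JacobiTriple μ a b e (⊝ oneS) -1·-1≋1
  factors : ∀ c K n → K ≤ n → poch (suc c) (2 ℕ.* suc μ) ≈[ K ] ∏ n (λ j → oneS ⊕ ⊝ oneS · mono (suc c ℕ.+ 2 ℕ.* suc μ ℕ.* j))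
  factors c K n K≤n = ≈[]-trans (poch-∏ c (μ ℕ.+ (suc μ ℕ.+ 0)) K n K≤n) (≋⇒≈[] K (∏-cong n (λ j → ℛ.+-congˡ (ℛ.sym (-1*x≈-x _)))))

jacobi⁺ : ∀ μ a b → suc a ℕ.+ suc b ≡ 2 ℕ.* suc μ →
  Sums (θ⁺ (suc μ) (+ suc a ℤ.- + suc μ)) (poch⁺ (suc a) (2 ℕ.* suc μ) · poch⁺ (suc b) (2 ℕ.* suc μ) · poch (2 ℕ.* suc μ) (2 ℕ.* suc μ))
jacobi⁺ μ a b e = sums-cong (λ k → ℛ.trans (ℛ.*-congʳ (ones ∣ k ∣)) (ℛ.*-identityˡ _)) ℛ.refl (sums (factors a) (factors b))
  where
  open JacobiTriple μ a b e oneS (ℛ.*-identityˡ oneS)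
  ones : ∀ n → oneS ^ˢ n ≋ oneS
  ones zero    = ℛ.refl
  ones (suc n) = ℛ.trans (ℛ.*-identityˡ _) (ones n)
  factors : ∀ c K n → K ≤ n → poch⁺ (suc c) (2 ℕ.* suc μ) ≈[ K ] ∏ n (λ j → oneS ⊕ oneS · mono (suc c ℕ.+ 2 ℕ.* suc μ ℕ.* j))
  factors c K n K≤n = ≈[]-trans (≈[]-· K (≈[]-sym (poch-square c (μ ℕ.+ (suc μ ℕ.+ 0)) K n K≤n)) (λ _ _ → refl))
    (≋⇒≈[] K (ℛ.trans (ℛ.solve (var (# 0) :* var (# 1) :* var (# 2)) (var (# 0) :* var (# 2) :* var (# 1)) (p ∷ x ∷ inv p ∷ []))
      (ℛ.trans (ℛ.*-congʳ (inv-right p refl)) (ℛ.trans (ℛ.*-identityˡ x) (∏-cong n (λ j → ℛ.+-congˡ (ℛ.sym (ℛ.*-identityˡ _))))))))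
    where
    p x : PS
    p = poch (suc c) (2 ℕ.* suc μ)
    x = ∏ n (λ j → 1+q^ (suc c ℕ.+ 2 ℕ.* suc μ ℕ.* j))

sgn-suc : ∀ k → sgn (ℤ.suc k) ≋ ⊝ sgn k
sgn-suc (+ n)          = -1*x≈-x _
sgn-suc (-[1+ zero ])  = ℛ.sym (ℛ.trans (ℛ.-‿cong (ℛ.*-identityʳ _)) (-‿involutive oneS))
sgn-suc (-[1+ suc n ]) = ℛ.sym (ℛ.trans (ℛ.-‿cong (-1*x≈-x _)) (-‿involutive _))

sgn-neg : ∀ k → sgn (ℤ.- k) ≋ sgn k
sgn-neg k = ℛ.reflexive (cong ((⊝ oneS) ^ˢ_) (ℤ.∣-i∣≡∣i∣ k))

sgn-+ : ∀ x y → sgn (x ℤ.+ y) ≋ sgn x · sgn y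
sgn-+ℕ : ∀ n y → sgn (+ n ℤ.+ y) ≋ sgn (+ n) · sgn y
sgn-+ℕ zero    y = ℛ.trans (ℛ.reflexive (cong sgn (ℤ.+-identityˡ y))) (ℛ.sym (ℛ.*-identityˡ _))
sgn-+ℕ (suc n) y = begin
  sgn (+ suc n ℤ.+ y)             ≡⟨ cong sgn (ℤ.+-assoc (+ 1) (+ n) y) ⟩
  sgn (ℤ.suc (+ n ℤ.+ y))         ≈⟨ sgn-suc (+ n ℤ.+ y) ⟩
  ⊝ sgn (+ n ℤ.+ y)               ≈⟨ ℛ.-‿cong (sgn-+ℕ n y) ⟩
  ⊝ (sgn (+ n) · sgn y)           ≈⟨ -‿distribˡ-* _ _ ⟩
  ⊝ sgn (+ n) · sgn y             ≈⟨ ℛ.*-congʳ (-1*x≈-x _) ⟨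
  sgn (+ suc n) · sgn y           ∎
sgn-+ (+ n)      y = sgn-+ℕ n y
sgn-+ (-[1+ n ]) y = begin
  sgn (-[1+ n ] ℤ.+ y)            ≈⟨ sgn-neg (-[1+ n ] ℤ.+ y) ⟨
  sgn (ℤ.- (-[1+ n ] ℤ.+ y))      ≡⟨ cong sgn (ℤ.neg-distrib-+ -[1+ n ] y) ⟩
  sgn (+ suc n ℤ.+ ℤ.- y)         ≈⟨ sgn-+ℕ (suc n) (ℤ.- y) ⟩
  sgn (+ suc n) · sgn (ℤ.- y)     ≈⟨ ℛ.*-congˡ (sgn-neg y) ⟩
  sgn (-[1+ n ]) · sgn y          ∎

sgn-square : ∀ k → sgn k · sgn k ≋ oneS
sgn-square k = power ∣ k ∣
  where
  power : ∀ n → (⊝ oneS) ^ˢ n · (⊝ oneS) ^ˢ n ≋ oneS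
  power zero    = ℛ.*-identityˡ oneS
  power (suc n) = ℛ.trans (ℛ.solve (var (# 0) :* var (# 1) :* (var (# 0) :* var (# 1))) ((var (# 0) :* var (# 0)) :* (var (# 1) :* var (# 1))) (⊝ oneS ∷ (⊝ oneS) ^ˢ n ∷ []))
    (ℛ.trans (ℛ.*-cong -1·-1≋1 (power n)) (ℛ.*-identityˡ oneS))

monoℤ-·-cong : ∀ {x y x′ y′} → + 0 ℤ.≤ x → + 0 ℤ.≤ y → + 0 ℤ.≤ x′ → + 0 ℤ.≤ y′ → x ℤ.+ y ≡ x′ ℤ.+ y′ → monoℤ x · monoℤ y ≋ monoℤ x′ · monoℤ y′
monoℤ-·-cong p r p′ r′ e = ℛ.trans (monoℤ-+ p r) (ℛ.trans (ℛ.reflexive (cong monoℤ e)) (ℛ.sym (monoℤ-+ p′ r′)))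

-- [p] [r] = Ψ_α Φ_β − q^r Φ_α Ψ_β with α = p + r, β = p − r, Φ_c = Σ q^{10 k² + c k}, Ψ_c = Φ_{c − 10}.
two-term : ∀ p r {X Y Ψα Φβ Φα Ψβ} → let α = + p ℤ.+ + r; β = + p ℤ.- + r in
  Sums (θ⁻ 5 (+ p ℤ.- + 5)) X → Sums (θ⁻ 5 (+ r ℤ.- + 5)) Y →
  Sums (θ⁺ 10 (α ℤ.- + 10)) Ψα → Sums (θ⁺ 10 β) Φβ → Sums (θ⁺ 10 α) Φα → Sums (θ⁺ 10 (β ℤ.- + 10)) Ψβ →
  ∣ + p ℤ.- + 5 ∣ ≤ 5 → ∣ + r ℤ.- + 5 ∣ ≤ 5 → ∣ α ℤ.- + 10 ∣ ≤ 10 → ∣ β ∣ ≤ 10 → ∣ α ∣ ≤ 10 → ∣ β ℤ.- + 10 ∣ ≤ 10 →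
  X · Y ≋ Ψα · Φβ ⊕ ⊝ (mono r · (Φα · Ψβ))
two-term p r {X} {Y} {Ψα} {Φβ} {Φα} {Ψβ} sX sY sΨα sΦβ sΦα sΨβ bp br b₁ b₂ b₃ b₄ = begin
  -- Here m = l + t and n = t - l + ρ. As m + n = 2t + ρ, the sign depends on ρ alone, and 5m² + 5n²
  -- is 10t² + 10l² up to terms of lower degree, so each class ρ is a product of two theta series.
  X · Y                                          ≈⟨ change-of-variables sX sY 2 (ℤ.- + 1) (+ 1) u v U V sU sV factor ⟩
  zeroS ⊕ Ψα · Φβ ⊕ ⊝ mono r · Φα · Ψβ           ≈⟨ ℛ.+-congʳ (ℛ.+-identityˡ _) ⟩
  Ψα · Φβ ⊕ ⊝ mono r · Φα · Ψβ                   ≈⟨ ℛ.+-congˡ (ℛ.trans (ℛ.*-assoc _ _ _) (ℛ.sym (-‿distribˡ-* _ _))) ⟩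
  Ψα · Φβ ⊕ ⊝ (mono r · (Φα · Ψβ))               ∎
  where
  α β : ℤ
  α = + p ℤ.+ + r
  β = + p ℤ.- + r
  u v : ℕ → PS
  u zero    = Ψα
  u (suc _) = ⊝ mono r · Φα
  v zero    = Φβ
  v (suc _) = Ψβ
  U V : ℕ → ℤ → PS
  U zero    t = θ⁺ 10 (α ℤ.- + 10) t
  U (suc _) t = ⊝ mono r · θ⁺ 10 α t
  V zero    l = θ⁺ 10 β l
  V (suc _) l = θ⁺ 10 (β ℤ.- + 10) l
  sU : ∀ ρ → ρ < 2 → Sums (U ρ) (u ρ)
  sU zero    _ = sΨα
  sU (suc _) _ = sums-scale (⊝ mono r) sΦα
  sV : ∀ ρ → ρ < 2 → Sums (V ρ) (v ρ)
  sV zero    _ = sΦβ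
  sV (suc _) _ = sΨβ
  collect : ∀ x y {z} → monoℤ (quad (+ 5) (+ p ℤ.- + 5) x) · monoℤ (quad (+ 5) (+ r ℤ.- + 5) y) ≋ z → θ⁻ 5 (+ p ℤ.- + 5) x · θ⁻ 5 (+ r ℤ.- + 5) y ≋ sgn (x ℤ.+ y) · z
  collect x y e = ℛ.trans (ℛ.solve ((var (# 0) :* var (# 1)) :* (var (# 2) :* var (# 3))) ((var (# 0) :* var (# 2)) :* (var (# 1) :* var (# 3)))
    (sgn x ∷ monoℤ (quad (+ 5) (+ p ℤ.- + 5) x) ∷ sgn y ∷ monoℤ (quad (+ 5) (+ r ℤ.- + 5) y) ∷ [])) (ℛ.*-cong (ℛ.sym (sgn-+ x y)) e)
  factor : ∀ ρ → ρ < 2 → ∀ t l → θ⁻ 5 (+ p ℤ.- + 5) (l ℤ.+ + 1 ℤ.* t) · θ⁻ 5 (+ r ℤ.- + 5) (+ 2 ℤ.* t ℤ.+ + ρ ℤ.+ (ℤ.- + 1) ℤ.* (l ℤ.+ + 1 ℤ.* t)) ≋ U ρ t · V ρ l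
  factor zero _ t l = ℛ.trans (collect x y (monoℤ-·-cong (quad-≥0 5 (+ p ℤ.- + 5) bp x) (quad-≥0 5 (+ r ℤ.- + 5) br y) (quad-≥0 10 (α ℤ.- + 10) b₁ t) (quad-≥0 10 β b₂ l) (exponent (+ p) (+ r) t l)))
    (ℛ.trans (ℛ.*-congʳ (ℛ.trans (ℛ.reflexive (cong sgn (even t l))) (ℛ.trans (sgn-+ t t) (sgn-square t)))) (ℛ.*-identityˡ _))
    where
    x y : ℤ
    x = l ℤ.+ + 1 ℤ.* t
    y = + 2 ℤ.* t ℤ.+ + 0 ℤ.+ (ℤ.- + 1) ℤ.* (l ℤ.+ + 1 ℤ.* t)
    even : ∀ t l → l ℤ.+ + 1 ℤ.* t ℤ.+ (+ 2 ℤ.* t ℤ.+ + 0 ℤ.+ (ℤ.- + 1) ℤ.* (l ℤ.+ + 1 ℤ.* t)) ≡ t ℤ.+ t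
    even = solve-∀
    exponent : ∀ p r t l → (+ 5 ℤ.* ((l ℤ.+ + 1 ℤ.* t) ℤ.* (l ℤ.+ + 1 ℤ.* t)) ℤ.+ (p ℤ.- + 5) ℤ.* (l ℤ.+ + 1 ℤ.* t))
      ℤ.+ (+ 5 ℤ.* ((+ 2 ℤ.* t ℤ.+ + 0 ℤ.+ (ℤ.- + 1) ℤ.* (l ℤ.+ + 1 ℤ.* t)) ℤ.* (+ 2 ℤ.* t ℤ.+ + 0 ℤ.+ (ℤ.- + 1) ℤ.* (l ℤ.+ + 1 ℤ.* t))) ℤ.+ (r ℤ.- + 5) ℤ.* (+ 2 ℤ.* t ℤ.+ + 0 ℤ.+ (ℤ.- + 1) ℤ.* (l ℤ.+ + 1 ℤ.* t)))
      ≡ (+ 10 ℤ.* (t ℤ.* t) ℤ.+ (p ℤ.+ r ℤ.- + 10) ℤ.* t) ℤ.+ (+ 10 ℤ.* (l ℤ.* l) ℤ.+ (p ℤ.- r) ℤ.* l)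
    exponent = solve-∀
  factor (suc zero) _ t l = ℛ.trans (collect x y (ℛ.trans (monoℤ-+ (quad-≥0 5 (+ p ℤ.- + 5) bp x) (quad-≥0 5 (+ r ℤ.- + 5) br y))
      (ℛ.trans (ℛ.reflexive (cong monoℤ (exponent (+ p) (+ r) t l)))
        (ℛ.sym (ℛ.trans (ℛ.*-congˡ (monoℤ-+ (quad-≥0 10 α b₃ t) (quad-≥0 10 (β ℤ.- + 10) b₄ l)))
          (monoℤ-+ {+ r} (ℤ.+≤+ z≤n) (ℤ.+-mono-≤ (quad-≥0 10 α b₃ t) (quad-≥0 10 (β ℤ.- + 10) b₄ l))))))))
    (ℛ.trans (ℛ.*-congʳ (ℛ.trans (ℛ.reflexive (cong sgn (odd t l))) (ℛ.trans (sgn-suc (t ℤ.+ t)) (ℛ.-‿cong (ℛ.trans (sgn-+ t t) (sgn-square t))))))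
      (ℛ.trans (-1*x≈-x _) (ℛ.trans (-‿distribˡ-* _ _) (ℛ.sym (ℛ.*-assoc _ _ _)))))
    where
    x y : ℤ
    x = l ℤ.+ + 1 ℤ.* t
    y = + 2 ℤ.* t ℤ.+ + 1 ℤ.+ (ℤ.- + 1) ℤ.* (l ℤ.+ + 1 ℤ.* t)
    odd : ∀ t l → l ℤ.+ + 1 ℤ.* t ℤ.+ (+ 2 ℤ.* t ℤ.+ + 1 ℤ.+ (ℤ.- + 1) ℤ.* (l ℤ.+ + 1 ℤ.* t)) ≡ + 1 ℤ.+ (t ℤ.+ t)
    odd = solve-∀
    exponent : ∀ p r t l → (+ 5 ℤ.* ((l ℤ.+ + 1 ℤ.* t) ℤ.* (l ℤ.+ + 1 ℤ.* t)) ℤ.+ (p ℤ.- + 5) ℤ.* (l ℤ.+ + 1 ℤ.* t))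
      ℤ.+ (+ 5 ℤ.* ((+ 2 ℤ.* t ℤ.+ + 1 ℤ.+ (ℤ.- + 1) ℤ.* (l ℤ.+ + 1 ℤ.* t)) ℤ.* (+ 2 ℤ.* t ℤ.+ + 1 ℤ.+ (ℤ.- + 1) ℤ.* (l ℤ.+ + 1 ℤ.* t))) ℤ.+ (r ℤ.- + 5) ℤ.* (+ 2 ℤ.* t ℤ.+ + 1 ℤ.+ (ℤ.- + 1) ℤ.* (l ℤ.+ + 1 ℤ.* t)))
      ≡ r ℤ.+ ((+ 10 ℤ.* (t ℤ.* t) ℤ.+ (p ℤ.+ r) ℤ.* t) ℤ.+ (+ 10 ℤ.* (l ℤ.* l) ℤ.+ (p ℤ.- r ℤ.- + 10) ℤ.* l))
    exponent = solve-∀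
  factor (suc (suc _)) (s≤s (s≤s ()))

-- Each bracket below is a 2 × 2 minor up to powers of q, so this is a Plücker relation.
plücker : ∀ x y z (Φa Ψa Φb Ψb Φc Ψc Φd Ψd : PS) {AB AC AD BC BD CD} →
  AB ≋ Ψa · Φb ⊕ ⊝ (x · (Φa · Ψb)) → AC ≋ Ψa · Φc ⊕ ⊝ (x · y · (Φa · Ψc)) → AD ≋ Ψa · Φd ⊕ ⊝ (x · y · z · (Φa · Ψd)) →
  BC ≋ Ψb · Φc ⊕ ⊝ (y · (Φb · Ψc)) → BD ≋ Ψb · Φd ⊕ ⊝ (y · z · (Φb · Ψd)) → CD ≋ Ψc · Φd ⊕ ⊝ (z · (Φc · Ψd)) →
  y · (AB · CD) ≋ AC · BD ⊕ ⊝ (AD · BC)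
plücker x y z Φa Ψa Φb Ψb Φc Ψc Φd Ψd ab ac ad bc bd cd =
  ℛ.trans (ℛ.*-congˡ (ℛ.*-cong ab cd)) (ℛ.trans
    (ℛ.solve (Y :* ((pa :* fb :- X :* (fa :* pb)) :* (pc :* fd :- Z :* (fc :* pd))))
      ((pa :* fc :- X :* Y :* (fa :* pc)) :* (pb :* fd :- Y :* Z :* (fb :* pd)) :- (pa :* fd :- X :* Y :* Z :* (fa :* pd)) :* (pb :* fc :- Y :* (fb :* pc)))
      (x ∷ y ∷ z ∷ Φa ∷ Ψa ∷ Φb ∷ Ψb ∷ Φc ∷ Ψc ∷ Φd ∷ Ψd ∷ []))
    (ℛ.sym (ℛ.+-cong (ℛ.*-cong ac bd) (ℛ.-‿cong (ℛ.*-cong ad bc)))))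
  where
  X Y Z fa pa fb pb fc pc fd pd : Expr 11
  X = var (# 0)
  Y = var (# 1)
  Z = var (# 2)
  fa = var (# 3)
  pa = var (# 4)
  fb = var (# 5)
  pb = var (# 6)
  fc = var (# 7)
  pc = var (# 8)
  fd = var (# 9)
  pd = var (# 10)

-- Weierstrass' three-term relation

g₁ g₂ g₃ g₄ g₅ J : PS
g₁ = poch 1 10 · poch 9 10
g₂ = poch 2 10 · poch 8 10
g₃ = poch 3 10 · poch 7 10
g₄ = poch 4 10 · poch 6 10
g₅ = poch 5 10 · poch 5 10
J  = poch 10 10

-- `[ p ]` is the sum of (-1)^k q^(5k² + (p - 5)k); p and 10 - p give the same series up to the
-- order of two factors. `Φ c` and `Ψ c` are the sums of q^(10k² + ck) and of q^(10k² + (c - 10)k).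
[_] Φ Ψ : ℕ → PS
[ p ] = poch p 10 · poch (10 ℕ.∸ p) 10 · J
Φ c = poch⁺ (10 ℕ.+ c) 20 · poch⁺ (10 ℕ.∸ c) 20 · poch 20 20
Ψ c = poch⁺ c 20 · poch⁺ (20 ℕ.∸ c) 20 · poch 20 20

≤! : ∀ {m n} → {T (m ≤ᵇ n)} → m ≤ n
≤! {m} {n} {t} = ℕ.≤ᵇ⇒≤ m n t

-- The digits name the two columns (Φ α, Ψ α) and (Φ β, Ψ β); then p = (α + β)/2 and r = (α - β)/2.
-- Each of the three quadruples 8642, 7531 and 9531 needs all of its six minors.
minor-86 : [ 7 ] · [ 1 ] ≋ Ψ 8 · Φ 6 ⊕ ⊝ (mono 1 · (Φ 8 · Ψ 6))
minor-86 = two-term 7 1 (jacobi⁻ 4 6 2 refl) (jacobi⁻ 4 0 8 refl) (jacobi⁺ 9 7 11 refl) (jacobi⁺ 9 15 3 refl) (jacobi⁺ 9 17 1 refl) (jacobi⁺ 9 5 13 refl) ≤! ≤! ≤! ≤! ≤! ≤!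

minor-84 : [ 6 ] · [ 2 ] ≋ Ψ 8 · Φ 4 ⊕ ⊝ (mono 2 · (Φ 8 · Ψ 4))
minor-84 = two-term 6 2 (jacobi⁻ 4 5 3 refl) (jacobi⁻ 4 1 7 refl) (jacobi⁺ 9 7 11 refl) (jacobi⁺ 9 13 5 refl) (jacobi⁺ 9 17 1 refl) (jacobi⁺ 9 3 15 refl) ≤! ≤! ≤! ≤! ≤! ≤!

minor-82 : [ 5 ] · [ 3 ] ≋ Ψ 8 · Φ 2 ⊕ ⊝ (mono 3 · (Φ 8 · Ψ 2))
minor-82 = two-term 5 3 (jacobi⁻ 4 4 4 refl) (jacobi⁻ 4 2 6 refl) (jacobi⁺ 9 7 11 refl) (jacobi⁺ 9 11 7 refl) (jacobi⁺ 9 17 1 refl) (jacobi⁺ 9 1 17 refl) ≤! ≤! ≤! ≤! ≤! ≤!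

minor-64 : [ 5 ] · [ 1 ] ≋ Ψ 6 · Φ 4 ⊕ ⊝ (mono 1 · (Φ 6 · Ψ 4))
minor-64 = two-term 5 1 (jacobi⁻ 4 4 4 refl) (jacobi⁻ 4 0 8 refl) (jacobi⁺ 9 5 13 refl) (jacobi⁺ 9 13 5 refl) (jacobi⁺ 9 15 3 refl) (jacobi⁺ 9 3 15 refl) ≤! ≤! ≤! ≤! ≤! ≤!

minor-62 : [ 4 ] · [ 2 ] ≋ Ψ 6 · Φ 2 ⊕ ⊝ (mono 2 · (Φ 6 · Ψ 2))
minor-62 = two-term 4 2 (jacobi⁻ 4 3 5 refl) (jacobi⁻ 4 1 7 refl) (jacobi⁺ 9 5 13 refl) (jacobi⁺ 9 11 7 refl) (jacobi⁺ 9 15 3 refl) (jacobi⁺ 9 1 17 refl) ≤! ≤! ≤! ≤! ≤! ≤!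

minor-42 : [ 3 ] · [ 1 ] ≋ Ψ 4 · Φ 2 ⊕ ⊝ (mono 1 · (Φ 4 · Ψ 2))
minor-42 = two-term 3 1 (jacobi⁻ 4 2 6 refl) (jacobi⁻ 4 0 8 refl) (jacobi⁺ 9 3 15 refl) (jacobi⁺ 9 11 7 refl) (jacobi⁺ 9 13 5 refl) (jacobi⁺ 9 1 17 refl) ≤! ≤! ≤! ≤! ≤! ≤!

minor-75 : [ 6 ] · [ 1 ] ≋ Ψ 7 · Φ 5 ⊕ ⊝ (mono 1 · (Φ 7 · Ψ 5))
minor-75 = two-term 6 1 (jacobi⁻ 4 5 3 refl) (jacobi⁻ 4 0 8 refl) (jacobi⁺ 9 6 12 refl) (jacobi⁺ 9 14 4 refl) (jacobi⁺ 9 16 2 refl) (jacobi⁺ 9 4 14 refl) ≤! ≤! ≤! ≤! ≤! ≤!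

minor-73 : [ 5 ] · [ 2 ] ≋ Ψ 7 · Φ 3 ⊕ ⊝ (mono 2 · (Φ 7 · Ψ 3))
minor-73 = two-term 5 2 (jacobi⁻ 4 4 4 refl) (jacobi⁻ 4 1 7 refl) (jacobi⁺ 9 6 12 refl) (jacobi⁺ 9 12 6 refl) (jacobi⁺ 9 16 2 refl) (jacobi⁺ 9 2 16 refl) ≤! ≤! ≤! ≤! ≤! ≤!

minor-71 : [ 4 ] · [ 3 ] ≋ Ψ 7 · Φ 1 ⊕ ⊝ (mono 3 · (Φ 7 · Ψ 1))
minor-71 = two-term 4 3 (jacobi⁻ 4 3 5 refl) (jacobi⁻ 4 2 6 refl) (jacobi⁺ 9 6 12 refl) (jacobi⁺ 9 10 8 refl) (jacobi⁺ 9 16 2 refl) (jacobi⁺ 9 0 18 refl) ≤! ≤! ≤! ≤! ≤! ≤!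

minor-53 : [ 4 ] · [ 1 ] ≋ Ψ 5 · Φ 3 ⊕ ⊝ (mono 1 · (Φ 5 · Ψ 3))
minor-53 = two-term 4 1 (jacobi⁻ 4 3 5 refl) (jacobi⁻ 4 0 8 refl) (jacobi⁺ 9 4 14 refl) (jacobi⁺ 9 12 6 refl) (jacobi⁺ 9 14 4 refl) (jacobi⁺ 9 2 16 refl) ≤! ≤! ≤! ≤! ≤! ≤!

minor-51 : [ 3 ] · [ 2 ] ≋ Ψ 5 · Φ 1 ⊕ ⊝ (mono 2 · (Φ 5 · Ψ 1))
minor-51 = two-term 3 2 (jacobi⁻ 4 2 6 refl) (jacobi⁻ 4 1 7 refl) (jacobi⁺ 9 4 14 refl) (jacobi⁺ 9 10 8 refl) (jacobi⁺ 9 14 4 refl) (jacobi⁺ 9 0 18 refl) ≤! ≤! ≤! ≤! ≤! ≤!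

minor-31 : [ 2 ] · [ 1 ] ≋ Ψ 3 · Φ 1 ⊕ ⊝ (mono 1 · (Φ 3 · Ψ 1))
minor-31 = two-term 2 1 (jacobi⁻ 4 1 7 refl) (jacobi⁻ 4 0 8 refl) (jacobi⁺ 9 2 16 refl) (jacobi⁺ 9 10 8 refl) (jacobi⁺ 9 12 6 refl) (jacobi⁺ 9 0 18 refl) ≤! ≤! ≤! ≤! ≤! ≤!

minor-95 : [ 7 ] · [ 2 ] ≋ Ψ 9 · Φ 5 ⊕ ⊝ (mono 2 · (Φ 9 · Ψ 5))
minor-95 = two-term 7 2 (jacobi⁻ 4 6 2 refl) (jacobi⁻ 4 1 7 refl) (jacobi⁺ 9 8 10 refl) (jacobi⁺ 9 14 4 refl) (jacobi⁺ 9 18 0 refl) (jacobi⁺ 9 4 14 refl) ≤! ≤! ≤! ≤! ≤! ≤!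

minor-93 : [ 6 ] · [ 3 ] ≋ Ψ 9 · Φ 3 ⊕ ⊝ (mono 3 · (Φ 9 · Ψ 3))
minor-93 = two-term 6 3 (jacobi⁻ 4 5 3 refl) (jacobi⁻ 4 2 6 refl) (jacobi⁺ 9 8 10 refl) (jacobi⁺ 9 12 6 refl) (jacobi⁺ 9 18 0 refl) (jacobi⁺ 9 2 16 refl) ≤! ≤! ≤! ≤! ≤! ≤!

minor-91 : [ 5 ] · [ 4 ] ≋ Ψ 9 · Φ 1 ⊕ ⊝ (mono 4 · (Φ 9 · Ψ 1))
minor-91 = two-term 5 4 (jacobi⁻ 4 4 4 refl) (jacobi⁻ 4 3 5 refl) (jacobi⁺ 9 8 10 refl) (jacobi⁺ 9 10 8 refl) (jacobi⁺ 9 18 0 refl) (jacobi⁺ 9 0 18 refl) ≤! ≤! ≤! ≤! ≤! ≤!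

monos : ∀ {a b c X Y} → a ℕ.+ b ≡ c → X ≋ mono a → Y ≋ mono b → X · Y ≋ mono c
monos {a} {b} refl p r = ℛ.trans (ℛ.*-cong p r) (mono-+ a b)

rescale : ∀ {r c X Y Z} → c ≋ mono r → X ≋ Y ⊕ ⊝ (mono r · Z) → X ≋ Y ⊕ ⊝ (c · Z)
rescale e p = ℛ.trans p (ℛ.+-congˡ (ℛ.-‿cong (ℛ.*-congʳ (ℛ.sym e))))

-- The weights x, y, z of `plücker` are q to the half differences of neighbouring column indices;
-- the weights of the other minors are their products, since half differences add up.
three-term-8642 : mono 1 · (([ 7 ] · [ 1 ]) · ([ 3 ] · [ 1 ])) ≋ ([ 6 ] · [ 2 ]) · ([ 4 ] · [ 2 ]) ⊕ ⊝ (([ 5 ] · [ 3 ]) · ([ 5 ] · [ 1 ]))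
three-term-8642 = plücker (mono 1) (mono 1) (mono 1) (Φ 8) (Ψ 8) (Φ 6) (Ψ 6) (Φ 4) (Ψ 4) (Φ 2) (Ψ 2)
  minor-86 (rescale (monos refl (ℛ.refl {mono 1}) (ℛ.refl {mono 1})) minor-84) (rescale (monos refl (monos refl (ℛ.refl {mono 1}) (ℛ.refl {mono 1})) (ℛ.refl {mono 1})) minor-82) minor-64 (rescale (monos refl (ℛ.refl {mono 1}) (ℛ.refl {mono 1})) minor-62) minor-42

three-term-7531 : mono 1 · (([ 6 ] · [ 1 ]) · ([ 2 ] · [ 1 ])) ≋ ([ 5 ] · [ 2 ]) · ([ 3 ] · [ 2 ]) ⊕ ⊝ (([ 4 ] · [ 3 ]) · ([ 4 ] · [ 1 ]))
three-term-7531 = plücker (mono 1) (mono 1) (mono 1) (Φ 7) (Ψ 7) (Φ 5) (Ψ 5) (Φ 3) (Ψ 3) (Φ 1) (Ψ 1)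
  minor-75 (rescale (monos refl (ℛ.refl {mono 1}) (ℛ.refl {mono 1})) minor-73) (rescale (monos refl (monos refl (ℛ.refl {mono 1}) (ℛ.refl {mono 1})) (ℛ.refl {mono 1})) minor-71) minor-53 (rescale (monos refl (ℛ.refl {mono 1}) (ℛ.refl {mono 1})) minor-51) minor-31

three-term-9531 : mono 1 · (([ 7 ] · [ 2 ]) · ([ 2 ] · [ 1 ])) ≋ ([ 6 ] · [ 3 ]) · ([ 3 ] · [ 2 ]) ⊕ ⊝ (([ 5 ] · [ 4 ]) · ([ 4 ] · [ 1 ]))
three-term-9531 = plücker (mono 2) (mono 1) (mono 1) (Φ 9) (Ψ 9) (Φ 5) (Ψ 5) (Φ 3) (Ψ 3) (Φ 1) (Ψ 1)
  minor-95 (rescale (monos refl (ℛ.refl {mono 2}) (ℛ.refl {mono 1})) minor-93) (rescale (monos refl (monos refl (ℛ.refl {mono 2}) (ℛ.refl {mono 1})) (ℛ.refl {mono 1})) minor-91) minor-53 (rescale (monos refl (ℛ.refl {mono 1}) (ℛ.refl {mono 1})) minor-51) minor-31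

symmetric : ∀ p p̄ → poch p 10 · poch p̄ 10 · J ≋ poch p̄ 10 · poch p 10 · J
symmetric p p̄ = ℛ.*-congʳ (ℛ.*-comm (poch p 10) (poch p̄ 10))

regular-J⁴ : Regular (J · J · (J · J))
regular-J⁴ = regular-≢0 (λ e → 1≢0 (≡.trans (≡.sym one) e))
  where
  1≢0 : + 1 ≢ + 0
  1≢0 ()
  one : (J · J · (J · J)) 0 ≡ + 1
  one = ≡.trans (·-0 (J · J) (J · J)) (cong₂ ℤ._*_ (·-0 J J) (·-0 J J))

module _ where
  open ℛ
  private
    a b c d e j x : Expr 7
    a = var (# 0)
    b = var (# 1)
    c = var (# 2)
    d = var (# 3)
    e = var (# 4)
    j = var (# 5)
    x = var (# 6)
    ρ : Vec PS 7
    ρ = g₁ ∷ g₂ ∷ g₃ ∷ g₄ ∷ g₅ ∷ J ∷ mono 1 ∷ []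

  -- The three-term relation divided by J⁴. This one will give β² = M + q; the next two present g₃
  -- g₄ ± q g₁ g₂ as products and will give 1 ± q κ.
  weierstrass₁ : g₂ · g₂ · (g₄ · g₄) ⊕ ⊝ (mono 1 · (g₁ · g₁ · (g₃ · g₃))) ≋ g₅ · g₅ · (g₁ · g₃)
  weierstrass₁ = cancel-by (j :* j :* (j :* j)) (b :* b :* (d :* d) :- x :* (a :* a :* (c :* c))) (e :* e :* (a :* c))
    ((con (ℤ.- + 1) , x :* (c :* j :* (a :* j) :* (c :* j :* (a :* j))) , (d :* j :* (b :* j)) :* (d :* j :* (b :* j)) :- (e :* j :* (c :* j)) :* (e :* j :* (a :* j))) ∷ []) ρ
    regular-J⁴ (trans (*-congˡ (*-congʳ (*-congʳ (symmetric 3 7)))) (trans three-term-8642 (+-congʳ (*-congʳ (*-congʳ (symmetric 6 4))))))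

  weierstrass₂ : g₁ · g₄ · (g₃ · g₄ ⊕ mono 1 · (g₁ · g₂)) ≋ g₅ · (g₂ · g₂) · g₃
  weierstrass₂ = cancel-by (j :* j :* (j :* j)) (a :* d :* (c :* d :+ x :* (a :* b))) (e :* (b :* b) :* c)
    ((con (+ 1) , x :* ((d :* j) :* (a :* j) :* (b :* j :* (a :* j))) , (e :* j :* (b :* j)) :* (c :* j :* (b :* j)) :- (d :* j :* (c :* j)) :* (d :* j :* (a :* j))) ∷ []) ρ
    regular-J⁴ (trans (*-congˡ (*-congʳ (*-congʳ (symmetric 4 6)))) three-term-7531)

  weierstrass₃ : g₂ · g₃ · (g₃ · g₄ ⊕ ⊝ (mono 1 · (g₁ · g₂))) ≋ g₅ · g₁ · (g₄ · g₄)
  weierstrass₃ = cancel-by (j :* j :* (j :* j)) (b :* c :* (c :* d :- x :* (a :* b))) (e :* a :* (d :* d))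
    ((con (ℤ.- + 1) , x :* ((c :* j) :* (b :* j) :* (b :* j :* (a :* j))) , (d :* j :* (c :* j)) :* (c :* j :* (b :* j)) :- (e :* j :* (d :* j)) :* (d :* j :* (a :* j))) ∷ []) ρ
    regular-J⁴ (trans (*-congˡ (*-congʳ (*-congʳ (symmetric 3 7)))) (trans three-term-9531 (+-congʳ (*-congʳ (*-congʳ (symmetric 6 4))))))

-- The quintuple product

-- `quintuple` produces linear coefficients larger than α, out of reach of `quad-≥0`. Re-centring
-- the sum at t + 1 brings the coefficient back into range, at the cost of a sign and a power of q.
shifted : ∀ α β e {f} → ∣ β ∣ ≤ α → Sums (θ⁻ α β) f →
  Sums (λ t → sgn t · monoℤ (quad (+ α) β (t ℤ.+ + 1) ℤ.+ + e)) (⊝ mono e · f)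
shifted α β e β≤α s = sums-cong eq ℛ.refl (sums-scale (⊝ mono e) (sums-shift (+ 1) s))
  where
  eq : ∀ k → ⊝ mono e · θ⁻ α β (k ℤ.+ + 1) ≋ sgn k · monoℤ (quad (+ α) β (k ℤ.+ + 1) ℤ.+ + e)
  eq k = begin
    ⊝ mono e · (sgn (k ℤ.+ + 1) · x)  ≈⟨ ℛ.*-congˡ (ℛ.*-congʳ (ℛ.trans (ℛ.reflexive (cong sgn (ℤ.+-comm k (+ 1)))) (sgn-suc k))) ⟩
    ⊝ mono e · (⊝ sgn k · x)          ≈⟨ signs (mono e) (sgn k) x ⟩
    sgn k · (x · mono e)              ≈⟨ ℛ.*-congˡ (monoℤ-+ (quad-≥0 α β β≤α (k ℤ.+ + 1)) (ℤ.+≤+ z≤n)) ⟩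
    sgn k · monoℤ (quad (+ α) β (k ℤ.+ + 1) ℤ.+ + e) ∎
    where
    x : PS
    x = monoℤ (quad (+ α) β (k ℤ.+ + 1))
    signs : ∀ a b c → ⊝ a · (⊝ b · c) ≋ b · (c · a)
    signs a b c = ℛ.trans (ℛ.*-cong (ℛ.sym (-1*x≈-x a)) (ℛ.*-congʳ (ℛ.sym (-1*x≈-x b))))
      (ℛ.trans (ℛ.solve ((var (# 3) :* var (# 0)) :* ((var (# 3) :* var (# 1)) :* var (# 2))) ((var (# 3) :* var (# 3)) :* (var (# 1) :* (var (# 2) :* var (# 0)))) (a ∷ b ∷ c ∷ ⊝ oneS ∷ []))
        (ℛ.trans (ℛ.*-congʳ -1·-1≋1) (ℛ.*-identityˡ _)))

scaled : ∀ α β e {f} → ∣ β ∣ ≤ α → Sums (θ⁻ α β) f → Sums (λ t → sgn t · monoℤ (quad (+ α) β t ℤ.+ + e)) (mono e · f)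
scaled α β e β≤α s = sums-cong (λ k → ℛ.trans (ℛ.solve (var (# 0) :* (var (# 1) :* var (# 2))) (var (# 1) :* (var (# 2) :* var (# 0))) (mono e ∷ sgn k ∷ monoℤ (quad (+ α) β k) ∷ []))
  (ℛ.*-congˡ (monoℤ-+ (quad-≥0 α β β≤α k) (ℤ.+≤+ z≤n)))) ℛ.refl (sums-scale (mono e) s)

-- The terms at k and −1 − k cancel.
sums-antisymmetric : Sums (θ⁻ 30 (+ 30)) zeroS
sums-antisymmetric = record { bound = λ K → K ; small = small ; total = total }
  where
  V : ℤ → PS
  V = θ⁻ 30 (+ 30)
  tiny : ∀ K k → K ≤ ∣ quad (+ 30) (+ 30) k ∣ → V k ≈[ K ] zeroS
  tiny K k p = ≈[]-trans (≈[]-· K {sgn k} {sgn k} (λ _ _ → refl) (mono-small p)) (≋⇒≈[] K (ℛ.zeroʳ (sgn k)))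
  size : ∀ n m → ∣ quad (+ 30) (+ 30) (+ n) ∣ ≡ n ℕ.* (30 ℕ.* n ℕ.+ 30)
  size n _ = ≡.trans (cong ∣_∣ (quad-factor (+ 30) (+ 30) (+ n))) (≡.trans (ℤ.abs-* (+ n) _)
    (cong (λ t → n ℕ.* ∣ t ℤ.+ + 30 ∣) (≡.sym (ℤ.pos-* 30 n))))
  large : ∀ n → n ≤ ∣ quad (+ 30) (+ 30) (+ n) ∣
  large n = ≡.subst (n ≤_) (≡.sym (size n n)) (ℕ.≤-trans (ℕ.m≤m*n n 30) (ℕ.*-monoʳ-≤ n (ℕ.m≤n+m 30 (30 ℕ.* n))))
  reflected : ∀ k → + 30 ℤ.* ((ℤ.- (+ 1 ℤ.+ k)) ℤ.* (ℤ.- (+ 1 ℤ.+ k))) ℤ.+ + 30 ℤ.* (ℤ.- (+ 1 ℤ.+ k)) ≡ + 30 ℤ.* (k ℤ.* k) ℤ.+ + 30 ℤ.* k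
  reflected = solve-∀
  small : ∀ K k → K < ∣ k ∣ → V k ≈[ K ] zeroS
  small K (+ n) p = tiny K (+ n) (ℕ.≤-trans (ℕ.<⇒≤ p) (large n))
  small K (-[1+ n ]) p = tiny K (-[1+ n ]) (≡.subst (λ t → K ≤ ∣ t ∣) (≡.sym (reflected (+ n))) (ℕ.≤-trans (ℕ.≤-pred p) (large n)))
  opposite : ∀ n → V (-[1+ n ]) ≋ ⊝ V (+ n)
  opposite n = ℛ.trans (ℛ.*-cong (-1*x≈-x _) (ℛ.reflexive (cong monoℤ (reflected (+ n))))) (ℛ.sym (-‿distribˡ-* _ _))
  paired : ∀ n → S (ℤ.- + n) (n ℕ.+ n) V ≋ zeroS
  paired zero = ℛ.refl
  paired (suc n) = begin
    S (ℤ.- + suc n) (suc n ℕ.+ suc n) V                     ≡⟨ cong (λ t → S (ℤ.- + suc n) t V) (len n) ⟩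
    S (ℤ.- + suc n) (1 ℕ.+ (n ℕ.+ n ℕ.+ 1)) V               ≈⟨ S-+ (ℤ.- + suc n) (n ℕ.+ n ℕ.+ 1) 1 V ⟩
    S (ℤ.- + suc n) (n ℕ.+ n ℕ.+ 1) V ⊕ (zeroS ⊕ V (ℤ.- + suc n ℤ.+ + (n ℕ.+ n ℕ.+ 1) ℤ.+ + 0))
      ≈⟨ ℛ.+-cong (S-+ (ℤ.- + suc n) 1 (n ℕ.+ n) V) (ℛ.trans (ℛ.+-identityˡ _) (ℛ.reflexive (cong V (last (+ n))))) ⟩
    zeroS ⊕ V (ℤ.- + suc n ℤ.+ + 0) ⊕ S (ℤ.- + suc n ℤ.+ + 1) (n ℕ.+ n) V ⊕ V (+ n)
      ≈⟨ ℛ.+-congʳ (ℛ.+-cong (ℛ.trans (ℛ.+-identityˡ _) (ℛ.trans (ℛ.reflexive (cong V (ℤ.+-identityʳ (ℤ.- + suc n)))) (opposite n)))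
           (ℛ.trans (ℛ.reflexive (cong (λ t → S t (n ℕ.+ n) V) (next (+ n)))) (paired n))) ⟩
    ⊝ V (+ n) ⊕ zeroS ⊕ V (+ n)                             ≈⟨ ℛ.+-congʳ (ℛ.+-identityʳ _) ⟩
    ⊝ V (+ n) ⊕ V (+ n)                                     ≈⟨ ℛ.-‿inverseˡ _ ⟩
    zeroS                                                   ∎
    where
    len : ∀ n → suc n ℕ.+ suc n ≡ 1 ℕ.+ (n ℕ.+ n ℕ.+ 1)
    len = ℕ-Solver.solve-∀
    last : ∀ n → ℤ.- (+ 1 ℤ.+ n) ℤ.+ (n ℤ.+ n ℤ.+ + 1) ℤ.+ + 0 ≡ n
    last = solve-∀
    next : ∀ n → ℤ.- (+ 1 ℤ.+ n) ℤ.+ + 1 ≡ ℤ.- n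
    next = solve-∀
  total : ∀ K → S (ℤ.- + K) (suc (2 ℕ.* K)) V ≈[ K ] zeroS
  total K = ≈[]-trans (≋⇒≈[] K (ℛ.trans (ℛ.reflexive (cong (λ t → S (ℤ.- + K) (suc t) V) (cong (λ t → K ℕ.+ t) (ℕ.+-identityʳ K)))) (ℛ.+-congʳ (paired K))))
    (≈[]-trans (≋⇒≈[] K (ℛ.+-identityˡ _)) (≡.subst (λ t → V t ≈[ K ] zeroS) (≡.sym (last (+ K))) (tiny K (+ K) (large K))))
    where
    last : ∀ n → ℤ.- n ℤ.+ (n ℤ.+ n) ≡ n
    last = solve-∀

-- The substitution m = l - t, n = t + 2l + ρ turns 10m² + 5n² into 15t² + 30l² up to lower terms.
-- The class ρ = 2 contributes nothing, its l-sum being antisymmetric. In both uses the other two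
-- l-sums equal (q²⁰; q²⁰)_∞, and the product becomes a sum of two theta series times this factor.
-- `E₁` and `E₂` leave room for re-centred exponents.
quintuple : ∀ c {A B} (E₁ E₂ : ℤ → ℤ) {u₀ u₁ u₂ v₀ v₁} → Sums (θ⁺ 5 (ℤ.- c)) A → Sums (θ⁻ 10 (+ 2 ℤ.* c ℤ.- + 10)) B →
  (∀ t → + 0 ℤ.≤ E₁ t) → (∀ t → E₁ t ≡ + 15 ℤ.* (t ℤ.* t) ℤ.+ (+ 20 ℤ.- + 3 ℤ.* c) ℤ.* t ℤ.+ (+ 5 ℤ.- c)) →
  (∀ t → + 0 ℤ.≤ E₂ t) → (∀ t → E₂ t ≡ + 15 ℤ.* (t ℤ.* t) ℤ.+ (+ 30 ℤ.- + 3 ℤ.* c) ℤ.* t ℤ.+ (+ 20 ℤ.- + 2 ℤ.* c)) →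
  Sums (θ⁻ 15 (+ 10 ℤ.- + 3 ℤ.* c)) u₀ → Sums (λ t → sgn t · monoℤ (E₁ t)) u₁ → Sums (λ t → sgn t · monoℤ (E₂ t)) u₂ →
  Sums (θ⁻ 30 (ℤ.- + 10)) v₀ → Sums (θ⁻ 30 (+ 10)) v₁ →
  ∣ ℤ.- c ∣ ≤ 5 → ∣ + 2 ℤ.* c ℤ.- + 10 ∣ ≤ 10 → ∣ + 10 ℤ.- + 3 ℤ.* c ∣ ≤ 15 →
  B · A ≋ u₀ · v₀ ⊕ u₁ · v₁
quintuple c {A} {B} E₁ E₂ {u₀} {u₁} {u₂} {v₀} {v₁} sA sB e₁≥0 e₁ e₂≥0 e₂ s₀ s₁ s₂ t₀ t₁ b₁ b₂ b₃ = begin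
  B · A                                             ≈⟨ change-of-variables sB sA 3 (+ 2) (ℤ.- + 1) u v U V sU sV factor ⟩
  zeroS ⊕ u₀ · v₀ ⊕ u₁ · v₁ ⊕ u₂ · zeroS            ≈⟨ ℛ.+-cong (ℛ.+-congʳ (ℛ.+-identityˡ _)) (ℛ.zeroʳ u₂) ⟩
  u₀ · v₀ ⊕ u₁ · v₁ ⊕ zeroS                         ≈⟨ ℛ.+-identityʳ _ ⟩
  u₀ · v₀ ⊕ u₁ · v₁                                 ∎
  where
  u v : ℕ → PS
  u 0 = u₀
  u 1 = u₁
  u (suc (suc _)) = u₂
  v 0 = v₀
  v 1 = v₁
  v (suc (suc _)) = zeroS
  U V : ℕ → ℤ → PS
  U 0 = θ⁻ 15 (+ 10 ℤ.- + 3 ℤ.* c)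
  U 1 t = sgn t · monoℤ (E₁ t)
  U (suc (suc _)) t = sgn t · monoℤ (E₂ t)
  V 0 = θ⁻ 30 (ℤ.- + 10)
  V 1 = θ⁻ 30 (+ 10)
  V (suc (suc _)) = θ⁻ 30 (+ 30)
  sU : ∀ ρ → ρ < 3 → Sums (U ρ) (u ρ)
  sU 0 _ = s₀
  sU 1 _ = s₁
  sU (suc (suc _)) _ = s₂
  sV : ∀ ρ → ρ < 3 → Sums (V ρ) (v ρ)
  sV 0 _ = t₀
  sV 1 _ = t₁
  sV (suc (suc _)) _ = sums-antisymmetric
  m n : ℤ → ℤ → ℤ → ℤ
  m ρ t l = l ℤ.+ (ℤ.- + 1) ℤ.* t
  n ρ t l = + 3 ℤ.* t ℤ.+ ρ ℤ.+ + 2 ℤ.* (l ℤ.+ (ℤ.- + 1) ℤ.* t)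
  join : ∀ ρ t l x y → + 0 ℤ.≤ x → + 0 ℤ.≤ y → quad (+ 10) (+ 2 ℤ.* c ℤ.- + 10) (m ρ t l) ℤ.+ quad (+ 5) (ℤ.- c) (n ρ t l) ≡ x ℤ.+ y →
    θ⁻ 10 (+ 2 ℤ.* c ℤ.- + 10) (m ρ t l) · θ⁺ 5 (ℤ.- c) (n ρ t l) ≋ (sgn t · monoℤ x) · (sgn l · monoℤ y)
  join ρ t l x y x≥0 y≥0 e = begin
    sgn (m ρ t l) · X₁ · X₂                      ≈⟨ ℛ.*-assoc _ _ _ ⟩
    sgn (m ρ t l) · (X₁ · X₂)                    ≈⟨ ℛ.*-cong sign (monoℤ-·-cong (quad-≥0 10 (+ 2 ℤ.* c ℤ.- + 10) b₂ (m ρ t l)) (quad-≥0 5 (ℤ.- c) b₁ (n ρ t l)) x≥0 y≥0 e) ⟩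
    sgn l · sgn t · (monoℤ x · monoℤ y)
      ≈⟨ ℛ.solve (var (# 0) :* var (# 1) :* (var (# 2) :* var (# 3))) ((var (# 1) :* var (# 2)) :* (var (# 0) :* var (# 3))) (sgn l ∷ sgn t ∷ monoℤ x ∷ monoℤ y ∷ []) ⟩
    (sgn t · monoℤ x) · (sgn l · monoℤ y)        ∎
    where
    X₁ X₂ : PS
    X₁ = monoℤ (quad (+ 10) (+ 2 ℤ.* c ℤ.- + 10) (m ρ t l))
    X₂ = monoℤ (quad (+ 5) (ℤ.- c) (n ρ t l))
    sign : sgn (m ρ t l) ≋ sgn l · sgn t
    sign = ℛ.trans (sgn-+ l _) (ℛ.*-congˡ (ℛ.trans (ℛ.reflexive (cong sgn (ℤ.-1*i≡-i t))) (sgn-neg t)))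
  ex₀ : ∀ c t l → (+ 10 ℤ.* ((l ℤ.+ (ℤ.- + 1) ℤ.* t) ℤ.* (l ℤ.+ (ℤ.- + 1) ℤ.* t)) ℤ.+ (+ 2 ℤ.* c ℤ.- + 10) ℤ.* (l ℤ.+ (ℤ.- + 1) ℤ.* t))
    ℤ.+ (+ 5 ℤ.* ((+ 3 ℤ.* t ℤ.+ + 0 ℤ.+ + 2 ℤ.* (l ℤ.+ (ℤ.- + 1) ℤ.* t)) ℤ.* (+ 3 ℤ.* t ℤ.+ + 0 ℤ.+ + 2 ℤ.* (l ℤ.+ (ℤ.- + 1) ℤ.* t))) ℤ.+ (ℤ.- c) ℤ.* (+ 3 ℤ.* t ℤ.+ + 0 ℤ.+ + 2 ℤ.* (l ℤ.+ (ℤ.- + 1) ℤ.* t)))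
    ≡ (+ 15 ℤ.* (t ℤ.* t) ℤ.+ (+ 10 ℤ.- + 3 ℤ.* c) ℤ.* t) ℤ.+ (+ 30 ℤ.* (l ℤ.* l) ℤ.+ (ℤ.- + 10) ℤ.* l)
  ex₀ = solve-∀
  ex₁ : ∀ c t l → (+ 10 ℤ.* ((l ℤ.+ (ℤ.- + 1) ℤ.* t) ℤ.* (l ℤ.+ (ℤ.- + 1) ℤ.* t)) ℤ.+ (+ 2 ℤ.* c ℤ.- + 10) ℤ.* (l ℤ.+ (ℤ.- + 1) ℤ.* t))
    ℤ.+ (+ 5 ℤ.* ((+ 3 ℤ.* t ℤ.+ + 1 ℤ.+ + 2 ℤ.* (l ℤ.+ (ℤ.- + 1) ℤ.* t)) ℤ.* (+ 3 ℤ.* t ℤ.+ + 1 ℤ.+ + 2 ℤ.* (l ℤ.+ (ℤ.- + 1) ℤ.* t))) ℤ.+ (ℤ.- c) ℤ.* (+ 3 ℤ.* t ℤ.+ + 1 ℤ.+ + 2 ℤ.* (l ℤ.+ (ℤ.- + 1) ℤ.* t)))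
    ≡ (+ 15 ℤ.* (t ℤ.* t) ℤ.+ (+ 20 ℤ.- + 3 ℤ.* c) ℤ.* t ℤ.+ (+ 5 ℤ.- c)) ℤ.+ (+ 30 ℤ.* (l ℤ.* l) ℤ.+ + 10 ℤ.* l)
  ex₁ = solve-∀
  ex₂ : ∀ c t l → (+ 10 ℤ.* ((l ℤ.+ (ℤ.- + 1) ℤ.* t) ℤ.* (l ℤ.+ (ℤ.- + 1) ℤ.* t)) ℤ.+ (+ 2 ℤ.* c ℤ.- + 10) ℤ.* (l ℤ.+ (ℤ.- + 1) ℤ.* t))
    ℤ.+ (+ 5 ℤ.* ((+ 3 ℤ.* t ℤ.+ + 2 ℤ.+ + 2 ℤ.* (l ℤ.+ (ℤ.- + 1) ℤ.* t)) ℤ.* (+ 3 ℤ.* t ℤ.+ + 2 ℤ.+ + 2 ℤ.* (l ℤ.+ (ℤ.- + 1) ℤ.* t))) ℤ.+ (ℤ.- c) ℤ.* (+ 3 ℤ.* t ℤ.+ + 2 ℤ.+ + 2 ℤ.* (l ℤ.+ (ℤ.- + 1) ℤ.* t)))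
    ≡ (+ 15 ℤ.* (t ℤ.* t) ℤ.+ (+ 30 ℤ.- + 3 ℤ.* c) ℤ.* t ℤ.+ (+ 20 ℤ.- + 2 ℤ.* c)) ℤ.+ (+ 30 ℤ.* (l ℤ.* l) ℤ.+ + 30 ℤ.* l)
  ex₂ = solve-∀
  factor : ∀ ρ → ρ < 3 → ∀ t l → θ⁻ 10 (+ 2 ℤ.* c ℤ.- + 10) (m (+ ρ) t l) · θ⁺ 5 (ℤ.- c) (n (+ ρ) t l) ≋ U ρ t · V ρ l
  factor 0 _ t l = join (+ 0) t l (quad (+ 15) (+ 10 ℤ.- + 3 ℤ.* c) t) (quad (+ 30) (ℤ.- + 10) l)
    (quad-≥0 15 (+ 10 ℤ.- + 3 ℤ.* c) b₃ t) (quad-≥0 30 (ℤ.- + 10) ≤! l) (ex₀ c t l)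
  factor 1 _ t l = join (+ 1) t l (E₁ t) (quad (+ 30) (+ 10) l) (e₁≥0 t) (quad-≥0 30 (+ 10) ≤! l)
    (≡.trans (ex₁ c t l) (cong (λ x → x ℤ.+ quad (+ 30) (+ 10) l) (≡.sym (e₁ t))))
  factor 2 _ t l = join (+ 2) t l (E₂ t) (quad (+ 30) (+ 30) l) (e₂≥0 t) (quad-≥0 30 (+ 30) ≤! l)
    (≡.trans (ex₂ c t l) (cong (λ x → x ℤ.+ quad (+ 30) (+ 30) l) (≡.sym (e₂ t))))
  factor (suc (suc (suc _))) (s≤s (s≤s (s≤s ())))

-- 5-dissections

pochs₃ : poch 20 60 · poch 40 60 · poch 60 60 ≋ poch 20 20
pochs₃ = ℛ.sym (ℛ.trans (poch-dissect 19 19 2) (ℛ.*-congʳ (ℛ.*-congʳ (ℛ.*-identityˡ _))))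

pochs₂ : ∀ a d → poch (suc a) (suc d) ≋ poch (suc a) (2 ℕ.* suc d) · poch (suc a ℕ.+ suc d) (2 ℕ.* suc d)
pochs₂ a d = ℛ.trans (poch-dissect a d 1) (ℛ.*-cong (ℛ.trans (ℛ.*-identityˡ _) (ℛ.reflexive (cong (λ t → poch t (2 ℕ.* suc d)) e₁)))
    (ℛ.reflexive (cong (λ t → poch t (2 ℕ.* suc d)) e₂)))
  where
  e₁ : suc a ℕ.+ suc d ℕ.* 0 ≡ suc a
  e₁ = ≡.trans (cong (λ t → suc a ℕ.+ t) (ℕ.*-zeroʳ (suc d))) (ℕ.+-identityʳ (suc a))
  e₂ : suc a ℕ.+ suc d ℕ.* 1 ≡ suc a ℕ.+ suc d
  e₂ = cong (λ t → suc a ℕ.+ t) (ℕ.*-identityʳ (suc d))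

unit-at0 : ∀ f → f 0 ≡ + 1 → Regular f
unit-at0 f e = regular-≢0 (λ e′ → 1≢0 (≡.trans (≡.sym e) e′))
  where
  1≢0 : + 1 ≢ + 0
  1≢0 ()

·-at0 : ∀ f g → f 0 ≡ + 1 → g 0 ≡ + 1 → (f · g) 0 ≡ + 1
·-at0 f g e e′ = ≡.trans (·-0 f g) (cong₂ ℤ._*_ e e′)

-- The theta series from the quintuple product, first index c and second index ρ. The same four
-- series occur in Σ (-1)^k q^(3k² - k) at k ≡ 0, 2, 4, 3 modulo 5, up to sign and a power of q and
-- with q⁵ in place of q.
u₃₀ u₃₁ u₁₀ u₁₁ : PS
u₃₀ = poch 14 30 · poch 16 30 · poch 30 30
u₃₁ = mono 2 · (poch 26 30 · poch 4 30 · poch 30 30)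
u₁₀ = poch 8 30 · poch 22 30 · poch 30 30
u₁₁ = ⊝ mono 2 · (poch 2 30 · poch 28 30 · poch 30 30)

E₃ E₁ : ℤ → ℤ
E₃ t = quad (+ 15) (+ 11) t ℤ.+ + 2
E₁ t = quad (+ 15) (ℤ.- + 13) (t ℤ.+ + 1) ℤ.+ + 2

s₃₁ : Sums (λ t → sgn t · monoℤ (E₃ t)) u₃₁
s₃₁ = scaled 15 (+ 11) 2 ≤! (jacobi⁻ 14 25 3 refl)

s₁₁ : Sums (λ t → sgn t · monoℤ (E₁ t)) u₁₁
s₁₁ = shifted 15 (ℤ.- + 13) 2 ≤! (jacobi⁻ 14 1 27 refl)

swap₁₂ : ∀ a b c → a · b · c ≋ b · a · c
swap₁₂ a b c = ℛ.*-congʳ (ℛ.*-comm a b)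

quintuple₃ : (poch 6 20 · poch 14 20 · poch 20 20) · (poch⁺ 2 10 · poch⁺ 8 10 · J) ≋ (u₃₀ ⊕ u₃₁) · poch 20 20
quintuple₃ = ℛ.trans (quintuple (+ 3) E₃ E₂ (jacobi⁺ 4 1 7 refl) (jacobi⁻ 9 5 13 refl)
    (λ t → ℤ.+-mono-≤ (quad-≥0 15 (+ 11) ≤! t) (ℤ.+≤+ z≤n)) e₁
    (λ t → ℤ.+-mono-≤ (quad-≥0 15 (ℤ.- + 9) ≤! (t ℤ.+ + 1)) (ℤ.+≤+ z≤n)) e₂
    (sums-cong (λ _ → ℛ.refl) (swap₁₂ _ _ _) (jacobi⁻ 14 15 13 refl)) s₃₁ (shifted 15 (ℤ.- + 9) 8 ≤! (jacobi⁻ 14 5 23 refl))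
    (sums-cong (λ _ → ℛ.refl) pochs₃ (jacobi⁻ 29 19 39 refl)) (sums-cong (λ _ → ℛ.refl) (ℛ.trans (swap₁₂ _ _ _) pochs₃) (jacobi⁻ 29 39 19 refl)) ≤! ≤! ≤!)
  (ℛ.sym (ℛ.distribʳ _ _ _))
  where
  E₂ : ℤ → ℤ
  E₂ t = quad (+ 15) (ℤ.- + 9) (t ℤ.+ + 1) ℤ.+ + 8
  e₁ : ∀ t → + 15 ℤ.* (t ℤ.* t) ℤ.+ + 11 ℤ.* t ℤ.+ + 2 ≡ + 15 ℤ.* (t ℤ.* t) ℤ.+ (+ 20 ℤ.- + 3 ℤ.* + 3) ℤ.* t ℤ.+ (+ 5 ℤ.- + 3)
  e₁ = solve-∀
  e₂ : ∀ t → + 15 ℤ.* ((t ℤ.+ + 1) ℤ.* (t ℤ.+ + 1)) ℤ.+ (ℤ.- + 9) ℤ.* (t ℤ.+ + 1) ℤ.+ + 8 ≡ + 15 ℤ.* (t ℤ.* t) ℤ.+ (+ 30 ℤ.- + 3 ℤ.* + 3) ℤ.* t ℤ.+ (+ 20 ℤ.- + 2 ℤ.* + 3)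
  e₂ = solve-∀

quintuple₁ : (poch 2 20 · poch 18 20 · poch 20 20) · (poch⁺ 4 10 · poch⁺ 6 10 · J) ≋ (u₁₀ ⊕ u₁₁) · poch 20 20
quintuple₁ = ℛ.trans (quintuple (+ 1) E₁ E₂ (jacobi⁺ 4 3 5 refl) (jacobi⁻ 9 1 17 refl)
    (λ t → ℤ.+-mono-≤ (quad-≥0 15 (ℤ.- + 13) ≤! (t ℤ.+ + 1)) (ℤ.+≤+ z≤n)) e₁
    (λ t → ℤ.+-mono-≤ (quad-≥0 15 (ℤ.- + 3) ≤! (t ℤ.+ + 1)) (ℤ.+≤+ z≤n)) e₂
    (sums-cong (λ _ → ℛ.refl) (swap₁₂ _ _ _) (jacobi⁻ 14 21 7 refl)) s₁₁ (shifted 15 (ℤ.- + 3) 6 ≤! (jacobi⁻ 14 11 17 refl))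
    (sums-cong (λ _ → ℛ.refl) pochs₃ (jacobi⁻ 29 19 39 refl)) (sums-cong (λ _ → ℛ.refl) (ℛ.trans (swap₁₂ _ _ _) pochs₃) (jacobi⁻ 29 39 19 refl)) ≤! ≤! ≤!)
  (ℛ.sym (ℛ.distribʳ _ _ _))
  where
  E₂ : ℤ → ℤ
  E₂ t = quad (+ 15) (ℤ.- + 3) (t ℤ.+ + 1) ℤ.+ + 6
  e₁ : ∀ t → + 15 ℤ.* ((t ℤ.+ + 1) ℤ.* (t ℤ.+ + 1)) ℤ.+ (ℤ.- + 13) ℤ.* (t ℤ.+ + 1) ℤ.+ + 2 ≡ + 15 ℤ.* (t ℤ.* t) ℤ.+ (+ 20 ℤ.- + 3 ℤ.* + 1) ℤ.* t ℤ.+ (+ 5 ℤ.- + 1)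
  e₁ = solve-∀
  e₂ : ∀ t → + 15 ℤ.* ((t ℤ.+ + 1) ℤ.* (t ℤ.+ + 1)) ℤ.+ (ℤ.- + 3) ℤ.* (t ℤ.+ + 1) ℤ.+ + 6 ≡ + 15 ℤ.* (t ℤ.* t) ℤ.+ (+ 30 ℤ.- + 3 ℤ.* + 1) ℤ.* t ℤ.+ (+ 20 ℤ.- + 2 ℤ.* + 1)
  e₂ = solve-∀

-- g₂ (u₃₀ + u₃₁) = J g₄ and g₄ (u₁₀ + u₁₁) = J g₂: both sides of the quintuple product cleared of denominators.
private
  clear : ∀ P p₁ p₂ s₁ s₂ v x {a b} → a 0 ≡ + 1 → b 0 ≡ + 1 → v 0 ≡ + 1 →
    (s₁ · s₂ · v) · ((p₁ · inv a) · (p₂ · inv b) · P) ≋ x · v → a · b · x ≋ P · ((s₁ · p₂) · (p₁ · s₂))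
  clear P p₁ p₂ s₁ s₂ v x {a} {b} a0 b0 v0 e = ℛ.cancel-by V (A :* B :* X) (Pv :* ((S₁ :* P₂) :* (P₁ :* S₂)))
    ((con (ℤ.- + 1) :* (A :* B) , (S₁ :* S₂ :* V) :* ((P₁ :* IA) :* (P₂ :* IB) :* Pv) , X :* V) ∷
     (P₁ :* P₂ :* S₁ :* S₂ :* V :* Pv :* (B :* IB) , A :* IA , con (+ 1)) ∷ (P₁ :* P₂ :* S₁ :* S₂ :* V :* Pv , B :* IB , con (+ 1)) ∷ [])
    (P ∷ p₁ ∷ p₂ ∷ s₁ ∷ s₂ ∷ v ∷ x ∷ a ∷ b ∷ inv a ∷ inv b ∷ [])
    (unit-at0 v v0) (e , inv-right a a0 , inv-right b b0)
    where
    Pv P₁ P₂ S₁ S₂ V X A B IA IB : Expr 11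
    Pv = var (# 0)
    P₁ = var (# 1)
    P₂ = var (# 2)
    S₁ = var (# 3)
    S₂ = var (# 4)
    V = var (# 5)
    X = var (# 6)
    A = var (# 7)
    B = var (# 8)
    IA = var (# 9)
    IB = var (# 10)

u₃-product : g₂ · (u₃₀ ⊕ u₃₁) ≋ J · g₄
u₃-product = ℛ.trans (clear J (poch 4 20) (poch 16 20) (poch 6 20) (poch 14 20) (poch 20 20) (u₃₀ ⊕ u₃₁) {poch 2 10} {poch 8 10} refl refl refl quintuple₃)
  (ℛ.*-congˡ (ℛ.trans (ℛ.*-comm _ _) (ℛ.*-cong (ℛ.sym (pochs₂ 3 9)) (ℛ.sym (pochs₂ 5 9)))))

u₁-product : g₄ · (u₁₀ ⊕ u₁₁) ≋ J · g₂
u₁-product = ℛ.trans (clear J (poch 8 20) (poch 12 20) (poch 2 20) (poch 18 20) (poch 20 20) (u₁₀ ⊕ u₁₁) {poch 4 10} {poch 6 10} refl refl refl quintuple₁)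
  (ℛ.*-congˡ (ℛ.*-cong (ℛ.sym (pochs₂ 1 9)) (ℛ.sym (pochs₂ 7 9))))

sums-subst : ∀ {Φ U} → IsSubst Φ U → ∀ {T f} → Sums T f → Sums (λ k → Φ (T k)) (Φ f)
sums-subst {Φ} s {T} {f} t = record
  { bound = bound
  ; small = λ K k p → ≈[]-trans (subst-mod s K (small K k p)) (≋⇒≈[] K (Subst.subst-0 s))
  ; total = λ K → ≈[]-trans (≋⇒≈[] K (ℛ.sym (∑-subst (suc (2 ℕ.* bound K)) (λ j → T (ℤ.- + bound K ℤ.+ + j))))) (subst-mod s K (total K)) }
  where
  open Sums t
  ∑-subst : ∀ n g → Φ (∑ n g) ≋ ∑ n (λ j → Φ (g j))
  ∑-subst zero    g = Subst.subst-0 s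
  ∑-subst (suc n) g = ℛ.trans (IsSubst.subst-⊕ s _ _) (ℛ.+-congʳ (∑-subst n g))

sgn-5+ : ∀ t r → sgn (+ 5 ℤ.* t ℤ.+ r) ≋ sgn t · sgn r
sgn-5+ t r = ℛ.trans (sgn-+ (+ 5 ℤ.* t) r) (ℛ.*-congʳ (begin
  sgn (+ 5 ℤ.* t)                    ≡⟨ cong sgn (lemma t) ⟩
  sgn ((t ℤ.+ t) ℤ.+ ((t ℤ.+ t) ℤ.+ t))  ≈⟨ ℛ.trans (sgn-+ (t ℤ.+ t) _) (ℛ.*-cong even (ℛ.trans (sgn-+ (t ℤ.+ t) t) (ℛ.*-congʳ even))) ⟩
  oneS · (oneS · sgn t)              ≈⟨ ℛ.trans (ℛ.*-identityˡ _) (ℛ.*-identityˡ _) ⟩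
  sgn t                              ∎))
  where
  even : sgn (t ℤ.+ t) ≋ oneS
  even = ℛ.trans (sgn-+ t t) (sgn-square t)
  lemma : ∀ t → + 5 ℤ.* t ≡ (t ℤ.+ t) ℤ.+ ((t ℤ.+ t) ℤ.+ t)
  lemma = solve-∀

module Dil5 = Subst (dil-isSubst 4)

dil5-term : ∀ t {x} → + 0 ℤ.≤ x → dil 5 (sgn t · monoℤ x) ≋ sgn t · monoℤ (+ 5 ℤ.* x)
dil5-term t {+ n} _ = ℛ.trans (Dil5.subst-· _ _) (ℛ.*-cong (ℛ.trans (Dil5.subst-^ (⊝ oneS) ∣ t ∣) (ℛ.^-cong ∣ t ∣ (ℛ.trans (Dil5.subst-⊝ oneS) (ℛ.-‿cong Dil5.subst-1))))
  (ℛ.trans (dil-mono 4 n) (ℛ.reflexive (cong monoℤ (ℤ.pos-* 5 n)))))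

-- On the class k = 5t + r the exponent 3k² - k is e + 5 X(t), so this part of the sum is a signed
-- power of q times a series in q⁵.
piece : ∀ r e (X : ℤ → ℤ) {f} → (∀ t → + 0 ℤ.≤ X t) → (∀ t → quad (+ 3) (ℤ.- + 1) (+ 5 ℤ.* t ℤ.+ + r) ≡ + e ℤ.+ + 5 ℤ.* X t) →
  Sums (λ t → sgn t · monoℤ (X t)) f → Sums (λ t → θ⁻ 3 (ℤ.- + 1) (+ 5 ℤ.* t ℤ.+ + r)) (sgn (+ r) · mono e · dil 5 f)
piece r e X X≥0 eq s = sums-cong step ℛ.refl (sums-scale (sgn (+ r) · mono e) (sums-subst (dil-isSubst 4) s))
  where
  step : ∀ t → sgn (+ r) · mono e · dil 5 (sgn t · monoℤ (X t)) ≋ θ⁻ 3 (ℤ.- + 1) (+ 5 ℤ.* t ℤ.+ + r)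
  step t = begin
    sgn (+ r) · mono e · dil 5 (sgn t · monoℤ (X t))     ≈⟨ ℛ.*-congˡ (dil5-term t (X≥0 t)) ⟩
    sgn (+ r) · mono e · (sgn t · monoℤ (+ 5 ℤ.* X t))
      ≈⟨ ℛ.solve (var (# 0) :* var (# 1) :* (var (# 2) :* var (# 3))) (var (# 2) :* var (# 0) :* (var (# 1) :* var (# 3))) (sgn (+ r) ∷ mono e ∷ sgn t ∷ monoℤ (+ 5 ℤ.* X t) ∷ []) ⟩
    sgn t · sgn (+ r) · (mono e · monoℤ (+ 5 ℤ.* X t))
      ≈⟨ ℛ.*-cong (ℛ.sym (sgn-5+ t (+ r))) (ℛ.trans (monoℤ-+ (ℤ.+≤+ z≤n) (nonneg (X≥0 t))) (ℛ.reflexive (cong monoℤ (≡.sym (eq t))))) ⟩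
    θ⁻ 3 (ℤ.- + 1) (+ 5 ℤ.* t ℤ.+ + r)                   ∎
    where
    nonneg : ∀ {x} → + 0 ℤ.≤ x → + 0 ℤ.≤ + 5 ℤ.* x
    nonneg p = ℤ.*-monoˡ-≤-nonNeg (+ 5) p

private
  positive-part : ∀ {s m x} → s ≋ oneS → s · m · x ≋ m · x
  positive-part e = ℛ.*-congʳ (ℛ.trans (ℛ.*-congʳ e) (ℛ.*-identityˡ _))

  negative-part : ∀ {s m x} → s ≋ ⊝ oneS → s · m · x ≋ ⊝ (m · x)
  negative-part e = ℛ.trans (ℛ.*-congʳ (ℛ.trans (ℛ.*-congʳ e) (-1*x≈-x _))) (ℛ.sym (-‿distribˡ-* _ _))

  mono-0· : ∀ {x} → mono 0 · x ≋ x
  mono-0· = ℛ.trans (ℛ.*-congʳ mono-0) (ℛ.*-identityˡ _)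

-- The pentagonal number theorem at q²: `JacobiTriple` has the even modulus 2μ, and doubling makes
-- k(3k - 1)/2 the integral form 3k² - k.
euler-sum : Sums (θ⁻ 3 (ℤ.- + 1)) (poch 2 2)
euler-sum = sums-cong (λ _ → ℛ.refl) (ℛ.sym (ℛ.trans (poch-dissect 1 1 2) (ℛ.*-congʳ (ℛ.*-congʳ (ℛ.*-identityˡ _))))) (jacobi⁻ 2 1 3 refl)

-- At k ≡ 0, 1, 2, 3, 4 the exponent 3k² - k lies in the classes 0, 2, 0, 4, 4 modulo 5. The two
-- parts sharing a class are the two halves of a quintuple product, so each class sums to a single
-- product.
euler-dissection₂ : poch 2 2 ≋ dil 5 (u₃₀ ⊕ u₃₁) ⊕ ⊝ (mono 2 · dil 5 J) ⊕ ⊝ (mono 4 · dil 5 (u₁₀ ⊕ u₁₁))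
euler-dissection₂ = ℛ.trans (sums-dissect 5 f_ euler-sum parts) (begin
  zeroS ⊕ f_ 0 ⊕ f_ 1 ⊕ f_ 2 ⊕ f_ 3 ⊕ f_ 4
    ≈⟨ ℛ.+-cong (ℛ.+-cong (ℛ.+-cong (ℛ.+-cong (ℛ.+-congˡ (ℛ.trans (positive-part ℛ.refl) mono-0·)) (negative-part odd₁))
         (ℛ.trans (positive-part even₂) mono-0·)) (negative-part odd₃)) last ⟩
  zeroS ⊕ dil 5 u₃₀ ⊕ ⊝ (mono 2 · dil 5 J) ⊕ dil 5 u₃₁ ⊕ ⊝ (mono 4 · dil 5 u₁₁) ⊕ ⊝ (mono 4 · dil 5 u₁₀)
    ≈⟨ ℛ.solve (con (+ 0) :+ a :- m₂ :* b :+ c :- m₄ :* d :- m₄ :* e) ((a :+ c) :- m₂ :* b :- m₄ :* (e :+ d))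
         (dil 5 u₃₀ ∷ dil 5 J ∷ dil 5 u₃₁ ∷ dil 5 u₁₁ ∷ dil 5 u₁₀ ∷ mono 2 ∷ mono 4 ∷ []) ⟩
  (dil 5 u₃₀ ⊕ dil 5 u₃₁) ⊕ ⊝ (mono 2 · dil 5 J) ⊕ ⊝ (mono 4 · (dil 5 u₁₀ ⊕ dil 5 u₁₁))
    ≈⟨ ℛ.+-cong (ℛ.+-congʳ (Dil5.subst-⊕ _ _)) (ℛ.-‿cong (ℛ.*-congˡ (Dil5.subst-⊕ _ _))) ⟨
  dil 5 (u₃₀ ⊕ u₃₁) ⊕ ⊝ (mono 2 · dil 5 J) ⊕ ⊝ (mono 4 · dil 5 (u₁₀ ⊕ u₁₁)) ∎)
  where
  a b c d e m₂ m₄ : Expr 7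
  a = var (# 0)
  b = var (# 1)
  c = var (# 2)
  d = var (# 3)
  e = var (# 4)
  m₂ = var (# 5)
  m₄ = var (# 6)
  f_ : ℕ → PS
  f_ 0 = sgn (+ 0) · mono 0 · dil 5 u₃₀
  f_ 1 = sgn (+ 1) · mono 2 · dil 5 J
  f_ 2 = sgn (+ 2) · mono 0 · dil 5 u₃₁
  f_ 3 = sgn (+ 3) · mono 4 · dil 5 u₁₁
  f_ (suc (suc (suc (suc _)))) = sgn (+ 4) · mono 4 · dil 5 (⊝ mono 0 · u₁₀)
  odd₁ : sgn (+ 1) ≋ ⊝ oneS
  odd₁ = ℛ.*-identityʳ _
  even₂ : sgn (+ 2) ≋ oneS
  even₂ = ℛ.trans (sgn-+ (+ 1) (+ 1)) (sgn-square (+ 1))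
  odd₃ : sgn (+ 3) ≋ ⊝ oneS
  odd₃ = ℛ.trans (ℛ.*-congˡ even₂) (ℛ.*-identityʳ _)
  even₄ : sgn (+ 4) ≋ oneS
  even₄ = ℛ.trans (sgn-+ (+ 2) (+ 2)) (sgn-square (+ 2))
  last : f_ 4 ≋ ⊝ (mono 4 · dil 5 u₁₀)
  last = ℛ.trans (positive-part even₄) (ℛ.trans (ℛ.*-congˡ (ℛ.trans (Dil5.subst-cong
      (ℛ.trans (ℛ.sym (-‿distribˡ-* _ _)) (ℛ.-‿cong mono-0·))) (Dil5.subst-⊝ _))) (ℛ.sym (-‿distribʳ-* _ _)))
  x₀ : ∀ t → + 3 ℤ.* ((+ 5 ℤ.* t ℤ.+ + 0) ℤ.* (+ 5 ℤ.* t ℤ.+ + 0)) ℤ.+ (ℤ.- + 1) ℤ.* (+ 5 ℤ.* t ℤ.+ + 0) ≡ + 0 ℤ.+ + 5 ℤ.* (+ 15 ℤ.* (t ℤ.* t) ℤ.+ (ℤ.- + 1) ℤ.* t)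
  x₀ = solve-∀
  x₁ : ∀ t → + 3 ℤ.* ((+ 5 ℤ.* t ℤ.+ + 1) ℤ.* (+ 5 ℤ.* t ℤ.+ + 1)) ℤ.+ (ℤ.- + 1) ℤ.* (+ 5 ℤ.* t ℤ.+ + 1) ≡ + 2 ℤ.+ + 5 ℤ.* (+ 15 ℤ.* (t ℤ.* t) ℤ.+ + 5 ℤ.* t)
  x₁ = solve-∀
  x₂ : ∀ t → + 3 ℤ.* ((+ 5 ℤ.* t ℤ.+ + 2) ℤ.* (+ 5 ℤ.* t ℤ.+ + 2)) ℤ.+ (ℤ.- + 1) ℤ.* (+ 5 ℤ.* t ℤ.+ + 2) ≡ + 0 ℤ.+ + 5 ℤ.* (+ 15 ℤ.* (t ℤ.* t) ℤ.+ + 11 ℤ.* t ℤ.+ + 2)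
  x₂ = solve-∀
  x₃ : ∀ t → + 3 ℤ.* ((+ 5 ℤ.* t ℤ.+ + 3) ℤ.* (+ 5 ℤ.* t ℤ.+ + 3)) ℤ.+ (ℤ.- + 1) ℤ.* (+ 5 ℤ.* t ℤ.+ + 3)
    ≡ + 4 ℤ.+ + 5 ℤ.* (+ 15 ℤ.* ((t ℤ.+ + 1) ℤ.* (t ℤ.+ + 1)) ℤ.+ (ℤ.- + 13) ℤ.* (t ℤ.+ + 1) ℤ.+ + 2)
  x₃ = solve-∀
  x₄ : ∀ t → + 3 ℤ.* ((+ 5 ℤ.* t ℤ.+ + 4) ℤ.* (+ 5 ℤ.* t ℤ.+ + 4)) ℤ.+ (ℤ.- + 1) ℤ.* (+ 5 ℤ.* t ℤ.+ + 4)
    ≡ + 4 ℤ.+ + 5 ℤ.* (+ 15 ℤ.* ((t ℤ.+ + 1) ℤ.* (t ℤ.+ + 1)) ℤ.+ (ℤ.- + 7) ℤ.* (t ℤ.+ + 1) ℤ.+ + 0)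
  x₄ = solve-∀
  parts : ∀ r → r < 5 → Sums (λ t → θ⁻ 3 (ℤ.- + 1) (+ 5 ℤ.* t ℤ.+ + r)) (f_ r)
  parts 0 _ = piece 0 0 (quad (+ 15) (ℤ.- + 1)) (quad-≥0 15 (ℤ.- + 1) ≤!) x₀ (jacobi⁻ 14 13 15 refl)
  parts 1 _ = piece 1 2 (quad (+ 15) (+ 5)) (quad-≥0 15 (+ 5) ≤!) x₁ (sums-cong (λ _ → ℛ.refl) ten (jacobi⁻ 14 19 9 refl))
    where
    ten : poch 20 30 · poch 10 30 · poch 30 30 ≋ J
    ten = ℛ.trans (swap₁₂ _ _ _) (ℛ.sym (ℛ.trans (poch-dissect 9 9 2) (ℛ.*-congʳ (ℛ.*-congʳ (ℛ.*-identityˡ _)))))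
  parts 2 _ = piece 2 0 E₃ (λ t → ℤ.+-mono-≤ (quad-≥0 15 (+ 11) ≤! t) (ℤ.+≤+ z≤n)) x₂ s₃₁
  parts 3 _ = piece 3 4 E₁ (λ t → ℤ.+-mono-≤ (quad-≥0 15 (ℤ.- + 13) ≤! (t ℤ.+ + 1)) (ℤ.+≤+ z≤n)) x₃ s₁₁
  parts 4 _ = piece 4 4 (λ t → quad (+ 15) (ℤ.- + 7) (t ℤ.+ + 1) ℤ.+ + 0) (λ t → ℤ.+-mono-≤ (quad-≥0 15 (ℤ.- + 7) ≤! (t ℤ.+ + 1)) (ℤ.+≤+ z≤n)) x₄
    (shifted 15 (ℤ.- + 7) 0 ≤! (jacobi⁻ 14 7 21 refl))
  parts (suc (suc (suc (suc (suc _))))) (s≤s (s≤s (s≤s (s≤s (s≤s ())))))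

dil-at : ∀ k f n → dil (suc k) f (n ℕ.* suc k) ≡ f n
dil-at k f zero    = dil-at0 (suc k) f
dil-at k f (suc n) = ≡.trans (dil-shift (suc k) f (n ℕ.* suc k)) (dil-at k (tail f) n)

-- Brings identities proved at q², where exponents are integral or squares become visible, back to
-- q.
dil-injective : ∀ k {f g} → dil (suc k) f ≋ dil (suc k) g → f ≋ g
dil-injective k {f} {g} e = pointwise λ n → ≡.trans (≡.sym (dil-at k f n)) (≡.trans (at e (n ℕ.* suc k)) (dil-at k g n))

dil-comm : ∀ j k f → dil (suc j) (dil (suc k) f) ≋ dil (suc k) (dil (suc j) f)
dil-comm j k f = ℛ.trans (dil-∘ j k f) (ℛ.trans (pointwise λ n → same n (ℕ.*-comm (suc j) (suc k))) (ℛ.sym (dil-∘ k j f)))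
  where
  same : ∀ n {a b} .{{_ : ℕ.NonZero a}} .{{_ : ℕ.NonZero b}} → a ≡ b → dil a f n ≡ dil b f n
  same n refl = refl

γ₁ γ₂ H : PS
γ₁ = poch 1 5 · poch 4 5
γ₂ = poch 2 5 · poch 3 5
H = poch 5 5

module Dil2 = Subst (dil-isSubst 1)

dil2-γ₁ : dil 2 γ₁ ≋ g₂
dil2-γ₁ = ℛ.trans (Dil2.subst-· _ _) (ℛ.*-cong (poch-dil 1 0 4) (poch-dil 1 3 4))

dil2-γ₂ : dil 2 γ₂ ≋ g₄
dil2-γ₂ = ℛ.trans (Dil2.subst-· _ _) (ℛ.*-cong (poch-dil 1 1 4) (poch-dil 1 2 4))

γ₁-at0 : γ₁ 0 ≡ + 1
γ₁-at0 = ·-at0 _ _ refl refl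

γ₂-at0 : γ₂ 0 ≡ + 1
γ₂-at0 = ·-at0 _ _ refl refl

-- Ramanujan's form: (q; q)_∞ equals (q²⁵; q²⁵)_∞ times 1/R(q⁵) - q - q² R(q⁵).
euler-dissection : poch 1 1 ≋ dil 5 (H · (γ₂ · inv γ₁)) ⊕ ⊝ (mono 1 · dil 5 H) ⊕ ⊝ (mono 2 · dil 5 (H · (γ₁ · inv γ₂)))
euler-dissection = dil-injective 1 (begin
  dil 2 (poch 1 1)      ≈⟨ poch-dil 1 0 0 ⟩
  poch 2 2              ≈⟨ euler-dissection₂ ⟩
  dil 5 (u₃₀ ⊕ u₃₁) ⊕ ⊝ (mono 2 · dil 5 J) ⊕ ⊝ (mono 4 · dil 5 (u₁₀ ⊕ u₁₁))
    ≈⟨ ℛ.+-cong (ℛ.+-cong (Dil5.subst-cong (quotient dil2-γ₁ γ₁-at0 dil2-γ₂ u₃-product)) (ℛ.-‿cong (ℛ.*-cong (ℛ.sym (dil-mono 1 1)) (Dil5.subst-cong (ℛ.sym (poch-dil 1 4 4))))))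
         (ℛ.-‿cong (ℛ.*-cong (ℛ.sym (dil-mono 1 2)) (Dil5.subst-cong (quotient dil2-γ₂ γ₂-at0 dil2-γ₁ u₁-product)))) ⟩
  dil 5 (dil 2 (H · (γ₂ · inv γ₁))) ⊕ ⊝ (dil 2 (mono 1) · dil 5 (dil 2 H)) ⊕ ⊝ (dil 2 (mono 2) · dil 5 (dil 2 (H · (γ₁ · inv γ₂))))
    ≈⟨ ℛ.+-cong (ℛ.+-cong (dil-comm 4 1 (H · (γ₂ · inv γ₁))) (ℛ.-‿cong (ℛ.*-congˡ (dil-comm 4 1 H)))) (ℛ.-‿cong (ℛ.*-congˡ (dil-comm 4 1 (H · (γ₁ · inv γ₂))))) ⟩
  dil 2 (dil 5 (H · (γ₂ · inv γ₁))) ⊕ ⊝ (dil 2 (mono 1) · dil 2 (dil 5 H)) ⊕ ⊝ (dil 2 (mono 2) · dil 2 (dil 5 (H · (γ₁ · inv γ₂))))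
    ≈⟨ ℛ.+-cong (ℛ.+-congˡ (ℛ.-‿cong (ℛ.sym (Dil2.subst-· _ _)))) (ℛ.-‿cong (ℛ.sym (Dil2.subst-· _ _))) ⟩
  dil 2 (dil 5 (H · (γ₂ · inv γ₁))) ⊕ ⊝ dil 2 (mono 1 · dil 5 H) ⊕ ⊝ dil 2 (mono 2 · dil 5 (H · (γ₁ · inv γ₂)))
    ≈⟨ ℛ.trans (Dil2.subst-⊕ _ _) (ℛ.+-cong (ℛ.trans (Dil2.subst-⊕ _ _) (ℛ.+-congˡ (Dil2.subst-⊝ _))) (Dil2.subst-⊝ _)) ⟨
  dil 2 (dil 5 (H · (γ₂ · inv γ₁)) ⊕ ⊝ (mono 1 · dil 5 H) ⊕ ⊝ (mono 2 · dil 5 (H · (γ₁ · inv γ₂)))) ∎)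
  where
  quotient : ∀ {γ γ′ g g′ u} → dil 2 γ ≋ g → γ 0 ≡ + 1 → dil 2 γ′ ≋ g′ → g · u ≋ J · g′ → u ≋ dil 2 (H · (γ′ · inv γ))
  quotient {γ} {γ′} {g} {g′} {u} e γ0 e′ p = begin
    u                                       ≈⟨ ℛ.*-identityˡ u ⟨
    oneS · u                                ≈⟨ ℛ.*-congʳ (inv-left (dil 2 γ) (≡.trans (dil-at0 2 γ) γ0)) ⟨
    inv (dil 2 γ) · dil 2 γ · u             ≈⟨ ℛ.trans (ℛ.*-assoc _ _ _) (ℛ.*-congˡ (ℛ.trans (ℛ.*-congʳ e) p)) ⟩
    inv (dil 2 γ) · (J · g′)
      ≈⟨ ℛ.solve (var (# 0) :* (var (# 1) :* var (# 2))) (var (# 1) :* (var (# 2) :* var (# 0))) (inv (dil 2 γ) ∷ J ∷ g′ ∷ []) ⟩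
    J · (g′ · inv (dil 2 γ))
      ≈⟨ ℛ.*-cong (poch-dil 1 4 4) (ℛ.*-cong e′ (Dil2.subst-inv γ0)) ⟨
    dil 2 H · (dil 2 γ′ · dil 2 (inv γ))    ≈⟨ ℛ.trans (ℛ.*-congˡ (ℛ.sym (Dil2.subst-· _ _))) (ℛ.sym (Dil2.subst-· _ _)) ⟩
    dil 2 (H · (γ′ · inv γ))                ∎

-- Residue classes modulo 5 missed by theta series

opaque
  unfolding mono
  mono-at : ∀ N e → e ≢ N → mono e N ≡ + 0
  mono-at zero    zero    p = ⊥-elim (p refl)
  mono-at zero    (suc e) p = refl
  mono-at (suc N) zero    p = refl
  mono-at (suc N) (suc e) p = mono-at N e (λ q → p (cong suc q))

sgn·mono-at : ∀ k e N → e ≢ N → (sgn k · mono e) N ≡ + 0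
sgn·mono-at k e N e≢N = power ∣ k ∣
  where
  power : ∀ n → ((⊝ oneS) ^ˢ n · mono e) N ≡ + 0
  power zero    = ≡.trans (at (ℛ.*-identityˡ (mono e)) N) (mono-at N e e≢N)
  power (suc n) = ≡.trans (at (ℛ.trans (ℛ.*-assoc (⊝ oneS) ((⊝ oneS) ^ˢ n) (mono e)) (-1*x≈-x ((⊝ oneS) ^ˢ n · mono e))) N)
    (≡.trans (at-⊝ ((⊝ oneS) ^ˢ n · mono e) N) (cong ℤ.-_ (power n)))

sums-vanish : ∀ {T f} → Sums T f → ∀ N → (∀ k → T k N ≡ + 0) → f N ≡ + 0
sums-vanish {T} {f} s N zero-term = ≡.trans (≡.sym (Sums.total s (suc N) N ℕ.≤-refl)) (all (suc (2 ℕ.* Sums.bound s (suc N))))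
  where
  all : ∀ n → ∑ n (λ j → T (ℤ.- + Sums.bound s (suc N) ℤ.+ + j)) N ≡ + 0
  all zero    = at-0 N
  all (suc n) = ≡.trans (at-⊕ (∑ n _) (T (ℤ.- + Sums.bound s (suc N) ℤ.+ + n)) N) (cong₂ ℤ._+_ (all n) (zero-term _))

-- Five instances suffice because the residue of the form depends only on k modulo 5; each is
-- decided by evaluation.
Avoids : ℤ → ℤ → ℕ → Set
Avoids α β s = ∀ r → r < 5 → ¬ 5 ∣ ∣ quad α β (+ r) ℤ.- + s ∣

avoids⇒≢ : ∀ α β s → Avoids α β s → ∀ k n → quad α β k ≢ + (5 ℕ.* n ℕ.+ s)
avoids⇒≢ α β s av k n e = av (k %ℕ 5) (n%ℕd<d k 5) (divides ∣ d ∣ (≡.trans (cong ∣_∣ eq) (≡.trans (ℤ.abs-* (+ 5) d) (ℕ.*-comm 5 ∣ d ∣))))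
  where
  ρ j d : ℤ
  ρ = + (k %ℕ 5)
  j = k /ℕ 5
  -- With k = ρ + 5j the form changes between ρ and k by 5 (α (5j² + 2jρ) + β j). If it takes the
  -- value 5n + s at k, this d is the quotient of its value at ρ, less s, by 5.
  d = + n ℤ.- (α ℤ.* (+ 5 ℤ.* (j ℤ.* j) ℤ.+ + 2 ℤ.* (j ℤ.* ρ)) ℤ.+ β ℤ.* j)
  expand : ∀ α β ρ j s n → (α ℤ.* (ρ ℤ.* ρ) ℤ.+ β ℤ.* ρ) ℤ.- s ≡
    (α ℤ.* ((ρ ℤ.+ j ℤ.* + 5) ℤ.* (ρ ℤ.+ j ℤ.* + 5)) ℤ.+ β ℤ.* (ρ ℤ.+ j ℤ.* + 5)) ℤ.- (+ 5 ℤ.* n ℤ.+ s) ℤ.+ + 5 ℤ.* (n ℤ.- (α ℤ.* (+ 5 ℤ.* (j ℤ.* j) ℤ.+ + 2 ℤ.* (j ℤ.* ρ)) ℤ.+ β ℤ.* j))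
  expand = solve-∀
  eq : quad α β ρ ℤ.- + s ≡ + 5 ℤ.* d
  eq = ≡.trans (expand α β ρ j (+ s) (+ n)) (≡.trans (cong (λ t → t ℤ.- (+ 5 ℤ.* + n ℤ.+ + s) ℤ.+ + 5 ℤ.* d)
    (≡.trans (cong (quad α β) (≡.sym (a≡a%ℕn+[a/ℕn]*n k 5))) (≡.trans e (cong (λ t → t ℤ.+ + s) (ℤ.pos-* 5 n)))))
    (≡.trans (cong (λ t → t ℤ.+ + 5 ℤ.* d) (ℤ.+-inverseʳ (+ 5 ℤ.* + n ℤ.+ + s))) (ℤ.+-identityˡ _)))

θ⁻-vanish : ∀ α β {f} → ∣ β ∣ ≤ α → Sums (θ⁻ α β) f → ∀ s → Avoids (+ α) β s → ∀ n → f (5 ℕ.* n ℕ.+ s) ≡ + 0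
θ⁻-vanish α β β≤α sm s av n = sums-vanish sm (5 ℕ.* n ℕ.+ s) (λ k → sgn·mono-at k ∣ quad (+ α) β k ∣ (5 ℕ.* n ℕ.+ s)
  (λ e → avoids⇒≢ (+ α) β s av k n (≡.trans (≡.sym (ℤ.0≤i⇒+∣i∣≡i (quad-≥0 α β β≤α k))) (cong +_ e))))

five-cases : ∀ {P : ℕ → Set} → P 0 → P 1 → P 2 → P 3 → P 4 → ∀ r → r < 5 → P r
five-cases p₀ p₁ p₂ p₃ p₄ 0 _ = p₀
five-cases p₀ p₁ p₂ p₃ p₄ 1 _ = p₁
five-cases p₀ p₁ p₂ p₃ p₄ 2 _ = p₂
five-cases p₀ p₁ p₂ p₃ p₄ 3 _ = p₃
five-cases p₀ p₁ p₂ p₃ p₄ 4 _ = p₄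
five-cases p₀ p₁ p₂ p₃ p₄ (suc (suc (suc (suc (suc _))))) (s≤s (s≤s (s≤s (s≤s (s≤s ())))))

∤! : ∀ {m} → {False (5 ∣? m)} → ¬ 5 ∣ m
∤! {m} {t} = toWitnessFalse t

-- Read at doubled exponents, 2(5n + 3) = 5(2n + 1) + 1, and 3k² - k misses the class 1 modulo 5.
-- For the class 4 the doubled exponent lies in the class 3, missed as well.
euler-vanish₃ : ∀ n → poch 1 1 (5 ℕ.* n ℕ.+ 3) ≡ + 0
euler-vanish₃ n = ≡.trans (≡.sym (dil-at 1 (poch 1 1) (5 ℕ.* n ℕ.+ 3))) (≡.trans (at (poch-dil 1 0 0) ((5 ℕ.* n ℕ.+ 3) ℕ.* 2))
  (≡.trans (cong (poch 2 2) (index n)) (θ⁻-vanish 3 (ℤ.- + 1) ≤! euler-sum 1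
    (five-cases ∤! ∤! ∤! ∤! ∤!) (suc (2 ℕ.* n)))))
  where
  index : ∀ n → (5 ℕ.* n ℕ.+ 3) ℕ.* 2 ≡ 5 ℕ.* suc (2 ℕ.* n) ℕ.+ 1
  index = ℕ-Solver.solve-∀

euler-vanish₄ : ∀ n → poch 1 1 (5 ℕ.* n ℕ.+ 4) ≡ + 0
euler-vanish₄ n = ≡.trans (≡.sym (dil-at 1 (poch 1 1) (5 ℕ.* n ℕ.+ 4))) (≡.trans (at (poch-dil 1 0 0) ((5 ℕ.* n ℕ.+ 4) ℕ.* 2))
  (≡.trans (cong (poch 2 2) (index n)) (θ⁻-vanish 3 (ℤ.- + 1) ≤! euler-sum 3
    (five-cases ∤! ∤! ∤! ∤! ∤!) (suc (2 ℕ.* n)))))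
  where
  index : ∀ n → (5 ℕ.* n ℕ.+ 4) ℕ.* 2 ≡ 5 ℕ.* suc (2 ℕ.* n) ℕ.+ 3
  index = ℕ-Solver.solve-∀

-- φ(−q) and ψ(−q)
φ⁻ ψ⁻ : PS
φ⁻ = poch 1 2 · poch 1 2 · poch 2 2
ψ⁻ = poch 1 4 · poch 3 4 · poch 4 4

φ⁻-vanish : ∀ s → Avoids (+ 1) (+ 0) s → ∀ n → φ⁻ (5 ℕ.* n ℕ.+ s) ≡ + 0
φ⁻-vanish = θ⁻-vanish 1 (+ 0) ≤! (jacobi⁻ 0 0 0 refl)

φ⁻-vanish₂ : ∀ n → φ⁻ (5 ℕ.* n ℕ.+ 2) ≡ + 0
φ⁻-vanish₂ = φ⁻-vanish 2 (five-cases ∤! ∤! ∤! ∤! ∤!)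

φ⁻-vanish₃ : ∀ n → φ⁻ (5 ℕ.* n ℕ.+ 3) ≡ + 0
φ⁻-vanish₃ = φ⁻-vanish 3 (five-cases ∤! ∤! ∤! ∤! ∤!)

-- For k running through ℤ, k(2k - 1) runs through the triangular numbers, which occupy only the
-- classes 0, 1, 3 modulo 5.
ψ⁻-vanish : ∀ s → Avoids (+ 2) (ℤ.- + 1) s → ∀ n → ψ⁻ (5 ℕ.* n ℕ.+ s) ≡ + 0
ψ⁻-vanish = θ⁻-vanish 2 (ℤ.- + 1) ≤! (jacobi⁻ 1 0 2 refl)

ψ⁻-vanish₂ : ∀ n → ψ⁻ (5 ℕ.* n ℕ.+ 2) ≡ + 0
ψ⁻-vanish₂ = ψ⁻-vanish 2 (five-cases ∤! ∤! ∤! ∤! ∤!)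

ψ⁻-vanish₄ : ∀ n → ψ⁻ (5 ℕ.* n ℕ.+ 4) ≡ + 0
ψ⁻-vanish₄ = ψ⁻-vanish 4 (five-cases ∤! ∤! ∤! ∤! ∤!)

open import Data.Fin using (zero; suc)

-- Multiplicative relations

infixl 7 _∙_
infix 8 _⁻¹

-- Elements of a free abelian group, so that product identities are decided by comparing exponents.
-- There is no unit word; `gen i ∙ gen⁻¹ i` stands in for it.
data Word (n : ℕ) : Set where
  gen gen⁻¹ : Fin n → Word n
  _∙_ : Word n → Word n → Word n

_⁻¹ : ∀ {n} → Word n → Word n
(gen i) ⁻¹   = gen⁻¹ i
(gen⁻¹ i) ⁻¹ = gen i
(v ∙ w) ⁻¹   = v ⁻¹ ∙ w ⁻¹

-- The generators together with their inverses.
Units : ℕ → Set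
Units n = Vec (PS × PS) n

eval : ∀ {n} → Word n → Units n → PS
eval (gen i)   ρ = proj₁ (lookup ρ i)
eval (gen⁻¹ i) ρ = proj₂ (lookup ρ i)
eval (v ∙ w)   ρ = eval v ρ · eval w ρ

_⟪_⟫ : ∀ {m n} → Word m → Vec (Word n) m → Word n
(gen i) ⟪ σ ⟫   = lookup σ i
(gen⁻¹ i) ⟪ σ ⟫ = (lookup σ i) ⁻¹
(v ∙ w) ⟪ σ ⟫   = v ⟪ σ ⟫ ∙ w ⟪ σ ⟫

Invertible : ∀ {n} → Units n → Set
Invertible ρ = ∀ i → proj₁ (lookup ρ i) · proj₂ (lookup ρ i) ≋ oneS

-- A pair (a , b) stands for a generator to the a-th power times its inverse to the b-th; `same`
-- compares the differences a - b by cross addition.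
Exponents : ℕ → Set
Exponents n = Vec (ℕ × ℕ) n

single single⁻¹ : ∀ {n} → Fin n → Exponents n
single   {suc n} zero    = (1 , 0) ∷ replicate n (0 , 0)
single   {suc n} (suc i) = (0 , 0) ∷ single i
single⁻¹ {suc n} zero    = (0 , 1) ∷ replicate n (0 , 0)
single⁻¹ {suc n} (suc i) = (0 , 0) ∷ single⁻¹ i

plus : ∀ {n} → Exponents n → Exponents n → Exponents n
plus []            []            = []
plus ((a , b) ∷ u) ((c , d) ∷ v) = (a ℕ.+ c , b ℕ.+ d) ∷ plus u v

exponents : ∀ {n} → Word n → Exponents n
exponents (gen i)   = single i
exponents (gen⁻¹ i) = single⁻¹ i
exponents (v ∙ w)   = plus (exponents v) (exponents w)

monomial : ∀ {n} → Exponents n → Units n → PS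
monomial []            []            = oneS
monomial ((a , b) ∷ u) ((g , h) ∷ ρ) = (g ^ˢ a · h ^ˢ b) · monomial u ρ

^-+ : ∀ f a b → f ^ˢ (a ℕ.+ b) ≋ f ^ˢ a · f ^ˢ b
^-+ f zero    b = ℛ.sym (ℛ.*-identityˡ _)
^-+ f (suc a) b = ℛ.trans (ℛ.*-congˡ (^-+ f a b)) (ℛ.sym (ℛ.*-assoc _ _ _))

monomial-0 : ∀ {n} (ρ : Units n) → monomial (replicate n (0 , 0)) ρ ≋ oneS
monomial-0 []            = ℛ.refl
monomial-0 ((g , h) ∷ ρ) = ℛ.trans (ℛ.*-cong (ℛ.*-identityˡ oneS) (monomial-0 ρ)) (ℛ.*-identityˡ oneS)

monomial-single : ∀ {n} (i : Fin n) ρ → monomial (single i) ρ ≋ proj₁ (lookup ρ i)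
monomial-single zero    ((g , h) ∷ ρ) = ℛ.trans (ℛ.*-cong (ℛ.trans (ℛ.*-identityʳ _) (ℛ.*-identityʳ g)) (monomial-0 ρ)) (ℛ.*-identityʳ g)
monomial-single (suc i) ((g , h) ∷ ρ) = ℛ.trans (ℛ.*-cong (ℛ.*-identityˡ oneS) (monomial-single i ρ)) (ℛ.*-identityˡ _)

monomial-single⁻¹ : ∀ {n} (i : Fin n) ρ → monomial (single⁻¹ i) ρ ≋ proj₂ (lookup ρ i)
monomial-single⁻¹ zero    ((g , h) ∷ ρ) = ℛ.trans (ℛ.*-cong (ℛ.trans (ℛ.*-identityˡ _) (ℛ.*-identityʳ h)) (monomial-0 ρ)) (ℛ.*-identityʳ h)
monomial-single⁻¹ (suc i) ((g , h) ∷ ρ) = ℛ.trans (ℛ.*-cong (ℛ.*-identityˡ oneS) (monomial-single⁻¹ i ρ)) (ℛ.*-identityˡ _)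

monomial-plus : ∀ {n} (u v : Exponents n) ρ → monomial (plus u v) ρ ≋ monomial u ρ · monomial v ρ
monomial-plus []            []            []            = ℛ.sym (ℛ.*-identityˡ oneS)
monomial-plus ((a , b) ∷ u) ((c , d) ∷ v) ((g , h) ∷ ρ) = ℛ.trans
  (ℛ.*-cong (ℛ.trans (ℛ.*-cong (^-+ g a c) (^-+ h b d)) (interchange _ _ _ _)) (monomial-plus u v ρ)) (interchange _ _ _ _)

exponents-correct : ∀ {n} (w : Word n) ρ → eval w ρ ≋ monomial (exponents w) ρ
exponents-correct (gen i)   ρ = ℛ.sym (monomial-single i ρ)
exponents-correct (gen⁻¹ i) ρ = ℛ.sym (monomial-single⁻¹ i ρ)
exponents-correct (v ∙ w)   ρ = ℛ.trans (ℛ.*-cong (exponents-correct v ρ) (exponents-correct w ρ)) (ℛ.sym (monomial-plus (exponents v) (exponents w) ρ))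

same : ∀ {n} → Exponents n → Exponents n → Bool
same []            []            = true
same ((a , b) ∷ u) ((c , d) ∷ v) = (a ℕ.+ d ≡ᵇ c ℕ.+ b) ∧ same u v

power-pair : ∀ {g h} → g · h ≋ oneS → ∀ k → g ^ˢ k · h ^ˢ k ≋ oneS
power-pair e zero    = ℛ.*-identityˡ oneS
power-pair e (suc k) = ℛ.trans (interchange _ _ _ _) (ℛ.trans (ℛ.*-cong e (power-pair e k)) (ℛ.*-identityˡ oneS))

same-pair : ∀ {g h} → g · h ≋ oneS → ∀ a b c d → a ℕ.+ d ≡ c ℕ.+ b → g ^ˢ a · h ^ˢ b ≋ g ^ˢ c · h ^ˢ d
same-pair {g} {h} e a b c d p = begin
  g ^ˢ a · h ^ˢ b                        ≈⟨ ℛ.*-identityʳ _ ⟨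
  g ^ˢ a · h ^ˢ b · oneS                 ≈⟨ ℛ.*-congˡ (power-pair e d) ⟨
  g ^ˢ a · h ^ˢ b · (g ^ˢ d · h ^ˢ d)      ≈⟨ interchange _ _ _ _ ⟩
  g ^ˢ a · g ^ˢ d · (h ^ˢ b · h ^ˢ d)      ≈⟨ ℛ.*-cong (ℛ.trans (ℛ.sym (^-+ g a d)) (ℛ.trans (ℛ.reflexive (cong (g ^ˢ_) p)) (^-+ g c b))) (ℛ.*-comm _ _) ⟩
  g ^ˢ c · g ^ˢ b · (h ^ˢ d · h ^ˢ b)      ≈⟨ interchange _ _ _ _ ⟩
  g ^ˢ c · h ^ˢ d · (g ^ˢ b · h ^ˢ b)      ≈⟨ ℛ.*-congˡ (power-pair e b) ⟩
  g ^ˢ c · h ^ˢ d · oneS                 ≈⟨ ℛ.*-identityʳ _ ⟩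
  g ^ˢ c · h ^ˢ d                        ∎

same-correct : ∀ {n} (u v : Exponents n) (ρ : Units n) → Invertible ρ → T (same u v) → monomial u ρ ≋ monomial v ρ
same-correct []            []            []            _   _ = ℛ.refl
same-correct ((a , b) ∷ u) ((c , d) ∷ v) ((g , h) ∷ ρ) inv t = ℛ.*-cong
  (same-pair (inv zero) a b c d (ℕ.≡ᵇ⇒≡ (a ℕ.+ d) (c ℕ.+ b) (proj₁ (ℛ.T-∧ t))))
  (same-correct u v ρ (λ i → inv (suc i)) (proj₂ (ℛ.T-∧ {a ℕ.+ d ≡ᵇ c ℕ.+ b} t)))

solve-units : ∀ {n} (ρ : Units n) → Invertible ρ → ∀ v w → {T (same (exponents v) (exponents w))} → eval v ρ ≋ eval w ρ
solve-units ρ inv v w {t} = ℛ.trans (exponents-correct v ρ) (ℛ.trans (same-correct (exponents v) (exponents w) ρ inv t) (ℛ.sym (exponents-correct w ρ)))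

record Represents {m n} (ρ : Units m) (σ : Vec (Word n) m) (τ : Units n) : Set where
  field represents : ∀ i → (proj₁ (lookup ρ i) ≋ eval (lookup σ i) τ) × (proj₂ (lookup ρ i) ≋ eval ((lookup σ i) ⁻¹) τ)

represent : ∀ {m n} {ρ : Units m} {σ : Vec (Word n) m} {τ} → Represents ρ σ τ → ∀ w → eval w ρ ≋ eval (w ⟪ σ ⟫) τ
represent r (gen i)   = proj₁ (Represents.represents r i)
represent r (gen⁻¹ i) = proj₂ (Represents.represents r i)
represent r (v ∙ w)   = ℛ.*-cong (represent r v) (represent r w)

both : (PS → PS) → PS × PS → PS × PS
both Φ (g , h) = Φ g , Φ h

subst-eval : ∀ {Φ U n} → IsSubst Φ U → ∀ (w : Word n) ρ → Φ (eval w ρ) ≋ eval w (map (both Φ) ρ)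
subst-eval {Φ} s (gen i)   ρ = ℛ.reflexive (cong proj₁ (≡.sym (lookup-map i (both Φ) ρ)))
subst-eval {Φ} s (gen⁻¹ i) ρ = ℛ.reflexive (cong proj₂ (≡.sym (lookup-map i (both Φ) ρ)))
subst-eval s (v ∙ w)   ρ = ℛ.trans (Subst.subst-· s _ _) (ℛ.*-cong (subst-eval s v ρ) (subst-eval s w ρ))

-- Generators at q, -q and q²

h₁ h₂ h₃ h₄ h₅ : PS
h₁ = inv g₁
h₂ = inv g₂
h₃ = inv g₃
h₄ = inv g₄
h₅ = inv g₅

g₁-at0 : g₁ 0 ≡ + 1
g₁-at0 = ·-at0 _ _ refl refl
g₂-at0 : g₂ 0 ≡ + 1
g₂-at0 = ·-at0 _ _ refl refl
g₃-at0 : g₃ 0 ≡ + 1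
g₃-at0 = ·-at0 _ _ refl refl
g₄-at0 : g₄ 0 ≡ + 1
g₄-at0 = ·-at0 _ _ refl refl
g₅-at0 : g₅ 0 ≡ + 1
g₅-at0 = ·-at0 _ _ refl refl

coarse : Units 5
coarse = (g₁ , h₁) ∷ (g₂ , h₂) ∷ (g₃ , h₃) ∷ (g₄ , h₄) ∷ (g₅ , h₅) ∷ []

-- Common generators for g₁, ..., g₅ at q, -q and q². The series g₂ and g₄ are left out because they
-- are products of the g's at q² (`g₂≋`, `g₄≋`).
fine : Units 8
fine = (g₁ , h₁) ∷ (g₃ , h₃) ∷ (g₅ , h₅) ∷ map (both (dil 2)) coarse

coarse-invertible : Invertible coarse
coarse-invertible zero = inv-right g₁ g₁-at0
coarse-invertible (suc zero) = inv-right g₂ g₂-at0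
coarse-invertible (suc (suc zero)) = inv-right g₃ g₃-at0
coarse-invertible (suc (suc (suc zero))) = inv-right g₄ g₄-at0
coarse-invertible (suc (suc (suc (suc zero)))) = inv-right g₅ g₅-at0

fine-invertible : Invertible fine
fine-invertible zero = inv-right g₁ g₁-at0
fine-invertible (suc zero) = inv-right g₃ g₃-at0
fine-invertible (suc (suc zero)) = inv-right g₅ g₅-at0
fine-invertible (suc (suc (suc i))) = ≡.subst (λ p → proj₁ p · proj₂ p ≋ oneS) (≡.sym (lookup-map i (both (dil 2)) coarse))
  (ℛ.trans (ℛ.sym (Dil2.subst-· _ _)) (ℛ.trans (Dil2.subst-cong (coarse-invertible i)) Dil2.subst-1))

inverse-of : ∀ {f g f′ g′} → f · g ≋ oneS → f′ · g′ ≋ oneS → f ≋ f′ → g ≋ g′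
inverse-of {f} {g} {f′} {g′} p p′ e = begin
  g                 ≈⟨ ℛ.trans (ℛ.*-congˡ p′) (ℛ.*-identityʳ g) ⟨
  g · (f′ · g′)     ≈⟨ ℛ.*-assoc _ _ _ ⟨
  g · f′ · g′       ≈⟨ ℛ.*-congʳ (ℛ.trans (ℛ.*-comm _ _) (ℛ.trans (ℛ.*-congʳ (ℛ.sym e)) p)) ⟩
  oneS · g′         ≈⟨ ℛ.*-identityˡ g′ ⟩
  g′                ∎

word-inverse : ∀ {n} {ρ : Units n} → Invertible ρ → ∀ w → eval w ρ · eval (w ⁻¹) ρ ≋ oneS
word-inverse i (gen j)   = i j
word-inverse i (gen⁻¹ j) = ℛ.trans (ℛ.*-comm _ _) (i j)
word-inverse i (v ∙ w)   = ℛ.trans (interchange _ _ _ _) (ℛ.trans (ℛ.*-cong (word-inverse i v) (word-inverse i w)) (ℛ.*-identityˡ oneS))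

represents-by : ∀ {m n} {ρ : Units m} (σ : Vec (Word n) m) {τ} → Invertible ρ → Invertible τ →
  (∀ i → proj₁ (lookup ρ i) ≋ eval (lookup σ i) τ) → Represents ρ σ τ
represents-by σ i j e = record { represents = λ k → e k , inverse-of (i k) (word-inverse j (lookup σ k)) (e k) }

γ₁≋ : γ₁ ≋ g₁ · g₄
γ₁≋ = ℛ.trans (ℛ.*-cong (pochs₂ 0 4) (pochs₂ 3 4)) (ℛ.trans (ℛ.solve ((var (# 0) :* var (# 1)) :* (var (# 2) :* var (# 3))) ((var (# 0) :* var (# 3)) :* (var (# 2) :* var (# 1)))
  (poch 1 10 ∷ poch 6 10 ∷ poch 4 10 ∷ poch 9 10 ∷ [])) ℛ.refl)

γ₂≋ : γ₂ ≋ g₂ · g₃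
γ₂≋ = ℛ.trans (ℛ.*-cong (pochs₂ 1 4) (pochs₂ 2 4)) (ℛ.solve ((var (# 0) :* var (# 1)) :* (var (# 2) :* var (# 3))) ((var (# 0) :* var (# 3)) :* (var (# 2) :* var (# 1)))
  (poch 2 10 ∷ poch 7 10 ∷ poch 3 10 ∷ poch 8 10 ∷ []))

-- The expressions over `fine` of g₁, ..., g₅ at q, at -q and at q². For odd index g(-q) = g(q²) /
-- g(q) by `norm₁`, `norm₃`, `norm₅`; g₂ and g₄ are even series.
σ σν σδ : Vec (Word 8) 5
σ  = gen (# 0) ∷ gen (# 3) ∙ gen (# 6) ∷ gen (# 1) ∷ gen (# 4) ∙ gen (# 5) ∷ gen (# 2) ∷ []
σν = gen (# 3) ∙ gen⁻¹ (# 0) ∷ gen (# 3) ∙ gen (# 6) ∷ gen (# 5) ∙ gen⁻¹ (# 1) ∷ gen (# 4) ∙ gen (# 5) ∷ gen (# 7) ∙ gen⁻¹ (# 2) ∷ []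
σδ = gen (# 3) ∷ gen (# 4) ∷ gen (# 5) ∷ gen (# 6) ∷ gen (# 7) ∷ []

g₂≋ : g₂ ≋ dil 2 g₁ · dil 2 g₄
g₂≋ = ℛ.trans (ℛ.sym dil2-γ₁) (ℛ.trans (Dil2.subst-cong γ₁≋) (Dil2.subst-· _ _))

g₄≋ : g₄ ≋ dil 2 g₂ · dil 2 g₃
g₄≋ = ℛ.trans (ℛ.sym dil2-γ₂) (ℛ.trans (Dil2.subst-cong γ₂≋) (Dil2.subst-· _ _))

module Negq = Subst negq-isSubst

norm-pair : ∀ {f g F G} → f · negq f ≋ F → g · negq g ≋ G → (f · g) · negq (f · g) ≋ F · G
norm-pair p r = ℛ.trans (ℛ.*-congˡ (Negq.subst-· _ _)) (ℛ.trans (interchange _ _ _ _) (ℛ.*-cong p r))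

norm₁ : g₁ · negq g₁ ≋ dil 2 g₁
norm₁ = ℛ.trans (norm-pair (poch-negq 0 4) (poch-negq 4 4)) (ℛ.sym (ℛ.trans (Dil2.subst-· _ _) (ℛ.*-cong (poch-dil 1 0 9) (poch-dil 1 8 9))))

norm₃ : g₃ · negq g₃ ≋ dil 2 g₃
norm₃ = ℛ.trans (norm-pair (poch-negq 1 4) (poch-negq 3 4)) (ℛ.sym (ℛ.trans (Dil2.subst-· _ _) (ℛ.*-cong (poch-dil 1 2 9) (poch-dil 1 6 9))))

norm₅ : g₅ · negq g₅ ≋ dil 2 g₅
norm₅ = ℛ.trans (norm-pair (poch-negq 2 4) (poch-negq 2 4)) (ℛ.sym (ℛ.trans (Dil2.subst-· _ _) (ℛ.*-cong (poch-dil 1 4 9) (poch-dil 1 4 9))))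

from-norm : ∀ {g h n G} → g · h ≋ oneS → g · n ≋ G → n ≋ G · h
from-norm {g} {h} {n} {G} p e = begin
  n             ≈⟨ ℛ.*-identityʳ n ⟨
  n · oneS      ≈⟨ ℛ.*-congˡ p ⟨
  n · (g · h)   ≈⟨ ℛ.trans (ℛ.sym (ℛ.*-assoc _ _ _)) (ℛ.*-congʳ (ℛ.trans (ℛ.*-comm n g) e)) ⟩
  G · h         ∎

even-invariant : ∀ {f g} → f ≋ dil 2 g → negq f ≋ f
even-invariant {f} {g} e = ℛ.trans (Negq.subst-cong e) (ℛ.trans (negq-dil2 g) (ℛ.sym e))

here : ∀ w → eval w coarse ≋ eval (w ⟪ σ ⟫) fine
here = represent (represents-by σ coarse-invertible fine-invertible λ where
  zero → ℛ.refl
  (suc zero) → g₂≋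
  (suc (suc zero)) → ℛ.refl
  (suc (suc (suc zero))) → g₄≋
  (suc (suc (suc (suc zero)))) → ℛ.refl)

negated : ∀ w → negq (eval w coarse) ≋ eval (w ⟪ σν ⟫) fine
negated w = ℛ.trans (subst-eval negq-isSubst w coarse) (represent (represents-by σν invertible fine-invertible λ where
  zero → from-norm (coarse-invertible (# 0)) norm₁
  (suc zero) → ℛ.trans (even-invariant {g = γ₁} (ℛ.sym dil2-γ₁)) g₂≋
  (suc (suc zero)) → from-norm (coarse-invertible (# 2)) norm₃
  (suc (suc (suc zero))) → ℛ.trans (even-invariant {g = γ₂} (ℛ.sym dil2-γ₂)) g₄≋
  (suc (suc (suc (suc zero)))) → from-norm (coarse-invertible (# 4)) norm₅) w)
  where
  invertible : Invertible (map (both negq) coarse)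
  invertible i = ≡.subst (λ p → proj₁ p · proj₂ p ≋ oneS) (≡.sym (lookup-map i (both negq) coarse))
    (ℛ.trans (ℛ.sym (Negq.subst-· _ _)) (ℛ.trans (Negq.subst-cong (coarse-invertible i)) Negq.subst-1))

doubled : ∀ w → dil 2 (eval w coarse) ≋ eval (w ⟪ σδ ⟫) fine
doubled w = ℛ.trans (subst-eval (dil-isSubst 1) w coarse) (represent (represents-by σδ invertible fine-invertible λ where
  zero → ℛ.refl
  (suc zero) → ℛ.refl
  (suc (suc zero)) → ℛ.refl
  (suc (suc (suc zero))) → ℛ.refl
  (suc (suc (suc (suc zero)))) → ℛ.refl) w)
  where
  invertible : Invertible (map (both (dil 2)) coarse)
  invertible i = fine-invertible (suc (suc (suc i)))

-- In classical terms κ = R(q) R(q²)², x = R(q²) / R(q)², F = φ(-q) / φ(-q⁵), β = ψ(q) / ψ(q⁵), and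
-- M = (q⁵; q¹⁰)_∞⁵ / (q; q²)_∞.
w₁ w₂ w₃ w₄ w₅ κʷ Mʷ βʷ Fʷ xʷ Rʷ R₂ʷ : Word 5
w₁ = gen (# 0)
w₂ = gen (# 1)
w₃ = gen (# 2)
w₄ = gen (# 3)
w₅ = gen (# 4)
κʷ = w₁ ∙ w₂ ∙ (w₃ ∙ w₄) ⁻¹
Mʷ = w₅ ∙ w₅ ∙ (w₁ ∙ w₃) ⁻¹
βʷ = w₂ ∙ w₄ ∙ (w₁ ∙ w₃) ⁻¹
Fʷ = w₁ ∙ w₁ ∙ w₂ ∙ (w₃ ∙ w₃) ∙ w₄
xʷ = w₂ ∙ w₂ ∙ w₂ ∙ (w₃ ∙ w₃) ∙ (w₁ ∙ w₁ ∙ (w₄ ∙ w₄ ∙ w₄)) ⁻¹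
Rʷ = w₁ ∙ w₄ ∙ (w₂ ∙ w₃) ⁻¹
R₂ʷ = w₂ ∙ w₄ ⁻¹

κ M β F x : PS
κ = eval κʷ coarse
M = eval Mʷ coarse
β = eval βʷ coarse
F = eval Fʷ coarse
x = eval xʷ coarse

-- Additive relations

-- A series that carries its constant term, so that regularity of a cancelled factor is decided by
-- evaluating a polynomial at integers.
record Pointed : Set where
  constructor _at0≡_by_
  field
    series   : PS
    value    : ℤ
    at0≡value : series 0 ≡ value
open Pointed public

constantTerm : ∀ {n} → Expr n → Vec ℤ n → ℤ
constantTerm (con c)  v = c
constantTerm (var i)  v = lookup v i
constantTerm (a :+ b) v = constantTerm a v ℤ.+ constantTerm b v
constantTerm (a :- b) v = constantTerm a v ℤ.- constantTerm b v
constantTerm (a :* b) v = constantTerm a v ℤ.* constantTerm b v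
constantTerm (a :^ k) v = power (constantTerm a v) k
  where
  power : ℤ → ℕ → ℤ
  power x zero    = + 1
  power x (suc k) = x ℤ.* power x k

at0-ℕ : ∀ n → ⌜ + n ⌝ 0 ≡ + n
at0-ℕ zero    = at-0 0
at0-ℕ (suc n) = ≡.trans (at-⊕ oneS ⌜ + n ⌝ 0) (cong (λ t → + 1 ℤ.+ t) (at0-ℕ n))

at0-⊖ : ∀ f g → (f ⊕ ⊝ g) 0 ≡ f 0 ℤ.- g 0
at0-⊖ f g = ≡.trans (at-⊕ f (⊝ g) 0) (cong (λ t → f 0 ℤ.+ t) (at-⊝ g 0))

constantTerm-correct : ∀ {n} (e : Expr n) (ρ : Vec Pointed n) → ⟦ e ⟧ (map series ρ) 0 ≡ constantTerm e (map value ρ)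
constantTerm-correct (con (+ 0))           ρ = at-0 0
constantTerm-correct (con (+ 1))           ρ = refl
constantTerm-correct (con (+ suc (suc n))) ρ = at0-ℕ (suc (suc n))
constantTerm-correct (con (-[1+ n ]))      ρ = ≡.trans (at-⊝ ⌜ + suc n ⌝ 0) (cong ℤ.-_ (at0-ℕ (suc n)))
constantTerm-correct (var i)  ρ = ≡.trans (cong (λ f → f 0) (lookup-map i series ρ))
  (≡.trans (at0≡value (lookup ρ i)) (≡.sym (lookup-map i value ρ)))
constantTerm-correct (a :+ b) ρ = ≡.trans (at-⊕ (⟦ a ⟧ (map series ρ)) (⟦ b ⟧ (map series ρ)) 0) (cong₂ ℤ._+_ (constantTerm-correct a ρ) (constantTerm-correct b ρ))
constantTerm-correct (a :- b) ρ = ≡.trans (at0-⊖ (⟦ a ⟧ (map series ρ)) (⟦ b ⟧ (map series ρ))) (cong₂ ℤ._-_ (constantTerm-correct a ρ) (constantTerm-correct b ρ))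
constantTerm-correct (a :* b) ρ = ≡.trans (·-0 (⟦ a ⟧ (map series ρ)) (⟦ b ⟧ (map series ρ))) (cong₂ ℤ._*_ (constantTerm-correct a ρ) (constantTerm-correct b ρ))
constantTerm-correct (a :^ zero)  ρ = refl
constantTerm-correct (a :^ suc k) ρ = ≡.trans (·-0 (⟦ a ⟧ (map series ρ)) (⟦ a ⟧ (map series ρ) ^ˢ k))
  (cong₂ ℤ._*_ (constantTerm-correct a ρ) (constantTerm-correct (a :^ k) ρ))

nonzero : ℤ → Bool
nonzero (+ 0) = false
nonzero _     = true

nonzero⇒≢0 : ∀ z → T (nonzero z) → z ≢ + 0
nonzero⇒≢0 (+ suc n)  _ ()
nonzero⇒≢0 (-[1+ n ]) _ ()

vars : ∀ {n} → Vec (Expr n) n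
vars = tabulate var

-- c (l - r) is the combination of the rules; c may be cancelled because its constant term is not zero.
deduce-after : ∀ {n} (s : Vec (Expr n) n → Expr n × Expr n × Expr n × List (Rule n)) (ρ : Vec Pointed n) →
  let c , l , r , h = s vars in
  {T (nonzero (constantTerm c (map value ρ)))} → {T (isZero n (norm (c :* (l :- r) :- combination h)))} →
  Holds (map series ρ) h → ⟦ l ⟧ (map series ρ) ≋ ⟦ r ⟧ (map series ρ)
deduce-after s ρ {t} {t′} hs = let c , l , r , h = s vars in
  ℛ.cancel-by c l r h (map series ρ) {t′} (regular-≢0 (λ e → nonzero⇒≢0 _ t (≡.trans (≡.sym (constantTerm-correct c ρ)) e))) hs

deduce : ∀ {n} (s : Vec (Expr n) n → Expr n × Expr n × List (Rule n)) (ρ : Vec PS n) →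
  let l , r , h = s vars in {T (isZero n (norm ((l :- r) :- combination h)))} → Holds ρ h → ⟦ l ⟧ ρ ≋ ⟦ r ⟧ ρ
deduce s ρ {t} hs = let l , r , h = s vars in ℛ.follow l r h ρ {t} hs

substitute : ∀ {Φ U n} → IsSubst Φ U → (s : Vec (Expr n) n → Expr n × Expr n) (ρ : Vec PS n) →
  let l , r = s vars in ⟦ l ⟧ ρ ≋ ⟦ r ⟧ ρ → ⟦ l ⟧ (map Φ ρ) ≋ ⟦ r ⟧ (map Φ ρ)
substitute h s ρ e = let l , r = s vars in ℛ.trans (ℛ.sym (subst-⟦⟧ l ρ)) (ℛ.trans (subst-cong e) (subst-⟦⟧ r ρ))
  where open Subst h

cancel-q : ∀ {f g} → mono 1 · f ≋ mono 1 · g → f ≋ g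
cancel-q {f} {g} e = pointwise λ n → ≡.trans (≡.sym (mono-shift 1 f n)) (≡.trans (at e (suc n)) (mono-shift 1 g n))

-- Theta quotients of levels 10 and 20

κ₂ M₂ β₂ F₂ y κ⁻ M⁻ β⁻ F⁻ x⁻ q τ τ₂ R₂ R₄ R⁻ : PS
κ₂ = dil 2 κ
M₂ = dil 2 M
β₂ = dil 2 β
F₂ = dil 2 F
y  = dil 2 x
κ⁻ = negq κ
M⁻ = negq M
β⁻ = negq β
F⁻ = negq F
x⁻ = negq x
q  = mono 1
τ  = κ · y
τ₂ = dil 2 τ
R₂ = dil 2 R
R₄ = dil 2 R₂
R⁻ = negq R

OneAt0 : ∀ {n} → Units n → Set
OneAt0 ρ = ∀ i → (proj₁ (lookup ρ i) 0 ≡ + 1) × (proj₂ (lookup ρ i) 0 ≡ + 1)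

eval-at0 : ∀ {n} (ρ : Units n) → OneAt0 ρ → ∀ w → eval w ρ 0 ≡ + 1
eval-at0 ρ o (gen i)   = proj₁ (o i)
eval-at0 ρ o (gen⁻¹ i) = proj₂ (o i)
eval-at0 ρ o (v ∙ w)   = ·-at0 (eval v ρ) (eval w ρ) (eval-at0 ρ o v) (eval-at0 ρ o w)

coarse-at0 : OneAt0 coarse
coarse-at0 zero = g₁-at0 , refl
coarse-at0 (suc zero) = g₂-at0 , refl
coarse-at0 (suc (suc zero)) = g₃-at0 , refl
coarse-at0 (suc (suc (suc zero))) = g₄-at0 , refl
coarse-at0 (suc (suc (suc (suc zero)))) = g₅-at0 , refl

κ-at0 : κ 0 ≡ + 1
κ-at0 = eval-at0 coarse coarse-at0 κʷ
M-at0 : M 0 ≡ + 1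
M-at0 = eval-at0 coarse coarse-at0 Mʷ
β-at0 : β 0 ≡ + 1
β-at0 = eval-at0 coarse coarse-at0 βʷ
F-at0 : F 0 ≡ + 1
F-at0 = eval-at0 coarse coarse-at0 Fʷ
x-at0 : x 0 ≡ + 1
x-at0 = eval-at0 coarse coarse-at0 xʷ

δ̂ ν̂ : Pointed → Pointed
δ̂ p = dil 2 (series p) at0≡ value p by ≡.trans (dil-at0 2 (series p)) (at0≡value p)
ν̂ p = negq (series p) at0≡ value p by ≡.trans (Negq.subst-at0 (series p)) (at0≡value p)

q-at0 : q 0 ≡ + 0
q-at0 = at-mono 1 0

q̂ κ̂ M̂ β̂ F̂ x̂ κ̂₂ M̂₂ β̂₂ F̂₂ ŷ κ̂⁻ M̂⁻ β̂⁻ F̂⁻ x̂⁻ τ̂ τ̂₂ : Pointed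
q̂ = q at0≡ + 0 by q-at0
κ̂ = κ at0≡ + 1 by κ-at0
M̂ = M at0≡ + 1 by M-at0
β̂ = β at0≡ + 1 by β-at0
F̂ = F at0≡ + 1 by F-at0
x̂ = x at0≡ + 1 by x-at0
κ̂₂ = δ̂ κ̂
M̂₂ = δ̂ M̂
β̂₂ = δ̂ β̂
F̂₂ = δ̂ F̂
ŷ = δ̂ x̂
κ̂⁻ = ν̂ κ̂
M̂⁻ = ν̂ M̂
β̂⁻ = ν̂ β̂
F̂⁻ = ν̂ F̂
x̂⁻ = ν̂ x̂
τ̂ = τ at0≡ + 1 by ·-at0 κ y κ-at0 (at0≡value ŷ)
τ̂₂ = δ̂ τ̂

units! : ∀ v w → {T (same (exponents v) (exponents w))} → eval v fine ≋ eval w fine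
units! = solve-units fine fine-invertible

coarse! : ∀ v w → {T (same (exponents v) (exponents w))} → eval v coarse ≋ eval w coarse
coarse! = solve-units coarse coarse-invertible

-- A relation between products at q, -q and q²: all sides are rewritten over `fine` and their
-- exponents compared. The following relations up to `F⁻β₂≋ββ` arise in the same way.
κκ⁻y≋κ₂ : κ · κ⁻ · y ≋ κ₂
κκ⁻y≋κ₂ = ℛ.trans (ℛ.*-cong (ℛ.*-cong (here κʷ) (negated κʷ)) (doubled xʷ))
  (ℛ.trans (units! (κʷ ⟪ σ ⟫ ∙ κʷ ⟪ σν ⟫ ∙ xʷ ⟪ σδ ⟫) (κʷ ⟪ σδ ⟫)) (ℛ.sym (doubled κʷ)))

xx⁻yy≋1 : x · x⁻ · (y · y) ≋ oneS
xx⁻yy≋1 = ℛ.trans (ℛ.*-cong (ℛ.*-cong (here xʷ) (negated xʷ)) (ℛ.*-cong (doubled xʷ) (doubled xʷ)))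
  (ℛ.trans (units! (xʷ ⟪ σ ⟫ ∙ xʷ ⟪ σν ⟫ ∙ (xʷ ⟪ σδ ⟫ ∙ xʷ ⟪ σδ ⟫)) (gen (# 0) ∙ gen⁻¹ (# 0))) (fine-invertible (# 0)))

ββ⁻≋β₂F₂ : β · β⁻ ≋ β₂ · F₂
ββ⁻≋β₂F₂ = ℛ.trans (ℛ.*-cong (here βʷ) (negated βʷ))
  (ℛ.trans (units! (βʷ ⟪ σ ⟫ ∙ βʷ ⟪ σν ⟫) (βʷ ⟪ σδ ⟫ ∙ Fʷ ⟪ σδ ⟫)) (ℛ.sym (ℛ.*-cong (doubled βʷ) (doubled Fʷ))))

FF⁻≋F₂F₂ : F · F⁻ ≋ F₂ · F₂
FF⁻≋F₂F₂ = ℛ.trans (ℛ.*-cong (here Fʷ) (negated Fʷ))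
  (ℛ.trans (units! (Fʷ ⟪ σ ⟫ ∙ Fʷ ⟪ σν ⟫) (Fʷ ⟪ σδ ⟫ ∙ Fʷ ⟪ σδ ⟫)) (ℛ.sym (ℛ.*-cong (doubled Fʷ) (doubled Fʷ))))

MM⁻≋M₂ : M · M⁻ ≋ M₂
MM⁻≋M₂ = ℛ.trans (ℛ.*-cong (here Mʷ) (negated Mʷ)) (ℛ.trans (units! (Mʷ ⟪ σ ⟫ ∙ Mʷ ⟪ σν ⟫) (Mʷ ⟪ σδ ⟫)) (ℛ.sym (doubled Mʷ)))

F⁻β₂≋ββ : F⁻ · β₂ ≋ β · β
F⁻β₂≋ββ = ℛ.trans (ℛ.*-cong (negated Fʷ) (doubled βʷ))
  (ℛ.trans (units! (Fʷ ⟪ σν ⟫ ∙ βʷ ⟪ σδ ⟫) (βʷ ⟪ σ ⟫ ∙ βʷ ⟪ σ ⟫)) (ℛ.sym (ℛ.*-cong (here βʷ) (here βʷ))))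

inv-word : ∀ v {f} → f ≋ eval v coarse → inv f ≋ eval (v ⁻¹) coarse
inv-word v e = ℛ.sym (inv-unique (≡.trans (at e 0) (eval-at0 coarse coarse-at0 v))
  (ℛ.trans (ℛ.*-congʳ e) (word-inverse {ρ = coarse} coarse-invertible v)))

opaque
  unfolding _⊕_
  R≋γ₁/γ₂ : R ≋ γ₁ · inv γ₂
  R≋γ₁/γ₂ = ℛ.refl

R≋ : R ≋ eval Rʷ coarse
R≋ = ℛ.trans R≋γ₁/γ₂ (ℛ.*-cong γ₁≋ (inv-word (w₂ ∙ w₃) γ₂≋))

R₂≋ : R₂ ≋ eval R₂ʷ coarse
R₂≋ = ℛ.trans (Dil2.subst-cong R≋) (ℛ.trans (doubled Rʷ) (ℛ.trans (units! (Rʷ ⟪ σδ ⟫) (R₂ʷ ⟪ σ ⟫)) (ℛ.sym (here R₂ʷ))))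

R₂≋xRR : R₂ ≋ x · (R · R)
R₂≋xRR = ℛ.trans R₂≋ (ℛ.trans (coarse! R₂ʷ (xʷ ∙ (Rʷ ∙ Rʷ))) (ℛ.*-congˡ (ℛ.sym (ℛ.*-cong R≋ R≋))))

RR₂R₂≋κ : R · (R₂ · R₂) ≋ κ
RR₂R₂≋κ = ℛ.trans (ℛ.*-cong R≋ (ℛ.*-cong R₂≋ R₂≋)) (coarse! (Rʷ ∙ (R₂ʷ ∙ R₂ʷ)) κʷ)

R₄≋ : R₄ ≋ eval (R₂ʷ ⟪ σδ ⟫) fine
R₄≋ = ℛ.trans (Dil2.subst-cong R₂≋) (doubled R₂ʷ)

R⁻≋ : R⁻ ≋ eval (Rʷ ⟪ σν ⟫) fine
R⁻≋ = ℛ.trans (Negq.subst-cong R≋) (negated Rʷ)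

RR⁻R₂≋R₄ : R · R⁻ · R₂ ≋ R₄
RR⁻R₂≋R₄ = ℛ.trans (ℛ.*-cong (ℛ.*-cong (ℛ.trans R≋ (here Rʷ)) R⁻≋) (ℛ.trans R₂≋ (here R₂ʷ)))
  (ℛ.trans (units! (Rʷ ⟪ σ ⟫ ∙ Rʷ ⟪ σν ⟫ ∙ R₂ʷ ⟪ σ ⟫) (R₂ʷ ⟪ σδ ⟫)) (ℛ.sym R₄≋))

RR₄≋τ : R · R₄ ≋ τ
RR₄≋τ = ℛ.trans (ℛ.*-cong (ℛ.trans R≋ (here Rʷ)) R₄≋)
  (ℛ.trans (units! (Rʷ ⟪ σ ⟫ ∙ R₂ʷ ⟪ σδ ⟫) (κʷ ⟪ σ ⟫ ∙ xʷ ⟪ σδ ⟫)) (ℛ.sym (ℛ.*-cong (here κʷ) (doubled xʷ))))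

aʷ₊ aʷ₋ : Word 5
aʷ₊ = w₅ ∙ (w₂ ∙ w₂) ∙ (w₁ ∙ (w₄ ∙ w₄)) ⁻¹
aʷ₋ = w₅ ∙ w₁ ∙ w₄ ∙ (w₂ ∙ (w₃ ∙ w₃)) ⁻¹

a₊ a₋ : PS
a₊ = eval aʷ₊ coarse
a₋ = eval aʷ₋ coarse

ĝ₁ ĝ₂ ĝ₃ ĝ₄ ĝ₅ â₊ â₋ : Pointed
ĝ₁ = g₁ at0≡ + 1 by g₁-at0
ĝ₂ = g₂ at0≡ + 1 by g₂-at0
ĝ₃ = g₃ at0≡ + 1 by g₃-at0
ĝ₄ = g₄ at0≡ + 1 by g₄-at0
ĝ₅ = g₅ at0≡ + 1 by g₅-at0
â₊ = a₊ at0≡ + 1 by eval-at0 coarse coarse-at0 aʷ₊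
â₋ = a₋ at0≡ + 1 by eval-at0 coarse coarse-at0 aʷ₋

-- `weierstrass₂` divided by g₁ g₃ g₄²; likewise `1-qκ≋a₋` is `weierstrass₃` divided by g₂ g₃² g₄.
1+qκ≋a₊ : oneS ⊕ q · κ ≋ a₊
1+qκ≋a₊ = deduce-after (λ { (q ∷ g₁ ∷ g₂ ∷ g₃ ∷ g₄ ∷ g₅ ∷ κ ∷ a ∷ []) →
    g₁ :* g₄ :* g₄ :* g₃ , con (+ 1) :+ q :* κ , a ,
    (q :* g₁ :* g₄ , κ :* (g₃ :* g₄) , g₁ :* g₂) ∷
    (con (+ 1) , g₁ :* g₄ :* (g₃ :* g₄ :+ q :* (g₁ :* g₂)) , g₅ :* (g₂ :* g₂) :* g₃) ∷
    (con (+ 0) :- g₃ , a :* (g₁ :* (g₄ :* g₄)) , g₅ :* (g₂ :* g₂)) ∷ [] })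
  (q̂ ∷ ĝ₁ ∷ ĝ₂ ∷ ĝ₃ ∷ ĝ₄ ∷ ĝ₅ ∷ κ̂ ∷ â₊ ∷ [])
  (coarse! (κʷ ∙ (w₃ ∙ w₄)) (w₁ ∙ w₂) , weierstrass₂ , coarse! (aʷ₊ ∙ (w₁ ∙ (w₄ ∙ w₄))) (w₅ ∙ (w₂ ∙ w₂)))

1-qκ≋a₋ : oneS ⊕ ⊝ (q · κ) ≋ a₋
1-qκ≋a₋ = deduce-after (λ { (q ∷ g₁ ∷ g₂ ∷ g₃ ∷ g₄ ∷ g₅ ∷ κ ∷ a ∷ []) →
    g₂ :* g₃ :* g₃ :* g₄ , con (+ 1) :- q :* κ , a ,
    (con (+ 0) :- q :* g₂ :* g₃ , κ :* (g₃ :* g₄) , g₁ :* g₂) ∷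
    (con (+ 1) , g₂ :* g₃ :* (g₃ :* g₄ :- q :* (g₁ :* g₂)) , g₅ :* g₁ :* (g₄ :* g₄)) ∷
    (con (+ 0) :- g₄ , a :* (g₂ :* (g₃ :* g₃)) , g₅ :* g₁ :* g₄) ∷ [] })
  (q̂ ∷ ĝ₁ ∷ ĝ₂ ∷ ĝ₃ ∷ ĝ₄ ∷ ĝ₅ ∷ κ̂ ∷ â₋ ∷ [])
  (coarse! (κʷ ∙ (w₃ ∙ w₄)) (w₁ ∙ w₂) , weierstrass₃ , coarse! (aʷ₋ ∙ (w₂ ∙ (w₃ ∙ w₃))) (w₅ ∙ w₁ ∙ w₄))

ββ≋M+q : β · β ≋ M ⊕ q
ββ≋M+q = deduce-after (λ { (q ∷ g₁ ∷ g₂ ∷ g₃ ∷ g₄ ∷ g₅ ∷ M ∷ β ∷ []) →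
    g₁ :* g₁ :* (g₃ :* g₃) , β :* β , M :+ q ,
    (β :* (g₁ :* g₃) :+ g₂ :* g₄ , β :* (g₁ :* g₃) , g₂ :* g₄) ∷
    (con (+ 1) , g₂ :* g₂ :* (g₄ :* g₄) :- q :* (g₁ :* g₁ :* (g₃ :* g₃)) , g₅ :* g₅ :* (g₁ :* g₃)) ∷
    (con (+ 0) :- g₁ :* g₃ , M :* (g₁ :* g₃) , g₅ :* g₅) ∷ [] })
  (q̂ ∷ ĝ₁ ∷ ĝ₂ ∷ ĝ₃ ∷ ĝ₄ ∷ ĝ₅ ∷ M̂ ∷ β̂ ∷ [])
  (coarse! (βʷ ∙ (w₁ ∙ w₃)) (w₂ ∙ w₄) , weierstrass₁ , coarse! (Mʷ ∙ (w₁ ∙ w₃)) (w₅ ∙ w₅))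

-- The product of the two preceding factorizations. In terms of k = q κ it says 1/k - k = M/q.
κM≋1-qqκκ : κ · M ≋ oneS ⊕ ⊝ (q · q · (κ · κ))
κM≋1-qqκκ = deduce (λ { (q ∷ κ ∷ M ∷ a ∷ b ∷ []) →
    κ :* M , con (+ 1) :- q :* q :* (κ :* κ) ,
    (con (+ 1) , κ :* M , a :* b) ∷ (con (+ 0) :- b , con (+ 1) :+ q :* κ , a) ∷ (con (+ 0) :- (con (+ 1) :+ q :* κ) , con (+ 1) :- q :* κ , b) ∷ [] })
  (q ∷ κ ∷ M ∷ a₊ ∷ a₋ ∷ []) (coarse! (κʷ ∙ Mʷ) (aʷ₊ ∙ aʷ₋) , 1+qκ≋a₊ , 1-qκ≋a₋)

-- Ramanujan's parametrization R(q²) / R(q)² = (1 + k) / (1 - k), from the quotient of the two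
-- factorizations.
x-κ : x · (oneS ⊕ ⊝ (q · κ)) ≋ oneS ⊕ q · κ
x-κ = ℛ.trans (ℛ.*-congˡ 1-qκ≋a₋) (ℛ.trans (coarse! (xʷ ∙ aʷ₋) aʷ₊) (ℛ.sym 1+qκ≋a₊))

dil-q≋qq : dil 2 q ≋ q · q
dil-q≋qq = ℛ.trans (dil-mono 1 1) (ℛ.sym (mono-+ 1 1))

negq-q≋-q : negq q ≋ ⊝ q
negq-q≋-q = negq-mono-odd 0

κ₂M₂ : κ₂ · M₂ ≋ oneS ⊕ ⊝ (q · q · (q · q) · (κ₂ · κ₂))
κ₂M₂ = ℛ.trans (substitute (dil-isSubst 1) (λ { (q ∷ κ ∷ M ∷ []) → κ :* M , con (+ 1) :- q :* q :* (κ :* κ) }) (q ∷ κ ∷ M ∷ []) κM≋1-qqκκ)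
  (ℛ.+-congˡ (ℛ.-‿cong (ℛ.*-congʳ (ℛ.*-cong dil-q≋qq dil-q≋qq))))

κ⁻M⁻ : κ⁻ · M⁻ ≋ oneS ⊕ ⊝ (q · q · (κ⁻ · κ⁻))
κ⁻M⁻ = ℛ.trans (substitute negq-isSubst (λ { (q ∷ κ ∷ M ∷ []) → κ :* M , con (+ 1) :- q :* q :* (κ :* κ) }) (q ∷ κ ∷ M ∷ []) κM≋1-qqκκ)
  (ℛ.+-congˡ (ℛ.-‿cong (ℛ.*-congʳ (ℛ.trans (ℛ.*-cong negq-q≋-q negq-q≋-q) (-q·-q)))))
  where
  -q·-q : ⊝ q · ⊝ q ≋ q · q
  -q·-q = ℛ.trans (ℛ.sym (-‿distribˡ-* q (⊝ q))) (ℛ.trans (ℛ.-‿cong (ℛ.sym (-‿distribʳ-* q q))) (-‿involutive (q · q)))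

y-κ₂ : y · (oneS ⊕ ⊝ (q · q · κ₂)) ≋ oneS ⊕ q · q · κ₂
y-κ₂ = ℛ.trans (ℛ.*-congˡ (ℛ.+-congˡ (ℛ.-‿cong (ℛ.*-congʳ (ℛ.sym dil-q≋qq)))))
  (ℛ.trans (substitute (dil-isSubst 1) (λ { (q ∷ κ ∷ x ∷ []) → x :* (con (+ 1) :- q :* κ) , con (+ 1) :+ q :* κ }) (q ∷ κ ∷ x ∷ []) x-κ) (ℛ.+-congˡ (ℛ.*-congʳ dil-q≋qq)))

minus-q : negq q ≋ zeroS ⊕ ⊝ q
minus-q = ℛ.trans negq-q≋-q (ℛ.sym (ℛ.+-identityˡ _))

x⁻-κ⁻ : x⁻ · (oneS ⊕ q · κ⁻) ≋ oneS ⊕ ⊝ (q · κ⁻)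
x⁻-κ⁻ = deduce (λ { (q ∷ q⁻ ∷ κ ∷ x ∷ []) → x :* (con (+ 1) :+ q :* κ) , con (+ 1) :- q :* κ ,
    (con (+ 1) , x :* (con (+ 1) :- q⁻ :* κ) , con (+ 1) :+ q⁻ :* κ) ∷ (x :* κ :+ κ , q⁻ , con (+ 0) :- q) ∷ [] })
  (q ∷ negq q ∷ κ⁻ ∷ x⁻ ∷ [])
  (substitute negq-isSubst (λ { (q ∷ κ ∷ x ∷ []) → x :* (con (+ 1) :- q :* κ) , con (+ 1) :+ q :* κ }) (q ∷ κ ∷ x ∷ []) x-κ , minus-q)

β⁻β⁻ : β⁻ · β⁻ ≋ M⁻ ⊕ ⊝ q
β⁻β⁻ = ℛ.trans (substitute negq-isSubst (λ { (q ∷ M ∷ β ∷ []) → β :* β , M :+ q }) (q ∷ M ∷ β ∷ []) ββ≋M+q) (ℛ.+-congˡ negq-q≋-q)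

β₂β₂ : β₂ · β₂ ≋ M₂ ⊕ q · q
β₂β₂ = ℛ.trans (substitute (dil-isSubst 1) (λ { (q ∷ M ∷ β ∷ []) → β :* β , M :+ q }) (q ∷ M ∷ β ∷ []) ββ≋M+q) (ℛ.+-congˡ dil-q≋qq)

-- Below k = q κ, k₂ = q² κ₂ and t = q τ stand for the classical parameters at q, q² and q.

κκ⁻-product : κ · κ⁻ · (oneS ⊕ q · q · κ₂) ≋ κ₂ · (oneS ⊕ ⊝ (q · q · κ₂))
κκ⁻-product = deduce (λ { (q ∷ κ ∷ κ⁻ ∷ κ₂ ∷ y ∷ []) →
    κ :* κ⁻ :* (con (+ 1) :+ q :* q :* κ₂) , κ₂ :* (con (+ 1) :- q :* q :* κ₂) ,
    (con (+ 1) :- q :* q :* κ₂ , κ :* κ⁻ :* y , κ₂) ∷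
    (con (+ 0) :- κ :* κ⁻ , y :* (con (+ 1) :- q :* q :* κ₂) , con (+ 1) :+ q :* q :* κ₂) ∷ [] })
  (q ∷ κ ∷ κ⁻ ∷ κ₂ ∷ y ∷ []) (κκ⁻y≋κ₂ , y-κ₂)

-- Inserting the parametrizations into `xx⁻yy≋1` gives (1 + k)(1 - k′)(1 + k₂)² = (1 - k)(1 + k′)(1
-- - k₂)² with k′ = q κ⁻. As the product k k′ is known, this is linear in k′ - k, with coefficient
-- 2(1 + k₂²).
κ-κ⁻ : κ · (oneS ⊕ q · q · κ₂) ⊕ ⌜ + 2 ⌝ · q · κ₂ ≋ κ⁻ · (oneS ⊕ q · q · κ₂)
κ-κ⁻ = cancel-q (deduce-after (λ { (q ∷ κ ∷ κ⁻ ∷ κ₂ ∷ x ∷ x⁻ ∷ y ∷ []) →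
    let k₂ = q :* q :* κ₂
        a = con (+ 1) :- q :* κ
        a′ = con (+ 1) :+ q :* κ
        b = con (+ 1) :+ q :* κ⁻
        b′ = con (+ 1) :- q :* κ⁻
        d = con (+ 1) :- k₂
        d′ = con (+ 1) :+ k₂
    in con (+ 2) :* (con (+ 1) :+ k₂ :* k₂) ,
       q :* (κ :* (con (+ 1) :+ q :* q :* κ₂) :+ con (+ 2) :* q :* κ₂) , q :* (κ⁻ :* (con (+ 1) :+ q :* q :* κ₂)) ,
    (d′ :* d :* d :* a :* b , x :* x⁻ :* (y :* y) , con (+ 1)) ∷
    (con (+ 0) :- d′ :* (x⁻ :* b) :* (y :* d :* (y :* d)) , x :* a , a′) ∷
    (con (+ 0) :- d′ :* a′ :* (y :* d :* (y :* d)) , x⁻ :* b , b′) ∷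
    (con (+ 0) :- d′ :* a′ :* b′ :* (y :* d :+ d′) , y :* d , d′) ∷
    (con (+ 4) :* k₂ :* q :* q , κ :* κ⁻ :* d′ , κ₂ :* d) ∷ [] })
  (q̂ ∷ κ̂ ∷ κ̂⁻ ∷ κ̂₂ ∷ x̂ ∷ x̂⁻ ∷ ŷ ∷ []) (xx⁻yy≋1 , x-κ , x⁻-κ⁻ , y-κ₂ , κκ⁻-product))

-- An equation for κ over the series in q²; its other root is -κ(-q).
κ-quadratic : κ · κ · (oneS ⊕ q · q · κ₂) ⊕ ⌜ + 2 ⌝ · q · κ · κ₂ ≋ κ₂ · (oneS ⊕ ⊝ (q · q · κ₂))
κ-quadratic = deduce (λ { (q ∷ κ ∷ κ⁻ ∷ κ₂ ∷ []) →
    let d′ = con (+ 1) :+ q :* q :* κ₂ in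
    κ :* κ :* d′ :+ con (+ 2) :* q :* κ :* κ₂ , κ₂ :* (con (+ 1) :- q :* q :* κ₂) ,
    (κ , κ :* d′ :+ con (+ 2) :* q :* κ₂ , κ⁻ :* d′) ∷ (con (+ 1) , κ :* κ⁻ :* d′ , κ₂ :* (con (+ 1) :- q :* q :* κ₂)) ∷ [] })
  (q ∷ κ ∷ κ⁻ ∷ κ₂ ∷ []) (κ-κ⁻ , κκ⁻-product)

κ⁻-quadratic : κ⁻ · κ⁻ · (oneS ⊕ q · q · κ₂) ≋ ⌜ + 2 ⌝ · q · κ⁻ · κ₂ ⊕ κ₂ · (oneS ⊕ ⊝ (q · q · κ₂))
κ⁻-quadratic = deduce (λ { (q ∷ κ ∷ κ⁻ ∷ κ₂ ∷ []) →
    let d′ = con (+ 1) :+ q :* q :* κ₂ in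
    κ⁻ :* κ⁻ :* d′ , con (+ 2) :* q :* κ⁻ :* κ₂ :+ κ₂ :* (con (+ 1) :- q :* q :* κ₂) ,
    (con (+ 0) :- κ⁻ , κ :* d′ :+ con (+ 2) :* q :* κ₂ , κ⁻ :* d′) ∷ (con (+ 1) , κ :* κ⁻ :* d′ , κ₂ :* (con (+ 1) :- q :* q :* κ₂)) ∷ [] })
  (q ∷ κ ∷ κ⁻ ∷ κ₂ ∷ []) (κ-κ⁻ , κκ⁻-product)

M-M⁻ : M₂ · (M ⊕ ⊝ M⁻) ≋ ⌜ + 2 ⌝ · q · M₂ ⊕ ⌜ + 4 ⌝ · q · q · q
M-M⁻ = deduce-after (λ { (q ∷ κ ∷ κ⁻ ∷ κ₂ ∷ M ∷ M⁻ ∷ M₂ ∷ []) →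
    let k₂ = q :* q :* κ₂
        w = con (+ 1) :+ k₂
    in κ₂ :* κ₂ , M₂ :* (M :- M⁻) , con (+ 2) :* q :* M₂ :+ con (+ 4) :* q :* q :* q ,
    (κ₂ :* (M :- M⁻) :- con (+ 2) :* q :* κ₂ , κ₂ :* M₂ , con (+ 1) :- q :* q :* (q :* q) :* (κ₂ :* κ₂)) ∷
    (con (+ 2) :* q :* q :* q :* κ₂ :- w :* (M :- M⁻) , κ :* κ⁻ :* w , κ₂ :* (con (+ 1) :- k₂)) ∷
    (w :* w :* κ⁻ , κ :* M , con (+ 1) :- q :* q :* (κ :* κ)) ∷
    (con (+ 0) :- w :* w :* κ , κ⁻ :* M⁻ , con (+ 1) :- q :* q :* (κ⁻ :* κ⁻)) ∷
    (con (+ 0) :- w :* (con (+ 1) :+ q :* q :* κ :* κ⁻) , κ :* w :+ con (+ 2) :* q :* κ₂ , κ⁻ :* w) ∷ [] })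
  (q̂ ∷ κ̂ ∷ κ̂⁻ ∷ κ̂₂ ∷ M̂ ∷ M̂⁻ ∷ M̂₂ ∷ []) (κ₂M₂ , κκ⁻-product , κM≋1-qqκκ , κ⁻M⁻ , κ-κ⁻)

-- Squaring `ββ⁻≋β₂F₂` gives (M + q)(M⁻ - q) = (M₂ + q²) F₂². By the product and the difference of M
-- and M⁻ the left side times M₂ is (M₂ + q²)(M₂ - 4q²), and M₂ + q² cancels. `MFF` then replaces q²
-- by q.
M₂F₂F₂ : M₂ · (F₂ · F₂) ⊕ ⌜ + 4 ⌝ · (q · q) ≋ M₂
M₂F₂F₂ = deduce-after (λ { (q ∷ M ∷ M⁻ ∷ M₂ ∷ β ∷ β⁻ ∷ β₂ ∷ F₂ ∷ []) →
    M₂ :+ q :* q , M₂ :* (F₂ :* F₂) :+ con (+ 4) :* (q :* q) , M₂ ,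
    (con (+ 0) :- M₂ :* F₂ :* F₂ , β₂ :* β₂ , M₂ :+ q :* q) ∷
    (con (+ 0) :- M₂ :* (β :* β⁻ :+ β₂ :* F₂) , β :* β⁻ , β₂ :* F₂) ∷
    (M₂ :* β⁻ :* β⁻ , β :* β , M :+ q) ∷ (M₂ :* (M :+ q) , β⁻ :* β⁻ , M⁻ :- q) ∷
    (M₂ , M :* M⁻ , M₂) ∷
    (con (+ 0) :- q , M₂ :* (M :- M⁻) , con (+ 2) :* q :* M₂ :+ con (+ 4) :* q :* q :* q) ∷ [] })
  (q̂ ∷ M̂ ∷ M̂⁻ ∷ M̂₂ ∷ β̂ ∷ β̂⁻ ∷ β̂₂ ∷ F̂₂ ∷ []) (β₂β₂ , ββ⁻≋β₂F₂ , ββ≋M+q , β⁻β⁻ , MM⁻≋M₂ , M-M⁻)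

MFF : M · (F · F) ⊕ ⌜ + 4 ⌝ · q ≋ M
MFF = dil-injective 1 (ℛ.trans (subst-⟦⟧ (M′ :* (F′ :* F′) :+ con (+ 4) :* q′) (M ∷ F ∷ q ∷ []))
    (ℛ.trans (ℛ.+-congˡ (ℛ.*-congˡ dil-q≋qq)) M₂F₂F₂))
  where
  open Subst (dil-isSubst 1)
  M′ F′ q′ : Expr 3
  M′ = var (# 0)
  F′ = var (# 1)
  q′ = var (# 2)

M⁻F⁻F⁻ : M⁻ · (F⁻ · F⁻) ≋ M⁻ ⊕ ⌜ + 4 ⌝ · q
M⁻F⁻F⁻ = deduce (λ { (q ∷ q⁻ ∷ M ∷ F ∷ []) → M :* (F :* F) , M :+ con (+ 4) :* q ,
    (con (+ 1) , M :* (F :* F) :+ con (+ 4) :* q⁻ , M) ∷ (con (+ 0) :- con (+ 4) , q⁻ , con (+ 0) :- q) ∷ [] })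
  (q ∷ negq q ∷ M⁻ ∷ F⁻ ∷ [])
  (substitute negq-isSubst (λ { (q ∷ M ∷ F ∷ []) → M :* (F :* F) :+ con (+ 4) :* q , M }) (q ∷ M ∷ F ∷ []) MFF , minus-q)

M₂-y : M₂ · (y · y ⊕ ⊝ oneS) ≋ ⌜ + 4 ⌝ · (q · q) · y
M₂-y = deduce-after (λ { (q ∷ κ₂ ∷ M₂ ∷ y ∷ []) →
    let d = con (+ 1) :- q :* q :* κ₂
        d′ = con (+ 1) :+ q :* q :* κ₂
    in κ₂ , M₂ :* (y :* y :- con (+ 1)) , con (+ 4) :* (q :* q) :* y ,
    (y :* y :- con (+ 1) , κ₂ :* M₂ , con (+ 1) :- q :* q :* (q :* q) :* (κ₂ :* κ₂)) ∷
    (y :* (y :* d :+ d′) :- d :* (y :* y :- con (+ 1)) , y :* d , d′) ∷ [] })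
  (q̂ ∷ κ̂₂ ∷ M̂₂ ∷ ŷ ∷ []) (κ₂M₂ , y-κ₂)

-- λ₃ + 1/λ₃, at q².
y+1/y : y · y ⊕ oneS ≋ y · (F ⊕ F⁻)
y+1/y = deduce-after (λ { (q ∷ M ∷ M⁻ ∷ M₂ ∷ F ∷ F⁻ ∷ F₂ ∷ y ∷ []) →
    let l = y :* y :+ con (+ 1)
        r = y :* (F :+ F⁻)
        c = y :* y :* M₂
    -- Only l² = r² follows from the rules; l + r has constant term 4, which decides the sign.
    in (l :+ r) :* M₂ :* M₂ , l , r ,
    (M₂ :* (y :* y :- con (+ 1)) :+ con (+ 4) :* (q :* q) :* y , M₂ :* (y :* y :- con (+ 1)) , con (+ 4) :* (q :* q) :* y) ∷
    (con (+ 0) :- c :* M⁻ , M :* (F :* F) :+ con (+ 4) :* q , M) ∷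
    (con (+ 0) :- c :* M , M⁻ :* (F⁻ :* F⁻) , M⁻ :+ con (+ 4) :* q) ∷
    (c :* (F :* F :+ F⁻ :* F⁻ :- con (+ 2)) , M :* M⁻ , M₂) ∷
    (con (+ 0) :- con (+ 2) :* c :* M₂ , F :* F⁻ , F₂ :* F₂) ∷
    (con (+ 0) :- con (+ 2) :* c , M₂ :* (F₂ :* F₂) :+ con (+ 4) :* (q :* q) , M₂) ∷
    (con (+ 0) :- con (+ 4) :* q :* y :* y , M₂ :* (M :- M⁻) , con (+ 2) :* q :* M₂ :+ con (+ 4) :* q :* q :* q) ∷ [] })
  (q̂ ∷ M̂ ∷ M̂⁻ ∷ M̂₂ ∷ F̂ ∷ F̂⁻ ∷ F̂₂ ∷ ŷ ∷ []) (M₂-y , MFF , M⁻F⁻F⁻ , MM⁻≋M₂ , FF⁻≋F₂F₂ , M₂F₂F₂ , M-M⁻)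

-- That is, 1/k + k = F(-q) + β(q²)/q. The squares agree because (1/k + k)² = (M/q)² + 4, and the
-- constant term fixes the sign.
1/k+k : oneS ⊕ q · q · (κ · κ) ≋ κ · (q · F⁻ ⊕ β₂)
1/k+k = deduce-after (λ { (q ∷ κ ∷ M ∷ M⁻ ∷ M₂ ∷ F⁻ ∷ β ∷ β₂ ∷ []) →
    let l = con (+ 1) :+ q :* q :* (κ :* κ)
        r = κ :* (q :* F⁻ :+ β₂)
        s = κ :* κ
    in (l :+ r) :* M⁻ , l , r ,
    (s , M₂ :* (M :- M⁻) , con (+ 2) :* q :* M₂ :+ con (+ 4) :* q :* q :* q) ∷
    (s :* (M :- con (+ 2) :* q) , M :* M⁻ , M₂) ∷
    (con (+ 0) :- s :* q :* q , M⁻ :* (F⁻ :* F⁻) , M⁻ :+ con (+ 4) :* q) ∷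
    (con (+ 0) :- s :* con (+ 2) :* q :* M⁻ , F⁻ :* β₂ , β :* β) ∷
    (con (+ 0) :- s :* con (+ 2) :* q :* M⁻ , β :* β , M :+ q) ∷
    (con (+ 0) :- s :* M⁻ , β₂ :* β₂ , M₂ :+ q :* q) ∷
    (con (+ 0) :- M⁻ :* (κ :* M :+ con (+ 1) :- q :* q :* (κ :* κ)) , κ :* M , con (+ 1) :- q :* q :* (κ :* κ)) ∷ [] })
  (q̂ ∷ κ̂ ∷ M̂ ∷ M̂⁻ ∷ M̂₂ ∷ F̂⁻ ∷ β̂ ∷ β̂₂ ∷ []) (M-M⁻ , MM⁻≋M₂ , M⁻F⁻F⁻ , F⁻β₂≋ββ , ββ≋M+q , β₂β₂ , κM≋1-qqκκ)

κ⁻τ≋κ₂ : κ⁻ · τ ≋ κ₂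
κ⁻τ≋κ₂ = ℛ.trans (ℛ.sym (ℛ.*-assoc κ⁻ κ y)) (ℛ.trans (ℛ.*-congʳ (ℛ.*-comm κ⁻ κ)) κκ⁻y≋κ₂)

-- Obtained from the quadratic equation of κ⁻ by inserting κ₂ = κ⁻ τ; the product κ⁻ M⁻ then removes
-- κ⁻.
1/t+t : oneS ⊕ q · q · (τ · τ) ≋ τ · (⌜ + 2 ⌝ · q ⊕ M⁻)
1/t+t = deduce-after (λ { (q ∷ κ⁻ ∷ κ₂ ∷ M⁻ ∷ τ ∷ []) →
    κ⁻ :* κ⁻ , con (+ 1) :+ q :* q :* (τ :* τ) , τ :* (con (+ 2) :* q :+ M⁻) ,
    (con (+ 1) , κ⁻ :* κ⁻ :* (con (+ 1) :+ q :* q :* κ₂) , con (+ 2) :* q :* κ⁻ :* κ₂ :+ κ₂ :* (con (+ 1) :- q :* q :* κ₂)) ∷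
    (q :* q :* (κ⁻ :* τ :+ κ₂) :- con (+ 2) :* q :* κ⁻ :- κ⁻ :* M⁻ , κ⁻ :* τ , κ₂) ∷
    (con (+ 0) :- κ₂ , κ⁻ :* M⁻ , con (+ 1) :- q :* q :* (κ⁻ :* κ⁻)) ∷ [] })
  (q̂ ∷ κ̂⁻ ∷ κ̂₂ ∷ M̂⁻ ∷ τ̂ ∷ []) (κ⁻-quadratic , κ⁻τ≋κ₂ , κ⁻M⁻)

-- From (1/t - t)² = (1/t + t)² - 4, where 1/t + t = 2 + M(-q)/q and `M⁻F⁻F⁻` make the right side a
-- square.
1/t-t : oneS ⊕ ⊝ (q · q · (τ · τ)) ≋ τ · (F⁻ · M⁻)
1/t-t = deduce-after (λ { (q ∷ M⁻ ∷ F⁻ ∷ τ ∷ []) →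
    let l = con (+ 1) :- q :* q :* (τ :* τ)
        r = τ :* (F⁻ :* M⁻)
        p = con (+ 1) :+ q :* q :* (τ :* τ)
        s = τ :* (con (+ 2) :* q :+ M⁻)
    in l :+ r , l , r , (p :+ s , p , s) ∷ (con (+ 0) :- τ :* τ :* M⁻ , M⁻ :* (F⁻ :* F⁻) , M⁻ :+ con (+ 4) :* q) ∷ [] })
  (q̂ ∷ M̂⁻ ∷ F̂⁻ ∷ τ̂ ∷ []) (1/t+t , M⁻F⁻F⁻)

κκ₂-product : (κ ⊕ q · κ₂) · (oneS ⊕ q · q · q · (κ · κ₂)) ≋ κ · κ₂ · (M · β₂)
κκ₂-product = deduce-after (λ { (q ∷ κ ∷ κ₂ ∷ M ∷ M₂ ∷ β₂ ∷ []) →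
    let l₁ = κ :+ q :* κ₂
        l₂ = con (+ 1) :+ q :* q :* q :* (κ :* κ₂)
        r = κ :* κ₂ :* (M :* β₂)
        k₂ = q :* q :* κ₂
    in l₁ :* l₂ :+ r , l₁ :* l₂ , r ,
    (l₂ :* l₂ :+ κ₂ :* (κ :* M) :* (q :* q) , κ :* κ :* (con (+ 1) :+ q :* q :* κ₂) :+ con (+ 2) :* q :* κ :* κ₂ , κ₂ :* (con (+ 1) :- q :* q :* κ₂)) ∷
    (con (+ 0) :- κ₂ :* l₂ :* l₂ :- κ₂ :* (κ :* M) :* (con (+ 1) :+ k₂ :- k₂ :* k₂) , κ :* M , con (+ 1) :- q :* q :* (κ :* κ)) ∷
    (con (+ 0) :- κ₂ :* (κ :* M) :* (κ :* M) :* κ₂ , β₂ :* β₂ , M₂ :+ q :* q) ∷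
    (con (+ 0) :- κ₂ :* (κ :* M) :* (κ :* M) , κ₂ :* M₂ , con (+ 1) :- q :* q :* (q :* q) :* (κ₂ :* κ₂)) ∷ [] })
  (q̂ ∷ κ̂ ∷ κ̂₂ ∷ M̂ ∷ M̂₂ ∷ β̂₂ ∷ []) (κ-quadratic , κM≋1-qqκκ , β₂β₂ , κ₂M₂)

-- This is R(q⁴) / (R(q)² R(q²)) = R(-q) / R(q), the series λ₁₀.
z : PS
z = x · y

ẑ : Pointed
ẑ = z at0≡ + 1 by ·-at0 x y x-at0 (at0≡value ŷ)

z-κ : (oneS ⊕ ⊝ (q · κ)) · (oneS ⊕ ⊝ (q · q · κ₂)) · z ≋ (oneS ⊕ q · κ) · (oneS ⊕ q · q · κ₂)
z-κ = ℛ.trans (ℛ.solve (a :* b :* (c :* d)) ((c :* a) :* (d :* b)) (oneS ⊕ ⊝ (q · κ) ∷ oneS ⊕ ⊝ (q · q · κ₂) ∷ x ∷ y ∷ [])) (ℛ.*-cong x-κ y-κ₂)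
  where
  a b c d : Expr 4
  a = var (# 0)
  b = var (# 1)
  c = var (# 2)
  d = var (# 3)

-- With `M₂-z⁺` this says z - 1/z = 4qβ₂/M₂ and z + 1/z = 2 + 4q²/M₂: one odd and one even, in
-- accordance with z(-q) = 1/z(q).
M₂-z⁻ : M₂ · (z · z ⊕ ⊝ oneS) ≋ ⌜ + 4 ⌝ · q · (z · β₂)
M₂-z⁻ = deduce-after (λ { (q ∷ κ ∷ κ₂ ∷ M ∷ M₂ ∷ β₂ ∷ z ∷ []) →
    let u = (con (+ 1) :- q :* κ) :* (con (+ 1) :- q :* q :* κ₂)
        w = (con (+ 1) :+ q :* κ) :* (con (+ 1) :+ q :* q :* κ₂)
        e₂ = con (+ 1) :- q :* q :* (q :* q) :* (κ₂ :* κ₂)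
    in u :* u , M₂ :* (z :* z :- con (+ 1)) , con (+ 4) :* q :* (z :* β₂) ,
    (M₂ :* (u :* z :+ w) :- con (+ 4) :* q :* u :* β₂ , u :* z , w) ∷
    (con (+ 4) :* q :* M₂ , (κ :+ q :* κ₂) :* (con (+ 1) :+ q :* q :* q :* (κ :* κ₂)) , κ :* κ₂ :* (M :* β₂)) ∷
    (con (+ 4) :* q :* β₂ :* κ :* M , κ₂ :* M₂ , e₂) ∷
    (con (+ 4) :* q :* β₂ :* e₂ , κ :* M , con (+ 1) :- q :* q :* (κ :* κ)) ∷ [] })
  (q̂ ∷ κ̂ ∷ κ̂₂ ∷ M̂ ∷ M̂₂ ∷ β̂₂ ∷ ẑ ∷ []) (z-κ , κκ₂-product , κ₂M₂ , κM≋1-qqκκ)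

M₂-z⁺ : M₂ · (z · z ⊕ oneS) ≋ z · (⌜ + 2 ⌝ · M₂ ⊕ ⌜ + 4 ⌝ · (q · q))
M₂-z⁺ = deduce-after (λ { (q ∷ κ ∷ κ₂ ∷ M₂ ∷ z ∷ []) →
    let u = (con (+ 1) :- q :* κ) :* (con (+ 1) :- q :* q :* κ₂)
        w = (con (+ 1) :+ q :* κ) :* (con (+ 1) :+ q :* q :* κ₂)
        m = con (+ 2) :* M₂ :+ con (+ 4) :* (q :* q)
    in u :* u , M₂ :* (z :* z :+ con (+ 1)) , z :* m ,
    (M₂ :* (u :* z :+ w) :- u :* m , u :* z , w) ∷
    (con (+ 4) :* q :* q :* M₂ , κ :* κ :* (con (+ 1) :+ q :* q :* κ₂) :+ con (+ 2) :* q :* κ :* κ₂ , κ₂ :* (con (+ 1) :- q :* q :* κ₂)) ∷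
    (con (+ 4) :* q :* q :* (con (+ 1) :- q :* q :* (κ :* κ)) , κ₂ :* M₂ , con (+ 1) :- q :* q :* (q :* q) :* (κ₂ :* κ₂)) ∷ [] })
  (q̂ ∷ κ̂ ∷ κ̂₂ ∷ M̂₂ ∷ ẑ ∷ []) (z-κ , κ-quadratic , κ₂M₂)

-- By the quadratic equation (κ + qκ₂)² = κκ₂M, hence (κ - qκ₂)² = κκ₂(M - 4q); the quotient of
-- these squares is F² by `MFF`.
F-κ : F · (κ ⊕ q · κ₂) ≋ κ ⊕ ⊝ (q · κ₂)
F-κ = deduce-after (λ { (q ∷ κ ∷ κ₂ ∷ M ∷ F ∷ []) →
    let l = F :* (κ :+ q :* κ₂)
        r = κ :- q :* κ₂
    in (l :+ r) :* M , l , r ,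
    ((κ :+ q :* κ₂) :* (κ :+ q :* κ₂) , M :* (F :* F) :+ con (+ 4) :* q , M) ∷
    (con (+ 0) :- con (+ 4) :* q , κ :* κ :* (con (+ 1) :+ q :* q :* κ₂) :+ con (+ 2) :* q :* κ :* κ₂ , κ₂ :* (con (+ 1) :- q :* q :* κ₂)) ∷
    (con (+ 4) :* q :* κ₂ , κ :* M , con (+ 1) :- q :* q :* (κ :* κ)) ∷ [] })
  (q̂ ∷ κ̂ ∷ κ̂₂ ∷ M̂ ∷ F̂ ∷ []) (MFF , κ-quadratic , κM≋1-qqκκ)

F⁻-κ⁻ : F⁻ · (κ⁻ ⊕ ⊝ (q · κ₂)) ≋ κ⁻ ⊕ q · κ₂
F⁻-κ⁻ = deduce (λ { (q ∷ q⁻ ∷ κ ∷ κ₂ ∷ κ₂′ ∷ F ∷ []) → F :* (κ :- q :* κ₂) , κ :+ q :* κ₂ ,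
    (con (+ 1) , F :* (κ :+ q⁻ :* κ₂′) , κ :- q⁻ :* κ₂′) ∷
    (con (+ 0) :- F :* q⁻ :- q⁻ , κ₂′ , κ₂) ∷ (con (+ 0) :- F :* κ₂ :- κ₂ , q⁻ , con (+ 0) :- q) ∷ [] })
  (q ∷ negq q ∷ κ⁻ ∷ κ₂ ∷ negq κ₂ ∷ F⁻ ∷ [])
  (substitute negq-isSubst (λ { (q ∷ κ ∷ κ₂ ∷ F ∷ []) → F :* (κ :+ q :* κ₂) , κ :- q :* κ₂ }) (q ∷ κ ∷ κ₂ ∷ F ∷ []) F-κ , negq-dil2 κ , minus-q)

-- F(-q) = (1 + t) / (1 - t): the relation `F⁻-κ⁻` after division by κ⁻, as κ₂ = κ⁻ τ.
F⁻-τ : F⁻ · (oneS ⊕ ⊝ (q · τ)) ≋ oneS ⊕ q · τ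
F⁻-τ = deduce-after (λ { (q ∷ κ⁻ ∷ κ₂ ∷ F⁻ ∷ τ ∷ []) → κ⁻ , F⁻ :* (con (+ 1) :- q :* τ) , con (+ 1) :+ q :* τ ,
    (con (+ 1) , F⁻ :* (κ⁻ :- q :* κ₂) , κ⁻ :+ q :* κ₂) ∷ (con (+ 0) :- q :* F⁻ :- q , κ⁻ :* τ , κ₂) ∷ [] })
  (q̂ ∷ κ̂⁻ ∷ κ̂₂ ∷ F̂⁻ ∷ τ̂ ∷ []) (F⁻-κ⁻ , κ⁻τ≋κ₂)

-- As y = τ/κ, the equation y = (1 + k₂) / (1 - k₂) is solved for k₂. This makes κ₂ rational in q, κ
-- and τ.
κ₂-τ : q · q · κ₂ · (τ ⊕ κ) ≋ τ ⊕ ⊝ κ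
κ₂-τ = deduce (λ { (q ∷ κ ∷ κ₂ ∷ y ∷ []) → q :* q :* κ₂ :* (κ :* y :+ κ) , κ :* y :- κ ,
    (con (+ 0) :- κ , y :* (con (+ 1) :- q :* q :* κ₂) , con (+ 1) :+ q :* q :* κ₂) ∷ [] })
  (q ∷ κ ∷ κ₂ ∷ y ∷ []) y-κ₂

τ-κ : (oneS ⊕ ⊝ (q · τ)) · (τ ⊕ q · (κ · κ)) ≋ κ · (oneS ⊕ q · q · (τ · τ))
τ-κ = deduce-after (λ { (q ∷ κ ∷ κ₂ ∷ y ∷ []) →
    let d = con (+ 1) :- q :* q :* κ₂
        d′ = con (+ 1) :+ q :* q :* κ₂
        τ = κ :* y
    in d :* d , (con (+ 1) :- q :* τ) :* (τ :+ q :* (κ :* κ)) , κ :* (con (+ 1) :+ q :* q :* (τ :* τ)) ,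
    (con (+ 0) :- con (+ 2) :* κ :* q :* q , κ :* κ :* d′ :+ con (+ 2) :* q :* κ :* κ₂ , κ₂ :* d) ∷
    (κ :* ((con (+ 1) :- q :* q :* κ :* κ) :* d :- (q :* κ :+ q :* q :* κ :* κ) :* (y :* d :+ d′)) , y :* d , d′) ∷ [] })
  (q̂ ∷ κ̂ ∷ κ̂₂ ∷ ŷ ∷ []) (κ-quadratic , y-κ₂)

-- Relations between q and q⁴

cancel-q^ : ∀ n {f g} → q ^ˢ n · f ≋ q ^ˢ n · g → f ≋ g
cancel-q^ zero    e = ℛ.trans (ℛ.sym (ℛ.*-identityˡ _)) (ℛ.trans e (ℛ.*-identityˡ _))
cancel-q^ (suc n) e = cancel-q^ n (cancel-q (ℛ.trans (ℛ.sym (ℛ.*-assoc _ _ _)) (ℛ.trans e (ℛ.*-assoc _ _ _))))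

τ₂-κ₂ : (oneS ⊕ ⊝ (q · q · τ₂)) · (τ₂ ⊕ q · q · (κ₂ · κ₂)) ≋ κ₂ · (oneS ⊕ q · q · (q · q) · (τ₂ · τ₂))
τ₂-κ₂ = ℛ.trans (ℛ.*-cong (ℛ.+-congˡ (ℛ.-‿cong (ℛ.*-congʳ (ℛ.sym dil-q≋qq)))) (ℛ.+-congˡ (ℛ.*-congʳ (ℛ.sym dil-q≋qq))))
  (ℛ.trans (substitute (dil-isSubst 1) (λ { (q ∷ κ ∷ τ ∷ []) → (con (+ 1) :- q :* τ) :* (τ :+ q :* (κ :* κ)) , κ :* (con (+ 1) :+ q :* q :* (τ :* τ)) }) (q ∷ κ ∷ τ ∷ []) τ-κ)
    (ℛ.*-congˡ (ℛ.+-congˡ (ℛ.*-congʳ (ℛ.*-cong dil-q≋qq dil-q≋qq)))))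

-- In terms of d = κ₂ (τ + κ) one has κ = τ − q² d, and the relations between τ, d and τ₂ are
-- d-τ (from τ-κ) and τ₂-quadratic (from τ₂-κ₂).
d : PS
d = κ₂ · (τ ⊕ κ)

d̂ : Pointed
d̂ = d at0≡ + 2 by ≡.trans (·-0 κ₂ (τ ⊕ κ)) (cong₂ ℤ._*_ (at0≡value κ̂₂) (≡.trans (at-⊕ τ κ 0) (cong₂ ℤ._+_ (at0≡value τ̂) κ-at0)))

d-τ : d · (oneS ⊕ ⊝ (⌜ + 2 ⌝ · q · τ) ⊕ ⌜ + 3 ⌝ · q · q · τ · τ) ⊕ q · q · q · d · d · (oneS ⊕ ⊝ (q · τ)) ≋ ⌜ + 2 ⌝ · τ · τ · τ
d-τ = cancel-q^ 2 (deduce (λ { (q ∷ κ ∷ κ₂ ∷ τ ∷ []) →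
    let d = κ₂ :* (τ :+ κ) in
    q :^ 2 :* (d :* (con (+ 1) :- con (+ 2) :* q :* τ :+ con (+ 3) :* q :* q :* τ :* τ) :+ q :* q :* q :* d :* d :* (con (+ 1) :- q :* τ)) ,
    q :^ 2 :* (con (+ 2) :* τ :* τ :* τ) ,
    (con (+ 1) , (con (+ 1) :- q :* τ) :* (τ :+ q :* (κ :* κ)) , κ :* (con (+ 1) :+ q :* q :* (τ :* τ))) ∷
    (q :^ 3 :* κ :* κ₂ :+ q :^ 3 :* κ₂ :* τ :+ q :^ 2 :* κ :* τ :+ con (+ 2) :* q :^ 2 :* τ :^ 2 :+ con (+ 1) :- q :^ 4 :* κ :* κ₂ :* τ :- q :^ 4 :* κ₂ :* τ :^ 2 :- q :* κ :- q :* τ , q :* q :* κ₂ :* (τ :+ κ) , τ :- κ) ∷ [] })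
  (q ∷ κ ∷ κ₂ ∷ τ ∷ []) (τ-κ , κ₂-τ))

τ₂-quadratic : q · q · τ · (⌜ + 2 ⌝ · τ ⊕ ⊝ (q · q · d)) · τ₂ · τ₂ ⊕ (τ ⊕ ⊝ (q · q · d)) · d ≋ ⌜ + 2 ⌝ · τ · (τ ⊕ ⊝ (q · q · d)) · τ₂
τ₂-quadratic = deduce-after (λ { (q ∷ κ ∷ κ₂ ∷ τ ∷ τ₂ ∷ []) →
    let d = κ₂ :* (τ :+ κ) in
    con (+ 2) , q :* q :* τ :* (con (+ 2) :* τ :- q :* q :* d) :* τ₂ :* τ₂ :+ (τ :- q :* q :* d) :* d , con (+ 2) :* τ :* (τ :- q :* q :* d) :* τ₂ ,
    (con (+ 0) :- (τ :+ κ) :* (τ :+ κ) , (con (+ 1) :- q :* q :* τ₂) :* (τ₂ :+ q :* q :* (κ₂ :* κ₂)) , κ₂ :* (con (+ 1) :+ q :* q :* (q :* q) :* (τ₂ :* τ₂))) ∷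
    (κ :* τ₂ :+ con (+ 3) :* τ :* τ₂ :- q :^ 2 :* κ :* κ₂ :* τ₂ :- q :^ 2 :* κ :* τ₂ :^ 2 :- q :^ 2 :* κ₂ :* τ :* τ₂ :- con (+ 3) :* q :^ 2 :* τ :* τ₂ :^ 2
     :- κ :* κ₂ :- κ₂ :* τ , q :* q :* κ₂ :* (τ :+ κ) , τ :- κ) ∷ [] })
  (q̂ ∷ κ̂ ∷ κ̂₂ ∷ τ̂ ∷ τ̂₂ ∷ []) (τ₂-κ₂ , κ₂-τ)

on-vars : (∀ {n} → Expr n → Expr n → Expr n → Expr n → Expr n → Expr n → Expr n × Expr n) → Expr 6 × Expr 6
on-vars f = f (var (# 0)) (var (# 1)) (var (# 2)) (var (# 3)) (var (# 4)) (var (# 5))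

⟦⟧-cong : ∀ {n} (e : Expr n) {ρ ρ′ : Vec PS n} → (∀ i → lookup ρ i ≋ lookup ρ′ i) → ℛ.⟦ e ⟧ ρ ≋ ℛ.⟦ e ⟧ ρ′
⟦⟧-cong (con (+ 0))           h = ℛ.refl
⟦⟧-cong (con (+ 1))           h = ℛ.refl
⟦⟧-cong (con (+ suc (suc n))) h = ℛ.refl
⟦⟧-cong (con (ℤ.-[1+ n ]))    h = ℛ.refl
⟦⟧-cong (var i)  h = h i
⟦⟧-cong (a :+ b) h = ℛ.+-cong (⟦⟧-cong a h) (⟦⟧-cong b h)
⟦⟧-cong (a :- b) h = ℛ.+-cong (⟦⟧-cong a h) (ℛ.-‿cong (⟦⟧-cong b h))
⟦⟧-cong (a :* b) h = ℛ.*-cong (⟦⟧-cong a h) (⟦⟧-cong b h)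
⟦⟧-cong (a :^ k) h = ℛ.^-cong k (⟦⟧-cong a h)

-- The same series twice. The relations are stated in κ and s = τ + κ, and proved after q² d = τ - κ
-- has removed both, so that q, τ, d and τ₂ remain, subject to two equations.
by-κ by-d : Vec PS 6
by-κ = q ∷ τ ∷ d ∷ τ₂ ∷ κ ∷ τ ⊕ κ ∷ []
by-d = q ∷ τ ∷ d ∷ τ₂ ∷ τ ⊕ ⊝ (q · q · d) ∷ ⌜ + 2 ⌝ · τ ⊕ ⊝ (q · q · d) ∷ []

κ-s : ∀ i → lookup by-κ i ≋ lookup by-d i
κ-s zero = ℛ.refl
κ-s (suc zero) = ℛ.refl
κ-s (suc (suc zero)) = ℛ.refl
κ-s (suc (suc (suc zero))) = ℛ.refl
κ-s (suc (suc (suc (suc zero)))) = deduce (λ { (q ∷ κ ∷ κ₂ ∷ τ ∷ []) → κ , τ :- q :* q :* (κ₂ :* (τ :+ κ)) ,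
  (con (+ 1) , q :* q :* κ₂ :* (τ :+ κ) , τ :- κ) ∷ [] }) (q ∷ κ ∷ κ₂ ∷ τ ∷ []) κ₂-τ
κ-s (suc (suc (suc (suc (suc zero))))) = deduce (λ { (q ∷ κ ∷ κ₂ ∷ τ ∷ []) → τ :+ κ , con (+ 2) :* τ :- q :* q :* (κ₂ :* (τ :+ κ)) ,
  (con (+ 1) , q :* q :* κ₂ :* (τ :+ κ) , τ :- κ) ∷ [] }) (q ∷ κ ∷ κ₂ ∷ τ ∷ []) κ₂-τ

eliminate : ∀ e → ℛ.⟦ e ⟧ by-κ ≋ ℛ.⟦ e ⟧ by-d
eliminate e = ⟦⟧-cong e {by-κ} {by-d} κ-s

-- The relation `κκ₂+τ₂τ₂` multiplied by s², where κ₂ occurs only through d = κ₂ s.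
parametric₆ : ∀ {n} → Expr n → Expr n → Expr n → Expr n → Expr n → Expr n → Expr n × Expr n
parametric₆ q τ d τ₂ κ s = (κ :* d :+ q :* s :* (τ₂ :* τ₂)) :^ 2 :* τ :* (con (+ 1) :- q :* q :* τ₂) ,
  (con (+ 1) :- q :* q :* (τ :* τ)) :* (con (+ 1) :+ q :* q :* τ₂) :* κ :* d :* s :* (τ₂ :* τ₂)

parametric₆-holds : let l , r = on-vars parametric₆ in ℛ.⟦ l ⟧ by-κ ≋ ℛ.⟦ r ⟧ by-κ
parametric₆-holds = let l , r = on-vars parametric₆ in ℛ.trans (eliminate l) (ℛ.trans (cancel-q^ 8 (deduce-after (λ { (q ∷ τ ∷ d ∷ τ₂ ∷ []) →
    let κ = τ :- q :* q :* d
        s = con (+ 2) :* τ :- q :* q :* d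
        l , r = parametric₆ q τ d τ₂ κ s
    -- In τ₂ the claim has degree 5, and `τ₂-quadratic` has leading coefficient q² τ s. Four
    -- reduction steps bring the degree down to 1, at the price of the factor q⁸ τ⁴ s⁴; the rest is
    -- a multiple of `d-τ`. The cofactors record this.
    in con (+ 1) :* τ :^ 4 :* s :^ 4 , q :^ 8 :* l , q :^ 8 :* r ,
    (q :^ 20 :* τ :^ 4 :* d :^ 5 :* τ₂ :^ 3 :+ con (+ 2) :* q :^ 19 :* τ :^ 4 :* d :^ 6 :* τ₂ :+ con (+ 9) :* q :^ 18 :* τ :^ 6 :* d :^ 5 :* τ₂
     :+ q :^ 18 :* τ :^ 4 :* d :^ 5 :* τ₂ :^ 2 :+ con (+ 2) :* q :^ 17 :* τ :^ 4 :* d :^ 6 :+ con (+ 25) :* q :^ 16 :* τ :^ 6 :* d :^ 5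
     :+ con (+ 40) :* q :^ 16 :* τ :^ 6 :* d :^ 3 :* τ₂ :^ 3 :+ con (+ 2) :* q :^ 16 :* τ :^ 4 :* d :^ 5 :* τ₂
     :+ con (+ 64) :* q :^ 15 :* τ :^ 6 :* d :^ 4 :* τ₂ :+ con (+ 56) :* q :^ 14 :* τ :^ 8 :* d :^ 3 :* τ₂
     :+ con (+ 24) :* q :^ 14 :* τ :^ 6 :* d :^ 3 :* τ₂ :^ 2 :+ con (+ 2) :* q :^ 14 :* τ :^ 4 :* d :^ 5 :+ con (+ 36) :* q :^ 13 :* τ :^ 6 :* d :^ 4
     :+ con (+ 132) :* q :^ 12 :* τ :^ 8 :* d :^ 3 :+ con (+ 80) :* q :^ 12 :* τ :^ 8 :* d :* τ₂ :^ 3 :+ con (+ 36) :* q :^ 12 :* τ :^ 6 :* d :^ 3 :* τ₂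
     :+ con (+ 96) :* q :^ 11 :* τ :^ 8 :* d :^ 2 :* τ₂ :+ con (+ 16) :* q :^ 10 :* τ :^ 10 :* d :* τ₂ :+ con (+ 16) :* q :^ 10 :* τ :^ 8 :* d :* τ₂ :^ 2
     :+ con (+ 16) :* q :^ 10 :* τ :^ 6 :* d :^ 3 :+ con (+ 16) :* q :^ 9 :* τ :^ 8 :* d :^ 2 :+ con (+ 32) :* q :^ 8 :* τ :^ 10 :* d
     :+ con (+ 16) :* q :^ 8 :* τ :^ 8 :* d :* τ₂ :- q :^ 20 :* τ :^ 5 :* d :^ 6 :* τ₂ :- con (+ 3) :* q :^ 18 :* τ :^ 5 :* d :^ 6
     :- con (+ 10) :* q :^ 18 :* τ :^ 5 :* d :^ 4 :* τ₂ :^ 3 :- con (+ 18) :* q :^ 17 :* τ :^ 5 :* d :^ 5 :* τ₂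
     :- con (+ 32) :* q :^ 16 :* τ :^ 7 :* d :^ 4 :* τ₂ :- con (+ 8) :* q :^ 16 :* τ :^ 5 :* d :^ 4 :* τ₂ :^ 2 :- con (+ 14) :* q :^ 15 :* τ :^ 5 :* d :^ 5
     :- con (+ 82) :* q :^ 14 :* τ :^ 7 :* d :^ 4 :- con (+ 80) :* q :^ 14 :* τ :^ 7 :* d :^ 2 :* τ₂ :^ 3 :- con (+ 14) :* q :^ 14 :* τ :^ 5 :* d :^ 4 :* τ₂
     :- con (+ 112) :* q :^ 13 :* τ :^ 7 :* d :^ 3 :* τ₂ :- con (+ 48) :* q :^ 12 :* τ :^ 9 :* d :^ 2 :* τ₂
     :- con (+ 32) :* q :^ 12 :* τ :^ 7 :* d :^ 2 :* τ₂ :^ 2 :- con (+ 10) :* q :^ 12 :* τ :^ 5 :* d :^ 4 :- con (+ 40) :* q :^ 11 :* τ :^ 7 :* d :^ 3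
     :- con (+ 104) :* q :^ 10 :* τ :^ 9 :* d :^ 2 :- con (+ 32) :* q :^ 10 :* τ :^ 9 :* τ₂ :^ 3 :- con (+ 40) :* q :^ 10 :* τ :^ 7 :* d :^ 2 :* τ₂
     :- con (+ 32) :* q :^ 9 :* τ :^ 9 :* d :* τ₂ :- con (+ 8) :* q :^ 8 :* τ :^ 7 :* d :^ 2 ,
     q :* q :* τ :* s :* τ₂ :* τ₂ :+ κ :* d , con (+ 2) :* τ :* κ :* τ₂) ∷
    (con (+ 2) :* q :^ 18 :* τ :^ 4 :* d :^ 6 :* τ₂ :+ con (+ 2) :* q :^ 16 :* τ :^ 4 :* d :^ 6 :+ con (+ 74) :* q :^ 14 :* τ :^ 6 :* d :^ 4 :* τ₂
     :+ con (+ 26) :* q :^ 12 :* τ :^ 6 :* d :^ 4 :+ con (+ 104) :* q :^ 10 :* τ :^ 8 :* d :^ 2 :* τ₂ :+ con (+ 8) :* q :^ 8 :* τ :^ 8 :* d :^ 2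
     :- con (+ 20) :* q :^ 16 :* τ :^ 5 :* d :^ 5 :* τ₂ :- con (+ 12) :* q :^ 14 :* τ :^ 5 :* d :^ 5 :- con (+ 128) :* q :^ 12 :* τ :^ 7 :* d :^ 3 :* τ₂
     :- con (+ 24) :* q :^ 10 :* τ :^ 7 :* d :^ 3 :- con (+ 32) :* q :^ 8 :* τ :^ 9 :* d :* τ₂ ,
     d :* (con (+ 1) :- con (+ 2) :* q :* τ :+ con (+ 3) :* q :* q :* τ :* τ) :+ q :* q :* q :* d :* d :* (con (+ 1) :- q :* τ) , con (+ 2) :* τ :* τ :* τ) ∷ [] })
  (q̂ ∷ τ̂ ∷ d̂ ∷ τ̂₂ ∷ []) (τ₂-quadratic , d-τ))) (ℛ.sym (eliminate r)))

-- The relation `xκ+τ₂τ₂` cleared of denominators, with x = (1 + k) / (1 - k) and F₂ expressed by κ₂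
-- and τ₂ through `F₂-κ₂` and `κ₄-τ₂`.
parametric₉ : ∀ {n} → Expr n → Expr n → Expr n → Expr n → Expr n → Expr n → Expr n × Expr n
parametric₉ q τ d τ₂ κ s = ((con (+ 1) :+ q :* κ) :* κ :+ q :* q :* q :* (τ₂ :* τ₂) :* (con (+ 1) :- q :* κ)) :^ 2 :* τ :* (q :* q :* d :* (s :* τ₂ :+ d) :- s :* (s :* τ₂ :- d)) ,
  (con (+ 1) :- con (+ 3) :* q :* q :* τ₂ :+ q :* q :* (q :* q) :* (τ₂ :* τ₂)) :* (con (+ 1) :- q :* q :* (τ :* τ)) :* (con (+ 1) :+ q :* κ) :* (con (+ 1) :- q :* κ) :* κ :* τ₂ :* (q :* q :* d :* (s :* τ₂ :+ d) :+ s :* (s :* τ₂ :- d))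

parametric₉-holds : let l , r = on-vars parametric₉ in ℛ.⟦ l ⟧ by-κ ≋ ℛ.⟦ r ⟧ by-κ
parametric₉-holds = let l , r = on-vars parametric₉ in ℛ.trans (eliminate l) (ℛ.trans (cancel-q^ 8 (deduce-after (λ { (q ∷ τ ∷ d ∷ τ₂ ∷ []) →
    let κ = τ :- q :* q :* d
        s = con (+ 2) :* τ :- q :* q :* d
        l , r = parametric₉ q τ d τ₂ κ s
    in con (+ 1) :* τ :^ 4 :* s :^ 4 , q :^ 8 :* l , q :^ 8 :* r ,
    (con (+ 2) :* q :^ 28 :* τ :^ 6 :* d :^ 7 :* τ₂ :^ 2 :+ con (+ 2) :* q :^ 28 :* τ :^ 4 :* d :^ 7 :* τ₂ :^ 3
     :+ con (+ 4) :* q :^ 27 :* τ :^ 4 :* d :^ 8 :* τ₂ :+ con (+ 18) :* q :^ 26 :* τ :^ 6 :* d :^ 7 :* τ₂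
     :+ con (+ 2) :* q :^ 26 :* τ :^ 4 :* d :^ 7 :* τ₂ :^ 2 :+ con (+ 8) :* q :^ 25 :* τ :^ 4 :* d :^ 8
     :+ con (+ 4) :* q :^ 25 :* τ :^ 4 :* d :^ 6 :* τ₂ :^ 3 :+ con (+ 102) :* q :^ 24 :* τ :^ 8 :* d :^ 5 :* τ₂ :^ 2
     :+ con (+ 102) :* q :^ 24 :* τ :^ 6 :* d :^ 5 :* τ₂ :^ 3 :+ con (+ 10) :* q :^ 24 :* τ :^ 4 :* d :^ 7 :* τ₂
     :+ con (+ 248) :* q :^ 23 :* τ :^ 6 :* d :^ 6 :* τ₂ :+ con (+ 8) :* q :^ 23 :* τ :^ 4 :* d :^ 6 :* τ₂ :^ 2
     :+ con (+ 54) :* q :^ 22 :* τ :^ 8 :* d :^ 5 :* τ₂ :+ con (+ 58) :* q :^ 22 :* τ :^ 7 :* d :^ 6 :+ con (+ 80) :* q :^ 22 :* τ :^ 6 :* d :^ 5 :* τ₂ :^ 2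
     :+ con (+ 96) :* q :^ 22 :* τ :^ 4 :* d :^ 7 :+ con (+ 2) :* q :^ 22 :* τ :^ 4 :* d :^ 5 :* τ₂ :^ 3 :+ con (+ 452) :* q :^ 21 :* τ :^ 6 :* d :^ 6
     :+ con (+ 164) :* q :^ 21 :* τ :^ 6 :* d :^ 4 :* τ₂ :^ 3 :+ con (+ 48) :* q :^ 21 :* τ :^ 4 :* d :^ 6 :* τ₂
     :+ con (+ 384) :* q :^ 20 :* τ :^ 10 :* d :^ 3 :* τ₂ :^ 2 :+ con (+ 132) :* q :^ 20 :* τ :^ 9 :* d :^ 4 :* τ₂
     :+ con (+ 384) :* q :^ 20 :* τ :^ 8 :* d :^ 3 :* τ₂ :^ 3 :+ con (+ 424) :* q :^ 20 :* τ :^ 6 :* d :^ 5 :* τ₂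
     :+ con (+ 6) :* q :^ 20 :* τ :^ 4 :* d :^ 5 :* τ₂ :^ 2 :+ con (+ 1284) :* q :^ 19 :* τ :^ 8 :* d :^ 4 :* τ₂
     :+ con (+ 292) :* q :^ 19 :* τ :^ 6 :* d :^ 4 :* τ₂ :^ 2 :+ con (+ 156) :* q :^ 19 :* τ :^ 4 :* d :^ 6 :+ con (+ 510) :* q :^ 18 :* τ :^ 9 :* d :^ 4
     :+ con (+ 144) :* q :^ 18 :* τ :^ 8 :* d :^ 3 :* τ₂ :^ 2 :+ con (+ 1318) :* q :^ 18 :* τ :^ 6 :* d :^ 5
     :+ con (+ 64) :* q :^ 18 :* τ :^ 6 :* d :^ 3 :* τ₂ :^ 3 :+ con (+ 38) :* q :^ 18 :* τ :^ 4 :* d :^ 5 :* τ₂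
     :+ con (+ 2052) :* q :^ 17 :* τ :^ 8 :* d :^ 4 :+ con (+ 416) :* q :^ 17 :* τ :^ 8 :* d :^ 2 :* τ₂ :^ 3
     :+ con (+ 552) :* q :^ 17 :* τ :^ 6 :* d :^ 4 :* τ₂ :+ con (+ 160) :* q :^ 16 :* τ :^ 12 :* d :* τ₂ :^ 2
     :+ con (+ 512) :* q :^ 16 :* τ :^ 11 :* d :^ 2 :* τ₂ :+ con (+ 160) :* q :^ 16 :* τ :^ 10 :* d :* τ₂ :^ 3
     :+ con (+ 1432) :* q :^ 16 :* τ :^ 8 :* d :^ 3 :* τ₂ :+ con (+ 176) :* q :^ 16 :* τ :^ 6 :* d :^ 3 :* τ₂ :^ 2
     :+ con (+ 68) :* q :^ 16 :* τ :^ 4 :* d :^ 5 :+ con (+ 992) :* q :^ 15 :* τ :^ 10 :* d :^ 2 :* τ₂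
     :+ con (+ 608) :* q :^ 15 :* τ :^ 8 :* d :^ 2 :* τ₂ :^ 2 :+ con (+ 1184) :* q :^ 15 :* τ :^ 6 :* d :^ 4 :+ con (+ 480) :* q :^ 14 :* τ :^ 11 :* d :^ 2
     :+ con (+ 2312) :* q :^ 14 :* τ :^ 8 :* d :^ 3 :+ con (+ 96) :* q :^ 14 :* τ :^ 8 :* d :* τ₂ :^ 3 :+ con (+ 232) :* q :^ 14 :* τ :^ 6 :* d :^ 3 :* τ₂
     :+ con (+ 1312) :* q :^ 13 :* τ :^ 10 :* d :^ 2 :+ con (+ 64) :* q :^ 13 :* τ :^ 10 :* τ₂ :^ 3 :+ con (+ 480) :* q :^ 13 :* τ :^ 8 :* d :^ 2 :* τ₂
     :+ con (+ 64) :* q :^ 12 :* τ :^ 13 :* τ₂ :+ con (+ 32) :* q :^ 12 :* τ :^ 11 :* τ₂ :^ 2 :+ con (+ 672) :* q :^ 12 :* τ :^ 10 :* d :* τ₂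
     :+ con (+ 224) :* q :^ 12 :* τ :^ 8 :* d :* τ₂ :^ 2 :+ con (+ 336) :* q :^ 12 :* τ :^ 6 :* d :^ 3 :+ con (+ 64) :* q :^ 11 :* τ :^ 12 :* τ₂
     :+ con (+ 64) :* q :^ 11 :* τ :^ 10 :* τ₂ :^ 2 :+ con (+ 640) :* q :^ 11 :* τ :^ 8 :* d :^ 2 :+ con (+ 32) :* q :^ 10 :* τ :^ 13
     :+ con (+ 576) :* q :^ 10 :* τ :^ 10 :* d :+ con (+ 64) :* q :^ 9 :* τ :^ 12 :+ con (+ 32) :* q :^ 8 :* τ :^ 9 :* τ₂
     :+ con (+ 64) :* q :^ 8 :* τ :^ 8 :* d :- con (+ 2) :* q :^ 28 :* τ :^ 5 :* d :^ 8 :* τ₂ :- con (+ 22) :* q :^ 26 :* τ :^ 7 :* d :^ 6 :* τ₂ :^ 2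
     :- con (+ 22) :* q :^ 26 :* τ :^ 5 :* d :^ 6 :* τ₂ :^ 3 :- con (+ 48) :* q :^ 25 :* τ :^ 5 :* d :^ 7 :* τ₂
     :- con (+ 58) :* q :^ 24 :* τ :^ 7 :* d :^ 6 :* τ₂ :- con (+ 6) :* q :^ 24 :* τ :^ 6 :* d :^ 7 :- con (+ 20) :* q :^ 24 :* τ :^ 5 :* d :^ 6 :* τ₂ :^ 2
     :- con (+ 8) :* q :^ 24 :* τ :^ 3 :* d :^ 8 :- con (+ 92) :* q :^ 23 :* τ :^ 5 :* d :^ 7 :- con (+ 40) :* q :^ 23 :* τ :^ 5 :* d :^ 5 :* τ₂ :^ 3
     :- con (+ 4) :* q :^ 23 :* τ :^ 3 :* d :^ 7 :* τ₂ :- con (+ 258) :* q :^ 22 :* τ :^ 9 :* d :^ 4 :* τ₂ :^ 2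
     :- con (+ 258) :* q :^ 22 :* τ :^ 7 :* d :^ 4 :* τ₂ :^ 3 :- con (+ 100) :* q :^ 22 :* τ :^ 5 :* d :^ 6 :* τ₂
     :- con (+ 720) :* q :^ 21 :* τ :^ 7 :* d :^ 5 :* τ₂ :- con (+ 76) :* q :^ 21 :* τ :^ 5 :* d :^ 5 :* τ₂ :^ 2
     :- con (+ 16) :* q :^ 21 :* τ :^ 3 :* d :^ 7 :- con (+ 234) :* q :^ 20 :* τ :^ 8 :* d :^ 5 :- con (+ 158) :* q :^ 20 :* τ :^ 7 :* d :^ 4 :* τ₂ :^ 2
     :- con (+ 480) :* q :^ 20 :* τ :^ 5 :* d :^ 6 :- con (+ 18) :* q :^ 20 :* τ :^ 5 :* d :^ 4 :* τ₂ :^ 3 :- con (+ 4) :* q :^ 20 :* τ :^ 3 :* d :^ 6 :* τ₂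
     :- con (+ 1236) :* q :^ 19 :* τ :^ 7 :* d :^ 5 :- con (+ 352) :* q :^ 19 :* τ :^ 7 :* d :^ 3 :* τ₂ :^ 3
     :- con (+ 228) :* q :^ 19 :* τ :^ 5 :* d :^ 5 :* τ₂ :- con (+ 336) :* q :^ 18 :* τ :^ 11 :* d :^ 2 :* τ₂ :^ 2
     :- con (+ 432) :* q :^ 18 :* τ :^ 10 :* d :^ 3 :* τ₂ :- con (+ 336) :* q :^ 18 :* τ :^ 9 :* d :^ 2 :* τ₂ :^ 3
     :- con (+ 998) :* q :^ 18 :* τ :^ 7 :* d :^ 4 :* τ₂ :- con (+ 52) :* q :^ 18 :* τ :^ 5 :* d :^ 4 :* τ₂ :^ 2 :- con (+ 8) :* q :^ 18 :* τ :^ 3 :* d :^ 6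
     :- con (+ 1440) :* q :^ 17 :* τ :^ 9 :* d :^ 3 :* τ₂ :- con (+ 576) :* q :^ 17 :* τ :^ 7 :* d :^ 3 :* τ₂ :^ 2
     :- con (+ 604) :* q :^ 17 :* τ :^ 5 :* d :^ 5 :- con (+ 648) :* q :^ 16 :* τ :^ 10 :* d :^ 3 :- con (+ 16) :* q :^ 16 :* τ :^ 9 :* d :^ 2 :* τ₂ :^ 2
     :- con (+ 2198) :* q :^ 16 :* τ :^ 7 :* d :^ 4 :- con (+ 112) :* q :^ 16 :* τ :^ 7 :* d :^ 2 :* τ₂ :^ 3
     :- con (+ 138) :* q :^ 16 :* τ :^ 5 :* d :^ 4 :* τ₂ :- con (+ 2112) :* q :^ 15 :* τ :^ 9 :* d :^ 3 :- con (+ 256) :* q :^ 15 :* τ :^ 9 :* d :* τ₂ :^ 3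
     :- con (+ 720) :* q :^ 15 :* τ :^ 7 :* d :^ 3 :* τ₂ :- con (+ 32) :* q :^ 14 :* τ :^ 13 :* τ₂ :^ 2 :- con (+ 288) :* q :^ 14 :* τ :^ 12 :* d :* τ₂
     :- con (+ 32) :* q :^ 14 :* τ :^ 11 :* τ₂ :^ 3 :- con (+ 64) :* q :^ 14 :* τ :^ 10 :* d :* τ₂ :^ 2 :- con (+ 1280) :* q :^ 14 :* τ :^ 9 :* d :^ 2 :* τ₂
     :- con (+ 288) :* q :^ 14 :* τ :^ 7 :* d :^ 2 :* τ₂ :^ 2 :- con (+ 220) :* q :^ 14 :* τ :^ 5 :* d :^ 4 :- con (+ 384) :* q :^ 13 :* τ :^ 11 :* d :* τ₂
     :- con (+ 320) :* q :^ 13 :* τ :^ 9 :* d :* τ₂ :^ 2 :- con (+ 1232) :* q :^ 13 :* τ :^ 7 :* d :^ 3 :- con (+ 192) :* q :^ 12 :* τ :^ 12 :* d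
     :- con (+ 1520) :* q :^ 12 :* τ :^ 9 :* d :^ 2 :- con (+ 32) :* q :^ 12 :* τ :^ 9 :* τ₂ :^ 3 :- con (+ 160) :* q :^ 12 :* τ :^ 7 :* d :^ 2 :* τ₂
     :- con (+ 448) :* q :^ 11 :* τ :^ 11 :* d :- con (+ 128) :* q :^ 11 :* τ :^ 9 :* d :* τ₂ :- con (+ 160) :* q :^ 10 :* τ :^ 11 :* τ₂
     :- con (+ 64) :* q :^ 10 :* τ :^ 9 :* τ₂ :^ 2 :- con (+ 240) :* q :^ 10 :* τ :^ 7 :* d :^ 2 :- con (+ 128) :* q :^ 9 :* τ :^ 9 :* d
     :- con (+ 96) :* q :^ 8 :* τ :^ 11 ,
     q :* q :* τ :* s :* τ₂ :* τ₂ :+ κ :* d , con (+ 2) :* τ :* κ :* τ₂) ∷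
    (con (+ 4) :* q :^ 26 :* τ :^ 4 :* d :^ 8 :* τ₂ :+ con (+ 16) :* q :^ 23 :* τ :^ 4 :* d :^ 7 :* τ₂ :+ con (+ 160) :* q :^ 22 :* τ :^ 6 :* d :^ 6 :* τ₂
     :+ con (+ 4) :* q :^ 22 :* τ :^ 5 :* d :^ 7 :+ con (+ 80) :* q :^ 21 :* τ :^ 4 :* d :^ 7 :+ con (+ 60) :* q :^ 20 :* τ :^ 4 :* d :^ 6 :* τ₂
     :+ con (+ 576) :* q :^ 19 :* τ :^ 6 :* d :^ 5 :* τ₂ :+ con (+ 364) :* q :^ 18 :* τ :^ 8 :* d :^ 4 :* τ₂ :+ con (+ 76) :* q :^ 18 :* τ :^ 7 :* d :^ 5
     :+ con (+ 76) :* q :^ 18 :* τ :^ 4 :* d :^ 6 :+ con (+ 656) :* q :^ 17 :* τ :^ 6 :* d :^ 5 :+ con (+ 1028) :* q :^ 16 :* τ :^ 6 :* d :^ 4 :* τ₂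
     :+ con (+ 1152) :* q :^ 15 :* τ :^ 8 :* d :^ 3 :* τ₂ :+ con (+ 48) :* q :^ 14 :* τ :^ 10 :* d :^ 2 :* τ₂ :+ con (+ 64) :* q :^ 14 :* τ :^ 9 :* d :^ 3
     :+ con (+ 556) :* q :^ 14 :* τ :^ 6 :* d :^ 4 :+ con (+ 416) :* q :^ 13 :* τ :^ 8 :* d :^ 3 :+ con (+ 1520) :* q :^ 12 :* τ :^ 8 :* d :^ 2 :* τ₂
     :+ con (+ 128) :* q :^ 11 :* τ :^ 10 :* d :* τ₂ :+ con (+ 304) :* q :^ 10 :* τ :^ 8 :* d :^ 2 :+ con (+ 128) :* q :^ 8 :* τ :^ 10 :* τ₂
     :- con (+ 40) :* q :^ 24 :* τ :^ 5 :* d :^ 7 :* τ₂ :- con (+ 8) :* q :^ 23 :* τ :^ 3 :* d :^ 8 :- con (+ 4) :* q :^ 22 :* τ :^ 3 :* d :^ 7 :* τ₂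
     :- con (+ 152) :* q :^ 21 :* τ :^ 5 :* d :^ 6 :* τ₂ :- con (+ 328) :* q :^ 20 :* τ :^ 7 :* d :^ 5 :* τ₂ :- con (+ 28) :* q :^ 20 :* τ :^ 6 :* d :^ 6
     :- con (+ 8) :* q :^ 20 :* τ :^ 3 :* d :^ 7 :- con (+ 320) :* q :^ 19 :* τ :^ 5 :* d :^ 6 :- con (+ 348) :* q :^ 18 :* τ :^ 5 :* d :^ 5 :* τ₂
     :- con (+ 1112) :* q :^ 17 :* τ :^ 7 :* d :^ 4 :* τ₂ :- con (+ 208) :* q :^ 16 :* τ :^ 9 :* d :^ 3 :* τ₂ :- con (+ 100) :* q :^ 16 :* τ :^ 8 :* d :^ 4
     :- con (+ 288) :* q :^ 16 :* τ :^ 5 :* d :^ 5 :- con (+ 728) :* q :^ 15 :* τ :^ 7 :* d :^ 4 :- con (+ 1680) :* q :^ 14 :* τ :^ 7 :* d :^ 3 :* τ₂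
     :- con (+ 608) :* q :^ 13 :* τ :^ 9 :* d :^ 2 :* τ₂ :- con (+ 16) :* q :^ 12 :* τ :^ 10 :* d :^ 2 :- con (+ 576) :* q :^ 12 :* τ :^ 7 :* d :^ 3
     :- con (+ 96) :* q :^ 11 :* τ :^ 9 :* d :^ 2 :- con (+ 704) :* q :^ 10 :* τ :^ 9 :* d :* τ₂ :- con (+ 64) :* q :^ 8 :* τ :^ 9 :* d ,
     d :* (con (+ 1) :- con (+ 2) :* q :* τ :+ con (+ 3) :* q :* q :* τ :* τ) :+ q :* q :* q :* d :* d :* (con (+ 1) :- q :* τ) , con (+ 2) :* τ :* τ :* τ) ∷ [] })
  (q̂ ∷ τ̂ ∷ d̂ ∷ τ̂₂ ∷ []) (τ₂-quadratic , d-τ))) (ℛ.sym (eliminate r)))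

-- Needed for λ₆: expressed in R at q, q², q⁴ and -q², the base of the square is a product times the
-- sum `a ⊕ q · N` studied below.
κκ₂+τ₂τ₂ : (κ · κ₂ ⊕ q · (τ₂ · τ₂)) ^ˢ 2 · τ · (oneS ⊕ ⊝ (q · q · τ₂)) ≋ (oneS ⊕ ⊝ (q · q · (τ · τ))) · (oneS ⊕ q · q · τ₂) · (κ · κ₂ · (τ₂ · τ₂))
κκ₂+τ₂τ₂ = deduce-after (λ { (q ∷ κ ∷ κ₂ ∷ τ ∷ τ₂ ∷ []) →
    let l , r = parametric₆ q τ (κ₂ :* (τ :+ κ)) τ₂ κ (τ :+ κ)
    in (τ :+ κ) :^ 2 , (κ :* κ₂ :+ q :* (τ₂ :* τ₂)) :^ 2 :* τ :* (con (+ 1) :- q :* q :* τ₂) ,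
    (con (+ 1) :- q :* q :* (τ :* τ)) :* (con (+ 1) :+ q :* q :* τ₂) :* (κ :* κ₂ :* (τ₂ :* τ₂)) ,
    (con (+ 1) , l , r) ∷ [] })
  (q̂ ∷ κ̂ ∷ κ̂₂ ∷ τ̂ ∷ τ̂₂ ∷ []) parametric₆-holds

κ₄ : PS
κ₄ = dil 2 κ₂

F₂-κ₂ : F₂ · (κ₂ ⊕ q · q · κ₄) ≋ κ₂ ⊕ ⊝ (q · q · κ₄)
F₂-κ₂ = ℛ.trans (ℛ.*-congˡ (ℛ.+-congˡ (ℛ.*-congʳ (ℛ.sym dil-q≋qq))))
  (ℛ.trans (substitute (dil-isSubst 1) (λ { (q ∷ κ ∷ κ₂ ∷ F ∷ []) → F :* (κ :+ q :* κ₂) , κ :- q :* κ₂ }) (q ∷ κ ∷ κ₂ ∷ F ∷ []) F-κ)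
    (ℛ.+-congˡ (ℛ.-‿cong (ℛ.*-congʳ dil-q≋qq))))

κ₄-τ₂ : q · q · (q · q) · κ₄ · (τ₂ ⊕ κ₂) ≋ τ₂ ⊕ ⊝ κ₂
κ₄-τ₂ = ℛ.trans (ℛ.*-congʳ (ℛ.*-congʳ (ℛ.*-cong (ℛ.sym dil-q≋qq) (ℛ.sym dil-q≋qq))))
  (substitute (dil-isSubst 1) (λ { (q ∷ κ ∷ κ₂ ∷ τ ∷ []) → q :* q :* κ₂ :* (τ :+ κ) , τ :- κ }) (q ∷ κ ∷ κ₂ ∷ τ ∷ []) κ₂-τ)

-- The analogue for λ₉: after multiplication by R the base of the square is R₂³ R₈ times the sum in
-- `a+qqqR₈m`.
xκ+τ₂τ₂ : (x · κ ⊕ q · q · q · (τ₂ · τ₂)) ^ˢ 2 · τ · F₂ ≋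
  (oneS ⊕ ⊝ (⌜ + 3 ⌝ · q · q · τ₂) ⊕ q · q · (q · q) · (τ₂ · τ₂)) · (oneS ⊕ ⊝ (q · q · (τ · τ))) · (x · κ · τ₂)
xκ+τ₂τ₂ = cancel-q^ 2 (deduce-after (λ { (q ∷ κ ∷ κ₂ ∷ κ₄ ∷ τ ∷ τ₂ ∷ x ∷ F₂ ∷ []) →
    let s = τ :+ κ
        u = con (+ 1) :- q :* κ
        w = con (+ 1) :+ q :* κ
        W = (x :* κ :+ q :* q :* q :* (τ₂ :* τ₂)) :^ 2 :* τ
        p = (con (+ 1) :- con (+ 3) :* q :* q :* τ₂ :+ q :* q :* (q :* q) :* (τ₂ :* τ₂)) :* (con (+ 1) :- q :* q :* (τ :* τ))
        c = (τ₂ :+ κ₂) :* (κ₂ :+ q :* q :* κ₄)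
        num = q :* q :* κ₂ :* (τ₂ :+ κ₂) :- (τ₂ :- κ₂)
        den = q :* q :* κ₂ :* (τ₂ :+ κ₂) :+ (τ₂ :- κ₂)
        l , r = parametric₉ q τ (κ₂ :* s) τ₂ κ s
    in c :* (u :* s) :^ 2 , q :^ 2 :* (W :* F₂) , q :^ 2 :* (p :* (x :* κ :* τ₂)) ,
    (con (+ 1) , l , r) ∷
    (s :^ 2 :* u :^ 2 :* W :* q :^ 2 :* (τ₂ :+ κ₂) , F₂ :* (κ₂ :+ q :* q :* κ₄) , κ₂ :- q :* q :* κ₄) ∷
    (con (+ 0) :- s :^ 2 :* u :^ 2 :* (W :+ p :* x :* κ :* τ₂) , q :* q :* (q :* q) :* κ₄ :* (τ₂ :+ κ₂) , τ₂ :- κ₂) ∷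
    (s :^ 2 :* (κ :* (u :* x :* κ :+ w :* κ :+ con (+ 2) :* q :^ 3 :* (τ₂ :* τ₂) :* u) :* τ :* num :- u :* p :* κ :* τ₂ :* den) , x :* u , w) ∷ [] })
  (q̂ ∷ κ̂ ∷ κ̂₂ ∷ δ̂ κ̂₂ ∷ τ̂ ∷ τ̂₂ ∷ x̂ ∷ F̂₂ ∷ []) (parametric₉-holds , F₂-κ₂ , κ₄-τ₂ , x-κ))

-- Odd parts

fine-at0 : OneAt0 fine
fine-at0 zero = coarse-at0 (# 0)
fine-at0 (suc zero) = coarse-at0 (# 2)
fine-at0 (suc (suc zero)) = coarse-at0 (# 4)
fine-at0 (suc (suc (suc i))) = ≡.subst (λ p → (proj₁ p 0 ≡ + 1) × (proj₂ p 0 ≡ + 1)) (≡.sym (lookup-map i (both (dil 2)) coarse))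
  (≡.trans (dil-at0 2 (proj₁ (lookup coarse i))) (proj₁ (coarse-at0 i)) , ≡.trans (dil-at0 2 (proj₂ (lookup coarse i))) (proj₂ (coarse-at0 i)))

square-root : (f g : Pointed) → value f ≡ + 1 → value g ≡ + 1 → series f · series f ≋ series g · series g → series f ≋ series g
square-root f@(_ at0≡ _ by _) g@(_ at0≡ _ by _) refl refl e =
  deduce-after (λ { (f ∷ g ∷ []) → f :+ g , f , g , (con (+ 1) , f :* f , g :* g) ∷ [] }) (f ∷ g ∷ []) e

R-at0 : R 0 ≡ + 1
R-at0 = ≡.trans (at R≋ 0) (eval-at0 coarse coarse-at0 Rʷ)

R̂ R̂₂ R̂₄ R̂⁻ : Pointed
R̂ = R at0≡ + 1 by R-at0
R̂₂ = δ̂ R̂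
R̂₄ = δ̂ R̂₂
R̂⁻ = ν̂ R̂

-- The square root of the product κ κ₂ M, which equals (κ + qκ₂)² by the quadratic equation of κ.
eʷ : Word 8
eʷ = gen (# 2) ∙ gen (# 3) ∙ gen⁻¹ (# 1) ∙ gen⁻¹ (# 5)

κ+qκ₂ : κ ⊕ q · κ₂ ≋ eval eʷ fine
κ+qκ₂ = square-root ((κ ⊕ q · κ₂) at0≡ + 1 by constantTerm-correct (var (# 0) :+ var (# 1) :* var (# 2)) (κ̂ ∷ q̂ ∷ κ̂₂ ∷ []))
  (eval eʷ fine at0≡ + 1 by eval-at0 fine fine-at0 eʷ) refl refl
  (deduce (λ { (q ∷ κ ∷ κ₂ ∷ M ∷ e ∷ []) → (κ :+ q :* κ₂) :* (κ :+ q :* κ₂) , e :* e ,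
    (con (+ 1) , κ :* κ :* (con (+ 1) :+ q :* q :* κ₂) :+ con (+ 2) :* q :* κ :* κ₂ , κ₂ :* (con (+ 1) :- q :* q :* κ₂)) ∷
    (con (+ 0) :- κ₂ , κ :* M , con (+ 1) :- q :* q :* (κ :* κ)) ∷
    (con (+ 1) , κ :* κ₂ :* M , e :* e) ∷ [] }) (q ∷ κ ∷ κ₂ ∷ M ∷ eval eʷ fine ∷ [])
    (κ-quadratic , κM≋1-qqκκ , ℛ.trans (ℛ.*-cong (ℛ.*-cong (here κʷ) (doubled κʷ)) (here Mʷ)) (units! (κʷ ⟪ σ ⟫ ∙ κʷ ⟪ σδ ⟫ ∙ Mʷ ⟪ σ ⟫) (eʷ ∙ eʷ))))

ϖʷ : Word 5
ϖʷ = w₂ ∙ w₃ ∙ (w₄ ∙ w₅) ⁻¹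

ϖ ϖ₂ : PS
ϖ = eval ϖʷ coarse
ϖ₂ = dil 2 ϖ

1-qqκ₂ : oneS ⊕ ⊝ (q · q · κ₂) ≋ dil 2 a₋
1-qqκ₂ = ℛ.trans (ℛ.+-congˡ (ℛ.-‿cong (ℛ.*-congʳ (ℛ.sym dil-q≋qq))))
  (substitute (dil-isSubst 1) (λ { (q ∷ κ ∷ a ∷ []) → con (+ 1) :- q :* κ , a }) (q ∷ κ ∷ a₋ ∷ []) 1-qκ≋a₋)

zR≋R⁻ : z · R ≋ R⁻
zR≋R⁻ = ℛ.trans (ℛ.*-cong (ℛ.*-cong (here xʷ) (doubled xʷ)) (ℛ.trans R≋ (here Rʷ)))
  (ℛ.trans (units! (xʷ ⟪ σ ⟫ ∙ xʷ ⟪ σδ ⟫ ∙ Rʷ ⟪ σ ⟫) (Rʷ ⟪ σν ⟫)) (ℛ.sym R⁻≋))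

-- As R(-q) = z R and z = (1 + k)(1 + k₂) / ((1 - k)(1 - k₂)), the difference is 2(k + k₂) R / ((1 -
-- k)(1 - k₂)). Its numerator is a product by `κ+qκ₂`, and everything of odd level cancels, leaving
-- a product in q².
R⁻-R : R⁻ ⊕ ⊝ R ≋ ⌜ + 2 ⌝ · q · ϖ₂
R⁻-R = deduce-after (λ { (q ∷ κ ∷ κ₂ ∷ z ∷ R ∷ R⁻ ∷ e ∷ a ∷ b ∷ ϖ ∷ []) →
    let u₁ = con (+ 1) :- q :* κ
        u₂ = con (+ 1) :- q :* q :* κ₂
    in u₁ :* u₂ , R⁻ :- R , con (+ 2) :* q :* ϖ ,
    (con (+ 0) :- u₁ :* u₂ , z :* R , R⁻) ∷
    (R , u₁ :* u₂ :* z , (con (+ 1) :+ q :* κ) :* (con (+ 1) :+ q :* q :* κ₂)) ∷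
    (con (+ 2) :* q :* R , κ :+ q :* κ₂ , e) ∷
    (con (+ 2) :* q , R :* e , a :* b :* ϖ) ∷
    (con (+ 0) :- con (+ 2) :* q :* ϖ :* b , u₁ , a) ∷
    (con (+ 0) :- con (+ 2) :* q :* ϖ :* u₁ , u₂ , b) ∷ [] })
  (q̂ ∷ κ̂ ∷ κ̂₂ ∷ ẑ ∷ R̂ ∷ R̂⁻ ∷ (eval eʷ fine at0≡ + 1 by eval-at0 fine fine-at0 eʷ) ∷ â₋ ∷ δ̂ â₋ ∷ δ̂ (ϖ at0≡ + 1 by eval-at0 coarse coarse-at0 ϖʷ) ∷ [])
  (zR≋R⁻ , z-κ , κ+qκ₂ ,
   ℛ.trans (ℛ.*-congʳ (ℛ.trans R≋ (here Rʷ))) (ℛ.trans (units! (Rʷ ⟪ σ ⟫ ∙ eʷ) (aʷ₋ ⟪ σ ⟫ ∙ aʷ₋ ⟪ σδ ⟫ ∙ ϖʷ ⟪ σδ ⟫))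
     (ℛ.sym (ℛ.*-cong (ℛ.*-cong (here aʷ₋) (doubled aʷ₋)) (doubled ϖʷ)))) ,
   1-qκ≋a₋ , 1-qqκ₂)

-- `N` is R(-q²). `ω` is the square root supplied by `RF⁻M⁻≋R₂F₂ωω`; it is chosen so that ω ϖ =
-- g₅(-q) / g₅(q), a series in q⁵.
N F₂⁻ β₂⁻ F₄ R₈ ω : PS
N = dil 2 R⁻
F₂⁻ = dil 2 F⁻
β₂⁻ = dil 2 β⁻
F₄ = dil 2 F₂
R₈ = dil 2 R₄

vʷ : Word 5
vʷ = w₄ ∙ (w₂ ∙ w₃) ⁻¹

ω = negq g₅ · eval vʷ coarse

R₂NR₄≋ : R₂ · N · R₄ ≋ R₈
R₂NR₄≋ = substitute (dil-isSubst 1) (λ { (R ∷ R⁻ ∷ R₂ ∷ R₄ ∷ []) → R :* R⁻ :* R₂ , R₄ }) (R ∷ R⁻ ∷ R₂ ∷ R₄ ∷ []) RR⁻R₂≋R₄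

R₂R₄R₄≋κ₂ : R₂ · (R₄ · R₄) ≋ κ₂
R₂R₄R₄≋κ₂ = substitute (dil-isSubst 1) (λ { (R ∷ R₂ ∷ κ ∷ []) → R :* (R₂ :* R₂) , κ }) (R ∷ R₂ ∷ κ ∷ []) RR₂R₂≋κ

R₂R₈≋τ₂ : R₂ · R₈ ≋ τ₂
R₂R₈≋τ₂ = substitute (dil-isSubst 1) (λ { (R ∷ R₄ ∷ τ ∷ []) → R :* R₄ , τ }) (R ∷ R₄ ∷ τ ∷ []) RR₄≋τ

RF⁻M⁻≋R₂F₂ωω : R · (F⁻ · M⁻) ≋ R₂ · F₂ · (ω · ω)
RF⁻M⁻≋R₂F₂ωω = ℛ.trans (ℛ.*-cong (ℛ.trans R≋ (here Rʷ)) (ℛ.*-cong (negated Fʷ) (negated Mʷ)))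
  (ℛ.trans (units! (Rʷ ⟪ σ ⟫ ∙ (Fʷ ⟪ σν ⟫ ∙ Mʷ ⟪ σν ⟫)) (R₂ʷ ⟪ σ ⟫ ∙ Fʷ ⟪ σδ ⟫ ∙ (w₅ ⟪ σν ⟫ ∙ vʷ ⟪ σ ⟫ ∙ (w₅ ⟪ σν ⟫ ∙ vʷ ⟪ σ ⟫))))
    (ℛ.sym (ℛ.*-cong (ℛ.*-cong (ℛ.trans R₂≋ (here R₂ʷ)) (doubled Fʷ)) (ℛ.*-cong (ℛ.*-cong (negated w₅) (here vʷ)) (ℛ.*-cong (negated w₅) (here vʷ))))))

F₂F₂⁻≋F₄F₄ : F₂ · F₂⁻ ≋ F₄ · F₄
F₂F₂⁻≋F₄F₄ = substitute (dil-isSubst 1) (λ { (F ∷ F⁻ ∷ F₂ ∷ []) → F :* F⁻ , F₂ :* F₂ }) (F ∷ F⁻ ∷ F₂ ∷ []) FF⁻≋F₂F₂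

F₂⁻-τ₂ : F₂⁻ · (oneS ⊕ ⊝ (q · q · τ₂)) ≋ oneS ⊕ q · q · τ₂
F₂⁻-τ₂ = ℛ.trans (ℛ.*-congˡ (ℛ.+-congˡ (ℛ.-‿cong (ℛ.*-congʳ (ℛ.sym dil-q≋qq)))))
  (ℛ.trans (substitute (dil-isSubst 1) (λ { (q ∷ τ ∷ F ∷ []) → F :* (con (+ 1) :- q :* τ) , con (+ 1) :+ q :* τ }) (q ∷ τ ∷ F⁻ ∷ []) F⁻-τ)
    (ℛ.+-congˡ (ℛ.*-congʳ dil-q≋qq)))

β₂⁻-τ₂ : oneS ⊕ ⊝ (⌜ + 3 ⌝ · q · q · τ₂) ⊕ q · q · (q · q) · (τ₂ · τ₂) ≋ τ₂ · (β₂⁻ · β₂⁻)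
β₂⁻-τ₂ = deduce (λ { (q ∷ q₂ ∷ τ ∷ M ∷ β ∷ []) →
    con (+ 1) :- con (+ 3) :* q :* q :* τ :+ q :* q :* (q :* q) :* (τ :* τ) , τ :* (β :* β) ,
    (con (+ 1) , con (+ 1) :+ q₂ :* q₂ :* (τ :* τ) , τ :* (con (+ 2) :* q₂ :+ M)) ∷
    (con (+ 0) :- τ , β :* β , M :- q₂) ∷
    (con (+ 3) :* τ :- (q₂ :+ q :* q) :* τ :* τ , q₂ , q :* q) ∷ [] })
  (q ∷ dil 2 q ∷ τ₂ ∷ dil 2 M⁻ ∷ β₂⁻ ∷ [])
  (substitute (dil-isSubst 1) (λ { (q ∷ τ ∷ M ∷ []) → con (+ 1) :+ q :* q :* (τ :* τ) , τ :* (con (+ 2) :* q :+ M) }) (q ∷ τ ∷ M⁻ ∷ []) 1/t+t ,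
   substitute (dil-isSubst 1) (λ { (q ∷ M ∷ β ∷ []) → β :* β , M :- q }) (q ∷ M⁻ ∷ β⁻ ∷ []) β⁻β⁻ , dil-q≋qq)

ω-at0 : ω 0 ≡ + 1
ω-at0 = ·-at0 (negq g₅) (eval vʷ coarse) (at0≡value (ν̂ ĝ₅)) (eval-at0 coarse coarse-at0 vʷ)

N̂ R̂₈ ω̂ F̂₂⁻ β̂₂⁻ F̂₄ : Pointed
N̂ = δ̂ R̂⁻
R̂₈ = δ̂ R̂₄
ω̂ = ω at0≡ + 1 by ω-at0
F̂₂⁻ = δ̂ F̂⁻
β̂₂⁻ = δ̂ β̂⁻
F̂₄ = δ̂ F̂₂

module _ (a : PS) (a-at0 : a 0 ≡ + 1) where
  private
    â : Pointed
    â = a at0≡ + 1 by a-at0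

  -- Here κκ₂ + qτ₂² = R₂⁴ R₄² N (a + qN), so `κκ₂+τ₂τ₂` makes the square of a + qN a product. Of
  -- its two roots, F₄ ω has constant term 1.
  a+qN : a · (R₂ · N) ≋ R → a ⊕ q · N ≋ F₄ · ω
  a+qN e = square-root ((a ⊕ q · N) at0≡ + 1 by constantTerm-correct (var (# 0) :+ var (# 1) :* var (# 2)) (â ∷ q̂ ∷ N̂ ∷ []))
    ((F₄ · ω) at0≡ + 1 by constantTerm-correct (var (# 0) :* var (# 1)) (F̂₄ ∷ ω̂ ∷ [])) refl refl
    (deduce-after (λ { (R ∷ R₂ ∷ F₂ ∷ F₂⁻ ∷ F₄ ∷ FM ∷ s ∷ ω ∷ []) →
      R₂ , s :* s , F₄ :* ω :* (F₄ :* ω) ,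
      (con (+ 1) , s :* s :* R₂ , FM :* F₂⁻ :* R) ∷ (F₂⁻ , R :* FM , R₂ :* F₂ :* (ω :* ω)) ∷ (R₂ :* (ω :* ω) , F₂ :* F₂⁻ , F₄ :* F₄) ∷ [] })
      (R̂ ∷ R̂₂ ∷ F̂₂ ∷ F̂₂⁻ ∷ F̂₄ ∷ ((F⁻ · M⁻) at0≡ + 1 by ·-at0 F⁻ M⁻ (at0≡value F̂⁻) (at0≡value M̂⁻)) ∷ ŝ ∷ ω̂ ∷ [])
      (squared , RF⁻M⁻≋R₂F₂ωω , F₂F₂⁻≋F₄F₄))
    where
    s : PS
    s = a ⊕ q · N
    ŝ : Pointed
    ŝ = s at0≡ + 1 by constantTerm-correct (var (# 0) :+ var (# 1) :* var (# 2)) (â ∷ q̂ ∷ N̂ ∷ [])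
    squared : s · s · R₂ ≋ F⁻ · M⁻ · F₂⁻ · R
    squared = deduce-after (λ { (q ∷ R ∷ R₂ ∷ R₄ ∷ N ∷ s ∷ FM ∷ F₂⁻ ∷ τ ∷ τ₂ ∷ κκ₂ ∷ []) →
        let A = κκ₂ :+ q :* (τ₂ :* τ₂)
            B = κκ₂ :* (τ₂ :* τ₂)
            E = R₂ :^ 4 :* R₄ :^ 2 :* N :* s
            G = R :* R₂ :^ 7 :* R₄ :^ 4 :* N :^ 2
            d = con (+ 1) :- q :* q :* τ₂
            e = con (+ 1) :+ q :* q :* τ₂
            n = con (+ 1) :- q :* q :* (τ :* τ)
        in R₂ :^ 7 :* R₄ :^ 4 :* N :^ 2 :* τ :* d , s :* s :* R₂ , FM :* F₂⁻ :* R ,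
        (con (+ 0) :- (A :+ E) :* τ :* d , A , E) ∷ (con (+ 1) , A :^ 2 :* τ :* d , n :* e :* B) ∷
        (n :* e , B , G) ∷ (G :* e , n , τ :* FM) ∷ (con (+ 0) :- G :* τ :* FM , F₂⁻ :* d , e) ∷ [] })
      (q̂ ∷ R̂ ∷ R̂₂ ∷ R̂₄ ∷ N̂ ∷ ŝ ∷ ((F⁻ · M⁻) at0≡ + 1 by ·-at0 F⁻ M⁻ (at0≡value F̂⁻) (at0≡value M̂⁻)) ∷ F̂₂⁻ ∷ τ̂ ∷ τ̂₂ ∷
        ((κ · κ₂) at0≡ + 1 by ·-at0 κ κ₂ (at0≡value κ̂) (at0≡value κ̂₂)) ∷ [])
      (sum-in-R , κκ₂+τ₂τ₂ , product-in-R , 1/t-t , F₂⁻-τ₂)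
      where
      sum-in-R : κ · κ₂ ⊕ q · (τ₂ · τ₂) ≋ R₂ ^ˢ 4 · R₄ ^ˢ 2 · N · s
      sum-in-R = deduce (λ { (q ∷ R ∷ R₂ ∷ R₄ ∷ N ∷ R₈ ∷ a ∷ κ ∷ κ₂ ∷ τ₂ ∷ []) →
          κ :* κ₂ :+ q :* (τ₂ :* τ₂) , R₂ :^ 4 :* R₄ :^ 2 :* N :* (a :+ q :* N) ,
          (con (+ 0) :- R₂ :^ 3 :* R₄ :^ 2 , a :* (R₂ :* N) , R) ∷
          (con (+ 0) :- κ₂ , R :* (R₂ :* R₂) , κ) ∷
          (con (+ 0) :- R :* (R₂ :* R₂) , R₂ :* (R₄ :* R₄) , κ₂) ∷
          (con (+ 0) :- q :* (R₂ :* R₈ :+ τ₂) , R₂ :* R₈ , τ₂) ∷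
          (con (+ 0) :- q :* R₂ :* R₂ :* (R₂ :* N :* R₄ :+ R₈) , R₂ :* N :* R₄ , R₈) ∷ [] })
        (q ∷ R ∷ R₂ ∷ R₄ ∷ N ∷ R₈ ∷ a ∷ κ ∷ κ₂ ∷ τ₂ ∷ []) (e , RR₂R₂≋κ , R₂R₄R₄≋κ₂ , R₂R₈≋τ₂ , R₂NR₄≋)
      product-in-R : κ · κ₂ · (τ₂ · τ₂) ≋ R · R₂ ^ˢ 7 · R₄ ^ˢ 4 · N ^ˢ 2
      product-in-R = deduce (λ { (R ∷ R₂ ∷ R₄ ∷ N ∷ R₈ ∷ κ ∷ κ₂ ∷ τ₂ ∷ []) →
          κ :* κ₂ :* (τ₂ :* τ₂) , R :* R₂ :^ 7 :* R₄ :^ 4 :* N :^ 2 ,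
          (con (+ 0) :- κ₂ :* (τ₂ :* τ₂) , R :* (R₂ :* R₂) , κ) ∷
          (con (+ 0) :- R :* (R₂ :* R₂) :* (τ₂ :* τ₂) , R₂ :* (R₄ :* R₄) , κ₂) ∷
          (con (+ 0) :- R :* (R₂ :* R₂) :* (R₂ :* (R₄ :* R₄)) :* (R₂ :* R₈ :+ τ₂) , R₂ :* R₈ , τ₂) ∷
          (con (+ 0) :- R :* (R₂ :* R₂) :* (R₂ :* (R₄ :* R₄)) :* R₂ :* R₂ :* (R₂ :* N :* R₄ :+ R₈) , R₂ :* N :* R₄ , R₈) ∷ [] })
        (R ∷ R₂ ∷ R₄ ∷ N ∷ R₈ ∷ κ ∷ κ₂ ∷ τ₂ ∷ []) (RR₂R₂≋κ , R₂R₄R₄≋κ₂ , R₂R₈≋τ₂ , R₂NR₄≋)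

  a+qqqR₈m : ∀ m → m 0 ≡ + 1 → a · R₈ ≋ oneS → m · R₂ ≋ R → a ⊕ q · q · q · R₈ · m ≋ β₂⁻ · ω
  a+qqqR₈m m m-at0 e f = square-root ŝ ((β₂⁻ · ω) at0≡ + 1 by constantTerm-correct (var (# 0) :* var (# 1)) (β̂₂⁻ ∷ ω̂ ∷ [])) refl refl
    (deduce-after (λ { (q ∷ R ∷ R₂ ∷ R₈ ∷ s ∷ FM ∷ F₂ ∷ β ∷ ω ∷ τ ∷ τ₂ ∷ xκ ∷ []) →
        let A = xκ :+ q :* q :* q :* (τ₂ :* τ₂)
            B = xκ :* τ₂
            E = R₂ :^ 3 :* R₈ :* s
            G = R₂ :^ 4 :* R₈
            n = con (+ 1) :- q :* q :* (τ :* τ)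
            p = con (+ 1) :- con (+ 3) :* q :* q :* τ₂ :+ q :* q :* (q :* q) :* (τ₂ :* τ₂)
            β² = β :* β
        in R₂ :^ 6 :* R₈ :^ 2 :* τ :* F₂ , s :* s , β :* ω :* (β :* ω) ,
        (con (+ 0) :- (R :* A :+ E) :* τ :* F₂ , R :* A , E) ∷
        (R :^ 2 , A :^ 2 :* τ :* F₂ , p :* n :* B) ∷
        (R :* p :* n , R :* B , G) ∷
        (R :* G :* n , p , τ₂ :* β²) ∷
        (R :* G :* τ₂ :* β² , n , τ :* FM) ∷
        (con (+ 0) :- R :* G :* β² :* τ :* FM , R₂ :* R₈ , τ₂) ∷
        (G :* β² :* τ :* R₂ :* R₈ , R :* FM , R₂ :* F₂ :* (ω :* ω)) ∷ [] })
      (q̂ ∷ R̂ ∷ R̂₂ ∷ R̂₈ ∷ ŝ ∷ ((F⁻ · M⁻) at0≡ + 1 by ·-at0 F⁻ M⁻ (at0≡value F̂⁻) (at0≡value M̂⁻)) ∷ F̂₂ ∷ β̂₂⁻ ∷ ω̂ ∷ τ̂ ∷ τ̂₂ ∷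
        ((x · κ) at0≡ + 1 by ·-at0 x κ (at0≡value x̂) (at0≡value κ̂)) ∷ [])
      (sum-in-R , xκ+τ₂τ₂ , product-in-R , β₂⁻-τ₂ , 1/t-t , R₂R₈≋τ₂ , RF⁻M⁻≋R₂F₂ωω))
    where
    s : PS
    s = a ⊕ q · q · q · R₈ · m
    ŝ : Pointed
    ŝ = s at0≡ + 1 by constantTerm-correct (var (# 0) :+ var (# 1) :* var (# 1) :* var (# 1) :* var (# 2) :* var (# 3)) (â ∷ q̂ ∷ R̂₈ ∷ (m at0≡ + 1 by m-at0) ∷ [])
    sum-in-R : R · (x · κ ⊕ q · q · q · (τ₂ · τ₂)) ≋ R₂ ^ˢ 3 · R₈ · s
    sum-in-R = deduce (λ { (q ∷ R ∷ R₂ ∷ R₈ ∷ a ∷ m ∷ x ∷ κ ∷ τ₂ ∷ []) →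
        R :* (x :* κ :+ q :* q :* q :* (τ₂ :* τ₂)) , R₂ :^ 3 :* R₈ :* (a :+ q :* q :* q :* R₈ :* m) ,
        (con (+ 0) :- R₂ :^ 3 , a :* R₈ , con (+ 1)) ∷
        (con (+ 0) :- R₂ :^ 2 :* q :* q :* q :* R₈ :* R₈ , m :* R₂ , R) ∷
        (con (+ 0) :- R :* x , R :* (R₂ :* R₂) , κ) ∷
        (con (+ 0) :- R₂ :* R₂ , R₂ , x :* (R :* R)) ∷
        (con (+ 0) :- R :* q :* q :* q :* (R₂ :* R₈ :+ τ₂) , R₂ :* R₈ , τ₂) ∷ [] })
      (q ∷ R ∷ R₂ ∷ R₈ ∷ a ∷ m ∷ x ∷ κ ∷ τ₂ ∷ []) (e , f , RR₂R₂≋κ , R₂≋xRR , R₂R₈≋τ₂)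
    product-in-R : R · (x · κ · τ₂) ≋ R₂ ^ˢ 4 · R₈
    product-in-R = deduce (λ { (R ∷ R₂ ∷ R₈ ∷ x ∷ κ ∷ τ₂ ∷ []) →
        R :* (x :* κ :* τ₂) , R₂ :^ 4 :* R₈ ,
        (con (+ 0) :- R :* x :* τ₂ , R :* (R₂ :* R₂) , κ) ∷
        (con (+ 0) :- R₂ :* R₂ :* τ₂ , R₂ , x :* (R :* R)) ∷
        (con (+ 0) :- R₂ :^ 3 , R₂ :* R₈ , τ₂) ∷ [] })
      (R ∷ R₂ ∷ R₈ ∷ x ∷ κ ∷ τ₂ ∷ []) (RR₂R₂≋κ , R₂≋xRR , R₂R₈≋τ₂)

-- Vanishing in residue classes modulo 5

_VanishesAt_ : PS → ℕ → Set
f VanishesAt s = ∀ n → n % 5 ≡ s → f n ≡ + 0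

vanish-progression : ∀ {f} s → (∀ n → f (5 ℕ.* n ℕ.+ s) ≡ + 0) → f VanishesAt s
vanish-progression {f} s h n e = ≡.trans (cong f (≡.trans (m≡m%n+[m/n]*n n 5) (≡.trans (ℕ.+-comm (n % 5) (n / 5 ℕ.* 5)) (cong₂ ℕ._+_ (ℕ.*-comm (n / 5) 5) e)))) (h (n / 5))

vanish-cong : ∀ {f g s} → f ≋ g → g VanishesAt s → f VanishesAt s
vanish-cong e v n p = ≡.trans (at e n) (v n p)

vanish-⊕ : ∀ {f g s} → f VanishesAt s → g VanishesAt s → (f ⊕ g) VanishesAt s
vanish-⊕ {f} {g} v w n p = ≡.trans (at-⊕ f g n) (cong₂ ℤ._+_ (v n p) (w n p))

vanish-⊝ : ∀ {f s} → f VanishesAt s → (⊝ f) VanishesAt s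
vanish-⊝ {f} v n p = ≡.trans (at-⊝ f n) (cong ℤ.-_ (v n p))

vanish-negq : ∀ {f s} → f VanishesAt s → negq f VanishesAt s
vanish-negq v n p = ≡.trans (cong (λ t → (ℤ.- (+ 1)) ℤ.^ n ℤ.* t) (v n p)) (ℤ.*-zeroʳ ((ℤ.- (+ 1)) ℤ.^ n))

-- m ↦ m a + b takes no residue class modulo 5 other than s to the class s′.
Reflects : ℕ → ℕ → ℕ → ℕ → Set
Reflects a b s s′ = At 0 × At 1 × At 2 × At 3 × At 4
  where
  At : ℕ → Set
  At r = T (not ((r ℕ.* a ℕ.+ b) % 5 ≡ᵇ s′) ∨ (r ≡ᵇ s))

reflects : ∀ a b s s′ → Reflects a b s s′ → ∀ m → (m ℕ.* a ℕ.+ b) % 5 ≡ s′ → m % 5 ≡ s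
reflects a b s s′ (t₀ , t₁ , t₂ , t₃ , t₄) m e = five-cases {λ r → m % 5 ≡ r → (r ℕ.* a ℕ.+ b) % 5 ≡ s′ → m % 5 ≡ s}
  (case 0 t₀) (case 1 t₁) (case 2 t₂) (case 3 t₃) (case 4 t₄)
  (m % 5) (m%n<n m 5) refl (≡.trans (≡.sym reduce) e)
  where
  T-implies : ∀ x y → T (not x ∨ y) → T x → T y
  T-implies true y t _ = t
  case : ∀ r → T (not ((r ℕ.* a ℕ.+ b) % 5 ≡ᵇ s′) ∨ (r ≡ᵇ s)) → m % 5 ≡ r → (r ℕ.* a ℕ.+ b) % 5 ≡ s′ → m % 5 ≡ s
  case r t p q = ≡.trans p (ℕ.≡ᵇ⇒≡ r s (T-implies ((r ℕ.* a ℕ.+ b) % 5 ≡ᵇ s′) (r ≡ᵇ s) t (ℕ.≡⇒≡ᵇ _ _ q)))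
  reduce : (m ℕ.* a ℕ.+ b) % 5 ≡ (m % 5 ℕ.* a ℕ.+ b) % 5
  reduce = ≡.trans (%-distribˡ-+ (m ℕ.* a) b 5) (≡.trans (cong (λ t → (t ℕ.+ b % 5) % 5) (≡.trans (%-distribˡ-* m a 5)
    (≡.trans (cong (λ t → (t ℕ.* (a % 5)) % 5) (≡.sym (m%n%n≡m%n m 5))) (≡.sym (%-distribˡ-* (m % 5) a 5)))))
    (≡.sym (%-distribˡ-+ (m % 5 ℕ.* a) b 5)))

vanish-q : ∀ {f} s s′ → {Reflects 1 1 s s′} → f VanishesAt s → (q · f) VanishesAt s′
vanish-q {f} s s′ {t} v zero    p = mono-below 1 f (ℕ.s≤s ℕ.z≤n)
vanish-q {f} s s′ {t} v (suc m) p = ≡.trans (mono-shift 1 f m) (v m (reflects 1 1 s s′ t m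
  (≡.trans (cong (_% 5) (≡.trans (ℕ.+-comm (m ℕ.* 1) 1) (cong suc (ℕ.*-identityʳ m)))) p)))

dil-zero : ∀ k f n → (∀ m → n ≡ m ℕ.* suc k → f m ≡ + 0) → dil (suc k) f n ≡ + 0
dil-zero k f n h with n % suc k in e
... | zero  = h (n / suc k) (≡.trans (m≡m%n+[m/n]*n n (suc k)) (cong (ℕ._+ (n / suc k) ℕ.* suc k) e))
... | suc _ = refl

vanish-dil2 : ∀ {f} s s′ → {Reflects 2 0 s s′} → f VanishesAt s → dil 2 f VanishesAt s′
vanish-dil2 {f} s s′ {t} v n p = dil-zero 1 f n λ m e → v m (reflects 2 0 s s′ t m
  (≡.trans (cong (_% 5) (≡.trans (ℕ.+-identityʳ (m ℕ.* 2)) (≡.sym e))) p))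

-- A term c q^(5j) does not move residue classes modulo 5; this is why factors that are series in q⁵
-- may be ignored throughout.
vanish-·dil5 : ∀ {f s} c → f VanishesAt s → (f · dil 5 c) VanishesAt s
vanish-·dil5 {f} {s} c v n p = ≡.trans (at-· f (dil 5 c) n) (≡.trans (sumTo-cong n term) (sumTo-0 n))
  where
  term : ∀ k → k ≤ n → f k ℤ.* dil 5 c (n ℕ.∸ k) ≡ + 0
  term k k≤n with (n ℕ.∸ k) % 5 in e
  ... | suc _ = ℤ.*-zeroʳ (f k)
  ... | zero  = cong (ℤ._* c ((n ℕ.∸ k) / 5)) (v k (≡.trans (≡.sym congruent) p))
    where
    congruent : n % 5 ≡ k % 5
    congruent = ≡.trans (cong (_% 5) (≡.trans (≡.sym (ℕ.m+[n∸m]≡n k≤n)) (cong (λ t → k ℕ.+ t)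
      (≡.trans (m≡m%n+[m/n]*n (n ℕ.∸ k) 5) (cong (ℕ._+ (n ℕ.∸ k) / 5 ℕ.* 5) e))))) ([m+kn]%n≡m%n k ((n ℕ.∸ k) / 5) 5)

vanish-⌜⌝ : ∀ {f s} c → f VanishesAt s → (⌜ c ⌝ · f) VanishesAt s
vanish-⌜⌝ {f} c v = vanish-cong (ℛ.trans (ℛ.*-comm ⌜ c ⌝ f) (ℛ.*-congˡ (ℛ.sym (Dil5.subst-⌜⌝ c)))) (vanish-·dil5 ⌜ c ⌝ v)

vanish-factor : ∀ {f g c s} → f ≋ g · dil 5 c → g VanishesAt s → f VanishesAt s
vanish-factor {c = c} e v = vanish-cong e (vanish-·dil5 c v)

vanish-dil5 : ∀ c s → dil 5 c VanishesAt suc s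
vanish-dil5 c s n p with n % 5
vanish-dil5 c s n refl | suc _ = refl

Odd : ℕ → Set
Odd n = n % 2 ≡ 1

negq-odd : ∀ f n → Odd n → negq f n ≡ ℤ.- f n
negq-odd f n o = ≡.trans (cong (ℤ._* f n) (sign n o)) (ℤ.-1*i≡-i (f n))
  where
  sign : ∀ n → Odd n → (ℤ.- (+ 1)) ℤ.^ n ≡ ℤ.- (+ 1)
  sign (suc zero)    _ = refl
  sign (suc (suc n)) o = ≡.trans (cong (λ t → (ℤ.- (+ 1)) ℤ.* ((ℤ.- (+ 1)) ℤ.* t)) (sign n (≡.trans (≡.sym ([m+kn]%n≡m%n n 1 2)) (≡.trans (cong (_% 2) (ℕ.+-comm n 2)) o)))) refl

-- L(q) - L(-q) is twice the odd part of L, so a vanishing class of `W` is inherited by the odd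
-- exponents of `L` only.
odd-coefficients : ∀ L {W s} → L ⊕ ⊝ negq L ≋ W → W VanishesAt s → ∀ n → Odd n → n % 5 ≡ s → L n ≡ + 0
odd-coefficients L {W} e v n o p = double (L n) (≡.trans (cong (λ t → L n ℤ.+ t) twice) (≡.trans (≡.sym (at-⊕ L (⊝ negq L) n)) (≡.trans (at e n) (v n p))))
  where
  twice : L n ≡ (⊝ negq L) n
  twice = ≡.trans (≡.sym (ℤ.neg-involutive (L n))) (≡.trans (cong ℤ.-_ (≡.sym (negq-odd L n o))) (≡.sym (at-⊝ (negq L) n)))
  double : ∀ i → i ℤ.+ i ≡ + 0 → i ≡ + 0
  double (+ zero)   _ = refl
  double (+ suc n)  ()
  double (-[1+ n ]) ()

⊛≋· : ∀ f g → f ⊛ g ≋ f · g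
⊛≋· f g = ℛ.reflexive (cong (λ _⋆_ → f ⋆ g) ⊛≡·)

powS≋^ : ∀ f k → powS f k ≋ f ^ˢ k
powS≋^ f zero    = ℛ.refl
powS≋^ f (suc k) = ℛ.trans (⊛≋· f (powS f k)) (ℛ.*-congˡ (powS≋^ f k))

^-at0 : ∀ f k → f 0 ≡ + 1 → (f ^ˢ k) 0 ≡ + 1
^-at0 f zero    e = refl
^-at0 f (suc k) e = ·-at0 f (f ^ˢ k) e (^-at0 f k e)

inv-equation : ∀ {d d′} → d′ 0 ≡ + 1 → d ≋ d′ → inv d · d′ ≋ oneS
inv-equation {d} {d′} o e = ℛ.trans (ℛ.*-congˡ (ℛ.sym e)) (inv-left d (≡.trans (at e 0) o))

quotient-equation : ∀ {a a′ d d′} → d′ 0 ≡ + 1 → a ≋ a′ → d ≋ d′ → (a ⊛ inv d) · d′ ≋ a′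
quotient-equation {a} {a′} {d} {d′} o e f = ℛ.trans (ℛ.*-congʳ (⊛≋· a (inv d))) (ℛ.trans (ℛ.*-assoc a (inv d) d′)
  (ℛ.trans (ℛ.*-congˡ (inv-equation o f)) (ℛ.trans (ℛ.*-identityʳ a) e)))

unit-factor : ∀ {f d a} → d 0 ≡ + 1 → a 0 ≡ + 1 → f · d ≋ a → f 0 ≡ + 1
unit-factor {f} {d} {a} d₀ a₀ e = ≡.trans (≡.sym (ℤ.*-identityʳ (f 0))) (≡.trans (cong (λ t → f 0 ℤ.* t) (≡.sym d₀)) (≡.trans (≡.sym (·-0 f d)) (≡.trans (at e 0) a₀)))

-- Vanishing classes of the theta quotients

O E : PS
O = poch 1 2
E = poch 2 2

O₅ E₅ : PS
O₅ = dil 5 O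
E₅ = dil 5 E

O₅≋ : O₅ ≋ poch 5 10
O₅≋ = poch-dil 4 0 1

E₅≋ : E₅ ≋ J
E₅≋ = poch-dil 4 1 1

O≋ : O ≋ g₁ · g₃ · O₅
O≋ = ℛ.trans (poch-dissect 0 1 4) (ℛ.trans (ℛ.solve
  (con (+ 1) :* var (# 0) :* var (# 1) :* var (# 2) :* var (# 3) :* var (# 4))
  (var (# 0) :* var (# 4) :* (var (# 1) :* var (# 3)) :* var (# 2))
  (poch 1 10 ∷ poch 3 10 ∷ poch 5 10 ∷ poch 7 10 ∷ poch 9 10 ∷ [])) (ℛ.*-congˡ (ℛ.sym O₅≋)))

E≋ : E ≋ g₂ · g₄ · E₅
E≋ = ℛ.trans (poch-dissect 1 1 4) (ℛ.trans (ℛ.solve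
  (con (+ 1) :* var (# 0) :* var (# 1) :* var (# 2) :* var (# 3) :* var (# 4))
  (var (# 0) :* var (# 3) :* (var (# 1) :* var (# 2)) :* var (# 4))
  (poch 2 10 ∷ poch 4 10 ∷ poch 6 10 ∷ poch 8 10 ∷ poch 10 10 ∷ [])) (ℛ.*-congˡ (ℛ.sym E₅≋)))

O-at0 : O 0 ≡ + 1
O-at0 = poch-at0 0 1
E-at0 : E 0 ≡ + 1
E-at0 = poch-at0 1 1

euler≋ : poch 1 1 ≋ O · E
euler≋ = pochs₂ 0 0

g₅≋ : g₅ ≋ O₅ · O₅
g₅≋ = ℛ.sym (ℛ.*-cong O₅≋ O₅≋)

ψ⁻≋ : ψ⁻ ≋ O · dil 2 E
ψ⁻≋ = ℛ.*-cong (ℛ.sym (pochs₂ 0 1)) (ℛ.sym (poch-dil 1 1 1))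

-- The reciprocal of c(q⁵) is again a series in q⁵.
vanish-quotient : ∀ {f g s} c → c 0 ≡ + 1 → f · dil 5 c ≋ g → g VanishesAt s → f VanishesAt s
vanish-quotient {f} {g} c c₀ h v = vanish-factor {c = inv c} (begin
  f                               ≈⟨ ℛ.*-identityʳ f ⟨
  f · oneS                        ≈⟨ ℛ.*-congˡ (ℛ.trans (ℛ.sym (Dil5.subst-· c (inv c))) (ℛ.trans (Dil5.subst-cong (inv-right c c₀)) Dil5.subst-1)) ⟨
  f · (dil 5 c · dil 5 (inv c))   ≈⟨ ℛ.*-assoc f (dil 5 c) (dil 5 (inv c)) ⟨
  f · dil 5 c · dil 5 (inv c)     ≈⟨ ℛ.*-congʳ h ⟩
  g · dil 5 (inv c)               ∎) v

euler₃ : (O · E) VanishesAt 3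
euler₃ = vanish-cong (ℛ.sym euler≋) (vanish-progression 3 euler-vanish₃)
euler₄ : (O · E) VanishesAt 4
euler₄ = vanish-cong (ℛ.sym euler≋) (vanish-progression 4 euler-vanish₄)

-- F is φ(-q) / φ(-q⁵), by splitting O and E into the g's and factors in q⁵.
F-vanish : ∀ s → φ⁻ VanishesAt s → F VanishesAt s
F-vanish s = vanish-quotient {f = F} φ⁻ (·-at0 (O · O) E (·-at0 O O O-at0 O-at0) E-at0)
  (ℛ.trans (ℛ.*-congˡ (ℛ.trans (Dil5.subst-· (O · O) E) (ℛ.*-congʳ (Dil5.subst-· O O))))
  (deduce (λ { (O ∷ E ∷ O₅ ∷ E₅ ∷ g₁ ∷ g₂ ∷ g₃ ∷ g₄ ∷ []) →
    g₁ :* g₁ :* g₂ :* (g₃ :* g₃) :* g₄ :* (O₅ :* O₅ :* E₅) , O :* O :* E ,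
    (con (+ 0) :- (O :+ g₁ :* g₃ :* O₅) :* E , O , g₁ :* g₃ :* O₅) ∷
    (con (+ 0) :- g₁ :* g₃ :* O₅ :* (g₁ :* g₃ :* O₅) , E , g₂ :* g₄ :* E₅) ∷ [] })
    (O ∷ E ∷ O₅ ∷ E₅ ∷ g₁ ∷ g₂ ∷ g₃ ∷ g₄ ∷ []) (O≋ , E≋)))

F₂-vanish : F VanishesAt 2
F₂-vanish = F-vanish 2 (vanish-progression 2 φ⁻-vanish₂)
F₃-vanish : F VanishesAt 3
F₃-vanish = F-vanish 3 (vanish-progression 3 φ⁻-vanish₃)

β⁻-vanish : ∀ s → ψ⁻ VanishesAt s → β⁻ VanishesAt s
β⁻-vanish s v = vanish-quotient {f = β⁻} (O · dil 2 E) (·-at0 O (dil 2 E) O-at0 (≡.trans (dil-at0 2 E) E-at0))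
  (ℛ.trans (ℛ.*-congˡ (ℛ.trans (Dil5.subst-· O (dil 2 E)) (ℛ.*-congˡ (dil-comm 4 1 E))))
  (deduce (λ { (O ∷ E ∷ O₅ ∷ E₅ ∷ g₁ ∷ g₃ ∷ d₂ ∷ d₄ ∷ β ∷ []) →
    β :* (O₅ :* E₅) , O :* E ,
    (con (+ 0) :- E , O , g₁ :* g₃ :* O₅) ∷
    (con (+ 0) :- g₁ :* g₃ :* O₅ , E , d₂ :* d₄ :* E₅) ∷
    (O₅ :* E₅ , β , g₁ :* g₃ :* (d₂ :* d₄)) ∷ [] })
    (O ∷ dil 2 E ∷ O₅ ∷ dil 2 E₅ ∷ g₁ ∷ g₃ ∷ dil 2 g₂ ∷ dil 2 g₄ ∷ β⁻ ∷ [])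
    (O≋ , substitute (dil-isSubst 1) (λ { (E ∷ E₅ ∷ g₂ ∷ g₄ ∷ []) → E , g₂ :* g₄ :* E₅ }) (E ∷ E₅ ∷ g₂ ∷ g₄ ∷ []) E≋ ,
     ℛ.trans (negated βʷ) (units! (βʷ ⟪ σν ⟫) (gen (# 0) ∙ gen (# 1) ∙ (gen (# 4) ∙ gen (# 6)))))))
  (vanish-cong (ℛ.sym ψ⁻≋) v)

β⁻₂-vanish : β⁻ VanishesAt 2
β⁻₂-vanish = β⁻-vanish 2 (vanish-progression 2 ψ⁻-vanish₂)
β⁻₄-vanish : β⁻ VanishesAt 4
β⁻₄-vanish = β⁻-vanish 4 (vanish-progression 4 ψ⁻-vanish₄)

unsign : ∀ {f s} → negq f VanishesAt s → f VanishesAt s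
unsign {f} v n p with ℤ.i*j≡0⇒i≡0∨j≡0 ((ℤ.- (+ 1)) ℤ.^ n) (v n p)
... | inj₂ z = z
... | inj₁ z = ⊥-elim (sign≢0 n z)
  where
  sign≢0 : ∀ n → (ℤ.- (+ 1)) ℤ.^ n ≢ + 0
  sign≢0 zero    ()
  sign≢0 (suc n) e = sign≢0 n (ℤ.neg-injective (≡.trans (≡.sym (ℤ.-1*i≡-i ((ℤ.- (+ 1)) ℤ.^ n))) e))

β₂-vanish : β VanishesAt 2
β₂-vanish = unsign {f = β} β⁻₂-vanish
β₄-vanish : β VanishesAt 4
β₄-vanish = unsign {f = β} β⁻₄-vanish

m : PS
m = eval (Mʷ ⁻¹) coarse

m₂ : PS
m₂ = dil 2 m

m-at0 : m 0 ≡ + 1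
m-at0 = eval-at0 coarse coarse-at0 (Mʷ ⁻¹)

Mm≋1 : M · m ≋ oneS
Mm≋1 = word-inverse {ρ = coarse} coarse-invertible Mʷ

gʷ : Word 5
gʷ = w₁ ∙ w₂ ∙ w₃ ∙ w₄

OE≋ : O · E ≋ eval gʷ coarse · (O₅ · E₅)
OE≋ = deduce (λ { (O ∷ E ∷ O₅ ∷ E₅ ∷ g₁ ∷ g₂ ∷ g₃ ∷ g₄ ∷ []) →
    O :* E , g₁ :* g₂ :* g₃ :* g₄ :* (O₅ :* E₅) ,
    (E , O , g₁ :* g₃ :* O₅) ∷ (g₁ :* g₃ :* O₅ , E , g₂ :* g₄ :* E₅) ∷ [] })
  (O ∷ E ∷ O₅ ∷ E₅ ∷ g₁ ∷ g₂ ∷ g₃ ∷ g₄ ∷ []) (O≋ , E≋)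

g₅^ : ∀ k → g₅ ^ˢ k ≋ dil 5 ((O · O) ^ˢ k)
g₅^ k = ℛ.sym (ℛ.trans (Dil5.subst-^ (O · O) k) (ℛ.^-cong k (ℛ.trans (Dil5.subst-· O O) (ℛ.sym g₅≋))))

vanish-g₅ : ∀ {f g s} k → f · g₅ ^ˢ k ≋ g → g VanishesAt s → f VanishesAt s
vanish-g₅ {f} k h = vanish-quotient {f = f} ((O · O) ^ˢ k) (^-at0 (O · O) k (·-at0 O O O-at0 O-at0)) (ℛ.trans (ℛ.*-congˡ (ℛ.sym (g₅^ k))) h)

g-vanish : ∀ s → (O · E) VanishesAt s → eval gʷ coarse VanishesAt s
g-vanish s = vanish-quotient {f = eval gʷ coarse} (O · E) (·-at0 O E O-at0 E-at0) (ℛ.trans (ℛ.*-congˡ (Dil5.subst-· O E)) (ℛ.sym OE≋))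

-- The power zero is written as w ∙ w⁻¹ for want of a unit word.
expand^ : ∀ {n} → Word n → ℕ → Word n
expand^ w zero = w ∙ w ⁻¹
expand^ w (suc k) = w ∙ expand^ w k

eval-^ : ∀ k → g₅ ^ˢ k ≋ eval (expand^ w₅ k) coarse
eval-^ zero    = ℛ.sym (coarse-invertible (# 4))
eval-^ (suc k) = ℛ.*-congˡ (eval-^ k)

-- Since M = g₅² / (g₁ g₃), each division by M multiplies by g₁ g₃ up to powers of g₅ = (q⁵;
-- q¹⁰)_∞². Thus β/M, β/M² and β/M³ become E, (q; q)_∞ and φ(-q) up to series in q⁵.
βmm-vanish : ∀ s → (O · E) VanishesAt s → (β · (m · m)) VanishesAt s
βmm-vanish s v = vanish-g₅ {f = β · (m · m)} 4 (ℛ.trans (ℛ.*-congˡ (eval-^ 4)) (coarse! (βʷ ∙ (Mʷ ⁻¹ ∙ Mʷ ⁻¹) ∙ expand^ w₅ 4) gʷ)) (g-vanish s v)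

βmmm-vanish : ∀ s → F VanishesAt s → (β · (m · (m · m))) VanishesAt s
βmmm-vanish s = vanish-g₅ {f = β · (m · (m · m))} 6 (ℛ.trans (ℛ.*-congˡ (eval-^ 6)) (coarse! (βʷ ∙ (Mʷ ⁻¹ ∙ (Mʷ ⁻¹ ∙ Mʷ ⁻¹)) ∙ expand^ w₅ 6) Fʷ))

g₂g₄-vanish : ∀ s → E VanishesAt s → (g₂ · g₄) VanishesAt s
g₂g₄-vanish s = vanish-quotient {f = g₂ · g₄} E E-at0 (ℛ.sym E≋)

βm-vanish : ∀ s → E VanishesAt s → (β · m) VanishesAt s
βm-vanish s v = vanish-g₅ {f = β · m} 2 (ℛ.trans (ℛ.*-congˡ (eval-^ 2)) (coarse! (βʷ ∙ Mʷ ⁻¹ ∙ expand^ w₅ 2) (w₂ ∙ w₄))) (g₂g₄-vanish s v)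

-- The classes 3 and 4 missed by (q; q)_∞ double to 1 and 3.
E≋dil : E ≋ dil 2 (O · E)
E≋dil = ℛ.sym (ℛ.trans (Dil2.subst-cong (ℛ.sym euler≋)) (poch-dil 1 0 0))

E₁-vanish : E VanishesAt 1
E₁-vanish = vanish-cong E≋dil (vanish-dil2 3 1 euler₃)
E₃-vanish : E VanishesAt 3
E₃-vanish = vanish-cong E≋dil (vanish-dil2 4 3 euler₄)

FM-vanish : ∀ s → (O · E) VanishesAt s → (F · M) VanishesAt s
FM-vanish s v = vanish-factor {c = (O · O) ^ˢ 2} (ℛ.trans (coarse! (Fʷ ∙ Mʷ) (gʷ ∙ expand^ w₅ 2)) (ℛ.*-congˡ (ℛ.trans (ℛ.sym (eval-^ 2)) (g₅^ 2)))) (g-vanish s v)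

negq-g₅ : negq g₅ · h₅ ≋ dil 5 (dil 2 (O · O) · (inv (O · O) · inv (O · O)))
negq-g₅ = ℛ.trans (ℛ.*-congʳ (from-norm (coarse-invertible (# 4)) norm₅)) (ℛ.trans (ℛ.*-assoc (dil 2 g₅) h₅ h₅)
  (ℛ.sym (ℛ.trans (Dil5.subst-· (dil 2 (O · O)) (inv (O · O) · inv (O · O))) (ℛ.*-cong (ℛ.trans (dil-comm 4 1 (O · O)) (Dil2.subst-cong OO)) (ℛ.trans (Dil5.subst-· (inv (O · O)) (inv (O · O))) (ℛ.*-cong i i))))))
  where
  OO : dil 5 (O · O) ≋ g₅
  OO = ℛ.trans (Dil5.subst-· O O) (ℛ.sym g₅≋)
  OO-at0 : (O · O) 0 ≡ + 1
  OO-at0 = ·-at0 O O O-at0 O-at0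
  i : dil 5 (inv (O · O)) ≋ h₅
  i = ℛ.trans (Dil5.subst-inv OO-at0) (inv-cong (≡.trans (dil-at0 5 (O · O)) OO-at0) OO)

ωϖ-vanish : ∀ {f} s → f VanishesAt s → (f · ω · ϖ) VanishesAt s
ωϖ-vanish {f} s = vanish-factor {c = dil 2 (O · O) · (inv (O · O) · inv (O · O))} (ℛ.trans (ℛ.*-assoc f ω ϖ) (ℛ.*-congˡ (ℛ.trans (ℛ.*-assoc (negq g₅) (eval vʷ coarse) ϖ)
  (ℛ.trans (ℛ.*-congˡ (coarse! (vʷ ∙ ϖʷ) (w₅ ⁻¹))) negq-g₅))))

-- The series λ₃, …, λ₁₀

halve : ∀ {f g} s → dil 2 f ≋ g → g VanishesAt ((s ℕ.* 2) % 5) → f VanishesAt s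
halve {f} {g} s h v n refl = ≡.trans (≡.sym (dil-at 1 f n)) (≡.trans (at h (n ℕ.* 2)) (v (n ℕ.* 2) (%-distribˡ-* n 2 5)))

R₁₆ : PS
R₁₆ = dil 2 R₈

R̂₁₆ : Pointed
R̂₁₆ = δ̂ R̂₈

N₂ : PS
N₂ = dil 2 N

N̂₂ : Pointed
N̂₂ = δ̂ N̂

dil-4 : ∀ f → dil 4 f ≋ dil 2 (dil 2 f)
dil-4 f = ℛ.sym (dil-∘ 1 1 f)

dil-16 : ∀ f → dil 16 f ≋ dil 2 (dil 2 (dil 2 (dil 2 f)))
dil-16 f = ℛ.trans (ℛ.sym (dil-∘ 3 3 f)) (ℛ.trans (dil-cong 4 (dil-4 f)) (dil-4 (dil 2 (dil 2 f))))

λ₃-equation : λ₃ · R ^ˢ 2 ≋ R₂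
λ₃-equation = quotient-equation (^-at0 R 2 R-at0) ℛ.refl (powS≋^ R 2)

λ₄-equation : λ₄ · (R · R₂ ^ˢ 2) ≋ oneS
λ₄-equation = inv-equation (·-at0 R (R₂ ^ˢ 2) R-at0 (^-at0 R₂ 2 (at0≡value R̂₂))) (ℛ.trans (⊛≋· R (powS R₂ 2)) (ℛ.*-congˡ (powS≋^ R₂ 2)))

λ₅-equation : λ₅ · (R · R₄) ≋ oneS
λ₅-equation = inv-equation (·-at0 R R₄ R-at0 (at0≡value R̂₄)) (ℛ.trans (⊛≋· R (dil 4 R)) (ℛ.*-congˡ (dil-4 R)))

λ₆-equation : λ₆ · (R⁻ · N₂) ≋ oneS
λ₆-equation = inv-equation (·-at0 R⁻ N₂ (at0≡value R̂⁻) (at0≡value N̂₂)) (ℛ.trans (⊛≋· R⁻ (dil 4 R⁻)) (ℛ.*-congˡ (dil-4 R⁻)))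

λ₇-equation : λ₇ · R ^ˢ 4 ≋ R₄
λ₇-equation = quotient-equation (^-at0 R 4 R-at0) (dil-4 R) (powS≋^ R 4)

λ₈-equation : λ₈ · R₄ ^ˢ 3 ≋ R ^ˢ 2
λ₈-equation = quotient-equation (^-at0 R₄ 3 (at0≡value R̂₄)) (powS≋^ R 2) (ℛ.trans (powS≋^ (dil 4 R) 3) (ℛ.^-cong 3 (dil-4 R)))

λ₉-equation : λ₉ · R₁₆ ≋ R
λ₉-equation = quotient-equation (at0≡value R̂₁₆) ℛ.refl (dil-16 R)

λ₁₀-equation : λ₁₀ · (R ^ˢ 2 · R₂) ≋ R₄
λ₁₀-equation = quotient-equation (·-at0 (R ^ˢ 2) R₂ (^-at0 R 2 R-at0) (at0≡value R̂₂)) (dil-4 R) (ℛ.trans (⊛≋· (powS R 2) R₂) (ℛ.*-congʳ (powS≋^ R 2)))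

R₄≋yR₂R₂ : R₄ ≋ y · (R₂ · R₂)
R₄≋yR₂R₂ = substitute (dil-isSubst 1) (λ { (R ∷ R₂ ∷ x ∷ []) → R₂ , x :* (R :* R) }) (R ∷ R₂ ∷ x ∷ []) R₂≋xRR

λ₃≋x : λ₃ ≋ x
λ₃≋x = deduce-after (λ { (R ∷ R₂ ∷ x ∷ l ∷ []) → R :^ 2 , l , x , (con (+ 1) , l :* R :^ 2 , R₂) ∷ (con (+ 1) , R₂ , x :* (R :* R)) ∷ [] })
  (R̂ ∷ R̂₂ ∷ x̂ ∷ (λ₃ at0≡ + 1 by unit-factor {d = R ^ˢ 2} {a = R₂} (^-at0 R 2 R-at0) (at0≡value R̂₂) λ₃-equation) ∷ []) (λ₃-equation , R₂≋xRR)

-- At q² the sum is twice the even part of F, so the classes 1 and 4 of λ₃ correspond to the classes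
-- 2 and 3 of F.
doubled-λ₃ : dil 2 (λ₃ ⊕ λ′ λ₃) ≋ F ⊕ F⁻
doubled-λ₃ = ℛ.trans (Dil2.subst-⊕ λ₃ (inv λ₃)) (ℛ.trans (ℛ.+-congʳ {x = dil 2 (inv λ₃)} (Dil2.subst-cong λ₃≋x))
  (deduce-after (λ { (y ∷ y′ ∷ F ∷ F⁻ ∷ []) → y , y :+ y′ , F :+ F⁻ , (con (+ 1) , y :* y :+ con (+ 1) , y :* (F :+ F⁻)) ∷ (con (+ 1) , y :* y′ , con (+ 1)) ∷ [] })
    (ŷ ∷ (dil 2 (inv λ₃) at0≡ + 1 by dil-at0 2 (inv λ₃)) ∷ F̂ ∷ F̂⁻ ∷ [])
    (y+1/y , ℛ.trans (ℛ.*-congʳ (Dil2.subst-cong (ℛ.sym λ₃≋x))) (ℛ.trans (ℛ.sym (Dil2.subst-· λ₃ (inv λ₃)))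
      (ℛ.trans (Dil2.subst-cong (inv-right λ₃ (≡.trans (at λ₃≋x 0) x-at0))) Dil2.subst-1)))))

λ₃-sum-vanishes : ∀ s → F VanishesAt ((s ℕ.* 2) % 5) → (λ₃ ⊕ λ′ λ₃) VanishesAt s
λ₃-sum-vanishes s v = halve s doubled-λ₃ (vanish-⊕ v (vanish-negq v))

inv-is : ∀ {f g} → g 0 ≡ + 1 → f · g ≋ oneS → inv f ≋ g
inv-is {f} {g} g₀ h = ℛ.sym (inv-unique (unit-factor {d = g} {a = oneS} g₀ refl h) h)

λ₄κ≋1 : λ₄ · κ ≋ oneS
λ₄κ≋1 = ℛ.trans (ℛ.*-congˡ (ℛ.trans (ℛ.sym RR₂R₂≋κ) (ℛ.*-congˡ (ℛ.*-congˡ (ℛ.sym (ℛ.*-identityʳ R₂)))))) λ₄-equation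

λ₄-sum : λ₄ ⊕ q ^ˢ 2 · λ′ λ₄ ≋ q · F⁻ ⊕ β₂
λ₄-sum = deduce-after (λ { (q ∷ κ ∷ F⁻ ∷ β₂ ∷ l ∷ l′ ∷ []) → κ , l :+ q :^ 2 :* l′ , q :* F⁻ :+ β₂ ,
    (con (+ 1) , l :* κ , con (+ 1)) ∷ (κ :* q :^ 2 , l′ , κ) ∷ (con (+ 1) , con (+ 1) :+ q :* q :* (κ :* κ) , κ :* (q :* F⁻ :+ β₂)) ∷ [] })
  (q̂ ∷ κ̂ ∷ F̂⁻ ∷ β̂₂ ∷ (λ₄ at0≡ + 1 by refl) ∷ (λ′ λ₄ at0≡ + 1 by refl) ∷ []) (λ₄κ≋1 , inv-is κ-at0 λ₄κ≋1 , 1/k+k)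

λ₅-difference : λ₅ ⊕ ⊝ (q ^ˢ 2 · λ′ λ₅) ≋ negq (F · M)
λ₅-difference = ℛ.trans (deduce-after (λ { (q ∷ τ ∷ FM ∷ l ∷ l′ ∷ []) → τ , l :- q :^ 2 :* l′ , FM ,
    (con (+ 1) , l :* τ , con (+ 1)) ∷ (con (+ 0) :- τ :* q :^ 2 , l′ , τ) ∷ (con (+ 1) , con (+ 1) :- q :* q :* (τ :* τ) , τ :* FM) ∷ [] })
  (q̂ ∷ τ̂ ∷ ((F⁻ · M⁻) at0≡ + 1 by ·-at0 F⁻ M⁻ (at0≡value F̂⁻) (at0≡value M̂⁻)) ∷ (λ₅ at0≡ + 1 by refl) ∷ (λ′ λ₅ at0≡ + 1 by refl) ∷ [])
  (λ₅τ≋1 , inv-is (at0≡value τ̂) λ₅τ≋1 , 1/t-t)) (ℛ.sym (Negq.subst-· F M))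
  where
  λ₅τ≋1 : λ₅ · τ ≋ oneS
  λ₅τ≋1 = ℛ.trans (ℛ.*-congˡ (ℛ.sym RR₄≋τ)) λ₅-equation

q^≋mono : ∀ k → q ^ˢ k ≋ mono k
q^≋mono zero    = ℛ.sym mono-0
q^≋mono (suc k) = ℛ.trans (ℛ.*-congˡ (q^≋mono k)) (mono-+ 1 k)

negq-q^ : ∀ k f → negq (q ^ˢ (2 ℕ.* k) · f) ≋ q ^ˢ (2 ℕ.* k) · negq f
negq-q^ k f = ℛ.trans (Negq.subst-· (q ^ˢ (2 ℕ.* k)) f) (ℛ.*-congʳ (ℛ.trans (Negq.subst-cong (q^≋mono (2 ℕ.* k)))
  (ℛ.trans (negq-mono-even k) (ℛ.sym (q^≋mono (2 ℕ.* k))))))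

odd-part⁺ : ∀ k f g → f ⊕ q ^ˢ (2 ℕ.* k) · g ⊕ ⊝ negq (f ⊕ q ^ˢ (2 ℕ.* k) · g) ≋ f ⊕ q ^ˢ (2 ℕ.* k) · g ⊕ ⊝ (negq f ⊕ q ^ˢ (2 ℕ.* k) · negq g)
odd-part⁺ k f g = ℛ.+-congˡ (ℛ.-‿cong (ℛ.trans (Negq.subst-⊕ f (q ^ˢ (2 ℕ.* k) · g)) (ℛ.+-congˡ (negq-q^ k g))))

odd-part⁻ : ∀ k f g → f ⊕ ⊝ (q ^ˢ (2 ℕ.* k) · g) ⊕ ⊝ negq (f ⊕ ⊝ (q ^ˢ (2 ℕ.* k) · g)) ≋ f ⊕ ⊝ (q ^ˢ (2 ℕ.* k) · g) ⊕ ⊝ (negq f ⊕ ⊝ (q ^ˢ (2 ℕ.* k) · negq g))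
odd-part⁻ k f g = ℛ.+-congˡ (ℛ.-‿cong (ℛ.trans (Negq.subst-⊕ f (⊝ (q ^ˢ (2 ℕ.* k) · g))) (ℛ.+-congˡ
  (ℛ.trans (Negq.subst-⊝ (q ^ˢ (2 ℕ.* k) · g)) (ℛ.-‿cong (negq-q^ k g))))))

sign-square : ∀ n → (ℤ.- (+ 1)) ℤ.^ n ℤ.* (ℤ.- (+ 1)) ℤ.^ n ≡ + 1
sign-square zero    = refl
sign-square (suc n) = ≡.trans (cong₂ ℤ._*_ (ℤ.-1*i≡-i s) (ℤ.-1*i≡-i s)) (≡.trans (≡.sym (ℤ.neg-distribˡ-* s (ℤ.- s)))
  (≡.trans (cong (ℤ.-_) (≡.sym (ℤ.neg-distribʳ-* s s))) (≡.trans (ℤ.neg-involutive (s ℤ.* s)) (sign-square n))))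
  where
  s : ℤ
  s = (ℤ.- (+ 1)) ℤ.^ n

sign-involutive : ∀ n a → (ℤ.- (+ 1)) ℤ.^ n ℤ.* ((ℤ.- (+ 1)) ℤ.^ n ℤ.* a) ≡ a
sign-involutive n a = ≡.trans (≡.sym (ℤ.*-assoc ((ℤ.- (+ 1)) ℤ.^ n) ((ℤ.- (+ 1)) ℤ.^ n) a)) (≡.trans (cong (ℤ._* a) (sign-square n)) (ℤ.*-identityˡ a))

negq-R⁻ : negq R⁻ ≋ R
negq-R⁻ = pointwise λ n → sign-involutive n (R n)

ϖ̂₂ : Pointed
ϖ̂₂ = δ̂ (ϖ at0≡ + 1 by eval-at0 coarse coarse-at0 ϖʷ)

module _ (a b : PS) (b-at0 : b 0 ≡ + 1) where
  /-equation : (a · inv b) · b ≋ a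
  /-equation = ℛ.trans (ℛ.*-assoc a (inv b) b) (ℛ.trans (ℛ.*-congˡ (inv-left b b-at0)) (ℛ.*-identityʳ a))

-- With λ₆′ = R⁻ N₂ the left side is -(R⁻ - R)(1/(R R⁻ N₂) + q² N₂). The first factor is 2q ϖ(q²).
-- By R R⁻ = R₄/R₂ the second is a + qN at q², where a = R/(R₂ N).
λ₆-odd : (λ₆ ⊕ ⊝ (q ^ˢ 2 · λ′ λ₆)) ⊕ ⊝ negq (λ₆ ⊕ ⊝ (q ^ˢ 2 · λ′ λ₆)) ≋ ⊝ (⌜ + 2 ⌝ · (q · dil 2 (F₄ · ω · ϖ)))
λ₆-odd = ℛ.trans (odd-part⁻ 1 λ₆ (λ′ λ₆)) (ℛ.trans (deduce-after (λ { (q ∷ q₂ ∷ R ∷ R⁻ ∷ R₂ ∷ R₄ ∷ N ∷ l ∷ n ∷ l′ ∷ n′ ∷ a ∷ W ∷ ϖ ∷ []) →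
    let c = R :* R⁻ :* N :* R₂ in
    c , l :- q :^ 2 :* l′ :- (n :- q :^ 2 :* n′) , con (+ 0) :- con (+ 2) :* (q :* (W :* ϖ)) ,
    (con (+ 0) :- c :* q :^ 2 , l′ , R⁻ :* N) ∷ (c :* q :^ 2 , n′ , R :* N) ∷
    (R₂ :* R , l :* (R⁻ :* N) , con (+ 1)) ∷
    (con (+ 0) :- R₂ :* R⁻ , n :* (R :* N) , con (+ 1)) ∷
    (con (+ 2) :* q :* ϖ :* a :* N , R :* R⁻ :* R₂ , R₄) ∷
    (con (+ 2) :* q :* ϖ , a :* (R₄ :* N) , R₂) ∷
    (con (+ 0) :- R₂ :- c :* q :^ 2 :* N , R⁻ :- R , con (+ 2) :* q :* ϖ) ∷
    (con (+ 0) :- c :* con (+ 2) :* q :* ϖ , a :+ q₂ :* N , W) ∷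
    (c :* con (+ 2) :* q :* ϖ :* N , q₂ , q :* q) ∷ [] })
  (q̂ ∷ δ̂ q̂ ∷ R̂ ∷ R̂⁻ ∷ R̂₂ ∷ R̂₄ ∷ N̂₂ ∷ l̂ ∷ ν̂ l̂ ∷ l̂′ ∷ ν̂ l̂′ ∷ δ̂ â ∷ δ̂ (F̂₄ω) ∷ ϖ̂₂ ∷ [])
  (λ₆′≋ , ℛ.trans (Negq.subst-cong λ₆′≋) negated-product , λ₆-equation ,
   ℛ.trans (ℛ.*-congˡ (ℛ.sym negated-product)) (ℛ.trans (ℛ.sym (Negq.subst-· λ₆ (R⁻ · N₂))) (ℛ.trans (Negq.subst-cong λ₆-equation) Negq.subst-1)) ,
   RR⁻R₂≋R₄ ,
   substitute (dil-isSubst 1) (λ { (a ∷ R ∷ R₂ ∷ N ∷ []) → a :* (R₂ :* N) , R }) (a ∷ R ∷ R₂ ∷ N ∷ []) a-equation ,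
   R⁻-R ,
   substitute (dil-isSubst 1) (λ { (q ∷ N ∷ a ∷ W ∷ []) → a :+ q :* N , W }) (q ∷ N ∷ a ∷ F₄ · ω ∷ []) (a+qN a a-at0 a-equation) ,
   dil-q≋qq)) (ℛ.trans (ℛ.+-identityˡ _) (ℛ.-‿cong (ℛ.*-congˡ (ℛ.*-congˡ (ℛ.sym (Dil2.subst-· (F₄ · ω) ϖ)))))))
  where
  l̂ l̂′ â F̂₄ω : Pointed
  l̂ = λ₆ at0≡ + 1 by refl
  l̂′ = λ′ λ₆ at0≡ + 1 by refl
  R₂N-at0 : (R₂ · N) 0 ≡ + 1
  R₂N-at0 = ·-at0 R₂ N (at0≡value R̂₂) (at0≡value N̂)
  a : PS
  a = R · inv (R₂ · N)
  a-at0 : a 0 ≡ + 1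
  a-at0 = ·-at0 R (inv (R₂ · N)) R-at0 refl
  a-equation : a · (R₂ · N) ≋ R
  a-equation = /-equation R (R₂ · N) R₂N-at0
  â = a at0≡ + 1 by a-at0
  F̂₄ω = (F₄ · ω) at0≡ + 1 by ·-at0 F₄ ω (at0≡value F̂₄) ω-at0
  λ₆′≋ : λ′ λ₆ ≋ R⁻ · N₂
  λ₆′≋ = inv-is (·-at0 R⁻ N₂ (at0≡value R̂⁻) (at0≡value N̂₂)) λ₆-equation
  negated-product : negq (R⁻ · N₂) ≋ R · N₂
  negated-product = ℛ.trans (Negq.subst-· R⁻ N₂) (ℛ.*-cong negq-R⁻ (negq-dil2 N))

-- The left side is -(R⁻ - R)(1/R₁₆ + q⁶ R₁₆/(R R⁻)). By R R⁻ = R₄/R₂ the second factor is the sum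
-- of `a+qqqR₈m` at q², with a = 1/R₈ and m = R/R₂.
λ₉-odd : (λ₉ ⊕ ⊝ (q ^ˢ 6 · λ′ λ₉)) ⊕ ⊝ negq (λ₉ ⊕ ⊝ (q ^ˢ 6 · λ′ λ₉)) ≋ ⊝ (⌜ + 2 ⌝ · (q · dil 2 (β₂⁻ · ω · ϖ)))
λ₉-odd = ℛ.trans (odd-part⁻ 3 λ₉ (λ′ λ₉)) (ℛ.trans (deduce-after (λ { (q ∷ q₂ ∷ R ∷ R⁻ ∷ R₂ ∷ R₄ ∷ S ∷ l ∷ n ∷ l′ ∷ n′ ∷ a ∷ m ∷ V ∷ ϖ ∷ []) →
    let c = S :* R :* R⁻ :* R₂
        rr = R :* R⁻ :* R₂
    in c , l :- q :^ 6 :* l′ :- (n :- q :^ 6 :* n′) , con (+ 0) :- con (+ 2) :* (q :* (V :* ϖ)) ,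
    (rr , l :* S , R) ∷ (con (+ 0) :- rr , n :* S , R⁻) ∷
    (con (+ 0) :- q :^ 6 :* S :* R⁻ :* R₂ , l′ :* R , S) ∷ (q :^ 6 :* S :* R :* R₂ , n′ :* R⁻ , S) ∷
    (con (+ 2) :* q :* ϖ :* rr , a :* S , con (+ 1)) ∷
    (con (+ 2) :* q :^ 7 :* ϖ :* S :^ 2 :* m , rr , R₄) ∷
    (con (+ 2) :* q :^ 7 :* ϖ :* S :^ 2 , m :* R₄ , R₂) ∷
    (con (+ 0) :- rr :- q :^ 6 :* S :^ 2 :* R₂ , R⁻ :- R , con (+ 2) :* q :* ϖ) ∷
    (con (+ 0) :- con (+ 2) :* q :* ϖ :* c , a :+ q₂ :* q₂ :* q₂ :* S :* m , V) ∷
    (con (+ 2) :* q :* ϖ :* c :* S :* m :* (q₂ :* q₂ :+ q₂ :* q :^ 2 :+ q :^ 4) , q₂ , q :* q) ∷ [] })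
  (q̂ ∷ δ̂ q̂ ∷ R̂ ∷ R̂⁻ ∷ R̂₂ ∷ R̂₄ ∷ R̂₁₆ ∷ l̂ ∷ ν̂ l̂ ∷ l̂′ ∷ ν̂ l̂′ ∷ δ̂ (a at0≡ + 1 by refl) ∷ δ̂ (m′ at0≡ + 1 by m-at0′) ∷
    δ̂ ((β₂⁻ · ω) at0≡ + 1 by ·-at0 β₂⁻ ω (at0≡value β̂₂⁻) ω-at0) ∷ ϖ̂₂ ∷ [])
  (λ₉-equation ,
   ℛ.trans (ℛ.*-congˡ (ℛ.sym (negq-dil2 R₈))) (ℛ.trans (ℛ.sym (Negq.subst-· λ₉ R₁₆)) (Negq.subst-cong λ₉-equation)) ,
   λ₉′-equation ,
   ℛ.trans (ℛ.sym (Negq.subst-· (λ′ λ₉) R)) (ℛ.trans (Negq.subst-cong λ₉′-equation) (negq-dil2 R₈)) ,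
   substitute (dil-isSubst 1) (λ { (a ∷ R₈ ∷ []) → a :* R₈ , con (+ 1) }) (a ∷ R₈ ∷ []) a-equation ,
   RR⁻R₂≋R₄ ,
   substitute (dil-isSubst 1) (λ { (m ∷ R ∷ R₂ ∷ []) → m :* R₂ , R }) (m′ ∷ R ∷ R₂ ∷ []) m-equation ,
   R⁻-R ,
   substitute (dil-isSubst 1) (λ { (q ∷ R₈ ∷ a ∷ m ∷ V ∷ []) → a :+ q :* q :* q :* R₈ :* m , V }) (q ∷ R₈ ∷ a ∷ m′ ∷ β₂⁻ · ω ∷ []) (a+qqqR₈m a refl m′ m-at0′ a-equation m-equation) ,
   dil-q≋qq)) (ℛ.trans (ℛ.+-identityˡ _) (ℛ.-‿cong (ℛ.*-congˡ (ℛ.*-congˡ (ℛ.sym (Dil2.subst-· (β₂⁻ · ω) ϖ)))))))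
  where
  l̂ l̂′ : Pointed
  l̂ = λ₉ at0≡ + 1 by unit-factor {d = R₁₆} {a = R} (at0≡value R̂₁₆) R-at0 λ₉-equation
  l̂′ = λ′ λ₉ at0≡ + 1 by refl
  a m′ : PS
  a = inv R₈
  m′ = R · inv R₂
  m-at0′ : m′ 0 ≡ + 1
  m-at0′ = ·-at0 R (inv R₂) R-at0 refl
  a-equation : a · R₈ ≋ oneS
  a-equation = inv-left R₈ (at0≡value R̂₈)
  m-equation : m′ · R₂ ≋ R
  m-equation = /-equation R R₂ (at0≡value R̂₂)
  λ₉′-equation : λ′ λ₉ · R ≋ R₁₆
  λ₉′-equation = deduce (λ { (R ∷ S ∷ l ∷ l′ ∷ []) → l′ :* R , S , (con (+ 0) :- l′ , l :* S , R) ∷ (S , l :* l′ , con (+ 1)) ∷ [] })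
    (R ∷ R₁₆ ∷ λ₉ ∷ λ′ λ₉ ∷ []) (λ₉-equation , inv-right λ₉ (at0≡value l̂))

z-at0 : z 0 ≡ + 1
z-at0 = at0≡value ẑ

m₂M₂≋1 : m₂ · M₂ ≋ oneS
m₂M₂≋1 = ℛ.trans (ℛ.sym (Dil2.subst-· m M)) (ℛ.trans (Dil2.subst-cong (ℛ.trans (ℛ.*-comm m M) Mm≋1)) Dil2.subst-1)

m̂₂ : Pointed
m̂₂ = δ̂ (m at0≡ + 1 by m-at0)

-- The left side is -(R⁻² - R²)(1/R₄³ - q⁴ R₄³/(R R⁻)²). The second factor is (1 - q⁴κ₂²)/R₄³ =
-- κ₂M₂/R₄³, and the first is 4qβ₂R₄/(M₂R₂) by `M₂-z⁻`; the product is 4qβ₂.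
λ₈-odd : (λ₈ ⊕ q ^ˢ 4 · λ′ λ₈) ⊕ ⊝ negq (λ₈ ⊕ q ^ˢ 4 · λ′ λ₈) ≋ ⊝ (⌜ + 4 ⌝ · (q · β₂))
λ₈-odd = ℛ.trans (odd-part⁺ 2 λ₈ (λ′ λ₈)) (ℛ.trans (deduce-after (λ { (q ∷ R ∷ R⁻ ∷ R₂ ∷ R₄ ∷ κ₂ ∷ M₂ ∷ β₂ ∷ l ∷ n ∷ l′ ∷ n′ ∷ []) →
    let P = R₄ :^ 3
        rr = R :* R⁻ :* R₂
        D = R⁻ :^ 2 :- R :^ 2
        c₁ = R₂ :^ 3 :* M₂
        s = con (+ 4) :* β₂ :* q :* R₄ :^ 3
    in R₄ :^ 3 :* R :^ 2 :* R⁻ :^ 2 :* c₁ , l :+ q :^ 4 :* l′ :- (n :+ q :^ 4 :* n′) , con (+ 0) :- con (+ 4) :* (q :* β₂) ,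
    (c₁ :* R :^ 2 :* R⁻ :^ 2 , l :* P , R :^ 2) ∷ (con (+ 0) :- c₁ :* R :^ 2 :* R⁻ :^ 2 , n :* P , R⁻ :^ 2) ∷
    (q :^ 4 :* c₁ :* P :* R⁻ :^ 2 , l′ :* R :^ 2 , P) ∷ (con (+ 0) :- q :^ 4 :* c₁ :* P :* R :^ 2 , n′ :* R⁻ :^ 2 , P) ∷
    (R₂ :* M₂ :* (con (+ 4) :* q :* β₂ :* P :- D) :* (rr :+ R₄) , rr , R₄) ∷
    (q :^ 4 :* P :^ 2 :* R₂ :^ 2 :- R₄ :^ 2 , M₂ :* R₂ :* D , con (+ 4) :* q :* β₂ :* R₄) ∷
    (s :* (q :^ 4 :* (R₂ :* (R₄ :* R₄) :+ κ₂) :+ M₂) , R₂ :* (R₄ :* R₄) , κ₂) ∷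
    (s , κ₂ :* M₂ , con (+ 1) :- q :* q :* (q :* q) :* (κ₂ :* κ₂)) ∷ [] })
  (q̂ ∷ R̂ ∷ R̂⁻ ∷ R̂₂ ∷ R̂₄ ∷ κ̂₂ ∷ M̂₂ ∷ β̂₂ ∷ l̂ ∷ ν̂ l̂ ∷ l̂′ ∷ ν̂ l̂′ ∷ [])
  (λ₈-equation , λ₈⁻-equation , λ₈′-equation , λ₈⁻′-equation , RR⁻R₂≋R₄ , difference , R₂R₄R₄≋κ₂ , κ₂M₂)) (ℛ.+-identityˡ _))
  where
  l̂ l̂′ : Pointed
  l̂ = λ₈ at0≡ + 1 by unit-factor {d = R₄ ^ˢ 3} {a = R ^ˢ 2} (^-at0 R₄ 3 (at0≡value R̂₄)) (^-at0 R 2 R-at0) λ₈-equation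
  l̂′ = λ′ λ₈ at0≡ + 1 by refl
  R₄-even : negq R₄ ≋ R₄
  R₄-even = negq-dil2 R₂
  λ₈⁻-equation : negq λ₈ · R₄ ^ˢ 3 ≋ R⁻ ^ˢ 2
  λ₈⁻-equation = ℛ.trans (ℛ.*-congˡ (ℛ.^-cong 3 (ℛ.sym R₄-even))) (substitute negq-isSubst (λ { (R ∷ R₄ ∷ l ∷ []) → l :* R₄ :^ 3 , R :^ 2 }) (R ∷ R₄ ∷ λ₈ ∷ []) λ₈-equation)
  λ₈′-equation : λ′ λ₈ · R ^ˢ 2 ≋ R₄ ^ˢ 3
  λ₈′-equation = deduce (λ { (R ∷ R₄ ∷ l ∷ l′ ∷ []) → l′ :* R :^ 2 , R₄ :^ 3 , (con (+ 0) :- l′ , l :* R₄ :^ 3 , R :^ 2) ∷ (R₄ :^ 3 , l :* l′ , con (+ 1)) ∷ [] })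
    (R ∷ R₄ ∷ λ₈ ∷ λ′ λ₈ ∷ []) (λ₈-equation , inv-right λ₈ (at0≡value l̂))
  λ₈⁻′-equation : negq (λ′ λ₈) · R⁻ ^ˢ 2 ≋ R₄ ^ˢ 3
  λ₈⁻′-equation = ℛ.trans (substitute negq-isSubst (λ { (R ∷ R₄ ∷ l ∷ []) → l :* R :^ 2 , R₄ :^ 3 }) (R ∷ R₄ ∷ λ′ λ₈ ∷ []) λ₈′-equation) (ℛ.^-cong 3 R₄-even)
  difference : M₂ · R₂ · (R⁻ ^ˢ 2 ⊕ ⊝ (R ^ˢ 2)) ≋ ⌜ + 4 ⌝ · q · β₂ · R₄
  difference = deduce (λ { (q ∷ R ∷ R⁻ ∷ R₂ ∷ R₄ ∷ M₂ ∷ β₂ ∷ z ∷ []) → M₂ :* R₂ :* (R⁻ :^ 2 :- R :^ 2) , con (+ 4) :* q :* β₂ :* R₄ ,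
      (con (+ 4) :* q :* β₂ :* R₂ :* R :- M₂ :* R₂ :* (z :* R :+ R⁻) , z :* R , R⁻) ∷
      (R₂ :* R :^ 2 , M₂ :* (z :* z :- con (+ 1)) , con (+ 4) :* q :* (z :* β₂)) ∷
      (con (+ 4) :* q :* β₂ , R :* R⁻ :* R₂ , R₄) ∷ [] })
    (q ∷ R ∷ R⁻ ∷ R₂ ∷ R₄ ∷ M₂ ∷ β₂ ∷ z ∷ []) (zR≋R⁻ , M₂-z⁻ , RR⁻R₂≋R₄)

λ₇≋xxy : λ₇ ≋ x · x · y
λ₇≋xxy = deduce-after (λ { (R ∷ R₂ ∷ R₄ ∷ x ∷ y ∷ l ∷ []) → R :^ 4 , l , x :* x :* y ,
    (con (+ 1) , l :* R :^ 4 , R₄) ∷ (con (+ 1) , R₄ , y :* (R₂ :* R₂)) ∷ (y :* (R₂ :+ x :* (R :* R)) , R₂ , x :* (R :* R)) ∷ [] })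
  (R̂ ∷ R̂₂ ∷ R̂₄ ∷ x̂ ∷ ŷ ∷ (λ₇ at0≡ + 1 by unit-factor {d = R ^ˢ 4} {a = R₄} (^-at0 R 4 R-at0) (at0≡value R̂₄) λ₇-equation) ∷ [])
  (λ₇-equation , R₄≋yR₂R₂ , R₂≋xRR)

-- As λ₇(q) = z²/y and λ₇(-q) = 1/(z² y), the left side factors as -(z - 1/z)(z + 1/z)(y - 1/y). The
-- relations `M₂-z⁻`, `M₂-z⁺` and `M₂-y` give these as 4qβ₂/M₂, 2 + 4q²/M₂ and 4q²/M₂.
λ₇-odd : (λ₇ ⊕ λ′ λ₇) ⊕ ⊝ negq (λ₇ ⊕ λ′ λ₇) ≋ ⊝ (⌜ + 32 ⌝ · (q · dil 2 (q · (β · (m · m) ⊕ ⌜ + 2 ⌝ · (q · (β · (m · (m · m))))))))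
λ₇-odd = ℛ.trans (ℛ.+-congˡ (ℛ.-‿cong (Negq.subst-⊕ λ₇ (λ′ λ₇)))) (ℛ.trans (deduce-after (λ { (q ∷ x ∷ x⁻ ∷ y ∷ M ∷ m ∷ β ∷ l ∷ n ∷ l′ ∷ n′ ∷ []) →
    let z = x :* y
        A = M :* (z :* z :- con (+ 1))
        A′ = con (+ 4) :* q :* (z :* β)
        B = M :* (z :* z :+ con (+ 1))
        B′ = z :* (con (+ 2) :* M :+ con (+ 4) :* (q :* q))
        C = M :* (y :* y :- con (+ 1))
        C′ = con (+ 4) :* (q :* q) :* y
        k = con (+ 32) :* q :^ 3 :* β :* z :^ 2 :* y
        c = z :^ 2 :* y
        M³ = M :^ 3
    in c :* M³ , l :+ l′ :- (n :+ n′) , con (+ 0) :- con (+ 32) :* (q :* (q :^ 2 :* (β :* (m :* m) :+ con (+ 2) :* (q :^ 2 :* (β :* (m :* (m :* m))))))) ,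
    (M³ :* z :^ 2 :* y :- M³ :* l′ :* y :* y , l , x :* x :* y) ∷
    (M³ :* y :^ 2 , l :* l′ , con (+ 1)) ∷
    (con (+ 0) :- M³ :+ M³ :* z :^ 2 :* y :* n′ , n :* c , con (+ 1)) ∷
    (con (+ 0) :- M³ :* z :^ 4 :* y :^ 2 , n :* n′ , con (+ 1)) ∷
    (con (+ 0) :- B :* C , A , A′) ∷ (con (+ 0) :- A′ :* C , B , B′) ∷ (con (+ 0) :- A′ :* B′ , C , C′) ∷
    (k :* (m :* M :+ con (+ 1)) :* M :+ con (+ 2) :* q :^ 2 :* k :* (m :^ 2 :* M :^ 2 :+ m :* M :+ con (+ 1)) , m :* M , con (+ 1)) ∷ [] })
  (q̂ ∷ x̂ ∷ x̂⁻ ∷ ŷ ∷ M̂₂ ∷ m̂₂ ∷ β̂₂ ∷ l̂ ∷ ν̂ l̂ ∷ l̂′ ∷ ν̂ l̂′ ∷ [])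
  (λ₇≋xxy , ll′≋1 , at-minus-q , ℛ.trans (ℛ.sym (Negq.subst-· λ₇ (λ′ λ₇))) (ℛ.trans (Negq.subst-cong ll′≋1) Negq.subst-1) ,
   M₂-z⁻ , M₂-z⁺ , M₂-y , m₂M₂≋1)) (ℛ.trans (ℛ.+-identityˡ _) (ℛ.-‿cong (ℛ.*-congˡ (ℛ.*-congˡ (ℛ.sym doubled-W))))))
  where
  l̂ l̂′ : Pointed
  l̂ = λ₇ at0≡ + 1 by unit-factor {d = R ^ˢ 4} {a = R₄} (^-at0 R 4 R-at0) (at0≡value R̂₄) λ₇-equation
  l̂′ = λ′ λ₇ at0≡ + 1 by refl
  ll′≋1 : λ₇ · λ′ λ₇ ≋ oneS
  ll′≋1 = inv-right λ₇ (at0≡value l̂)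
  at-minus-q : negq λ₇ · (z ^ˢ 2 · y) ≋ oneS
  at-minus-q = deduce (λ { (x ∷ x⁻ ∷ y ∷ y⁻ ∷ n ∷ []) →
      let u = x :* x⁻ :* (y :* y)
      in n :* ((x :* y) :^ 2 :* y) , con (+ 1) ,
      ((x :* y) :^ 2 :* y , n , x⁻ :* x⁻ :* y⁻) ∷ ((x :* y) :^ 2 :* y :* x⁻ :* x⁻ , y⁻ , y) ∷ (u :+ con (+ 1) , u , con (+ 1)) ∷ [] })
    (x ∷ x⁻ ∷ y ∷ negq y ∷ negq λ₇ ∷ [])
    (substitute negq-isSubst (λ { (x ∷ y ∷ n ∷ []) → n , x :* x :* y }) (x ∷ y ∷ λ₇ ∷ []) λ₇≋xxy , negq-dil2 x , xx⁻yy≋1)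
  doubled-W : dil 2 (q · (β · (m · m) ⊕ ⌜ + 2 ⌝ · (q · (β · (m · (m · m)))))) ≋ q ^ˢ 2 · (β₂ · (m₂ · m₂) ⊕ ⌜ + 2 ⌝ · (q ^ˢ 2 · (β₂ · (m₂ · (m₂ · m₂)))))
  doubled-W = ℛ.trans (Dil2.subst-⟦⟧ (q′ :* (b :* (n :* n) :+ con (+ 2) :* (q′ :* (b :* (n :* (n :* n)))))) (q ∷ β ∷ m ∷ []))
    (ℛ.*-cong qq (ℛ.+-congˡ (ℛ.*-congˡ (ℛ.*-congʳ qq))))
    where
    q′ b n : Expr 3
    q′ = var (# 0)
    b = var (# 1)
    n = var (# 2)
    qq : dil 2 q ≋ q ^ˢ 2
    qq = ℛ.trans dil-q≋qq (ℛ.*-congˡ (ℛ.sym (ℛ.*-identityʳ q)))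

λ₁₀≋z : λ₁₀ ≋ z
λ₁₀≋z = deduce-after (λ { (R ∷ R₂ ∷ R₄ ∷ x ∷ y ∷ l ∷ []) → R :^ 2 :* R₂ , l , x :* y ,
    (con (+ 1) , l :* (R :^ 2 :* R₂) , R₄) ∷ (con (+ 1) , R₄ , y :* (R₂ :* R₂)) ∷ (y :* R₂ , R₂ , x :* (R :* R)) ∷ [] })
  (R̂ ∷ R̂₂ ∷ R̂₄ ∷ x̂ ∷ ŷ ∷ (λ₁₀ at0≡ + 1 by unit-factor {d = R ^ˢ 2 · R₂} {a = R₄} (·-at0 (R ^ˢ 2) R₂ (^-at0 R 2 R-at0) (at0≡value R̂₂)) (at0≡value R̂₄) λ₁₀-equation) ∷ [])
  (λ₁₀-equation , R₄≋yR₂R₂ , R₂≋xRR)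

λ₁₀-at0 : λ₁₀ 0 ≡ + 1
λ₁₀-at0 = ≡.trans (at λ₁₀≋z 0) z-at0

-- λ₁₀(q) λ₁₀(-q) = x x⁻ y² = 1, because y is even.
λ₁₀′≋ : λ′ λ₁₀ ≋ negq λ₁₀
λ₁₀′≋ = inv-is (≡.trans (Negq.subst-at0 λ₁₀) λ₁₀-at0) (deduce (λ { (x ∷ x⁻ ∷ y ∷ y⁻ ∷ l ∷ n ∷ []) → l :* n , con (+ 1) ,
    (n , l , x :* y) ∷ (x :* y , n , x⁻ :* y⁻) ∷ (x :* y :* x⁻ , y⁻ , y) ∷ (con (+ 1) , x :* x⁻ :* (y :* y) , con (+ 1)) ∷ [] })
  (x ∷ x⁻ ∷ y ∷ negq y ∷ λ₁₀ ∷ negq λ₁₀ ∷ [])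
  (λ₁₀≋z , substitute negq-isSubst (λ { (x ∷ y ∷ n ∷ []) → n , x :* y }) (x ∷ y ∷ λ₁₀ ∷ []) λ₁₀≋z , negq-dil2 x , xx⁻yy≋1))

λ₁₀-difference : λ₁₀ ⊕ ⊝ λ′ λ₁₀ ≋ ⌜ + 4 ⌝ · (q · dil 2 (β · m))
λ₁₀-difference = ℛ.trans (deduce-after (λ { (q ∷ M ∷ m ∷ β ∷ z ∷ l ∷ l′ ∷ []) → z :* M , l :- l′ , con (+ 4) :* (q :* (β :* m)) ,
    (z :* M :+ M :* l′ , l , z) ∷ (con (+ 0) :- M , l :* l′ , con (+ 1)) ∷
    (con (+ 1) , M :* (z :* z :- con (+ 1)) , con (+ 4) :* q :* (z :* β)) ∷
    (con (+ 0) :- con (+ 4) :* q :* z :* β , m :* M , con (+ 1)) ∷ [] })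
  (q̂ ∷ M̂₂ ∷ m̂₂ ∷ β̂₂ ∷ ẑ ∷ (λ₁₀ at0≡ + 1 by λ₁₀-at0) ∷ (λ′ λ₁₀ at0≡ + 1 by refl) ∷ [])
  (λ₁₀≋z , inv-right λ₁₀ λ₁₀-at0 , M₂-z⁻ , m₂M₂≋1)) (ℛ.*-congˡ (ℛ.*-congˡ (ℛ.sym (Dil2.subst-· β m))))

-- The series λ₁ and λ₂

ρ ι : PS
ρ = R ^ˢ 5
ι = inv ρ

ρ-at0 : ρ 0 ≡ + 1
ρ-at0 = ^-at0 R 5 R-at0

ρι≋1 : ρ · ι ≋ oneS
ρι≋1 = inv-right ρ ρ-at0

-- Expresses R⁵ as κ/x² = κ ((1 - k)/(1 + k))², rational in q and k.
ρxx≋κ : ρ · (x · x) ≋ κ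
ρxx≋κ = deduce (λ { (R ∷ R₂ ∷ x ∷ κ ∷ []) → R :^ 5 :* (x :* x) , κ ,
    (con (+ 1) , R :* (R₂ :* R₂) , κ) ∷ (con (+ 0) :- R :* (R₂ :+ x :* (R :* R)) , R₂ , x :* (R :* R)) ∷ [] })
  (R ∷ R₂ ∷ x ∷ κ ∷ []) (RR₂R₂≋κ , R₂≋xRR)

g : PS
g = eval gʷ coarse

ĝ ρ̂ ι̂ : Pointed
ĝ = g at0≡ + 1 by eval-at0 coarse coarse-at0 gʷ
ρ̂ = ρ at0≡ + 1 by ρ-at0
ι̂ = ι at0≡ + 1 by refl

-- Here g = (q; q)_∞ / (q⁵; q⁵)_∞.
icosahedral : ι ⊕ ⊝ (⌜ + 11 ⌝ · q) ⊕ ⊝ (q ^ˢ 2 · ρ) ≋ g ^ˢ 6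
icosahedral = ℛ.trans (deduce-after (λ { (q ∷ κ ∷ M ∷ x ∷ β ∷ F ∷ ρ ∷ ι ∷ []) →
    let k = q :* κ
        u = con (+ 1) :- k
        w = con (+ 1) :+ k
        n = con (+ 1) :- q :* q :* (κ :* κ)
        a = κ :* M
        Φ = ι :- con (+ 11) :* q :- q :^ 2 :* ρ
        β² = β :* β
    -- The right side is g⁶ = F⁴ β². With F² = 1 - 4q/M, β² = M + q and κM = 1 - k² it becomes
    -- rational in q and k, and so does the left side by `ρxx≋κ`.
    in M :^ 2 :* κ :^ 3 , Φ , F :^ 4 :* β² ,
    (κ :* Φ :* (a :+ n) :- ((a :- con (+ 4) :* k) :^ 2 :+ (n :+ k) :* (a :+ n :- con (+ 8) :* k)) , a , n) ∷
    (con (+ 0) :- n :^ 2 :* ι :- q :^ 2 :* u :^ 4 :* κ , ρ :* (x :* x) , κ) ∷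
    (n :^ 2 :* x :^ 2 , ρ :* ι , con (+ 1)) ∷
    ((w :^ 2 :+ q :^ 2 :* u :^ 2 :* κ :* ρ) :* (x :* u :+ w) , x :* u , w) ∷
    (con (+ 0) :- κ :^ 3 :* β² :* (M :* F :^ 2 :+ M :- con (+ 4) :* q) , M :* (F :* F) :+ con (+ 4) :* q , M) ∷
    (con (+ 0) :- κ :^ 3 :* (M :- con (+ 4) :* q) :^ 2 , β² , M :+ q) ∷ [] })
  (q̂ ∷ κ̂ ∷ M̂ ∷ x̂ ∷ β̂ ∷ F̂ ∷ ρ̂ ∷ ι̂ ∷ []) (κM≋1-qqκκ , ρxx≋κ , ρι≋1 , x-κ , MFF , ββ≋M+q))
  (ℛ.trans (ℛ.*-congʳ (ℛ.*-congˡ (ℛ.*-congˡ (ℛ.*-congˡ (ℛ.*-identityʳ F)))))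
    (ℛ.trans (coarse! (Fʷ ∙ (Fʷ ∙ (Fʷ ∙ Fʷ)) ∙ (βʷ ∙ βʷ)) (gʷ ∙ (gʷ ∙ (gʷ ∙ (gʷ ∙ (gʷ ∙ gʷ))))))
      (ℛ.*-congˡ {x = g} (ℛ.*-congˡ {x = g} (ℛ.*-congˡ {x = g} (ℛ.*-congˡ {x = g} (ℛ.*-congˡ {x = g} (ℛ.sym (ℛ.*-identityʳ g)))))))))

V W : PS
V = dil 5 R
W = dil 5 (γ₂ · inv γ₁)

VW≋1 : V · W ≋ oneS
VW≋1 = ℛ.trans (ℛ.sym (Dil5.subst-· R (γ₂ · inv γ₁))) (ℛ.trans (Dil5.subst-cong (ℛ.trans (ℛ.*-congʳ R≋γ₁/γ₂) cancelled)) Dil5.subst-1)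
  where
  cancelled : γ₁ · inv γ₂ · (γ₂ · inv γ₁) ≋ oneS
  cancelled = deduce (λ { (a ∷ b ∷ c ∷ d ∷ []) → a :* c :* (b :* d) , con (+ 1) , (b :* c , a :* d , con (+ 1)) ∷ (con (+ 1) , b :* c , con (+ 1)) ∷ [] })
    (γ₁ ∷ γ₂ ∷ inv γ₂ ∷ inv γ₁ ∷ []) (inv-right γ₁ γ₁-at0 , inv-right γ₂ γ₂-at0)

V̂ Ŵ : Pointed
V̂ = V at0≡ + 1 by ≡.trans (dil-at0 5 R) R-at0
Ŵ = W at0≡ + 1 by ≡.trans (dil-at0 5 (γ₂ · inv γ₁)) (·-at0 γ₂ (inv γ₁) γ₂-at0 refl)

H≋ : H ≋ dil 5 (poch 1 1)
H≋ = ℛ.sym (poch-dil 4 0 0)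

euler≋gH : poch 1 1 ≋ g · H
euler≋gH = ℛ.trans euler≋ (ℛ.trans OE≋ (ℛ.*-congˡ {x = g} (ℛ.trans (ℛ.sym (Dil5.subst-· O E)) (ℛ.trans (Dil5.subst-cong (ℛ.sym euler≋)) (ℛ.sym H≋)))))

ĝ₅′ : Pointed
ĝ₅′ = dil 5 g at0≡ + 1 by ≡.trans (dil-at0 5 g) (at0≡value ĝ)

-- The left side is (q; q)_∞ / (q²⁵; q²⁵)_∞, so this is the 5-dissection of (q; q)_∞ divided by its
-- last factor.
gg′≋ : g · dil 5 g ≋ W ⊕ ⊝ q ⊕ ⊝ (q ^ˢ 2 · V)
gg′≋ = deduce-after (λ { (q ∷ qq ∷ V ∷ W ∷ g ∷ g′ ∷ f ∷ H ∷ H′ ∷ HW ∷ HV ∷ []) → H′ , g :* g′ , W :- q :- q :^ 2 :* V ,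
    (con (+ 0) :- con (+ 1) , f , g :* H) ∷ (con (+ 0) :- g , H , g′ :* H′) ∷ (con (+ 1) , f , HW :- q :* H′ :- qq :* HV) ∷
    (con (+ 1) , HW , H′ :* W) ∷ (con (+ 0) :- qq , HV , H′ :* V) ∷ (con (+ 0) :- H′ :* V , qq , q :^ 2) ∷ [] })
  (q̂ ∷ (mono 2 at0≡ + 0 by at-mono 2 0) ∷ V̂ ∷ Ŵ ∷ ĝ ∷ ĝ₅′ ∷ (poch 1 1 at0≡ + 1 by refl) ∷ (H at0≡ + 1 by refl) ∷ (dil 5 H at0≡ + 1 by refl) ∷
    (dil 5 (H · (γ₂ · inv γ₁)) at0≡ + 1 by ≡.trans (dil-at0 5 (H · (γ₂ · inv γ₁))) (·-at0 H (γ₂ · inv γ₁) refl (·-at0 γ₂ (inv γ₁) γ₂-at0 refl))) ∷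
    (dil 5 (H · (γ₁ · inv γ₂)) at0≡ + 1 by ≡.trans (dil-at0 5 (H · (γ₁ · inv γ₂))) (·-at0 H (γ₁ · inv γ₂) refl (·-at0 γ₁ (inv γ₂) γ₁-at0 refl))) ∷ [])
  (euler≋gH , ℛ.trans H≋ (ℛ.trans (Dil5.subst-cong euler≋gH) (Dil5.subst-· g H)) , euler-dissection ,
   Dil5.subst-· H (γ₂ · inv γ₁) , ℛ.trans (Dil5.subst-· H (γ₁ · inv γ₂)) (ℛ.*-congˡ (Dil5.subst-cong (ℛ.sym R≋γ₁/γ₂))) , ℛ.sym (q^≋mono 2))

dil5-q : dil 5 q ≋ q ^ˢ 5
dil5-q = ℛ.trans (dil-mono 4 1) (ℛ.sym (q^≋mono 5))

-- v = q R(q⁵) and the quintic polynomials of Ramanujan's relation R⁵ Q = R(q⁵) P.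
v P Q s t : ∀ {n} → Expr n → Expr n → Expr n
v q V = q :* V
P q V = con (+ 1) :- con (+ 2) :* v q V :+ con (+ 4) :* v q V :^ 2 :- con (+ 3) :* v q V :^ 3 :+ v q V :^ 4
Q q V = con (+ 1) :+ con (+ 3) :* v q V :+ con (+ 4) :* v q V :^ 2 :+ con (+ 2) :* v q V :^ 3 :+ v q V :^ 4
s q V = con (+ 1) :- v q V :- v q V :^ 2
t q V = con (+ 1) :- con (+ 11) :* v q V :^ 5 :- v q V :^ 10

on-qV : (∀ {n} → Expr n → Expr n → Expr n) → PS
on-qV f = ℛ.⟦ f (var (# 0)) (var (# 1)) ⟧ (q ∷ V ∷ [])

gg′V≋s : g · dil 5 g · V ≋ on-qV s
gg′V≋s = deduce (λ { (q ∷ V ∷ W ∷ g ∷ g′ ∷ []) → g :* g′ :* V , s q V , (V , g :* g′ , W :- q :- q :^ 2 :* V) ∷ (con (+ 1) , V :* W , con (+ 1)) ∷ [] })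
  (q ∷ V ∷ W ∷ g ∷ dil 5 g ∷ []) (gg′≋ , VW≋1)

g′⁶V⁵≋t : dil 5 g ^ˢ 6 · V ^ˢ 5 ≋ on-qV t
g′⁶V⁵≋t = deduce (λ { (q ∷ q₅ ∷ V ∷ g ∷ ρ ∷ ι ∷ []) → g :^ 6 :* V :^ 5 , t q V ,
    (con (+ 0) :- V :^ 5 , ι :- con (+ 11) :* q₅ :- q₅ :^ 2 :* ρ , g :^ 6) ∷
    (con (+ 0) :- V :^ 5 :* q₅ :^ 2 :- ι , ρ , V :^ 5) ∷
    (con (+ 1) , ρ :* ι , con (+ 1)) ∷
    (con (+ 0) :- con (+ 11) :* V :^ 5 :- V :^ 10 :* (q₅ :+ q :^ 5) , q₅ , q :^ 5) ∷ [] })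
  (q ∷ dil 5 q ∷ V ∷ dil 5 g ∷ dil 5 ρ ∷ dil 5 ι ∷ [])
  (substitute (dil-isSubst 4) (λ { (q ∷ g ∷ ρ ∷ ι ∷ []) → ι :- con (+ 11) :* q :- q :^ 2 :* ρ , g :^ 6 }) (q ∷ g ∷ ρ ∷ ι ∷ []) icosahedral ,
   Dil5.subst-^ R 5 , ℛ.trans (ℛ.sym (Dil5.subst-· ρ ι)) (ℛ.trans (Dil5.subst-cong ρι≋1) Dil5.subst-1) , dil5-q)

-- From (1/ρ - 11q - q²ρ) V P Q = s⁵ and s⁵ = Q² - 11 v P Q - v² P² one gets (V P - ρ Q)(Q + q² ρ V P) = 0.
ramanujan : ρ · on-qV Q ≋ V · on-qV P
ramanujan = deduce-after (λ { (q ∷ V ∷ g ∷ g′ ∷ ρ ∷ ι ∷ []) →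
    let Φ = ι :- con (+ 11) :* q :- q :^ 2 :* ρ
    -- Besides s, the cancelled factor Q + q² ρ V P has constant term 1; this selects ρ = V P/Q
    -- among the two roots. The polynomials satisfy P Q s = t, whence the factor s.
    in s q V :* (Q q V :+ q :^ 2 :* ρ :* V :* P q V) , ρ :* Q q V , V :* P q V ,
    (con (+ 0) :- ρ :* V :* t q V , Φ , g :^ 6) ∷
    (ρ :* V :* g :^ 6 , g′ :^ 6 :* V :^ 5 , t q V) ∷
    (con (+ 0) :- ρ :* ((g :* g′ :* V) :^ 5 :+ (g :* g′ :* V) :^ 4 :* s q V :+ (g :* g′ :* V) :^ 3 :* s q V :^ 2 :+ (g :* g′ :* V) :^ 2 :* s q V :^ 3 :+ (g :* g′ :* V) :* s q V :^ 4 :+ s q V :^ 5) , g :* g′ :* V , s q V) ∷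
    (V :* t q V , ρ :* ι , con (+ 1)) ∷ [] })
  (q̂ ∷ V̂ ∷ ĝ ∷ ĝ₅′ ∷ ρ̂ ∷ ι̂ ∷ []) (icosahedral , g′⁶V⁵≋t , gg′V≋s , ρι≋1)

-- p = q R⁵ becomes v⁵ under q ↦ q⁵.
p t₀ : ∀ {n} → Expr n → Expr n → Expr n
p q R = q :* R :^ 5
t₀ q R = con (+ 1) :- con (+ 11) :* p q R :- p q R :^ 2

on-qR : (∀ {n} → Expr n → Expr n → Expr n) → PS
on-qR f = ℛ.⟦ f (var (# 0)) (var (# 1)) ⟧ (q ∷ R ∷ [])

dil5-on : (f : ∀ {n} → Expr n → Expr n → Expr n) → dil 5 (on-qR f) ≋ ℛ.⟦ f (var (# 0)) (var (# 1)) ⟧ (dil 5 q ∷ V ∷ [])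
dil5-on f = Dil5.subst-⟦⟧ (f (var (# 0)) (var (# 1))) (q ∷ R ∷ [])

-- Since 1/ρ = Q/(V P) and P Q s = 1 - 11v⁵ - v¹⁰, the sum for λ₁ has numerator s(Q² + v²P²) and the
-- difference for λ₂ has numerator s(P² - Q²), over denominators in q⁵. The `aᵢ` and `bᵢ` collect
-- the powers of v in these numerators by class modulo 5; the classes 3, 4 are absent from the first
-- and the class 0 from the second.
a₀ a₁ a₂ b₁ b₂ b₃ b₄ Rt₀ : ∀ {n} → Expr n → Expr n → Expr n
a₀ q R = con (+ 1) :- con (+ 66) :* p q R :- con (+ 11) :* p q R :^ 2
a₁ q R = R :* (con (+ 5) :+ con (+ 5) :* p q R :^ 2)
a₂ q R = R :^ 2 :* (con (+ 11) :- con (+ 66) :* p q R :- p q R :^ 2)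
b₁ q R = R :* (con (+ 55) :* p q R :- con (+ 10))
b₂ q R = R :^ 2 :* (con (+ 5) :+ con (+ 35) :* p q R)
b₃ q R = R :^ 3 :* (con (+ 5) :* p q R :- con (+ 35))
b₄ q R = R :^ 4 :* (con (+ 55) :+ con (+ 10) :* p q R)
Rt₀ q R = R :* t₀ q R

on-at0 : (f : ∀ {n} → Expr n → Expr n → Expr n) → on-qR f 0 ≡ constantTerm (f (var (# 0)) (var (# 1))) (+ 0 ∷ + 1 ∷ [])
on-at0 f = constantTerm-correct (f (var (# 0)) (var (# 1))) (q̂ ∷ R̂ ∷ [])

λ₁≋ι : λ₁ ≋ ι
λ₁≋ι = inv-cong (≡.trans (at (powS≋^ R 5) 0) ρ-at0) (powS≋^ R 5)

λ₁′≋ρ : λ′ λ₁ ≋ ρ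
λ₁′≋ρ = inv-is ρ-at0 (ℛ.trans (ℛ.*-congʳ λ₁≋ι) (ℛ.trans (ℛ.*-comm ι ρ) ρι≋1))

λ₁-sum : (λ₁ ⊕ q ^ˢ 2 · λ′ λ₁) · dil 5 (on-qR Rt₀) ≋ dil 5 (on-qR a₀) ⊕ q · (dil 5 (on-qR a₁) ⊕ q · dil 5 (on-qR a₂))
λ₁-sum = ℛ.trans (ℛ.*-cong (ℛ.+-cong λ₁≋ι (ℛ.*-congˡ λ₁′≋ρ)) (dil5-on Rt₀))
  (ℛ.trans (deduce (λ { (q ∷ q₅ ∷ V ∷ ρ ∷ ι ∷ []) → (ι :+ q :^ 2 :* ρ) :* Rt₀ q₅ V , a₀ q₅ V :+ q :* (a₁ q₅ V :+ q :* a₂ q₅ V) ,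
    (q :^ 2 :* V :* P q V :* s q V :- ι :* Q q V :* s q V , ρ :* Q q V , V :* P q V) ∷
    (Q q V :^ 2 :* s q V , ρ :* ι , con (+ 1)) ∷
    (con (+ 66) :* V :^ 5 :+ con (+ 66) :* q :^ 2 :* V :^ 7 :+ (con (+ 11) :* V :^ 10 :- con (+ 5) :* q :* V :^ 11 :+ q :^ 2 :* V :^ 12) :* (q₅ :+ q :^ 5)
     :- (ι :+ q :^ 2 :* ρ) :* V :* (con (+ 11) :* V :^ 5 :+ V :^ 10 :* (q₅ :+ q :^ 5)) , q₅ , q :^ 5) ∷ [] })
    (q ∷ dil 5 q ∷ V ∷ ρ ∷ ι ∷ []) (ramanujan , ρι≋1 , dil5-q))
  (ℛ.sym (ℛ.+-cong (dil5-on a₀) (ℛ.*-congˡ (ℛ.+-cong (dil5-on a₁) (ℛ.*-congˡ (dil5-on a₂)))))))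

λ₂-equation : λ₂ · V ≋ ρ
λ₂-equation = quotient-equation (at0≡value V̂) (powS≋^ R 5) ℛ.refl

λ₂-at0 : λ₂ 0 ≡ + 1
λ₂-at0 = unit-factor {d = V} {a = ρ} (at0≡value V̂) ρ-at0 λ₂-equation

λ₂-difference : (λ₂ ⊕ ⊝ λ′ λ₂) · dil 5 (on-qR t₀) ≋ q · (dil 5 (on-qR b₁) ⊕ q · (dil 5 (on-qR b₂) ⊕ q · (dil 5 (on-qR b₃) ⊕ q · dil 5 (on-qR b₄))))
λ₂-difference = ℛ.trans (ℛ.*-congˡ (dil5-on t₀))
  (ℛ.trans (deduce-after (λ { (q ∷ q₅ ∷ V ∷ ρ ∷ l ∷ l′ ∷ []) → V , (l :- l′) :* t₀ q₅ V , q :* (b₁ q₅ V :+ q :* (b₂ q₅ V :+ q :* (b₃ q₅ V :+ q :* b₄ q₅ V))) ,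
    (t q V :+ l′ :* Q q V :^ 2 :* s q V , l :* V , ρ) ∷
    ((P q V :+ l′ :* Q q V) :* s q V , ρ :* Q q V , V :* P q V) ∷
    (con (+ 0) :- V :* Q q V :^ 2 :* s q V , l :* l′ , con (+ 1)) ∷
    (con (+ 0) :- V :* (l :- l′) :* (con (+ 11) :* V :^ 5 :+ V :^ 10 :* (q₅ :+ q :^ 5))
     :- V :^ 7 :* (con (+ 55) :* q :+ con (+ 35) :* q :^ 2 :* V :+ con (+ 5) :* q :^ 3 :* V :^ 2 :+ con (+ 10) :* q :^ 4 :* V :^ 3) , q₅ , q :^ 5) ∷ [] })
    (q̂ ∷ (dil 5 q at0≡ + 0 by ≡.trans (dil-at0 5 q) q-at0) ∷ V̂ ∷ ρ̂ ∷ (λ₂ at0≡ + 1 by λ₂-at0) ∷ (λ′ λ₂ at0≡ + 1 by refl) ∷ [])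
    (λ₂-equation , ramanujan , inv-right λ₂ λ₂-at0 , dil5-q))
  (ℛ.sym (ℛ.*-congˡ (ℛ.+-cong (dil5-on b₁) (ℛ.*-congˡ (ℛ.+-cong (dil5-on b₂) (ℛ.*-congˡ (ℛ.+-cong (dil5-on b₃) (ℛ.*-congˡ (dil5-on b₄))))))))))

open import Data.Nat using (_∸_) renaming (_+_ to _+ℕ_; _*_ to _*ℕ_)
open import Data.Integer using (-_; _*_; _^_)

-- Coefficients

q^-shift : ∀ k g n → k ≤ n → (q ^ˢ k · g) n ≡ g (n ∸ k)
q^-shift k g n k≤n = ≡.trans (at (ℛ.*-congʳ {g} (q^≋mono k)) n)
  (≡.trans (cong (mono k · g) (≡.sym (ℕ.m+[n∸m]≡n k≤n))) (mono-shift k g (n ∸ k)))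

sum-vanishes : ∀ f g n → (f ⊕ g) n ≡ + 0 → f n ≡ - g n
sum-vanishes f g n e = ℤ.i-j≡0⇒i≡j (f n) (- g n) (≡.trans (cong (λ x → f n ℤ.+ x) (ℤ.neg-involutive (g n))) (≡.trans (≡.sym (at-⊕ f g n)) e))

difference-vanishes : ∀ f g n → (f ⊕ ⊝ g) n ≡ + 0 → f n ≡ g n
difference-vanishes f g n e = ℤ.i-j≡0⇒i≡j (f n) (g n) (≡.trans (cong (λ x → f n ℤ.+ x) (≡.sym (at-⊝ g n))) (≡.trans (≡.sym (at-⊕ f (⊝ g) n)) e))

shifted-sum-vanishes : ∀ k f g n → k ≤ n → (f ⊕ q ^ˢ k · g) n ≡ + 0 → f n ≡ - g (n ∸ k)
shifted-sum-vanishes k f g n k≤n e = ≡.trans (sum-vanishes f (q ^ˢ k · g) n e) (cong -_ (q^-shift k g n k≤n))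

shifted-difference-vanishes : ∀ k f g n → k ≤ n → (f ⊕ ⊝ (q ^ˢ k · g)) n ≡ + 0 → f n ≡ g (n ∸ k)
shifted-difference-vanishes k f g n k≤n e = ≡.trans (difference-vanishes f (q ^ˢ k · g) n e) (q^-shift k g n k≤n)

5n+r : ∀ n r → (5 *ℕ n +ℕ r) % 5 ≡ r % 5
5n+r n r = ≡.trans (cong (_% 5) (≡.trans (ℕ.+-comm (5 *ℕ n) r) (cong (r +ℕ_) (ℕ.*-comm 5 n)))) ([m+kn]%n≡m%n r n 5)

10n+r-mod5 : ∀ n r → (10 *ℕ n +ℕ r) % 5 ≡ r % 5
10n+r-mod5 n r = ≡.trans (cong (λ x → (x +ℕ r) % 5) (ℕ.*-assoc 5 2 n)) (5n+r (2 *ℕ n) r)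

10n+r-mod2 : ∀ n r → (10 *ℕ n +ℕ r) % 2 ≡ r % 2
10n+r-mod2 n r = ≡.trans (cong (_% 2) (≡.trans (ℕ.+-comm (10 *ℕ n) r) (cong (r +ℕ_) (≡.trans (cong (_*ℕ n) {10} {5 *ℕ 2} refl) (≡.trans (ℕ.*-comm 10 n) (≡.sym (ℕ.*-assoc n 5 2)))))))
  ([m+kn]%n≡m%n r (n *ℕ 5) 2)

λ₁-sum-vanishes : ∀ s → (dil 5 (on-qR a₀) ⊕ q · (dil 5 (on-qR a₁) ⊕ q · dil 5 (on-qR a₂))) VanishesAt s → (λ₁ ⊕ q ^ˢ 2 · λ′ λ₁) VanishesAt s
λ₁-sum-vanishes s = vanish-quotient {f = λ₁ ⊕ q ^ˢ 2 · λ′ λ₁} (on-qR Rt₀) (on-at0 Rt₀) λ₁-sum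

λ₁-coefficients : ∀ n r → (r ≡ 3 ⊎ r ≡ 4) → λ₁ (5 *ℕ n +ℕ r) ≡ - λ′ λ₁ (5 *ℕ n +ℕ r ∸ 2)
λ₁-coefficients n _ (inj₁ refl) = shifted-sum-vanishes 2 λ₁ (λ′ λ₁) (5 *ℕ n +ℕ 3) (ℕ.m≤n⇒m≤o+n (5 *ℕ n) ≤!)
  -- A series in q⁵ lives in the class 0, so the three summands live in the classes 0, 1 and 2;
  -- every `vanish-q` undoes one factor q.
  (λ₁-sum-vanishes 3 (vanish-⊕ (vanish-dil5 (on-qR a₀) 2) (vanish-q 2 3 (vanish-⊕ (vanish-dil5 (on-qR a₁) 1) (vanish-q 1 2 (vanish-dil5 (on-qR a₂) 0))))) (5 *ℕ n +ℕ 3) (5n+r n 3))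
λ₁-coefficients n _ (inj₂ refl) = shifted-sum-vanishes 2 λ₁ (λ′ λ₁) (5 *ℕ n +ℕ 4) (ℕ.m≤n⇒m≤o+n (5 *ℕ n) ≤!)
  (λ₁-sum-vanishes 4 (vanish-⊕ (vanish-dil5 (on-qR a₀) 3) (vanish-q 3 4 (vanish-⊕ (vanish-dil5 (on-qR a₁) 2) (vanish-q 2 3 (vanish-dil5 (on-qR a₂) 1))))) (5 *ℕ n +ℕ 4) (5n+r n 4))

λ₂-coefficients : ∀ n → λ₂ (5 *ℕ n) ≡ λ′ λ₂ (5 *ℕ n)
λ₂-coefficients n = difference-vanishes λ₂ (λ′ λ₂) (5 *ℕ n) (vanish-quotient {f = λ₂ ⊕ ⊝ λ′ λ₂} (on-qR t₀) (on-at0 t₀) λ₂-difference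
  (vanish-q 4 0 (vanish-⊕ (vanish-dil5 (on-qR b₁) 3) (vanish-q 3 4 (vanish-⊕ (vanish-dil5 (on-qR b₂) 2) (vanish-q 2 3 (vanish-⊕ (vanish-dil5 (on-qR b₃) 1) (vanish-q 1 2 (vanish-dil5 (on-qR b₄) 0))))))))
  (5 *ℕ n) (≡.trans (cong (_% 5) (≡.sym (ℕ.+-identityʳ (5 *ℕ n)))) (5n+r n 0)))

λ₃-coefficients : ∀ n r → (r ≡ 1 ⊎ r ≡ 4) → λ₃ (5 *ℕ n +ℕ r) ≡ - λ′ λ₃ (5 *ℕ n +ℕ r)
λ₃-coefficients n _ (inj₁ refl) = sum-vanishes λ₃ (λ′ λ₃) (5 *ℕ n +ℕ 1) (λ₃-sum-vanishes 1 F₂-vanish (5 *ℕ n +ℕ 1) (5n+r n 1))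
λ₃-coefficients n _ (inj₂ refl) = sum-vanishes λ₃ (λ′ λ₃) (5 *ℕ n +ℕ 4) (λ₃-sum-vanishes 4 F₃-vanish (5 *ℕ n +ℕ 4) (5n+r n 4))

λ₄-coefficients : ∀ n r → (r ≡ 3 ⊎ r ≡ 4) → λ₄ (5 *ℕ n +ℕ r) ≡ - λ′ λ₄ (5 *ℕ n +ℕ r ∸ 2)
λ₄-coefficients n _ (inj₁ refl) = shifted-sum-vanishes 2 λ₄ (λ′ λ₄) (5 *ℕ n +ℕ 3) (ℕ.m≤n⇒m≤o+n (5 *ℕ n) ≤!)
  (vanish-cong λ₄-sum (vanish-⊕ (vanish-q 2 3 (vanish-negq F₂-vanish)) (vanish-dil2 4 3 β₄-vanish)) (5 *ℕ n +ℕ 3) (5n+r n 3))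
λ₄-coefficients n _ (inj₂ refl) = shifted-sum-vanishes 2 λ₄ (λ′ λ₄) (5 *ℕ n +ℕ 4) (ℕ.m≤n⇒m≤o+n (5 *ℕ n) ≤!)
  (vanish-cong λ₄-sum (vanish-⊕ (vanish-q 3 4 (vanish-negq F₃-vanish)) (vanish-dil2 2 4 β₂-vanish)) (5 *ℕ n +ℕ 4) (5n+r n 4))

λ₅-coefficients : ∀ n r → 2 ≤ r → (O · E) VanishesAt (r % 5) → λ₅ (5 *ℕ n +ℕ r) ≡ λ′ λ₅ (5 *ℕ n +ℕ r ∸ 2)
λ₅-coefficients n r 2≤r v = shifted-difference-vanishes 2 λ₅ (λ′ λ₅) (5 *ℕ n +ℕ r) (ℕ.m≤n⇒m≤o+n (5 *ℕ n) 2≤r)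
  (vanish-cong λ₅-difference (vanish-negq (FM-vanish (r % 5) v)) (5 *ℕ n +ℕ r) (5n+r n r))

10n+r-odd : ∀ L {W} n r → Odd r → (L ⊕ ⊝ negq L) ≋ W → W VanishesAt (r % 5) → L (10 *ℕ n +ℕ r) ≡ + 0
10n+r-odd L n r o e v = odd-coefficients L e v (10 *ℕ n +ℕ r) (≡.trans (10n+r-mod2 n r) o) (10n+r-mod5 n r)

λ₆-coefficients : ∀ n r → (r ≡ 5 ⊎ r ≡ 7) → λ₆ (10 *ℕ n +ℕ r) ≡ λ′ λ₆ (10 *ℕ n +ℕ r ∸ 2)
λ₆-coefficients n _ (inj₁ refl) = shifted-difference-vanishes 2 λ₆ (λ′ λ₆) (10 *ℕ n +ℕ 5) (ℕ.m≤n⇒m≤o+n (10 *ℕ n) ≤!)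
  -- Read from the inside: F misses 3, F(q²) misses 1, F(q⁴) misses 2. The factor ωϖ keeps the
  -- class, passing to q² doubles it to 4, and the factor q moves it to 0, the class of 5.
  (10n+r-odd (λ₆ ⊕ ⊝ (q ^ˢ 2 · λ′ λ₆)) n 5 refl λ₆-odd (vanish-⊝ (vanish-⌜⌝ (+ 2) (vanish-q 4 0 (vanish-dil2 2 4 (ωϖ-vanish {F₄} 2 (vanish-dil2 1 2 (vanish-dil2 3 1 F₃-vanish))))))))
λ₆-coefficients n _ (inj₂ refl) = shifted-difference-vanishes 2 λ₆ (λ′ λ₆) (10 *ℕ n +ℕ 7) (ℕ.m≤n⇒m≤o+n (10 *ℕ n) ≤!)
  (10n+r-odd (λ₆ ⊕ ⊝ (q ^ˢ 2 · λ′ λ₆)) n 7 refl λ₆-odd (vanish-⊝ (vanish-⌜⌝ (+ 2) (vanish-q 1 2 (vanish-dil2 3 1 (ωϖ-vanish {F₄} 3 (vanish-dil2 4 3 (vanish-dil2 2 4 F₂-vanish))))))))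

λ₇-coefficients : ∀ n r → (r ≡ 1 ⊎ r ≡ 9) → λ₇ (10 *ℕ n +ℕ r) ≡ - λ′ λ₇ (10 *ℕ n +ℕ r)
λ₇-coefficients n _ (inj₁ refl) = sum-vanishes λ₇ (λ′ λ₇) (10 *ℕ n +ℕ 1) (10n+r-odd (λ₇ ⊕ λ′ λ₇) n 1 refl λ₇-odd (vanish-⊝ (vanish-⌜⌝ (+ 32) (vanish-q 0 1 (vanish-dil2 0 0
  (vanish-q 4 0 (vanish-⊕ (βmm-vanish 4 euler₄) (vanish-⌜⌝ (+ 2) (vanish-q 3 4 (βmmm-vanish 3 F₃-vanish))))))))))
λ₇-coefficients n _ (inj₂ refl) = sum-vanishes λ₇ (λ′ λ₇) (10 *ℕ n +ℕ 9) (10n+r-odd (λ₇ ⊕ λ′ λ₇) n 9 refl λ₇-odd (vanish-⊝ (vanish-⌜⌝ (+ 32) (vanish-q 3 4 (vanish-dil2 4 3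
  (vanish-q 3 4 (vanish-⊕ (βmm-vanish 3 euler₃) (vanish-⌜⌝ (+ 2) (vanish-q 2 3 (βmmm-vanish 2 F₂-vanish))))))))))

λ₈-coefficients : ∀ n r → (r ≡ 5 ⊎ r ≡ 9) → λ₈ (10 *ℕ n +ℕ r) ≡ - λ′ λ₈ (10 *ℕ n +ℕ r ∸ 4)
λ₈-coefficients n _ (inj₁ refl) = shifted-sum-vanishes 4 λ₈ (λ′ λ₈) (10 *ℕ n +ℕ 5) (ℕ.m≤n⇒m≤o+n (10 *ℕ n) ≤!)
  (10n+r-odd (λ₈ ⊕ q ^ˢ 4 · λ′ λ₈) n 5 refl λ₈-odd (vanish-⊝ (vanish-⌜⌝ (+ 4) (vanish-q 4 0 (vanish-dil2 2 4 β₂-vanish)))))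
λ₈-coefficients n _ (inj₂ refl) = shifted-sum-vanishes 4 λ₈ (λ′ λ₈) (10 *ℕ n +ℕ 9) (ℕ.m≤n⇒m≤o+n (10 *ℕ n) ≤!)
  (10n+r-odd (λ₈ ⊕ q ^ˢ 4 · λ′ λ₈) n 9 refl λ₈-odd (vanish-⊝ (vanish-⌜⌝ (+ 4) (vanish-q 3 4 (vanish-dil2 4 3 β₄-vanish)))))

λ₉-coefficients : ∀ n r → (r ≡ 7 ⊎ r ≡ 9) → λ₉ (10 *ℕ n +ℕ r) ≡ λ′ λ₉ (10 *ℕ n +ℕ r ∸ 6)
λ₉-coefficients n _ (inj₁ refl) = shifted-difference-vanishes 6 λ₉ (λ′ λ₉) (10 *ℕ n +ℕ 7) (ℕ.m≤n⇒m≤o+n (10 *ℕ n) ≤!)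
  (10n+r-odd (λ₉ ⊕ ⊝ (q ^ˢ 6 · λ′ λ₉)) n 7 refl λ₉-odd (vanish-⊝ (vanish-⌜⌝ (+ 2) (vanish-q 1 2 (vanish-dil2 3 1 (ωϖ-vanish {β₂⁻} 3 (vanish-dil2 4 3 β⁻₄-vanish)))))))
λ₉-coefficients n _ (inj₂ refl) = shifted-difference-vanishes 6 λ₉ (λ′ λ₉) (10 *ℕ n +ℕ 9) (ℕ.m≤n⇒m≤o+n (10 *ℕ n) ≤!)
  (10n+r-odd (λ₉ ⊕ ⊝ (q ^ˢ 6 · λ′ λ₉)) n 9 refl λ₉-odd (vanish-⊝ (vanish-⌜⌝ (+ 2) (vanish-q 3 4 (vanish-dil2 4 3 (ωϖ-vanish {β₂⁻} 4 (vanish-dil2 2 4 β⁻₂-vanish)))))))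

-- As 1/λ₁₀ is λ₁₀(-q), the coefficients differ by the sign (-1)^(2n + r) = (-1)^r, whatever r is.
λ₁₀-coefficients₂ : ∀ n r → λ₁₀ (2 *ℕ n +ℕ r) ≡ (- + 1) ^ r * λ′ λ₁₀ (2 *ℕ n +ℕ r)
λ₁₀-coefficients₂ n r = ≡.sym (≡.trans (cong (λ a → (- + 1) ^ r * a) (≡.trans (at λ₁₀′≋ (2 *ℕ n +ℕ r)) (cong (λ a → a * λ₁₀ (2 *ℕ n +ℕ r)) same-sign)))
  (sign-involutive r (λ₁₀ (2 *ℕ n +ℕ r))))
  where
  same-sign : (- + 1) ^ (2 *ℕ n +ℕ r) ≡ (- + 1) ^ r
  same-sign = ≡.trans (ℤ.^-distribˡ-+-* (- + 1) (2 *ℕ n) r) (≡.trans (cong (λ a → a * (- + 1) ^ r)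
    (≡.trans (≡.sym (ℤ.^-*-assoc (- + 1) 2 n)) (ℤ.^-zeroˡ n))) (ℤ.*-identityˡ ((- + 1) ^ r)))

λ₁₀-coefficients₅ : ∀ n r → (r ≡ 2 ⊎ r ≡ 3) → λ₁₀ (5 *ℕ n +ℕ r) ≡ λ′ λ₁₀ (5 *ℕ n +ℕ r)
λ₁₀-coefficients₅ n _ (inj₁ refl) = difference-vanishes λ₁₀ (λ′ λ₁₀) (5 *ℕ n +ℕ 2)
  (vanish-cong λ₁₀-difference (vanish-⌜⌝ (+ 4) (vanish-q 1 2 (vanish-dil2 3 1 (βm-vanish 3 E₃-vanish)))) (5 *ℕ n +ℕ 2) (5n+r n 2))
λ₁₀-coefficients₅ n _ (inj₂ refl) = difference-vanishes λ₁₀ (λ′ λ₁₀) (5 *ℕ n +ℕ 3)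
  (vanish-cong λ₁₀-difference (vanish-⌜⌝ (+ 4) (vanish-q 2 3 (vanish-dil2 1 2 (βm-vanish 1 E₁-vanish)))) (5 *ℕ n +ℕ 3) (5n+r n 3))

theorem1p4 : (∀ n r → (r ≡ 3 ⊎ r ≡ 4) → λ₁ (5 *ℕ n +ℕ r) ≡ - λ′ λ₁ (5 *ℕ n +ℕ r ∸ 2))
    × (∀ n → λ₂ (5 *ℕ n) ≡ λ′ λ₂ (5 *ℕ n))
    × (∀ n r → (r ≡ 1 ⊎ r ≡ 4) → λ₃ (5 *ℕ n +ℕ r) ≡ - λ′ λ₃ (5 *ℕ n +ℕ r))
    × (∀ n r → (r ≡ 3 ⊎ r ≡ 4) → λ₄ (5 *ℕ n +ℕ r) ≡ - λ′ λ₄ (5 *ℕ n +ℕ r ∸ 2))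
    × (∀ n r → (r ≡ 3 ⊎ r ≡ 4) → λ₅ (5 *ℕ n +ℕ r) ≡ λ′ λ₅ (5 *ℕ n +ℕ r ∸ 2))
    × (∀ n r → (r ≡ 5 ⊎ r ≡ 7) → λ₆ (10 *ℕ n +ℕ r) ≡ λ′ λ₆ (10 *ℕ n +ℕ r ∸ 2))
    × (∀ n r → (r ≡ 1 ⊎ r ≡ 9) → λ₇ (10 *ℕ n +ℕ r) ≡ - λ′ λ₇ (10 *ℕ n +ℕ r))
    × (∀ n r → (r ≡ 5 ⊎ r ≡ 9) → λ₈ (10 *ℕ n +ℕ r) ≡ - λ′ λ₈ (10 *ℕ n +ℕ r ∸ 4))
    × (∀ n r → (r ≡ 7 ⊎ r ≡ 9) → λ₉ (10 *ℕ n +ℕ r) ≡ λ′ λ₉ (10 *ℕ n +ℕ r ∸ 6))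
    × (∀ n r → (r ≡ 0 ⊎ r ≡ 1) → λ₁₀ (2 *ℕ n +ℕ r) ≡ (- + 1) ^ r * λ′ λ₁₀ (2 *ℕ n +ℕ r))
    × (∀ n r → (r ≡ 2 ⊎ r ≡ 3) → λ₁₀ (5 *ℕ n +ℕ r) ≡ λ′ λ₁₀ (5 *ℕ n +ℕ r))
theorem1p4 = λ₁-coefficients , λ₂-coefficients , λ₃-coefficients , λ₄-coefficients
  , (λ { n r (inj₁ refl) → λ₅-coefficients n r ≤! euler₃ ; n r (inj₂ refl) → λ₅-coefficients n r ≤! euler₄ })
  , λ₆-coefficients , λ₇-coefficients , λ₈-coefficients , λ₉-coefficients , (λ n r _ → λ₁₀-coefficients₂ n r) , λ₁₀-coefficients₅
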